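{- Define graphs $F_g$ ($1\le g\le 12$) and constants $c_g$ ($1\le g\le 11$) by $F_1=K_4$, $F_2=W_5$, $F_3=W_7$, $F_4=\overline{C}_7$, $F_5=W_9$, $F_6=H_2^{+}$, $F_7=W_{11}$, $F_8=H_2$, $F_9=W_{13}$, $F_{10}=T_0$, $F_{11}=W_{15}$, $F_{12}=H_1^{++}$, and $c_1=\tfrac23$, $c_2=\tfrac25$, $c_3=\tfrac13$, $c_4=\tfrac27$, $c_5=\tfrac14$, $c_6=\tfrac29$, $c_7=\tfrac15$, $c_8=\tfrac2{11}$, $c_9=\tfrac16$, $c_{10}=\tfrac2{13}$, $c_{11}=\tfrac17$. Let $r\ge 3$ be an integer and let $H$ be a graph with chromatic number $r+1$. If $g+1$ is minimal such that $H$ is not homomorphic to $K_{r-3}+F_{g+1}$, then \[ \delta_H = 1-\frac{1}{r-1+c_g}. \] If $H$ is homomorphic to all of $K_{r-3}+F_g$ ($1\le g\le 12$), then there is a smallest positive integer $g$ for which $H$ is not homomorphic to $K_{r-2}+C_{2g+1}$, and \[ 1-\frac{1}{r-1} < 1-\frac{1}{r-1+2/(2g-1)} \le \delta_H \le 1-\frac{1}{r-1+1/7}. \]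
   Context: All graphs are finite and simple. $K_m$ is the complete graph on $m$ vertices ($K_0$ is the empty graph), $C_m$ the cycle on $m$ vertices. The join $G+F$ is obtained from disjoint copies of $G$ and $F$ by joining every vertex of $G$ to every vertex of $F$ (so $K_0+F=F$). A graph $G$ is homomorphic to $F$ if there is a map $\varphi:V(G)\to V(F)$ sending edges to edges. The graphs: $W_k$ (the $k$-wheel) is one vertex joined to all vertices of a $k$-cycle. $\overline{C}_7$ is the complement of the $7$-cycle, equivalently the graph on $v_0,\dots,v_6$ with $v_iv_j$ an edge iff $j-i\equiv \pm1,\pm2 \pmod 7$. $H_2$ is $\overline{C}_7$ with the edge $v_6v_1$ removed. $H_2^{+}$ is $H_2$ together with a new vertex $u$ adjacent to exactly $v_0,v_2,v_5$. $H_1^{++}$ has vertices $v_0,\dots,v_6,u_l,u_r$ and edges $v_iv_{i+1}$ (indices mod 7) for all $i$, together with $v_3v_5, v_5v_0, v_0v_2, v_2v_4, v_6v_1$, and $u_l$ adjacent to $v_0,v_2,v_3$, $u_r$ adjacent to $v_0,v_3,v_5$. $T_0$ has vertices $v_0,\dots,v_6,t,u_1,u_6$ with edges $v_iv_{i+1}$ (indices mod 7) for all $i$, $u_1$ adjacent to $v_0,v_2,v_3,v_4,v_5,v_6$, $u_6$ adjacent to $v_0,v_1,v_2,v_3,v_4,v_5$, and $t$ adjacent to $v_0,u_1,u_6$ (no other edges). $\delta(G)$ is minimum degree, $|G|$ the number of vertices; $G$ is $H$-free if it has no subgraph isomorphic to $H$. For a graph $H$ of chromatic number $r+1$, $\delta_H$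 is the infimum of all $c$ such that for every $\eta>0$ there is $n_0$ such that every $H$-free graph $G$ on $n\ge n_0$ vertices with $\delta(G)\ge cn$ can be made $r$-partite by deleting at most $\eta n^2$ edges. -}

module Defs where

open import Data.Bool using (Bool; true; false; not; _∧_; _∨_; if_then_else_)
open import Data.Nat as ℕ using (ℕ; zero; suc; _+_; _∸_; _≡ᵇ_; _<ᵇ_)
open import Data.Fin using (Fin; toℕ)
open import Data.Fin.Properties using (_≟_)
open import Data.Integer using (+_)
open import Data.Rational using (ℚ; 0ℚ; 1ℚ; _/_; _-_; _*_; _≤_; _<_)
open import Data.List using (List; []; _∷_)
open import Data.Bool.ListAction using (any)
open import Data.Product using (Σ; ∃; _×_; _,_)
open import Relation.Binary.PropositionalEquality using (_≡_)
open import Relation.Nullary using (¬_)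
open import Relation.Nullary.Decidable using (⌊_⌋)
open import Function.Definitions using (Injective)

-- Finite simple graphs.
-- A graph has vertex set Fin size.  Its adjacency is obtained from an
-- arbitrary relation 'rel' on ℕ by symmetrising it and removing loops,
-- so every value of this record is a finite simple graph, and every
-- finite simple graph arises (take rel = its adjacency relation).

record Graph : Set where
  field
    size : ℕ
    rel  : ℕ → ℕ → Bool

open Graph public

adjℕ : Graph → ℕ → ℕ → Bool
adjℕ G a b = not (a ≡ᵇ b) ∧ (rel G a b ∨ rel G b a)

Adj : (G : Graph) → Fin (size G) → Fin (size G) → Bool
Adj G i j = adjℕ G (toℕ i) (toℕ j)

Edge : (G : Graph) → Fin (size G) → Fin (size G) → Set
Edge G i j = Adj G i j ≡ true

Hom : Graph → Graph → Set
Hom G F = Σ (Fin (size G) → Fin (size F)) λ φ →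
  ∀ i j → Edge G i j → Edge F (φ i) (φ j)

Contains : Graph → Graph → Set
Contains G H = Σ (Fin (size H) → Fin (size G)) λ φ →
  Injective _≡_ _≡_ φ × (∀ i j → Edge H i j → Edge G (φ i) (φ j))

Free : Graph → Graph → Set
Free H G = ¬ Contains G H

Colourable : Graph → ℕ → Set
Colourable G k = Σ (Fin (size G) → Fin k) λ f →
  ∀ i j → Edge G i j → ¬ (f i ≡ f j)

HasChromaticNumber : Graph → ℕ → Set
HasChromaticNumber G k = Colourable G k × (∀ m → m ℕ.< k → ¬ Colourable G m)

countTrue : ∀ {n} → (Fin n → Bool) → ℕ
countTrue {zero}  p = 0
countTrue {suc n} p = (if p Fin.zero then 1 else 0) + countTrue (λ i → p (Fin.suc i))
  where import Data.Fin as Fin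

degree : (G : Graph) → Fin (size G) → ℕ
degree G v = countTrue (λ u → Adj G v u)

sumFin : ∀ {n} → (Fin n → ℕ) → ℕ
sumFin {zero}  f = 0
sumFin {suc n} f = f Fin.zero + sumFin (λ i → f (Fin.suc i))
  where import Data.Fin as Fin

monoEdges : ∀ {r} (G : Graph) → (Fin (size G) → Fin r) → ℕ
monoEdges G f = sumFin λ i → countTrue λ j →
  (toℕ i <ᵇ toℕ j) ∧ Adj G i j ∧ ⌊ f i ≟ f j ⌋

-- a // b = a/b  (only ever used with b > 0; a // 0 = 0 is a dummy)
_//_ : ℕ → ℕ → ℚ
a // zero  = 0ℚ
a // suc b = (+ a) / suc b

ℕtoℚ : ℕ → ℚ
ℕtoℚ n = n // 1

-- δ_H, with r = χ(H) − 1.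
-- Works H r c : for every η > 0 there is n₀ such that every H-free G on
-- n ≥ n₀ vertices with δ(G) ≥ c n can be made r-partite by deleting at
-- most η n² edges.  (c, η rational.)

Works : Graph → ℕ → ℚ → Set
Works H r c = ∀ (η : ℚ) → 0ℚ < η → ∃ λ n₀ → ∀ (G : Graph) → n₀ ℕ.≤ size G →
  Free H G →
  (∀ v → c * ℕtoℚ (size G) ≤ ℕtoℚ (degree G v)) →
  Σ (Fin (size G) → Fin r) λ f →
    ℕtoℚ (monoEdges G f) ≤ η * ℕtoℚ (size G ℕ.* size G)

-- δ_H ≤ x   (every rational c > x belongs to the set whose infimum is δ_H)
DeltaLe : Graph → ℕ → ℚ → Set
DeltaLe H r x = ∀ c → x < c → Works H r c

-- δ_H ≥ x   (no rational c < x belongs to that set)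
DeltaGe : Graph → ℕ → ℚ → Set
DeltaGe H r x = ∀ c → c < x → ¬ Works H r c

DeltaEq : Graph → ℕ → ℚ → Set
DeltaEq H r x = DeltaLe H r x × DeltaGe H r x

-- 1 − 1/(r − 1 + p/q)  written as  1 − q/(p + (r−1) q)   (p, q > 0)
bnd : ℕ → ℕ → ℕ → ℚ
bnd r p q = 1ℚ - (q // (p + (r ∸ 1) ℕ.* q))

fromEdges : ℕ → List (ℕ × ℕ) → Graph
fromEdges n es = record { size = n ; rel = λ a b → any (λ { (x , y) → (x ≡ᵇ a) ∧ (y ≡ᵇ b) }) es }

K : ℕ → Graph
K m = record { size = m ; rel = λ _ _ → true }

-- cycle v₀ … v_{m−1}: edges v_i v_{i+1} and v₀ v_{m−1}  (used for m ≥ 3)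
C : ℕ → Graph
C m = record { size = m ; rel = λ a b → (b ≡ᵇ suc a) ∨ ((a ≡ᵇ 0) ∧ (b ≡ᵇ (m ∸ 1))) }

_⊕_ : Graph → Graph → Graph
G ⊕ F = record
  { size = size G + size F
  ; rel  = λ a b → if a <ᵇ size G
                     then (if b <ᵇ size G then adjℕ G a b else true)
                     else (if b <ᵇ size G then true else adjℕ F (a ∸ size G) (b ∸ size G))
  }

W : ℕ → Graph
W k = K 1 ⊕ C k

-- complement of C₇ : v_i v_j iff j − i ≡ ±1, ±2 (mod 7)
C̄₇ : Graph
C̄₇ = fromEdges 7
  ( (0 , 1) ∷ (1 , 2) ∷ (2 , 3) ∷ (3 , 4) ∷ (4 , 5) ∷ (5 , 6) ∷ (6 , 0)
  ∷ (0 , 2) ∷ (1 , 3) ∷ (2 , 4) ∷ (3 , 5) ∷ (4 , 6) ∷ (5 , 0) ∷ (6 , 1) ∷ [])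

-- C̄₇ minus the edge v₆v₁
H₂ : Graph
H₂ = fromEdges 7
  ( (0 , 1) ∷ (1 , 2) ∷ (2 , 3) ∷ (3 , 4) ∷ (4 , 5) ∷ (5 , 6) ∷ (6 , 0)
  ∷ (0 , 2) ∷ (1 , 3) ∷ (2 , 4) ∷ (3 , 5) ∷ (4 , 6) ∷ (5 , 0) ∷ [])

-- H₂ plus u = vertex 7 adjacent to v₀, v₂, v₅
H₂⁺ : Graph
H₂⁺ = fromEdges 8
  ( (0 , 1) ∷ (1 , 2) ∷ (2 , 3) ∷ (3 , 4) ∷ (4 , 5) ∷ (5 , 6) ∷ (6 , 0)
  ∷ (0 , 2) ∷ (1 , 3) ∷ (2 , 4) ∷ (3 , 5) ∷ (4 , 6) ∷ (5 , 0)
  ∷ (7 , 0) ∷ (7 , 2) ∷ (7 , 5) ∷ [])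

-- H₁⁺⁺ : v₀…v₆ = 0…6, u_l = 7, u_r = 8
H₁⁺⁺ : Graph
H₁⁺⁺ = fromEdges 9
  ( (0 , 1) ∷ (1 , 2) ∷ (2 , 3) ∷ (3 , 4) ∷ (4 , 5) ∷ (5 , 6) ∷ (6 , 0)
  ∷ (3 , 5) ∷ (5 , 0) ∷ (0 , 2) ∷ (2 , 4) ∷ (6 , 1)
  ∷ (7 , 0) ∷ (7 , 2) ∷ (7 , 3)
  ∷ (8 , 0) ∷ (8 , 3) ∷ (8 , 5) ∷ [])

-- T₀ : v₀…v₆ = 0…6, t = 7, u₁ = 8, u₆ = 9
T₀ : Graph
T₀ = fromEdges 10
  ( (0 , 1) ∷ (1 , 2) ∷ (2 , 3) ∷ (3 , 4) ∷ (4 , 5) ∷ (5 , 6) ∷ (6 , 0)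
  ∷ (8 , 0) ∷ (8 , 2) ∷ (8 , 3) ∷ (8 , 4) ∷ (8 , 5) ∷ (8 , 6)
  ∷ (9 , 0) ∷ (9 , 1) ∷ (9 , 2) ∷ (9 , 3) ∷ (9 , 4) ∷ (9 , 5)
  ∷ (7 , 0) ∷ (7 , 8) ∷ (7 , 9) ∷ [])

-- F_g for 1 ≤ g ≤ 12 (other indices: dummy K₀, never used)
F : ℕ → Graph
F 1  = K 4
F 2  = W 5
F 3  = W 7
F 4  = C̄₇
F 5  = W 9
F 6  = H₂⁺
F 7  = W 11
F 8  = H₂
F 9  = W 13
F 10 = T₀
F 11 = W 15
F 12 = H₁⁺⁺
F _  = K 0

-- c_g = cNum g / cDen g  for 1 ≤ g ≤ 11
cNum : ℕ → ℕ
cNum 1  = 2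
cNum 2  = 2
cNum 3  = 1
cNum 4  = 2
cNum 5  = 1
cNum 6  = 2
cNum 7  = 1
cNum 8  = 2
cNum 9  = 1
cNum 10 = 2
cNum 11 = 1
cNum _  = 1

cDen : ℕ → ℕ
cDen 1  = 3
cDen 2  = 5
cDen 3  = 3
cDen 4  = 7
cDen 5  = 4
cDen 6  = 9
cDen 7  = 5
cDen 8  = 11
cDen 9  = 6
cDen 10 = 13
cDen 11 = 7
cDen _  = 1

{-# OPTIONS --safe #-}
module Submission where

-- Lower bounds.  Blow up K_{r-3} + F_{g+1} (or K_{r-2} + C_{2g+1}) with weights for which every vertex misses at most the
-- weight μ of a vertex of K_{r-3}.  Giving each part its most popular colour, a colouring with few monochromatic edges
-- would properly colour the base graph, which is not r-colourable.
--
-- Upper bounds.  If G is far from r-partite, then a sample of bounded size has positive probability of being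
-- non-r-colourable: along a tree of sampled vertices, lists of allowed colours shrink until one is empty.  By Chebyshev a
-- further sample preserves the minimum degree condition after the removal of few vertices.  The structural theorem
-- (last paragraph) then gives a homomorphism of some K_{r-3} + F_j, j ≤ g, into the sample.  Hence such homomorphisms have positive density,
-- and the Erdős box theorem yields a blow-up of K_{r-3} + F_j, which contains H.
--
-- Structural theorem.  Let N be the number of vertices, let each vertex miss at most m vertices, and let N > (r-1+c_g) m.
-- If no K_{r-3} + F_j with j ≤ g maps into the graph, then it is r-colourable.  For r = 3, weighting the vertices of a
-- configuration produces a vertex with many neighbours in it; iterating this excludes K₄, odd wheels, H₂, T₀ and the Moser
-- spindle.  Removing a maximum independent set I then leaves no odd closed walk, by induction on its length.  For r ≥ 4
-- and a ∉ I, the set I meets only one class of an (r-1)-colouring of N(a) and contains that class, so G - I is locally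
-- (r-2)-colourable and one proceeds by induction on r.

-- The constants come from pairs of matching weightings. If weights of total w on a pattern are such
-- that every vertex of the graph misses at least B of them, then B·N ≤ w·m, so the pattern cannot
-- occur when N > (w/B)·m. An odd closed walk of length k in a neighbourhood has k/(k-2) = 1 +
-- 2/(k-2), which gives the values 2/3, 2/5, 2/7, ... belonging to wheels. The other values come
-- from the ratios 7/3 (spindle), 9/4 (`H₂⁺`), 11/5 (`H₂`), 13/6 (`T₀`) and 15/7 (`H₁⁺⁺` without its
-- two extra vertices); the lower bounds weight `C̄₇`, `H₂⁺`, `H₂`, `T₀` and `H₁⁺⁺` with just these
-- ratios. The ratio 15/7 recurs in the count for a heptagon outside I, which is why the upper
-- bounds stop at 1/7. Patterns and closed walks are only mapped homomorphically and may repeat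
-- vertices. Every count is by positions, so this is harmless, and it allows samples with
-- repetition. Inequalities between ratios are cross-multiplied in ℕ and subtracted terms are moved
-- to the other side.

module Rationals where
  open import Defs using (ℕtoℚ; _//_)
  open import Data.Nat as ℕ using (ℕ; zero; suc)
  import Data.Nat.Properties as ℕP
  open import Data.Nat.Tactic.RingSolver using (solve-∀)
  open import Data.Integer as ℤ using (+_; +[1+_]; -[1+_])
  import Data.Integer.Properties as ℤP
  open import Data.Rational
  open import Data.Rational.Properties
  open import Data.Rational.Unnormalised as ℚᵘ using (mkℚᵘ; *≡*; *≤*; *<*)
  import Data.Rational.Unnormalised.Properties as ℚᵘP
  open import Data.Rational.Solver using (module +-*-Solver)
  open import Data.Product using (∃; _×_; _,_)
  open import Relation.Binary.PropositionalEquality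

  -- From rational thresholds to inequalities in ℕ.

  toℚᵘ-// : ∀ a b → toℚᵘ (a // suc b) ℚᵘ.≃ mkℚᵘ (+ a) b
  toℚᵘ-// a b = toℚᵘ-fromℚᵘ (mkℚᵘ (+ a) b)

  ℕtoℚ-+ : ∀ a b → ℕtoℚ (a ℕ.+ b) ≡ ℕtoℚ a + ℕtoℚ b
  ℕtoℚ-+ a b = toℚᵘ-injective (ℚᵘP.≃-trans (toℚᵘ-// (a ℕ.+ b) 0) (ℚᵘP.≃-sym (ℚᵘP.≃-trans (toℚᵘ-homo-+ (ℕtoℚ a) (ℕtoℚ b))
    (ℚᵘP.≃-trans (ℚᵘP.+-cong (toℚᵘ-// a 0) (toℚᵘ-// b 0)) (*≡* (cong (ℤ._* + 1) (cong₂ ℤ._+_ (ℤP.*-identityʳ (+ a)) (ℤP.*-identityʳ (+ b)))))))))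

  ℕtoℚ-* : ∀ a b → ℕtoℚ (a ℕ.* b) ≡ ℕtoℚ a * ℕtoℚ b
  ℕtoℚ-* a b = toℚᵘ-injective (ℚᵘP.≃-trans (toℚᵘ-// (a ℕ.* b) 0) (ℚᵘP.≃-sym (ℚᵘP.≃-trans (toℚᵘ-homo-* (ℕtoℚ a) (ℕtoℚ b))
    (ℚᵘP.≃-trans (ℚᵘP.*-cong (toℚᵘ-// a 0) (toℚᵘ-// b 0)) (*≡* (cong (ℤ._* + 1) (sym (ℤP.pos-* a b))))))))

  //-* : ∀ a b → 1 ℕ.≤ b → (a // b) * ℕtoℚ b ≡ ℕtoℚ a
  //-* a (suc b) _ = toℚᵘ-injective (ℚᵘP.≃-trans (toℚᵘ-homo-* (a // suc b) (ℕtoℚ (suc b)))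
    (ℚᵘP.≃-trans (ℚᵘP.*-cong (toℚᵘ-// a b) (toℚᵘ-// (suc b) 0)) (ℚᵘP.≃-trans
      (*≡* (trans (ℤP.*-identityʳ _) (cong (+ a ℤ.*_) (cong +_ (sym (ℕP.*-identityʳ (suc b))))))) (ℚᵘP.≃-sym (toℚᵘ-// a 0)))))

  //-mono-< : ∀ {a b c d} → 1 ℕ.≤ b → 1 ℕ.≤ d → a ℕ.* d ℕ.< c ℕ.* b → a // b < c // d
  //-mono-< {a} {suc b} {c} {suc d} _ _ l = toℚᵘ-cancel-< (ℚᵘP.<-respʳ-≃ (ℚᵘP.≃-sym (toℚᵘ-// c d)) (ℚᵘP.<-respˡ-≃ (ℚᵘP.≃-sym (toℚᵘ-// a b))
    (*<* (subst₂ ℤ._<_ (ℤP.pos-* a (suc d)) (ℤP.pos-* c (suc b)) (ℤ.+<+ l)))))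

  ℕtoℚ-mono-≤ : ∀ {a b} → a ℕ.≤ b → ℕtoℚ a ≤ ℕtoℚ b
  ℕtoℚ-mono-≤ {a} {b} l = toℚᵘ-cancel-≤ (ℚᵘP.≤-respʳ-≃ (ℚᵘP.≃-sym (toℚᵘ-// b 0)) (ℚᵘP.≤-respˡ-≃ (ℚᵘP.≃-sym (toℚᵘ-// a 0))
    (*≤* (subst₂ ℤ._≤_ (sym (ℤP.*-identityʳ (+ a))) (sym (ℤP.*-identityʳ (+ b))) (ℤ.+≤+ l)))))

  ℕtoℚ-cancel-≤ : ∀ {a b} → ℕtoℚ a ≤ ℕtoℚ b → a ℕ.≤ b
  ℕtoℚ-cancel-≤ {a} {b} l with ℚᵘP.≤-respʳ-≃ (toℚᵘ-// b 0) (ℚᵘP.≤-respˡ-≃ (toℚᵘ-// a 0) (toℚᵘ-mono-≤ l))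
  ... | *≤* l′ = ℤP.drop‿+≤+ (subst₂ ℤ._≤_ (ℤP.*-identityʳ (+ a)) (ℤP.*-identityʳ (+ b)) l′)

  ℕtoℚ-pos : ∀ {n} → 1 ℕ.≤ n → Positive (ℕtoℚ n)
  ℕtoℚ-pos l = positive (<-≤-trans (positive⁻¹ 1ℚ) (ℕtoℚ-mono-≤ l))

  ℕtoℚ-nonNeg : ∀ n → NonNegative (ℕtoℚ n)
  ℕtoℚ-nonNeg n = nonNegative (ℕtoℚ-mono-≤ {0} {n} ℕ.z≤n)

  archimedean : ∀ δ → 0ℚ < δ → ∃ λ k → 1 ℕ.≤ k × 1ℚ ≤ ℕtoℚ k * δ
  -- The denominator serves as k: its product with δ is the numerator, which is at least one.
  archimedean δ@(mkℚ +[1+ a ] d _) _ = suc d , ℕ.s≤s ℕ.z≤n ,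
    toℚᵘ-cancel-≤ (ℚᵘP.≤-respʳ-≃ (ℚᵘP.≃-sym (ℚᵘP.≃-trans (toℚᵘ-homo-* (ℕtoℚ (suc d)) δ) (ℚᵘP.*-congʳ {mkℚᵘ +[1+ a ] d} (toℚᵘ-// (suc d) 0))))
      (*≤* (ℤ.+≤+ (subst₂ ℕ._≤_ (lhs d) (rhs d a) (ℕP.m≤m*n (suc d) (suc a))))))
    where
    lhs : ∀ d → 1 ℕ.+ d ≡ 1 ℕ.* (1 ℕ.* (1 ℕ.+ d))
    lhs = solve-∀
    rhs : ∀ d a → (1 ℕ.+ d) ℕ.* (1 ℕ.+ a) ≡ (1 ℕ.+ d) ℕ.* (1 ℕ.+ a) ℕ.* 1
    rhs = solve-∀
  archimedean (mkℚ (+ zero) d _) (*<* l) with subst (ℤ._< + 0) refl l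
  ... | ℤ.+<+ ()
  archimedean (mkℚ -[1+ a ] d _) (*<* ())

  -- Replaces η by a unit fraction 1/e below it, so that farness becomes a condition on naturals.
  denominator-of : ∀ η → 0ℚ < η → ∃ λ e → 1 ℕ.≤ e × (∀ M N → e ℕ.* M ℕ.≤ N → ℕtoℚ M ≤ η * ℕtoℚ N)
  denominator-of η η>0 with archimedean η η>0
  ... | e , e≥1 , l = e , e≥1 , λ M N le → *-cancelˡ-≤-pos (ℕtoℚ e) ⦃ ℕtoℚ-pos e≥1 ⦄ (begin
      ℕtoℚ e * ℕtoℚ M ≡⟨ sym (ℕtoℚ-* e M) ⟩
      ℕtoℚ (e ℕ.* M) ≤⟨ ℕtoℚ-mono-≤ le ⟩
      ℕtoℚ N ≡⟨ sym (*-identityˡ (ℕtoℚ N)) ⟩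
      1ℚ * ℕtoℚ N ≤⟨ *-monoʳ-≤-nonNeg (ℕtoℚ N) ⦃ ℕtoℚ-nonNeg N ⦄ l ⟩
      ℕtoℚ e * η * ℕtoℚ N ≡⟨ *-assoc (ℕtoℚ e) η (ℕtoℚ N) ⟩
      ℕtoℚ e * (η * ℕtoℚ N) ∎)
    where open ≤-Reasoning

  //-bound : ∀ E M N → 1 ℕ.≤ E → ℕtoℚ M ≤ (1 // E) * ℕtoℚ N → E ℕ.* M ℕ.≤ N
  //-bound E M N E≥1 l = ℕtoℚ-cancel-≤ (begin
    ℕtoℚ (E ℕ.* M) ≡⟨ ℕtoℚ-* E M ⟩
    ℕtoℚ E * ℕtoℚ M ≤⟨ *-monoˡ-≤-nonNeg (ℕtoℚ E) ⦃ ℕtoℚ-nonNeg E ⦄ l ⟩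
    ℕtoℚ E * ((1 // E) * ℕtoℚ N) ≡⟨ sym (*-assoc (ℕtoℚ E) (1 // E) (ℕtoℚ N)) ⟩
    ℕtoℚ E * (1 // E) * ℕtoℚ N ≡⟨ cong (_* ℕtoℚ N) (trans (*-comm (ℕtoℚ E) (1 // E)) (//-* 1 E E≥1)) ⟩
    1ℚ * ℕtoℚ N ≡⟨ *-identityˡ (ℕtoℚ N) ⟩
    ℕtoℚ N ∎)
    where open ≤-Reasoning

  open +-*-Solver using (solve; _:=_; _:+_; _:*_; :-_; _:-_; con)

  x<y⇒0<y-x : ∀ {x y} → x < y → 0ℚ < y - x
  x<y⇒0<y-x {x} {y} l = subst (_< y - x) (+-inverseʳ x) (+-monoˡ-< (- x) l)

  scaled : ∀ D q c → 1 ℕ.≤ D → ℕtoℚ D * (c - (1ℚ - (q // D))) ≡ ℕtoℚ D * c - ℕtoℚ D + ℕtoℚ q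
  scaled D q c D≥1 = trans (solve 3 (λ D c x → D :* (c :- (con 1ℚ :- x)) := D :* c :- D :+ x :* D) refl (ℕtoℚ D) c (q // D))
    (cong (λ z → ℕtoℚ D * c - ℕtoℚ D + z) (//-* q D D≥1))

  scaled′ : ∀ D q c → 1 ℕ.≤ D → ℕtoℚ D * ((1ℚ - (q // D)) - c) ≡ ℕtoℚ D - ℕtoℚ q - ℕtoℚ D * c
  scaled′ D q c D≥1 = trans (solve 3 (λ D c x → D :* ((con 1ℚ :- x) :- c) := D :- x :* D :- D :* c) refl (ℕtoℚ D) c (q // D))
    (cong (λ z → ℕtoℚ D - z - ℕtoℚ D * c) (//-* q D D≥1))

  pos-* : ∀ {D δ} → 1 ℕ.≤ D → 0ℚ < δ → 0ℚ < ℕtoℚ D * δ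
  pos-* {D} {δ} D≥1 δ>0 = positive⁻¹ (ℕtoℚ D * δ) ⦃ pos*pos⇒pos (ℕtoℚ D) ⦃ ℕtoℚ-pos D≥1 ⦄ δ ⦃ positive δ>0 ⦄ ⦄

  -- The degree condition says m ≤ (1 - c)n for the number m of missed vertices. Multiplied by D·k,
  -- where k·D·(c - (1 - q/D)) ≥ 1, it leaves a whole n to spare; this surplus later absorbs the
  -- sampling error.
  strict-slack : ∀ {D q c} → 1 ℕ.≤ D → 1ℚ - (q // D) < c → ∃ λ k → 1 ℕ.≤ k ×
    (∀ n d m → d ℕ.+ m ≡ n → c * ℕtoℚ n ≤ ℕtoℚ d → D ℕ.* k ℕ.* m ℕ.+ n ℕ.≤ k ℕ.* q ℕ.* n)
  strict-slack {D} {q} {c} D≥1 l with archimedean (ℕtoℚ D * (c - (1ℚ - (q // D)))) (pos-* D≥1 (x<y⇒0<y-x l))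
  ... | k , k≥1 , big = k , k≥1 , λ n d m d+m≡n dl → ℕtoℚ-cancel-≤ (below n d m d+m≡n dl)
    where
    open ≤-Reasoning
    D̂ = ℕtoℚ D
    k̂ = ℕtoℚ k
    q̂ = ℕtoℚ q
    below : ∀ n d m → d ℕ.+ m ≡ n → c * ℕtoℚ n ≤ ℕtoℚ d → ℕtoℚ (D ℕ.* k ℕ.* m ℕ.+ n) ≤ ℕtoℚ (k ℕ.* q ℕ.* n)
    below n d m eq dl = begin
      ℕtoℚ (D ℕ.* k ℕ.* m ℕ.+ n) ≡⟨ trans (ℕtoℚ-+ (D ℕ.* k ℕ.* m) n) (cong (_+ n̂) (trans (ℕtoℚ-* (D ℕ.* k) m) (cong (_* m̂) (ℕtoℚ-* D k)))) ⟩
      D̂ * k̂ * m̂ + n̂ ≡⟨ cong (λ z → D̂ * k̂ * m̂ + z) (sym (*-identityˡ n̂)) ⟩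
      D̂ * k̂ * m̂ + 1ℚ * n̂ ≤⟨ +-monoʳ-≤ (D̂ * k̂ * m̂) (*-monoʳ-≤-nonNeg n̂ ⦃ ℕtoℚ-nonNeg n ⦄ (≤-trans big (≤-reflexive (cong (k̂ *_) (scaled D q c D≥1))))) ⟩
      D̂ * k̂ * m̂ + k̂ * (D̂ * c - D̂ + q̂) * n̂
        ≡⟨ solve 6 (λ D k m c q n → D :* k :* m :+ k :* (D :* c :- D :+ q) :* n := D :* k :* (c :* n) :+ (D :* k :* m :- D :* k :* n :+ k :* q :* n)) refl D̂ k̂ m̂ c q̂ n̂ ⟩
      D̂ * k̂ * (c * n̂) + (D̂ * k̂ * m̂ - D̂ * k̂ * n̂ + k̂ * q̂ * n̂)
        ≤⟨ +-monoˡ-≤ (D̂ * k̂ * m̂ - D̂ * k̂ * n̂ + k̂ * q̂ * n̂) (*-monoˡ-≤-nonNeg (D̂ * k̂) ⦃ nonNeg*nonNeg⇒nonNeg D̂ ⦃ ℕtoℚ-nonNeg D ⦄ k̂ ⦃ ℕtoℚ-nonNeg k ⦄ ⦄ dl) ⟩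
      D̂ * k̂ * d̂ + (D̂ * k̂ * m̂ - D̂ * k̂ * n̂ + k̂ * q̂ * n̂)
        ≡⟨ solve 6 (λ D k m d q n → D :* k :* d :+ (D :* k :* m :- D :* k :* n :+ k :* q :* n) := D :* k :* (d :+ m) :- D :* k :* n :+ k :* q :* n) refl D̂ k̂ m̂ d̂ q̂ n̂ ⟩
      D̂ * k̂ * (d̂ + m̂) - D̂ * k̂ * n̂ + k̂ * q̂ * n̂ ≡⟨ cong (λ z → D̂ * k̂ * z - D̂ * k̂ * n̂ + k̂ * q̂ * n̂) (trans (sym (ℕtoℚ-+ d m)) (cong ℕtoℚ eq)) ⟩
      D̂ * k̂ * n̂ - D̂ * k̂ * n̂ + k̂ * q̂ * n̂ ≡⟨ solve 2 (λ a b → a :- a :+ b := b) refl (D̂ * k̂ * n̂) (k̂ * q̂ * n̂) ⟩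
      k̂ * q̂ * n̂ ≡⟨ sym (trans (ℕtoℚ-* (k ℕ.* q) n) (cong (_* n̂) (ℕtoℚ-* k q))) ⟩
      ℕtoℚ (k ℕ.* q ℕ.* n) ∎
      where
      n̂ = ℕtoℚ n
      d̂ = ℕtoℚ d
      m̂ = ℕtoℚ m

  -- Counterpart of `strict-slack` for constructions: as c is strictly below the threshold, a vertex
  -- may miss n/(D·k) more than the ideal share q/D of the vertices.
  tolerance : ∀ {D q c} → 1 ℕ.≤ D → c < 1ℚ - (q // D) → ∃ λ k → 1 ℕ.≤ k ×
    (∀ n d m → d ℕ.+ m ≡ n → D ℕ.* k ℕ.* m ℕ.≤ k ℕ.* q ℕ.* n ℕ.+ n → c * ℕtoℚ n ≤ ℕtoℚ d)
  tolerance {D} {q} {c} D≥1 l with archimedean (ℕtoℚ D * ((1ℚ - (q // D)) - c)) (pos-* D≥1 (x<y⇒0<y-x l))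
  ... | k , k≥1 , big = k , k≥1 , λ n d m d+m≡n dl →
      *-cancelˡ-≤-pos (D̂ * k̂) ⦃ pos*pos⇒pos D̂ ⦃ ℕtoℚ-pos D≥1 ⦄ k̂ ⦃ ℕtoℚ-pos k≥1 ⦄ ⦄ (below n d m d+m≡n dl)
    where
    open ≤-Reasoning
    D̂ = ℕtoℚ D
    k̂ = ℕtoℚ k
    q̂ = ℕtoℚ q
    below : ∀ n d m → d ℕ.+ m ≡ n → D ℕ.* k ℕ.* m ℕ.≤ k ℕ.* q ℕ.* n ℕ.+ n → D̂ * k̂ * (c * ℕtoℚ n) ≤ D̂ * k̂ * ℕtoℚ d
    below n d m eq dl = begin
      D̂ * k̂ * (c * n̂) ≡⟨ solve 5 (λ D k c n m → D :* k :* (c :* n) := D :* k :* m :+ (D :* k :* (c :* n) :- D :* k :* m)) refl D̂ k̂ c n̂ m̂ ⟩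
      D̂ * k̂ * m̂ + (D̂ * k̂ * (c * n̂) - D̂ * k̂ * m̂) ≤⟨ +-monoˡ-≤ (D̂ * k̂ * (c * n̂) - D̂ * k̂ * m̂) miss ⟩
      k̂ * q̂ * n̂ + 1ℚ * n̂ + (D̂ * k̂ * (c * n̂) - D̂ * k̂ * m̂)
        ≤⟨ +-monoˡ-≤ (D̂ * k̂ * (c * n̂) - D̂ * k̂ * m̂) (+-monoʳ-≤ (k̂ * q̂ * n̂) (*-monoʳ-≤-nonNeg n̂ ⦃ ℕtoℚ-nonNeg n ⦄ (≤-trans big (≤-reflexive (cong (k̂ *_) (scaled′ D q c D≥1)))))) ⟩
      k̂ * q̂ * n̂ + k̂ * (D̂ - q̂ - D̂ * c) * n̂ + (D̂ * k̂ * (c * n̂) - D̂ * k̂ * m̂)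
        ≡⟨ solve 6 (λ D k q n c m → k :* q :* n :+ k :* (D :- q :- D :* c) :* n :+ (D :* k :* (c :* n) :- D :* k :* m) := D :* k :* n :- D :* k :* m) refl D̂ k̂ q̂ n̂ c m̂ ⟩
      D̂ * k̂ * n̂ - D̂ * k̂ * m̂ ≡⟨ cong (λ z → D̂ * k̂ * z - D̂ * k̂ * m̂) (trans (sym (cong ℕtoℚ eq)) (ℕtoℚ-+ d m)) ⟩
      D̂ * k̂ * (d̂ + m̂) - D̂ * k̂ * m̂ ≡⟨ solve 3 (λ a d m → a :* (d :+ m) :- a :* m := a :* d) refl (D̂ * k̂) d̂ m̂ ⟩
      D̂ * k̂ * d̂ ∎
      where
      n̂ = ℕtoℚ n
      d̂ = ℕtoℚ d
      m̂ = ℕtoℚ m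
      miss : D̂ * k̂ * m̂ ≤ k̂ * q̂ * n̂ + 1ℚ * n̂
      miss = begin
        D̂ * k̂ * m̂ ≡⟨ sym (trans (ℕtoℚ-* (D ℕ.* k) m) (cong (_* m̂) (ℕtoℚ-* D k))) ⟩
        ℕtoℚ (D ℕ.* k ℕ.* m) ≤⟨ ℕtoℚ-mono-≤ dl ⟩
        ℕtoℚ (k ℕ.* q ℕ.* n ℕ.+ n) ≡⟨ trans (ℕtoℚ-+ (k ℕ.* q ℕ.* n) n) (cong₂ _+_ (trans (ℕtoℚ-* (k ℕ.* q) n) (cong (_* n̂) (ℕtoℚ-* k q))) (sym (*-identityˡ n̂))) ⟩
        k̂ * q̂ * n̂ + 1ℚ * n̂ ∎

open import Data.Bool using (Bool; true; false; not; if_then_else_; _∧_; _∨_)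
open import Data.Bool.Properties using () renaming (_≟_ to _≟ᵇ_)
open import Data.Empty using (⊥-elim; ⊥)
open import Data.Fin using (Fin; zero; suc; _↑ˡ_; _↑ʳ_; toℕ; fromℕ<; splitAt)
open import Data.Fin.Properties using (all?; toℕ<n; any?; splitAt-↑ˡ; splitAt-↑ʳ) renaming (_≟_ to _≟ᶠ_)
open import Data.List using (List; []; _∷_)
open import Data.List.Relation.Unary.All using (All; []; _∷_)
open import Data.Nat
open import Data.Nat.Properties
open import Data.Nat.Tactic.RingSolver using (solve-∀)
open import Data.Product using (∃; _,_; Σ; _×_; proj₁; proj₂)
open import Data.Sum using (_⊎_; inj₁; inj₂; [_,_]′)
open import Data.Unit using (tt)
open import Function using (_∘_)
open import Relation.Binary.PropositionalEquality hiding (J)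
open import Relation.Nullary using (¬_; yes; no; ⌊_⌋; Dec)
open import Relation.Nullary.Decidable using (_×-dec_; _→-dec_; ¬?)
import Data.Rational as ℚ

-- Finite sums and cardinalities.

module Sums where
  open import Defs using (sumFin; countTrue)

  𝟙 : Bool → ℕ
  𝟙 b = if b then 1 else 0

  # : ∀ {n} → (Fin n → Bool) → ℕ
  # p = sumFin (λ i → 𝟙 (p i))

  countTrue≡# : ∀ {n} (p : Fin n → Bool) → countTrue p ≡ # p
  countTrue≡# {zero}  p = refl
  countTrue≡# {suc n} p = cong (𝟙 (p zero) +_) (countTrue≡# (p ∘ suc))

  ∑-cong : ∀ {n} {f g : Fin n → ℕ} → (∀ i → f i ≡ g i) → sumFin f ≡ sumFin g
  ∑-cong {zero}  e = refl
  ∑-cong {suc n} e = cong₂ _+_ (e zero) (∑-cong (e ∘ suc))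

  ∑-mono : ∀ {n} {f g : Fin n → ℕ} → (∀ i → f i ≤ g i) → sumFin f ≤ sumFin g
  ∑-mono {zero}  e = z≤n
  ∑-mono {suc n} e = +-mono-≤ (e zero) (∑-mono (e ∘ suc))

  ∑-+ : ∀ {n} (f g : Fin n → ℕ) → sumFin (λ i → f i + g i) ≡ sumFin f + sumFin g
  ∑-+ {zero}  f g = refl
  ∑-+ {suc n} f g rewrite ∑-+ (f ∘ suc) (g ∘ suc) = +-interchange (f zero) (g zero) _ _
    where
    +-interchange : ∀ a b c d → (a + b) + (c + d) ≡ (a + c) + (b + d)
    +-interchange = solve-∀

  ∑-*ˡ : ∀ {n} k (f : Fin n → ℕ) → sumFin (λ i → k * f i) ≡ k * sumFin f
  ∑-*ˡ {zero}  k f = sym (*-zeroʳ k)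
  ∑-*ˡ {suc n} k f rewrite ∑-*ˡ k (f ∘ suc) = sym (*-distribˡ-+ k (f zero) _)

  ∑-*ʳ : ∀ {n} (f : Fin n → ℕ) k → sumFin (λ i → f i * k) ≡ sumFin f * k
  ∑-*ʳ f k = trans (∑-cong λ i → *-comm (f i) k) (trans (∑-*ˡ k f) (*-comm k _))

  ∑-const : ∀ n k → sumFin {n} (λ _ → k) ≡ n * k
  ∑-const zero    k = refl
  ∑-const (suc n) k = cong (k +_) (∑-const n k)

  ∑-zero : ∀ n → sumFin {n} (λ _ → 0) ≡ 0
  ∑-zero n = trans (∑-const n 0) (*-zeroʳ n)

  ∑-swap : ∀ {a b} (f : Fin a → Fin b → ℕ) →
    sumFin (λ i → sumFin (λ j → f i j)) ≡ sumFin (λ j → sumFin (λ i → f i j))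
  ∑-swap {zero}  {b} f = sym (∑-zero b)
  ∑-swap {suc a} {b} f rewrite ∑-swap (f ∘ suc) = sym (∑-+ (f zero) _)

  ∑-term : ∀ {n} (f : Fin n → ℕ) i → f i ≤ sumFin f
  ∑-term f zero    = m≤m+n (f zero) _
  ∑-term f (suc i) = ≤-trans (∑-term (f ∘ suc) i) (m≤n+m _ (f zero))

  ∑-<⇒∃ : ∀ {n} {f g : Fin n → ℕ} → sumFin f < sumFin g → ∃ λ i → f i < g i
  ∑-<⇒∃ {zero}          ()
  ∑-<⇒∃ {suc n} {f} {g} l with f zero <? g zero
  ... | yes p = zero , p
  ... | no ¬p with ∑-<⇒∃ {f = f ∘ suc} {g ∘ suc} (≰⇒> λ q → <⇒≱ l (+-mono-≤ (≮⇒≥ ¬p) q))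
  ...   | i , q = suc i , q

  ∑-single : ∀ {n} (i : Fin n) (f : Fin n → ℕ) → (∀ j → ¬ j ≡ i → f j ≡ 0) → sumFin f ≡ f i
  ∑-single {suc n} zero f h =
    trans (cong (f zero +_) (trans (∑-cong λ j → h (suc j) λ ()) (∑-zero n))) (+-identityʳ _)
  ∑-single {suc n} (suc i) f h = trans (cong (_+ sumFin (f ∘ suc)) (h zero λ ()))
    (∑-single i (f ∘ suc) λ j ne → h (suc j) λ { refl → ne refl })

  #-mono : ∀ {n} {p q : Fin n → Bool} → (∀ i → p i ≡ true → q i ≡ true) → # p ≤ # q
  #-mono {p = p} {q} h = ∑-mono λ i → go (p i) (q i) (h i)
    where
    go : ∀ a b → (a ≡ true → b ≡ true) → 𝟙 a ≤ 𝟙 b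
    go false b     h = z≤n
    go true  true  h = ≤-refl
    go true  false h with h refl
    ... | ()

  #-≤n : ∀ {n} (p : Fin n → Bool) → # p ≤ n
  #-≤n {n} p = ≤-trans (∑-mono {g = λ _ → 1} λ i → 𝟙≤1 (p i)) (≤-reflexive (trans (∑-const n 1) (*-identityʳ n)))
    where
    𝟙≤1 : ∀ b → 𝟙 b ≤ 1
    𝟙≤1 true  = ≤-refl
    𝟙≤1 false = z≤n

  #-complement : ∀ {n} (p : Fin n → Bool) → # p + # (not ∘ p) ≡ n
  #-complement {n} p = trans (sym (∑-+ (λ i → 𝟙 (p i)) (λ i → 𝟙 (not (p i)))))
    (trans (∑-cong λ i → go (p i)) (trans (∑-const n 1) (*-identityʳ n)))
    where
    go : ∀ b → 𝟙 b + 𝟙 (not b) ≡ 1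
    go true  = refl
    go false = refl

  #-∃ : ∀ {n} (p : Fin n → Bool) → 1 ≤ # p → ∃ λ i → p i ≡ true
  #-∃ {n} p l with ∑-<⇒∃ {f = λ _ → 0} {λ i → 𝟙 (p i)} (subst (_< # p) (sym (∑-zero n)) l)
  ... | i , q with p i in eq
  ...   | true = i , eq
  ...   | false with q
  ...     | ()

  ∑-spike : ∀ {n} (i : Fin n) → sumFin (λ j → 𝟙 ⌊ j ≟ᶠ i ⌋) ≡ 1
  ∑-spike i = trans (∑-single i _ off) on
    where
    off : ∀ j → ¬ j ≡ i → 𝟙 ⌊ j ≟ᶠ i ⌋ ≡ 0
    off j ne with j ≟ᶠ i
    ... | yes e = ⊥-elim (ne e)
    ... | no _  = refl
    on : 𝟙 ⌊ i ≟ᶠ i ⌋ ≡ 1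
    on with i ≟ᶠ i
    ... | yes _ = refl
    ... | no ¬e = ⊥-elim (¬e refl)

  -- Adding b back at the two zeros of h keeps every term at most b. Used when two of r colours or
  -- clique positions contribute nothing.
  ∑-vanish₂ : ∀ {r} (h : Fin r → ℕ) (b : ℕ) (s t : Fin r) → ¬ s ≡ t → h s ≡ 0 → h t ≡ 0 → (∀ x → h x ≤ b) →
    sumFin h + (b + b) ≤ r * b
  ∑-vanish₂ {r} h b s t ne hs ht hb = begin
    sumFin h + (b + b)
      ≡⟨ cong₂ (λ x y → sumFin h + (x + y)) (sym (spike s)) (sym (spike t)) ⟩
    sumFin h + (sumFin (λ x → 𝟙 ⌊ x ≟ᶠ s ⌋ * b) + sumFin (λ x → 𝟙 ⌊ x ≟ᶠ t ⌋ * b))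
      ≡⟨ cong (sumFin h +_) (sym (∑-+ (λ x → 𝟙 ⌊ x ≟ᶠ s ⌋ * b) (λ x → 𝟙 ⌊ x ≟ᶠ t ⌋ * b))) ⟩
    sumFin h + sumFin (λ x → 𝟙 ⌊ x ≟ᶠ s ⌋ * b + 𝟙 ⌊ x ≟ᶠ t ⌋ * b)
      ≡⟨ sym (∑-+ h (λ x → 𝟙 ⌊ x ≟ᶠ s ⌋ * b + 𝟙 ⌊ x ≟ᶠ t ⌋ * b)) ⟩
    sumFin (λ x → h x + (𝟙 ⌊ x ≟ᶠ s ⌋ * b + 𝟙 ⌊ x ≟ᶠ t ⌋ * b))
      ≤⟨ ∑-mono pointwise ⟩
    sumFin {r} (λ _ → b) ≡⟨ ∑-const r b ⟩
    r * b ∎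
    where
    open ≤-Reasoning
    spike : ∀ y → sumFin (λ x → 𝟙 ⌊ x ≟ᶠ y ⌋ * b) ≡ b
    spike y = trans (∑-*ʳ (λ x → 𝟙 ⌊ x ≟ᶠ y ⌋) b) (trans (cong (_* b) (∑-spike y)) (+-identityʳ b))
    pointwise : ∀ x → h x + (𝟙 ⌊ x ≟ᶠ s ⌋ * b + 𝟙 ⌊ x ≟ᶠ t ⌋ * b) ≤ b
    pointwise x with x ≟ᶠ s | x ≟ᶠ t
    ... | yes refl | yes e    = ⊥-elim (ne e)
    ... | yes refl | no _     = ≤-reflexive (trans (cong (_+ (b + 0 + 0)) hs) (trans (+-identityʳ _) (+-identityʳ _)))
    ... | no _     | yes refl = ≤-reflexive (trans (cong (_+ (b + 0)) ht) (+-identityʳ _))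
    ... | no _     | no _     = ≤-trans (≤-reflexive (+-identityʳ _)) (hb x)

  two≤ : ∀ {k} (g : Fin k → ℕ) s t → ¬ s ≡ t → 1 ≤ g s → 1 ≤ g t → 2 ≤ sumFin g
  two≤ {k} g s t ne a b = begin
    2 ≡⟨ cong₂ _+_ (sym (∑-spike s)) (sym (∑-spike t)) ⟩
    sumFin (λ x → 𝟙 ⌊ x ≟ᶠ s ⌋) + sumFin (λ x → 𝟙 ⌊ x ≟ᶠ t ⌋) ≡⟨ sym (∑-+ (λ x → 𝟙 ⌊ x ≟ᶠ s ⌋) (λ x → 𝟙 ⌊ x ≟ᶠ t ⌋)) ⟩
    sumFin (λ x → 𝟙 ⌊ x ≟ᶠ s ⌋ + 𝟙 ⌊ x ≟ᶠ t ⌋) ≤⟨ ∑-mono pw ⟩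
    sumFin g ∎
    where
    open ≤-Reasoning
    pw : ∀ x → 𝟙 ⌊ x ≟ᶠ s ⌋ + 𝟙 ⌊ x ≟ᶠ t ⌋ ≤ g x
    pw x with x ≟ᶠ s | x ≟ᶠ t
    ... | yes refl | yes e = ⊥-elim (ne e)
    ... | yes refl | no _ = a
    ... | no _ | yes refl = b
    ... | no _ | no _ = z≤n

  ∑-split : ∀ a b (f : Fin (a + b) → ℕ) → sumFin f ≡ sumFin (λ i → f (i ↑ˡ b)) + sumFin (λ j → f (a ↑ʳ j))
  ∑-split zero    b f = refl
  ∑-split (suc a) b f = trans (cong (f zero +_) (∑-split a b (f ∘ suc))) (sym (+-assoc (f zero) _ _))

-- Graphs relative to a vertex subset, walks, bipartiteness, maximum independent sets.

module Graphs where
  open Sums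
  open import Defs using (sumFin)
  open import Data.Bool using (_xor_)
  open import Data.Fin.Subset.Properties using (anySubset?)
  open import Data.Vec using (lookup; tabulate)
  open import Data.Vec.Properties using (lookup∘tabulate)

  ∧-true : ∀ {a b} → a ∧ b ≡ true → a ≡ true × b ≡ true
  ∧-true {true} {true} _ = refl , refl

  ∧-intro : ∀ {a b} → a ≡ true → b ≡ true → a ∧ b ≡ true
  ∧-intro refl refl = refl

  not-true : ∀ {a} → not a ≡ true → a ≡ false
  not-true {false} _ = refl

  ¬true⇒false : ∀ {a} → ¬ a ≡ true → a ≡ false
  ¬true⇒false {false} _ = refl
  ¬true⇒false {true}  h = ⊥-elim (h refl)

  absurd : ∀ {ℓ} {A : Set ℓ} {a} → a ≡ true → a ≡ false → A
  absurd refl ()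

  true? : ∀ a → a ≡ true ⊎ a ≡ false
  true? true  = inj₁ refl
  true? false = inj₂ refl

  -- Lets finitely many instances of excluded middle be assumed at once while refuting something.
  ¬¬-all : ∀ {k} {P : Fin k → Set} → (∀ i → ¬ ¬ P i) → ¬ ¬ (∀ i → P i)
  ¬¬-all {zero}  h c = c λ ()
  ¬¬-all {suc k} h c = h zero λ p₀ → ¬¬-all (h ∘ suc) λ ps → c λ { zero → p₀ ; (suc i) → ps i }

  ¬¬-dec : ∀ {A : Set} → ¬ ¬ Dec A
  ¬¬-dec h = h (no λ a → h (yes a))

  first : ∀ {n} → (Fin n → Bool) → Fin n → Fin n
  first {suc n} p d with p zero
  ... | true  = zero
  first {suc zero} p d | false = d
  first {suc (suc n)} p zero    | false = suc (first (p ∘ suc) zero)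
  first {suc (suc n)} p (suc d) | false = suc (first (p ∘ suc) d)

  first-true : ∀ {n} (p : Fin n → Bool) d i → p i ≡ true → p (first p d) ≡ true
  first-true {suc n} p d i e with p zero in eq
  ... | true  = eq
  first-true {suc zero} p d zero e | false = absurd e eq
  first-true {suc (suc n)} p zero    zero    e | false = absurd e eq
  first-true {suc (suc n)} p zero    (suc i) e | false = first-true (p ∘ suc) zero i e
  first-true {suc (suc n)} p (suc d) zero    e | false = absurd e eq
  first-true {suc (suc n)} p (suc d) (suc i) e | false = first-true (p ∘ suc) d i e

  -- The least element depends only on the set. Vertices with the same reachability predicate
  -- thereby receive the same root.
  first-cong : ∀ {n} (p q : Fin n → Bool) d d′ i → (∀ j → p j ≡ q j) → p i ≡ true → first p d ≡ first q d′
  first-cong {suc n} p q d d′ i h e with p zero in eq | q zero in eq′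
  ... | true  | true  = refl
  ... | true  | false = absurd (trans (sym (h zero)) eq) eq′
  ... | false | true  = absurd (trans (h zero) eq′) eq
  first-cong {suc zero} p q d d′ zero h e | false | false = absurd e eq
  first-cong {suc (suc n)} p q d d′ zero h e | false | false = absurd e eq
  first-cong {suc (suc n)} p q zero zero (suc i) h e | false | false =
    cong suc (first-cong (p ∘ suc) (q ∘ suc) zero zero i (h ∘ suc) e)
  first-cong {suc (suc n)} p q zero (suc d′) (suc i) h e | false | false =
    cong suc (first-cong (p ∘ suc) (q ∘ suc) zero d′ i (h ∘ suc) e)
  first-cong {suc (suc n)} p q (suc d) zero (suc i) h e | false | false =
    cong suc (first-cong (p ∘ suc) (q ∘ suc) d zero i (h ∘ suc) e)
  first-cong {suc (suc n)} p q (suc d) (suc d′) (suc i) h e | false | false =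
    cong suc (first-cong (p ∘ suc) (q ∘ suc) d d′ i (h ∘ suc) e)

  odd : ℕ → Bool
  odd zero    = false
  odd (suc n) = not (odd n)

  odd-+ : ∀ a b → odd (a + b) ≡ odd a xor odd b
  odd-+ zero    b = refl
  odd-+ (suc a) b rewrite odd-+ a b with odd a | odd b
  ... | true  | true  = refl
  ... | true  | false = refl
  ... | false | true  = refl
  ... | false | false = refl

  record Gr (n : ℕ) : Set where
    field
      adj : Fin n → Fin n → Bool
      adj-sym : ∀ u v → adj u v ≡ adj v u
      adj-irr : ∀ v → adj v v ≡ false

  module Structure {n : ℕ} (G : Gr n) where
    open Gr G

    Sub : Set
    Sub = Fin n → Bool

    _⊑_ : Sub → Sub → Set
    P ⊑ Q = ∀ v → P v ≡ true → Q v ≡ true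

    Nb : Sub → Fin n → Sub
    Nb U a v = U v ∧ adj a v

    Miss : Sub → Fin n → Sub
    Miss U a v = U v ∧ not (adj a v)

    _∖_ : Sub → Sub → Sub
    (U ∖ I) v = U v ∧ not (I v)

    Bounded : Sub → ℕ → Set
    Bounded U m = ∀ v → U v ≡ true → # (Miss U v) ≤ m

    Indep : Sub → Set
    Indep I = ∀ u v → I u ≡ true → I v ≡ true → adj u v ≡ false

    Col : ℕ → Sub → Set
    Col k P = Σ (Fin n → Fin k) λ c → ∀ u v → P u ≡ true → P v ≡ true → adj u v ≡ true → ¬ c u ≡ c v

    Bip : Sub → Set
    Bip P = Σ (Fin n → Bool) λ c → ∀ u v → P u ≡ true → P v ≡ true → adj u v ≡ true → ¬ c u ≡ c v

    adj-sym′ : ∀ {u v} → adj u v ≡ true → adj v u ≡ true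
    adj-sym′ {u} {v} e = trans (adj-sym v u) e

    adj-sym″ : ∀ {u v} → adj u v ≡ false → adj v u ≡ false
    adj-sym″ {u} {v} e = trans (adj-sym v u) e

    #-split : ∀ (U : Sub) (a : Fin n) → # U ≡ # (Nb U a) + # (Miss U a)
    #-split U a = trans (∑-cong λ v → go (U v) (adj a v)) (∑-+ (λ v → 𝟙 (Nb U a v)) (λ v → 𝟙 (Miss U a v)))
      where
      go : ∀ x y → 𝟙 x ≡ 𝟙 (x ∧ y) + 𝟙 (x ∧ not y)
      go true  true  = refl
      go true  false = refl
      go false _     = refl

    -- Σ_q w_q·m bounds the total weight missed, which is at least B per vertex up to the correction e on I.
    weigh : ∀ {k m} (U I : Sub) (φ : Fin k → Fin n) (w : Fin k → ℕ) (B e : ℕ) →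
      (∀ q → # (Miss U (φ q)) ≤ m) →
      (∀ v → U v ≡ true → B ≤ sumFin (λ q → w q * 𝟙 (not (adj (φ q) v))) + e * 𝟙 (I v)) →
      B * # U ≤ sumFin w * m + e * # I
    weigh {k} {m} U I φ w B e bd h = begin
      B * # U
        ≡⟨ sym (∑-*ˡ B (λ v → 𝟙 (U v))) ⟩
      sumFin (λ v → B * 𝟙 (U v))
        ≤⟨ ∑-mono pointwise ⟩
      sumFin (λ v → sumFin (λ q → w q * 𝟙 (Miss U (φ q) v)) + e * 𝟙 (I v))
        ≡⟨ ∑-+ (λ v → sumFin (λ q → w q * 𝟙 (Miss U (φ q) v))) (λ v → e * 𝟙 (I v)) ⟩
      sumFin (λ v → sumFin (λ q → w q * 𝟙 (Miss U (φ q) v))) + sumFin (λ v → e * 𝟙 (I v))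
        ≡⟨ cong₂ _+_ (∑-swap (λ v q → w q * 𝟙 (Miss U (φ q) v))) (∑-*ˡ e (λ v → 𝟙 (I v))) ⟩
      sumFin (λ q → sumFin (λ v → w q * 𝟙 (Miss U (φ q) v))) + e * # I
        ≡⟨ cong (_+ e * # I) (∑-cong λ q → ∑-*ˡ (w q) (λ v → 𝟙 (Miss U (φ q) v))) ⟩
      sumFin (λ q → w q * # (Miss U (φ q))) + e * # I
        ≤⟨ +-monoˡ-≤ (e * # I) (∑-mono λ q → *-monoʳ-≤ (w q) (bd q)) ⟩
      sumFin (λ q → w q * m) + e * # I
        ≡⟨ cong (_+ e * # I) (∑-*ʳ w m) ⟩
      sumFin w * m + e * # I ∎
      where
      open ≤-Reasoning
      pointwise : ∀ v → B * 𝟙 (U v) ≤ sumFin (λ q → w q * 𝟙 (Miss U (φ q) v)) + e * 𝟙 (I v)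
      pointwise v with U v in eq
      ... | true  = subst (_≤ sumFin (λ q → w q * 𝟙 (not (adj (φ q) v))) + e * 𝟙 (I v)) (sym (*-identityʳ B)) (h v eq)
      ... | false = subst (_≤ sumFin (λ q → w q * 0) + e * 𝟙 (I v)) (sym (*-zeroʳ B)) z≤n

    -- Walks and bipartiteness.

    data Walk (P : Sub) : Fin n → Fin n → ℕ → Set where
      stop : ∀ {u} → P u ≡ true → Walk P u u 0
      step : ∀ {u v w k} → P u ≡ true → adj u v ≡ true → Walk P v w k → Walk P u w (suc k)

    module _ {P : Sub} where
      start∈ : ∀ {u v k} → Walk P u v k → P u ≡ true
      start∈ (stop p)     = p
      start∈ (step p _ _) = p

      end∈ : ∀ {u v k} → Walk P u v k → P v ≡ true
      end∈ (stop p)     = p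
      end∈ (step _ _ w) = end∈ w

      _◅◅_ : ∀ {u v w k l} → Walk P u v k → Walk P v w l → Walk P u w (k + l)
      stop _     ◅◅ w′ = w′
      step p e w ◅◅ w′ = step p e (w ◅◅ w′)

      snoc : ∀ {u v w k} → Walk P u v k → adj v w ≡ true → P w ≡ true → Walk P u w (suc k)
      snoc (stop p)     e q = step p e (stop q)
      snoc (step p f w) e q = step p f (snoc w e q)

      reverse : ∀ {u v k} → Walk P u v k → Walk P v u k
      reverse (stop p)     = stop p
      reverse (step p e w) = snoc (reverse w) (adj-sym′ e) p

    OddClosedFree : Sub → Set
    OddClosedFree P = ∀ v k → odd k ≡ true → ¬ Walk P v v k

    bip? : ∀ P → Dec (Bip P)
    bip? P with anySubset? {P = λ s → ∀ u v → P u ≡ true → P v ≡ true → adj u v ≡ true → ¬ lookup s u ≡ lookup s v}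
      (λ s → all? λ u → all? λ v → (P u ≟ᵇ true) →-dec ((P v ≟ᵇ true) →-dec ((adj u v ≟ᵇ true) →-dec ¬? (lookup s u ≟ᵇ lookup s v))))
    ... | yes (s , h) = yes (lookup s , h)
    ... | no ¬h = no λ { (c , h) → ¬h (tabulate c , λ u v p q e eq →
            h u v p q e (trans (sym (lookup∘tabulate c u)) (trans eq (lookup∘tabulate c v)))) }

    -- Walks are unbounded, so reachability comes without a decision procedure. But `Bip P` is
    -- decidable, hence refuting its negation suffices, and there `reach?` and `even?` may be
    -- assumed. The colour of a vertex tells whether an even walk from the root of its component
    -- reaches it; equal colours on an edge close up to an odd walk.
    oddClosedFree⇒bip : ∀ P → OddClosedFree P → Bip P
    oddClosedFree⇒bip P free with bip? P
    ... | yes b = b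
    ... | no ¬b = ⊥-elim (¬¬-all (λ u → ¬¬-all λ v → ¬¬-dec {∃ (Walk P u v)}) λ reach? →
                   ¬¬-all (λ u → ¬¬-all λ v → ¬¬-dec {∃ λ k → odd k ≡ false × Walk P u v k}) λ even? →
                   ¬b (colouring reach? even?))
      where
      colouring : (∀ u v → Dec (∃ (Walk P u v))) → (∀ u v → Dec (∃ λ k → odd k ≡ false × Walk P u v k)) → Bip P
      colouring reach? even? = c , proper
        where
        reaches : Fin n → Fin n → Bool
        reaches v u = ⌊ reach? u v ⌋
        root : Fin n → Fin n
        root v = first (reaches v) v
        c : Fin n → Bool
        c v = ⌊ even? (root v) v ⌋
        reaches-self : ∀ v → P v ≡ true → reaches v v ≡ true
        reaches-self v p with reach? v v
        ... | yes _ = refl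
        ... | no ¬w = ⊥-elim (¬w (0 , stop p))
        reaches⇒walk : ∀ v u → reaches v u ≡ true → ∃ (Walk P u v)
        reaches⇒walk v u e with reach? u v
        ... | yes w = w
        reaches-adj : ∀ u v → P u ≡ true → P v ≡ true → adj u v ≡ true → ∀ x → reaches u x ≡ reaches v x
        reaches-adj u v p q e x with reach? x u | reach? x v
        ... | yes _ | yes _ = refl
        ... | no _  | no _  = refl
        ... | yes (k , w) | no ¬w = ⊥-elim (¬w (suc k , snoc w e q))
        ... | no ¬w | yes (k , w) = ⊥-elim (¬w (suc k , snoc w (adj-sym′ e) p))
        odd-closed : ∀ {x y z} k l → Walk P x y k → Walk P x z l → adj y z ≡ true → odd k ≡ odd l → ⊥
        odd-closed {x} k l w w′ e eq = free x (suc k + l) par (snoc w e (end∈ w′) ◅◅ reverse w′)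
          where
          par : odd (suc k + l) ≡ true
          par rewrite odd-+ (suc k) l | eq with odd l
          ... | true  = refl
          ... | false = refl
        proper : ∀ u v → P u ≡ true → P v ≡ true → adj u v ≡ true → ¬ c u ≡ c v
        proper u v p q e eq with first-cong (reaches u) (reaches v) u v u (reaches-adj u v p q e) (reaches-self u p)
        ... | r with even? (root u) u | even? (root v) v
        ... | yes (k , ek , w) | yes (l , el , w′) =
                odd-closed k l w (subst (λ x → Walk P x v l) (sym r) w′) e (trans ek (sym el))
        proper u v p q e () | r | yes _ | no _
        proper u v p q e () | r | no _ | yes _
        ... | no ¬w | no ¬w′ with reaches⇒walk u (root u) (first-true (reaches u) u u (reaches-self u p))
                                | reaches⇒walk v (root v) (first-true (reaches v) v v (reaches-self v q))
        ...   | k , w | l , w′ with odd k in ok | odd l in ol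
        ...     | false | _     = ¬w (k , ok , w)
        ...     | true  | false = ¬w′ (l , ol , w′)
        ...     | true  | true  = odd-closed k l w (subst (λ x → Walk P x v l) (sym r) w′) e (trans ok (sym ol))

    -- Maximum independent sets.

    record MaxIndep (U : Sub) : Set where
      field
        set : Sub
        ⊑U : set ⊑ U
        indep : Indep set
        max : ∀ J → J ⊑ U → Indep J → # J ≤ # set

    -- The candidate size descends from the trivial bound n, and the first size that is attained is
    -- maximal.
    maxIndep : ∀ U → MaxIndep U
    maxIndep U = go n λ J _ _ → #-≤n J
      where
      Ok : Sub → Set
      Ok I = (∀ v → I v ≡ true → U v ≡ true) × (∀ u v → I u ≡ true → I v ≡ true → adj u v ≡ false)
      ok? : ∀ I → Dec (Ok I)
      ok? I = (all? λ v → (I v ≟ᵇ true) →-dec (U v ≟ᵇ true)) ×-dec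
              (all? λ u → all? λ v → (I u ≟ᵇ true) →-dec ((I v ≟ᵇ true) →-dec (adj u v ≟ᵇ false)))
      go : ∀ k → (∀ J → J ⊑ U → Indep J → # J ≤ k) → MaxIndep U
      go zero h = record { set = λ _ → false ; ⊑U = λ _ () ; indep = λ _ _ ()
                         ; max = λ J s i → ≤-trans (h J s i) z≤n }
      go (suc k) h with anySubset? (λ s → ok? (lookup s) ×-dec (suc k ≤? # (lookup s)))
      ... | yes (s , (sub , ind) , l) =
              record { set = lookup s ; ⊑U = sub ; indep = ind ; max = λ J p q → ≤-trans (h J p q) l }
      ... | no ¬s = go k λ J sub ind → ≤-pred (≰⇒> λ l → ¬s (tabulate J ,
              ((λ v e → sub v (trans (sym (lookup∘tabulate J v)) e)) ,
               (λ u v e f → ind u v (trans (sym (lookup∘tabulate J u)) e) (trans (sym (lookup∘tabulate J v)) f))) ,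
              ≤-trans l (≤-reflexive (∑-cong λ i → cong 𝟙 (sym (lookup∘tabulate J i))))))

-- Weighting certificates that exclude patterns, checked by evaluation.

module Certificates where
  open Sums
  open Graphs
  open import Defs using (sumFin)
  open import Data.Fin.Properties using (toℕ-injective)
  open import Data.List using (_++_; map)
  open import Data.Nat.ListAction using () renaming (sum to sumᴸ)
  open import Data.Bool.ListAction using (any; all)
  open import Data.Maybe using (Maybe; just; nothing)

  Edges : Set
  Edges = List (ℕ × ℕ)

  Pattern : Set
  Pattern = ℕ × Edges

  at : List ℕ → ℕ → ℕ
  at []       _       = 0
  at (x ∷ _)  zero    = x
  at (_ ∷ xs) (suc i) = at xs i

  atᵇ : List Bool → ℕ → Bool
  atᵇ []       _       = false
  atᵇ (x ∷ _)  zero    = x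
  atᵇ (_ ∷ xs) (suc i) = atᵇ xs i

  missed : List ℕ → List Bool → ℕ
  missed []       _        = 0
  missed (w ∷ ws) []       = 0
  missed (w ∷ ws) (b ∷ bs) = w * 𝟙 (not b) + missed ws bs

  -- Runs through all adjacency vectors of a vertex towards the k vertices of a pattern, so that the
  -- case distinction over its possible neighbourhoods is a computation.
  every : ℕ → (List Bool → Bool) → Bool
  every zero    f = f []
  every (suc k) f = every k (λ a → f (true ∷ a)) ∧ every k (λ a → f (false ∷ a))

  within : List ℕ → List Bool → Bool
  within S a = all (atᵇ a) S

  joined : Edges → ℕ → ℕ → Bool
  joined es a b = any (λ e → ((proj₁ e ≡ᵇ a) ∧ (proj₂ e ≡ᵇ b)) ∨ ((proj₁ e ≡ᵇ b) ∧ (proj₂ e ≡ᵇ a))) es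

  allBelow : ℕ → (ℕ → Bool) → Bool
  allBelow zero    f = true
  allBelow (suc k) f = f 0 ∧ allBelow k (f ∘ suc)

  isHom : Pattern → Pattern → List ℕ → Bool
  isHom (kF , esF) (k , es) ρ =
    allBelow kF (λ i → at ρ i <ᵇ k) ∧ all (λ e → joined es (at ρ (proj₁ e)) (at ρ (proj₂ e))) esF

  -- The new vertex is numbered 0 and the old ones are shifted by one.
  extend : Pattern → List ℕ → Pattern
  extend (k , es) S = suc k , map (λ e → suc (proj₁ e) , suc (proj₂ e)) es ++ map (λ q → 0 , suc q) S

  -- In (S , j , ρ), a new vertex adjacent to all of S creates the forbidden pattern number j; ρ is
  -- the homomorphism showing this, with 0 standing for the new vertex.
  Bad : Set
  Bad = List ℕ × ℕ × List ℕ

  -- node w B bads branches: a vertex missing less than B of the weight w has its neighbourhood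
  -- containing one of the bad sets (creating a forbidden pattern) or one of the branch sets.
  data Tree : Set where
    node : List ℕ → ℕ → List Bad → List (List ℕ × Tree) → Tree

  weights : Tree → List ℕ
  weights (node w _ _ _) = w

  bound : Tree → ℕ
  bound (node _ B _ _) = B

  branchless : Tree → Bool
  branchless (node _ _ _ [])      = true
  branchless (node _ _ _ (_ ∷ _)) = false

  nth : List Pattern → ℕ → Maybe Pattern
  nth []       _       = nothing
  nth (F ∷ _)  zero    = just F
  nth (_ ∷ Fs) (suc j) = nth Fs j

  badOK : List Pattern → Pattern → Bad → Bool
  badOK forb Q (S , j , ρ) with nth forb j
  ... | nothing = false
  ... | just F  = isHom F (extend Q S) ρ

  coversNode : List ℕ → ℕ → List Bad → List (List ℕ) → ℕ → Bool
  coversNode w B bads brs k =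
    every k λ a → (B ≤ᵇ missed w a) ∨ any (λ b → within (proj₁ b) a) bads ∨ any (λ S → within S a) brs

  module _ (forb : List Pattern) (num den : ℕ) where
    mutual
      -- The condition on `sumᴸ w` makes B·N ≤ (Σw)·m incompatible with N > (den/num)·m.
      check : Pattern → Tree → Bool
      check Q (node w B bads brs) =
        coversNode w B bads (map proj₁ brs) (proj₁ Q) ∧ all (badOK forb Q) bads ∧
        (1 ≤ᵇ B) ∧ (sumᴸ w * num ≤ᵇ B * den) ∧ checkAll Q brs

      checkAll : Pattern → List (List ℕ × Tree) → Bool
      checkAll Q []              = true
      checkAll Q ((S , t) ∷ brs) = check (extend Q S) t ∧ checkAll Q brs

  ∨-true : ∀ {a b} → a ∨ b ≡ true → a ≡ true ⊎ b ≡ true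
  ∨-true {true}  _ = inj₁ refl
  ∨-true {false} e = inj₂ e

  ≤ᵇ-true : ∀ {a b} → (a ≤ᵇ b) ≡ true → a ≤ b
  ≤ᵇ-true {a} {b} e = ≤ᵇ⇒≤ a b (subst Data.Bool.T (sym e) tt)
    where import Data.Bool

  <ᵇ-true : ∀ {a b} → (a <ᵇ b) ≡ true → a < b
  <ᵇ-true {a} {b} e = <ᵇ⇒< a b (subst Data.Bool.T (sym e) tt)
    where import Data.Bool

  ≡ᵇ-true : ∀ {a b} → (a ≡ᵇ b) ≡ true → a ≡ b
  ≡ᵇ-true {a} {b} e = ≡ᵇ⇒≡ a b (subst Data.Bool.T (sym e) tt)
    where import Data.Bool

  all⇒All : ∀ {A : Set} (p : A → Bool) xs → all p xs ≡ true → All (λ x → p x ≡ true) xs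
  all⇒All p []       _ = []
  all⇒All p (x ∷ xs) e with ∧-true {p x} e
  ... | e₁ , e₂ = e₁ ∷ all⇒All p xs e₂

  allBelow⇒ : ∀ k f → allBelow k f ≡ true → ∀ i → i < k → f i ≡ true
  allBelow⇒ (suc k) f e zero    _       = proj₁ (∧-true {f 0} e)
  allBelow⇒ (suc k) f e (suc i) (s≤s l) = allBelow⇒ k (f ∘ suc) (proj₂ (∧-true {f 0} e)) i l

  All-map : ∀ {A : Set} {p q : A → Set} {xs} → (∀ {x} → p x → q x) → All p xs → All q xs
  All-map h []       = []
  All-map h (x ∷ xs) = h x ∷ All-map h xs

  All-++ : ∀ {A : Set} {p : A → Set} {xs ys} → All p xs → All p ys → All p (xs ++ ys)
  All-++ []       ys = ys
  All-++ (x ∷ xs) ys = x ∷ All-++ xs ys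

  All-mapped : ∀ {A B : Set} {p : B → Set} (f : A → B) {xs} → All (p ∘ f) xs → All p (map f xs)
  All-mapped f []       = []
  All-mapped f (x ∷ xs) = x ∷ All-mapped f xs

  clash : Edges → List ℕ → ℕ → Bool
  clash es cols len = any (λ e → (proj₁ e <ᵇ len) ∧ ((proj₂ e <ᵇ len) ∧ (at cols (proj₁ e) ≡ᵇ at cols (proj₂ e)))) es

  -- uncolourable₃ k es cols len: no assignment of three colours to the next k vertices extends cols properly.
  uncolourable₃ : ℕ → Edges → List ℕ → ℕ → Bool
  uncolourable₃ zero    es cols len = clash es cols len
  uncolourable₃ (suc k) es cols len = clash es cols len ∨
    (uncolourable₃ k es (cols ++ 0 ∷ []) (suc len) ∧
     (uncolourable₃ k es (cols ++ 1 ∷ []) (suc len) ∧ uncolourable₃ k es (cols ++ 2 ∷ []) (suc len)))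

  not3 : Pattern → Bool
  not3 (k , es) = uncolourable₃ k es [] 0

  firsts : (ℕ → ℕ) → ℕ → List ℕ
  firsts f zero    = []
  firsts f (suc k) = firsts f k ++ f k ∷ []

  at-firsts : ∀ f k i → i < k → at (firsts f k) i ≡ f i
  at-firsts f (suc k) i l with m≤n⇒m<n∨m≡n (≤-pred l)
  ... | inj₁ lt = trans (at-++ˡ (firsts f k) (subst (i <_) (sym (len f k)) lt)) (at-firsts f k i lt)
    where
    len : ∀ f k → Data.List.length (firsts f k) ≡ k
    len f zero    = refl
    len f (suc k) = trans (Data.List.Properties.length-++ (firsts f k)) (trans (+-comm _ 1) (cong suc (len f k)))
      where import Data.List.Properties
    at-++ˡ : ∀ xs {ys i} → i < Data.List.length xs → at (xs ++ ys) i ≡ at xs i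
    at-++ˡ (x ∷ xs) {i = zero}  _       = refl
    at-++ˡ (x ∷ xs) {i = suc i} (s≤s l) = at-++ˡ xs l
    import Data.List
  ... | inj₂ refl = go f k
    where
    at-++ʳ : ∀ xs x → at (xs ++ x ∷ []) (Data.List.length xs) ≡ x
    at-++ʳ []       x = refl
    at-++ʳ (_ ∷ xs) x = at-++ʳ xs x
    import Data.List
    len : ∀ f k → Data.List.length (firsts f k) ≡ k
    len f zero    = refl
    len f (suc k) = trans (Data.List.Properties.length-++ (firsts f k)) (trans (+-comm _ 1) (cong suc (len f k)))
      where import Data.List.Properties
    go : ∀ f k → at (firsts f k ++ f k ∷ []) k ≡ f k
    go f k = trans (cong (at (firsts f k ++ f k ∷ [])) (sym (len f k))) (at-++ʳ (firsts f k) (f k))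

  -- The branch of the search that follows the values of f never meets a clash.
  uncolourable₃⇒ : ∀ k es len (f : ℕ → ℕ) → (∀ i → f i < 3) → All (λ e → ¬ f (proj₁ e) ≡ f (proj₂ e)) es →
    ¬ uncolourable₃ k es (firsts f len) len ≡ true
  uncolourable₃⇒ k es len f lt proper e = go k len e
    where
    no-clash : ∀ len es → All (λ e → ¬ f (proj₁ e) ≡ f (proj₂ e)) es → ¬ clash es (firsts f len) len ≡ true
    no-clash len ((a , b) ∷ es) (h ∷ hs) e with ∨-true {(a <ᵇ len) ∧ ((b <ᵇ len) ∧ (at (firsts f len) a ≡ᵇ at (firsts f len) b))} e
    ... | inj₂ e′ = no-clash len es hs e′
    ... | inj₁ e′ with ∧-true {a <ᵇ len} e′
    ...   | la , e″ with ∧-true {b <ᵇ len} e″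
    ...     | lb , eq = h (trans (sym (at-firsts f len a (<ᵇ-true la))) (trans (≡ᵇ-true eq) (at-firsts f len b (<ᵇ-true lb))))
    go : ∀ k len → ¬ uncolourable₃ k es (firsts f len) len ≡ true
    go zero    len e = no-clash len es proper e
    go (suc k) len e with ∨-true {clash es (firsts f len) len} e
    ... | inj₁ c = no-clash len es proper c
    ... | inj₂ c with ∧-true {uncolourable₃ k es (firsts f len ++ 0 ∷ []) (suc len)} c
    ...   | c₀ , c′ with ∧-true {uncolourable₃ k es (firsts f len ++ 1 ∷ []) (suc len)} c′
    ...     | c₁ , c₂ with f len in eq | lt len
    ...       | 0 | _ = go k (suc len) (subst (λ t → uncolourable₃ k es (firsts f len ++ t ∷ []) (suc len) ≡ true) (sym eq) c₀)
    ...       | 1 | _ = go k (suc len) (subst (λ t → uncolourable₃ k es (firsts f len ++ t ∷ []) (suc len) ≡ true) (sym eq) c₁)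
    ...       | 2 | _ = go k (suc len) (subst (λ t → uncolourable₃ k es (firsts f len ++ t ∷ []) (suc len) ≡ true) (sym eq) c₂)
    ...       | suc (suc (suc _)) | s≤s (s≤s (s≤s ()))

  module Embeddings {n : ℕ} (G : Gr n) where
    open Gr G
    open Structure G

    -- φ is total on ℕ, so that composing it with lookup lists needs no bounds; injectivity is not
    -- demanded.
    record Emb (P : Sub) (Q : Pattern) (φ : ℕ → Fin n) : Set where
      field
        inside : ∀ i → i < proj₁ Q → P (φ i) ≡ true
        edges  : All (λ e → adj (φ (proj₁ e)) (φ (proj₂ e)) ≡ true) (proj₂ Q)

    Avoids : Sub → Pattern → Set
    Avoids P F = ∀ φ → ¬ Emb P F φ

    adjs : (ℕ → Fin n) → Fin n → ℕ → List Bool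
    adjs φ v zero    = []
    adjs φ v (suc k) = adj (φ 0) v ∷ adjs (φ ∘ suc) v k

    every⇒ : ∀ k f → every k f ≡ true → ∀ φ v → f (adjs φ v k) ≡ true
    every⇒ zero    f e φ v = e
    every⇒ (suc k) f e φ v with ∧-true {every k (λ a → f (true ∷ a))} e
    ... | e₁ , e₂ with adj (φ 0) v
    ...   | true  = every⇒ k _ e₁ (φ ∘ suc) v
    ...   | false = every⇒ k _ e₂ (φ ∘ suc) v

    atᵇ-adjs : ∀ k φ v q → atᵇ (adjs φ v k) q ≡ true → adj (φ q) v ≡ true
    atᵇ-adjs (suc k) φ v zero    e = e
    atᵇ-adjs (suc k) φ v (suc q) e = atᵇ-adjs k (φ ∘ suc) v q e

    within-adjs : ∀ k φ v S → within S (adjs φ v k) ≡ true → All (λ q → adj (φ q) v ≡ true) S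
    within-adjs k φ v S e = All-map (λ {q} → atᵇ-adjs k φ v q) (all⇒All (atᵇ (adjs φ v k)) S e)

    missed-adjs : ∀ w k φ v → missed w (adjs φ v k) ≡ sumFin {k} (λ q → at w (toℕ q) * 𝟙 (not (adj (φ (toℕ q)) v)))
    missed-adjs []       k       φ v = sym (∑-zero k)
    missed-adjs (x ∷ w) zero     φ v = refl
    missed-adjs (x ∷ w) (suc k)  φ v = cong (x * 𝟙 (not (adj (φ 0) v)) +_) (missed-adjs w k (φ ∘ suc) v)

    ∑-at≤ : ∀ w k → sumFin {k} (λ q → at w (toℕ q)) ≤ sumᴸ w
    ∑-at≤ []      k       = ≤-reflexive (∑-zero k)
    ∑-at≤ (x ∷ w) zero    = z≤n
    ∑-at≤ (x ∷ w) (suc k) = +-monoʳ-≤ x (∑-at≤ w k)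

    push : Fin n → (ℕ → Fin n) → ℕ → Fin n
    push v φ zero    = v
    push v φ (suc i) = φ i

    extend-emb : ∀ {P Q φ v S} → Emb P Q φ → P v ≡ true → All (λ q → adj (φ q) v ≡ true) S →
      Emb P (extend Q S) (push v φ)
    extend-emb {v = v} E p a = record
      { inside = λ { zero _ → p ; (suc i) (s≤s l) → Emb.inside E i l }
      ; edges  = All-++ (All-mapped _ (Emb.edges E)) (All-mapped _ (All-map (λ e → adj-sym′ e) a)) }

    joined⇒ : ∀ es (φ : ℕ → Fin n) a b → All (λ e → adj (φ (proj₁ e)) (φ (proj₂ e)) ≡ true) es → joined es a b ≡ true → adj (φ a) (φ b) ≡ true
    joined⇒ ((x , y) ∷ es) φ a b (h ∷ hs) e with ∨-true {((x ≡ᵇ a) ∧ (y ≡ᵇ b)) ∨ ((x ≡ᵇ b) ∧ (y ≡ᵇ a))} e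
    ... | inj₂ e′ = joined⇒ es φ a b hs e′
    ... | inj₁ e′ with ∨-true {(x ≡ᵇ a) ∧ (y ≡ᵇ b)} e′
    ...   | inj₁ d with ∧-true {x ≡ᵇ a} d
    ...     | p , q with ≡ᵇ-true {x} p | ≡ᵇ-true {y} q
    ...       | refl | refl = h
    joined⇒ ((x , y) ∷ es) φ a b (h ∷ hs) e | inj₁ e′ | inj₂ d with ∧-true {x ≡ᵇ b} d
    ...     | p , q with ≡ᵇ-true {x} p | ≡ᵇ-true {y} q
    ...       | refl | refl = adj-sym′ h

    compose-emb : ∀ {P F Q φ} ρ → Emb P Q φ → isHom F Q ρ ≡ true → Emb P F (φ ∘ at ρ)
    compose-emb {P} {kF , esF} {k , es} {φ} ρ E e with ∧-true {allBelow kF (λ i → at ρ i <ᵇ k)} e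
    ... | e₁ , e₂ = record
      { inside = λ i l → Emb.inside E (at ρ i) (<ᵇ-true (allBelow⇒ kF _ e₁ i l))
      ; edges  = All-map (λ {x} → joined⇒ es φ (at ρ (proj₁ x)) (at ρ (proj₂ x)) (Emb.edges E))
                   (all⇒All (λ x → joined es (at ρ (proj₁ x)) (at ρ (proj₂ x))) esF e₂) }

    not3⇒ : ∀ {P Q φ} → not3 Q ≡ true → Emb P Q φ → All (λ e → proj₁ e < proj₁ Q × proj₂ e < proj₁ Q) (proj₂ Q) → ¬ Col 3 P
    not3⇒ {P} {k , es} {φ} e E wf (c , proper) = uncolourable₃⇒ k es 0 (λ i → toℕ (c (φ i))) (λ i → toℕ<n (c (φ i)))
      (go es (Emb.edges E) wf) e
      where
      go : ∀ es → All (λ e → adj (φ (proj₁ e)) (φ (proj₂ e)) ≡ true) es → All (λ e → proj₁ e < k × proj₂ e < k) es →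
        All (λ e → ¬ toℕ (c (φ (proj₁ e))) ≡ toℕ (c (φ (proj₂ e)))) es
      go []       []       []               = []
      go (x ∷ es) (a ∷ as) ((l₁ , l₂) ∷ ls) =
        (λ eq → proper _ _ (Emb.inside E _ l₁) (Emb.inside E _ l₂) a (toℕ-injective eq)) ∷ go es as ls

    nth-avoids : ∀ {P} forb j {F} → All (Avoids P) forb → nth forb j ≡ just F → Avoids P F
    nth-avoids (F ∷ _)  zero    (h ∷ _)  refl = h
    nth-avoids (_ ∷ Fs) (suc j) (_ ∷ hs) e    = nth-avoids Fs j hs e

    badOK⇒⊥ : ∀ {P forb Q φ v} b → All (Avoids P) forb → Emb P Q φ → P v ≡ true → badOK forb Q b ≡ true →
      within (proj₁ b) (adjs φ v (proj₁ Q)) ≡ true → ⊥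
    badOK⇒⊥ {P} {forb} {Q} {φ} {v} (S , j , ρ) av E p ok w with nth forb j in eq
    ... | just F = nth-avoids forb j av eq _
          (compose-emb ρ (extend-emb E p (within-adjs (proj₁ Q) φ v S w)) ok)

    module _ {P : Sub} {forb : List Pattern} (av : All (Avoids P) forb) where
      -- A vertex missing less than B would see a bad set, contrary to `av`, or a branch set,
      -- contrary to the hypothesis. The bound is kept apart from the count because it is also used
      -- for the vertices of a subset while all of U is counted.
      covered : ∀ {Q φ} w B bads brs → Emb P Q φ → coversNode w B bads brs (proj₁ Q) ≡ true →
        all (badOK forb Q) bads ≡ true →
        (∀ v → P v ≡ true → All (λ S → ¬ All (λ q → adj (φ q) v ≡ true) S) brs) →
        ∀ v → P v ≡ true → B ≤ sumFin {proj₁ Q} (λ q → at w (toℕ q) * 𝟙 (not (adj (φ (toℕ q)) v)))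
      covered {k , es} {φ} w B bads brs E cov ok nobr v p
        with ∨-true {B ≤ᵇ missed w (adjs φ v k)} (every⇒ k _ cov φ v)
      ... | inj₁ e = subst (B ≤_) (missed-adjs w k φ v) (≤ᵇ-true e)
      ... | inj₂ e with ∨-true {any (λ b → within (proj₁ b) (adjs φ v k)) bads} e
      ...   | inj₁ e′ = ⊥-elim (go bads (all⇒All _ bads ok) e′)
        where
        go : ∀ bs → All (λ b → badOK forb (k , es) b ≡ true) bs → any (λ b → within (proj₁ b) (adjs φ v k)) bs ≡ true → ⊥
        go (b ∷ bs) (o ∷ os) e with ∨-true {within (proj₁ b) (adjs φ v k)} e
        ... | inj₁ h = badOK⇒⊥ b av E p o h
        ... | inj₂ h = go bs os h
      ...   | inj₂ e′ = ⊥-elim (go brs (nobr v p) e′)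
        where
        go : ∀ bs → All (λ S → ¬ All (λ q → adj (φ q) v ≡ true) S) bs → any (λ S → within S (adjs φ v k)) bs ≡ true → ⊥
        go (S ∷ bs) (o ∷ os) e with ∨-true {within S (adjs φ v k)} e
        ... | inj₁ h = o (within-adjs k φ v S h)
        ... | inj₂ h = go bs os h

      leaf-bound : ∀ {num den Q φ} t → branchless t ≡ true → check forb num den Q t ≡ true → Emb P Q φ →
        ∀ v → P v ≡ true → bound t ≤ sumFin {proj₁ Q} (λ q → at (weights t) (toℕ q) * 𝟙 (not (adj (φ (toℕ q)) v)))
      leaf-bound {Q = Q} (node w B bads []) _ e E with ∧-true {coversNode w B bads [] (proj₁ Q)} e
      ... | cov , e₁ = covered w B bads [] E cov (proj₁ (∧-true {all (badOK forb Q) bads} e₁)) (λ _ _ → [])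

    -- Final contradiction of the weighted counts: N ≤ (b/a)m and N > (d/c)m although b/a ≤ d/c.
    no-gap : ∀ a b c d N m → a * N ≤ b * m → d * m < c * N → b * c ≤ a * d → 1 ≤ a → ⊥
    no-gap a@(suc _) b c d N m p q r _ = <-irrefl refl (begin-strict
      a * (c * N) ≡⟨ lemma a c N ⟩
      c * (a * N) ≤⟨ *-monoʳ-≤ c p ⟩
      c * (b * m) ≡⟨ lemma′ c b m ⟩
      b * c * m   ≤⟨ *-monoˡ-≤ m r ⟩
      a * d * m   ≡⟨ *-assoc a d m ⟩
      a * (d * m) <⟨ *-monoʳ-< a q ⟩
      a * (c * N) ∎)
      where
      open ≤-Reasoning
      open import Data.Nat.Tactic.RingSolver using (solve-∀)
      lemma : ∀ a c N → a * (c * N) ≡ c * (a * N)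
      lemma = solve-∀
      lemma′ : ∀ c b m → c * (b * m) ≡ b * c * m
      lemma′ = solve-∀

    module _ {U : Sub} {m : ℕ} (bd : Bounded U m) {forb : List Pattern} (av : All (Avoids U) forb)
             {num den : ℕ} (gap : den * m < num * # U) where
      mutual
        -- Induction on the tree. A vertex whose neighbourhood contains a branch set extends the
        -- embedding, and the subtree refutes the extension. Once no branch occurs, every vertex
        -- misses at least B and the count is contradictory.
        refute : ∀ {Q} t → check forb num den Q t ≡ true → Avoids U Q
        refute {Q} (node w B bads brs) e φ E with ∧-true {coversNode w B bads (map proj₁ brs) (proj₁ Q)} e
        ... | cov , e₁ with ∧-true {all (badOK forb Q) bads} e₁
        ... | ok , e₂ with ∧-true {1 ≤ᵇ B} e₂
        ... | one , e₃ with ∧-true {sumᴸ w * num ≤ᵇ B * den} e₃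
        ... | ratio , sub = no-gap B (sumᴸ w) num den (# U) m
                (≤-trans (weigh U (λ _ → false) (φ ∘ toℕ) (λ q → at w (toℕ q)) B 0
                            (λ q → bd _ (Emb.inside E (toℕ q) (toℕ<n q)))
                            (λ v p → ≤-trans (covered av w B bads (map proj₁ brs) E cov ok
                               (λ v p → refuteAll brs sub φ E v p) v p) (m≤m+n _ _)))
                  (≤-trans (≤-reflexive (+-identityʳ _)) (*-monoˡ-≤ m (∑-at≤ w (proj₁ Q)))))
                gap (≤ᵇ-true ratio) (≤ᵇ-true one)

        refuteAll : ∀ {Q} brs → checkAll forb num den Q brs ≡ true → ∀ φ → Emb U Q φ → ∀ v → U v ≡ true →
          All (λ S → ¬ All (λ q → adj (φ q) v ≡ true) S) (map proj₁ brs)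
        refuteAll []              e φ E v p = []
        refuteAll {Q} ((S , t) ∷ brs) e φ E v p with ∧-true {check forb num den (extend Q S) t} e
        ... | e₁ , e₂ = (λ a → refute t e₁ _ (extend-emb E p a)) ∷ refuteAll brs e₂ φ E v p

-- The excluded patterns and their certificates.

module Trees where
  open Certificates

  -- `Γ₂`, `Γ₂⁺`, `Θ` are `H₂`, `H₂⁺`, `T₀`; `Γ₁` is `H₁⁺⁺` without `u_l`, `u_r`. `Δ₂` is a heptagon
  -- with two further vertices, missing only position 0 and only position 2 of it. The hub of a
  -- wheel comes last here.
  K₄ W₅ W₇ C̄ Γ₂ Γ₂⁺ Γ₁ Θ Δ₂ spindle : Pattern
  K₄ = 4 , (1 , 0) ∷ (2 , 0) ∷ (2 , 1) ∷ (3 , 0) ∷ (3 , 1) ∷ (3 , 2) ∷ []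
  W₅ = 6 , (0 , 1) ∷ (1 , 2) ∷ (2 , 3) ∷ (3 , 4) ∷ (4 , 0) ∷ (5 , 0) ∷ (5 , 1) ∷ (5 , 2) ∷ (5 , 3) ∷ (5 , 4) ∷ []
  W₇ = 8 , (0 , 1) ∷ (1 , 2) ∷ (2 , 3) ∷ (3 , 4) ∷ (4 , 5) ∷ (5 , 6) ∷ (6 , 0) ∷ (7 , 0) ∷ (7 , 1) ∷ (7 , 2) ∷ (7 , 3) ∷ (7 , 4) ∷ (7 , 5) ∷ (7 , 6) ∷ []
  C̄ = 7 , (0 , 1) ∷ (1 , 2) ∷ (2 , 3) ∷ (3 , 4) ∷ (4 , 5) ∷ (5 , 6) ∷ (6 , 0) ∷ (0 , 2) ∷ (1 , 3) ∷ (2 , 4) ∷ (3 , 5) ∷ (4 , 6) ∷ (5 , 0) ∷ (6 , 1) ∷ []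
  Γ₂ = 7 , (0 , 1) ∷ (1 , 2) ∷ (2 , 3) ∷ (3 , 4) ∷ (4 , 5) ∷ (5 , 6) ∷ (6 , 0) ∷ (0 , 2) ∷ (1 , 3) ∷ (2 , 4) ∷ (3 , 5) ∷ (4 , 6) ∷ (5 , 0) ∷ []
  Γ₂⁺ = 8 , (0 , 1) ∷ (1 , 2) ∷ (2 , 3) ∷ (3 , 4) ∷ (4 , 5) ∷ (5 , 6) ∷ (6 , 0) ∷ (0 , 2) ∷ (1 , 3) ∷ (2 , 4) ∷ (3 , 5) ∷ (4 , 6) ∷ (5 , 0) ∷ (7 , 0) ∷ (7 , 2) ∷ (7 , 5) ∷ []
  Γ₁ = 7 , (0 , 1) ∷ (1 , 2) ∷ (2 , 3) ∷ (3 , 4) ∷ (4 , 5) ∷ (5 , 6) ∷ (6 , 0) ∷ (3 , 5) ∷ (5 , 0) ∷ (0 , 2) ∷ (2 , 4) ∷ (6 , 1) ∷ []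
  Θ = 10 , (0 , 1) ∷ (1 , 2) ∷ (2 , 3) ∷ (3 , 4) ∷ (4 , 5) ∷ (5 , 6) ∷ (6 , 0) ∷ (8 , 0) ∷ (8 , 2) ∷ (8 , 3) ∷ (8 , 4) ∷ (8 , 5) ∷ (8 , 6) ∷ (9 , 0) ∷ (9 , 1) ∷ (9 , 2) ∷ (9 , 3) ∷ (9 , 4) ∷ (9 , 5) ∷ (7 , 0) ∷ (7 , 8) ∷ (7 , 9) ∷ []
  Δ₂ = 9 , (0 , 1) ∷ (1 , 2) ∷ (2 , 3) ∷ (3 , 4) ∷ (4 , 5) ∷ (5 , 6) ∷ (6 , 0) ∷ (7 , 1) ∷ (7 , 2) ∷ (7 , 3) ∷ (7 , 4) ∷ (7 , 5) ∷ (7 , 6) ∷ (8 , 0) ∷ (8 , 1) ∷ (8 , 3) ∷ (8 , 4) ∷ (8 , 5) ∷ (8 , 6) ∷ []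
  spindle = 7 , (0 , 1) ∷ (0 , 2) ∷ (1 , 2) ∷ (1 , 3) ∷ (2 , 3) ∷ (0 , 4) ∷ (0 , 5) ∷ (4 , 5) ∷ (4 , 6) ∷ (5 , 6) ∷ (3 , 6) ∷ []

  -- Total 9 over bound 4 is 2 + c₅, the value at which `F 6` becomes the obstruction.
  tree-Γ₂⁺ : Tree
  tree-Γ₂⁺ =
    node (2 ∷ 1 ∷ 2 ∷ 1 ∷ 1 ∷ 1 ∷ 1 ∷ 0 ∷ []) 4
      (((0 ∷ 1 ∷ 2 ∷ []) , 0 , (0 ∷ 1 ∷ 2 ∷ 3 ∷ [])) ∷ ((0 ∷ 3 ∷ 5 ∷ []) , 1 , (0 ∷ 1 ∷ 7 ∷ 5 ∷ 4 ∷ 6 ∷ [])) ∷ ((2 ∷ 4 ∷ 6 ∷ []) , 1 , (0 ∷ 3 ∷ 4 ∷ 6 ∷ 7 ∷ 5 ∷ [])) ∷ ((0 ∷ 2 ∷ 4 ∷ []) , 1 , (0 ∷ 1 ∷ 2 ∷ 4 ∷ 5 ∷ 3 ∷ [])) ∷ ((0 ∷ 2 ∷ 6 ∷ []) , 1 , (0 ∷ 3 ∷ 8 ∷ 6 ∷ 7 ∷ 1 ∷ [])) ∷ ((1 ∷ 2 ∷ 3 ∷ []) , 0 , (0 ∷ 2 ∷ 3 ∷ 4 ∷ [])) ∷ ((0 ∷ 1 ∷ 5 ∷ []) , 1 , (0 ∷ 2 ∷ 3 ∷ 8 ∷ 6 ∷ 1 ∷ [])) ∷ ((0 ∷ 1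 ∷ 3 ∷ 4 ∷ 6 ∷ []) , 1 , (1 ∷ 2 ∷ 4 ∷ 5 ∷ 7 ∷ 0 ∷ [])) ∷ [])
      []

  check-Γ₂⁺ : check (K₄ ∷ W₅ ∷ W₇ ∷ C̄ ∷ []) 4 9 Γ₂⁺ tree-Γ₂⁺ ≡ true
  check-Γ₂⁺ = refl

  -- Total 11 over bound 5 is 2 + c₇. The first bad set is the one that creates `Γ₂⁺`.
  tree-Γ₂ : Tree
  tree-Γ₂ =
    node (3 ∷ 1 ∷ 2 ∷ 1 ∷ 1 ∷ 2 ∷ 1 ∷ []) 5
      (((0 ∷ 2 ∷ 5 ∷ []) , 4 , (1 ∷ 2 ∷ 3 ∷ 4 ∷ 5 ∷ 6 ∷ 7 ∷ 0 ∷ [])) ∷ ((0 ∷ 1 ∷ 2 ∷ []) , 0 , (0 ∷ 1 ∷ 2 ∷ 3 ∷ [])) ∷ ((0 ∷ 3 ∷ 5 ∷ []) , 1 , (0 ∷ 1 ∷ 7 ∷ 5 ∷ 4 ∷ 6 ∷ [])) ∷ ((2 ∷ 3 ∷ 4 ∷ []) , 0 , (0 ∷ 3 ∷ 4 ∷ 5 ∷ [])) ∷ ((0 ∷ 5 ∷ 6 ∷ []) , 0 , (0 ∷ 1 ∷ 6 ∷ 7 ∷ [])) ∷ ((2 ∷ 4 ∷ 6 ∷ []) , 1 , (0 ∷ 3 ∷ 4 ∷ 6 ∷ 7 ∷ 5 ∷ [])) ∷ ((1 ∷ 2 ∷ 3 ∷ []) , 0 , (0 ∷ 2 ∷ 3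 ∷ 4 ∷ [])) ∷ ((0 ∷ 1 ∷ 4 ∷ 5 ∷ []) , 3 , (0 ∷ 1 ∷ 2 ∷ 3 ∷ 4 ∷ 5 ∷ 6 ∷ [])) ∷ ((0 ∷ 2 ∷ 3 ∷ 6 ∷ []) , 3 , (0 ∷ 1 ∷ 7 ∷ 6 ∷ 5 ∷ 4 ∷ 3 ∷ [])) ∷ ((0 ∷ 1 ∷ 3 ∷ 4 ∷ 6 ∷ []) , 1 , (1 ∷ 2 ∷ 4 ∷ 5 ∷ 7 ∷ 0 ∷ [])) ∷ [])
      []

  check-Γ₂ : check (K₄ ∷ W₅ ∷ W₇ ∷ C̄ ∷ Γ₂⁺ ∷ []) 5 11 Γ₂ tree-Γ₂ ≡ true
  check-Γ₂ = refl

  -- Total 15 over bound 7 is 2 + c₁₁.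
  tree-Γ₁ : Tree
  tree-Γ₁ =
    node (3 ∷ 1 ∷ 3 ∷ 2 ∷ 2 ∷ 3 ∷ 1 ∷ []) 7
      (((0 ∷ 2 ∷ 5 ∷ []) , 1 , (0 ∷ 3 ∷ 2 ∷ 7 ∷ 6 ∷ 1 ∷ [])) ∷ ((2 ∷ 3 ∷ 4 ∷ []) , 0 , (0 ∷ 3 ∷ 4 ∷ 5 ∷ [])) ∷ ((0 ∷ 1 ∷ 6 ∷ []) , 0 , (0 ∷ 1 ∷ 2 ∷ 7 ∷ [])) ∷ ((3 ∷ 4 ∷ 5 ∷ []) , 0 , (0 ∷ 4 ∷ 5 ∷ 6 ∷ [])) ∷ ((0 ∷ 1 ∷ 2 ∷ []) , 0 , (0 ∷ 1 ∷ 2 ∷ 3 ∷ [])) ∷ ((0 ∷ 5 ∷ 6 ∷ []) , 0 , (0 ∷ 1 ∷ 6 ∷ 7 ∷ [])) ∷ ((1 ∷ 2 ∷ 3 ∷ 5 ∷ []) , 3 , (6 ∷ 4 ∷ 0 ∷ 3 ∷ 2 ∷ 1 ∷ 7 ∷ [])) ∷ ((1 ∷ 2 ∷ 4 ∷ 5 ∷ []) , 3 , (6 ∷ 5 ∷ 0 ∷ 3 ∷ 2 ∷ 1 ∷ 7 ∷ [])) ∷ ((0 ∷ 1 ∷ 3 ∷ 5 ∷ []) , 3 , (3 ∷ 2 ∷ 1 ∷ 0 ∷ 6 ∷ 4 ∷ 5 ∷ [])) ∷ ((0 ∷ 1 ∷ 4 ∷ 5 ∷ []) , 3 , (3 ∷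 2 ∷ 1 ∷ 0 ∷ 6 ∷ 5 ∷ 4 ∷ [])) ∷ ((0 ∷ 2 ∷ 3 ∷ 6 ∷ []) , 3 , (6 ∷ 7 ∷ 1 ∷ 0 ∷ 3 ∷ 4 ∷ 5 ∷ [])) ∷ ((0 ∷ 2 ∷ 4 ∷ 6 ∷ []) , 3 , (6 ∷ 7 ∷ 1 ∷ 0 ∷ 3 ∷ 5 ∷ 4 ∷ [])) ∷ ((2 ∷ 3 ∷ 5 ∷ 6 ∷ []) , 3 , (3 ∷ 4 ∷ 0 ∷ 6 ∷ 7 ∷ 1 ∷ 2 ∷ [])) ∷ ((2 ∷ 4 ∷ 5 ∷ 6 ∷ []) , 3 , (3 ∷ 5 ∷ 0 ∷ 6 ∷ 7 ∷ 1 ∷ 2 ∷ [])) ∷ [])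
      []

  check-Γ₁ : check (K₄ ∷ W₅ ∷ W₇ ∷ Γ₂ ∷ []) 7 15 Γ₁ tree-Γ₁ ≡ true
  check-Γ₁ = refl

  -- Four neighbourhoods are too large for the root weights without creating a forbidden pattern;
  -- they become branches, where the spindle with that vertex is refuted by unit weights. The
  -- symmetries of the spindle permute the four branch sets.
  tree-spindle : Tree
  tree-spindle =
    node (0 ∷ 1 ∷ 1 ∷ 2 ∷ 1 ∷ 1 ∷ 2 ∷ []) 4
      (((0 ∷ 1 ∷ 2 ∷ []) , 0 , (0 ∷ 1 ∷ 2 ∷ 3 ∷ [])) ∷ ((4 ∷ 5 ∷ 6 ∷ []) , 0 , (0 ∷ 5 ∷ 6 ∷ 7 ∷ [])) ∷ ((1 ∷ 2 ∷ 3 ∷ []) , 0 , (0 ∷ 2 ∷ 3 ∷ 4 ∷ [])) ∷ ((0 ∷ 4 ∷ 5 ∷ []) , 0 , (0 ∷ 1 ∷ 5 ∷ 6 ∷ [])) ∷ ((1 ∷ 2 ∷ 4 ∷ 6 ∷ []) , 3 , (5 ∷ 7 ∷ 0 ∷ 2 ∷ 3 ∷ 1 ∷ 6 ∷ [])) ∷ ((1 ∷ 2 ∷ 5 ∷ 6 ∷ []) , 3 , (6 ∷ 7 ∷ 0 ∷ 2 ∷ 3 ∷ 1 ∷ 5 ∷ [])) ∷ ((1 ∷ 3 ∷ 4 ∷ 5 ∷ []) , 3 , (2 ∷ 4 ∷ 0 ∷ 5 ∷ 6 ∷ 1 ∷ 3 ∷ [])) ∷ ((2 ∷ 3 ∷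 4 ∷ 5 ∷ []) , 3 , (3 ∷ 4 ∷ 0 ∷ 5 ∷ 6 ∷ 1 ∷ 2 ∷ [])) ∷ [])
      (((1 ∷ 3 ∷ 6 ∷ []) , node (1 ∷ 1 ∷ 1 ∷ 1 ∷ 1 ∷ 1 ∷ 1 ∷ 1 ∷ []) 4
        (((0 ∷ 1 ∷ 2 ∷ []) , 1 , (0 ∷ 1 ∷ 5 ∷ 4 ∷ 2 ∷ 3 ∷ [])) ∷ ((3 ∷ 4 ∷ 7 ∷ []) , 1 , (0 ∷ 4 ∷ 3 ∷ 1 ∷ 8 ∷ 5 ∷ [])) ∷ ((1 ∷ 5 ∷ 6 ∷ []) , 0 , (0 ∷ 2 ∷ 6 ∷ 7 ∷ [])) ∷ ((0 ∷ 2 ∷ 4 ∷ []) , 0 , (0 ∷ 1 ∷ 3 ∷ 5 ∷ [])) ∷ ((5 ∷ 6 ∷ 7 ∷ []) , 0 , (0 ∷ 6 ∷ 7 ∷ 8 ∷ [])) ∷ ((1 ∷ 2 ∷ 3 ∷ []) , 0 , (0 ∷ 2 ∷ 3 ∷ 4 ∷ [])) ∷ ((0 ∷ 4 ∷ 7 ∷ []) , 0 , (0 ∷ 1 ∷ 5 ∷ 8 ∷ [])) ∷ ((0 ∷ 1 ∷ 3 ∷ 7 ∷ []) , 3 , (1 ∷ 8 ∷ 0 ∷ 2 ∷ 4 ∷ 3 ∷ 5 ∷ [])) ∷ ((1 ∷ 2 ∷ 4 ∷ 7 ∷ []) , 3 , (0 ∷ 3 ∷ 2 ∷ 6 ∷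 7 ∷ 8 ∷ 5 ∷ [])) ∷ ((3 ∷ 4 ∷ 5 ∷ 6 ∷ []) , 3 , (4 ∷ 5 ∷ 0 ∷ 6 ∷ 7 ∷ 2 ∷ 3 ∷ [])) ∷ ((0 ∷ 1 ∷ 4 ∷ 5 ∷ []) , 3 , (6 ∷ 2 ∷ 0 ∷ 1 ∷ 5 ∷ 8 ∷ 7 ∷ [])) ∷ ((0 ∷ 1 ∷ 4 ∷ 6 ∷ []) , 3 , (7 ∷ 2 ∷ 0 ∷ 1 ∷ 5 ∷ 8 ∷ 6 ∷ [])) ∷ ((0 ∷ 2 ∷ 5 ∷ 6 ∷ []) , 3 , (1 ∷ 3 ∷ 0 ∷ 6 ∷ 7 ∷ 8 ∷ 5 ∷ [])) ∷ ((2 ∷ 3 ∷ 5 ∷ 7 ∷ []) , 3 , (6 ∷ 8 ∷ 0 ∷ 3 ∷ 4 ∷ 2 ∷ 7 ∷ [])) ∷ ((2 ∷ 3 ∷ 6 ∷ 7 ∷ []) , 3 , (7 ∷ 8 ∷ 0 ∷ 3 ∷ 4 ∷ 2 ∷ 6 ∷ [])) ∷ [])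
        []) ∷ ((2 ∷ 3 ∷ 6 ∷ []) , node (1 ∷ 1 ∷ 1 ∷ 1 ∷ 1 ∷ 1 ∷ 1 ∷ 1 ∷ []) 4
        (((0 ∷ 1 ∷ 3 ∷ []) , 1 , (0 ∷ 1 ∷ 5 ∷ 3 ∷ 2 ∷ 4 ∷ [])) ∷ ((2 ∷ 4 ∷ 7 ∷ []) , 1 , (0 ∷ 3 ∷ 4 ∷ 1 ∷ 8 ∷ 5 ∷ [])) ∷ ((1 ∷ 5 ∷ 6 ∷ []) , 0 , (0 ∷ 2 ∷ 6 ∷ 7 ∷ [])) ∷ ((0 ∷ 3 ∷ 4 ∷ []) , 0 , (0 ∷ 1 ∷ 4 ∷ 5 ∷ [])) ∷ ((5 ∷ 6 ∷ 7 ∷ []) , 0 , (0 ∷ 6 ∷ 7 ∷ 8 ∷ [])) ∷ ((1 ∷ 2 ∷ 3 ∷ []) , 0 , (0 ∷ 2 ∷ 3 ∷ 4 ∷ [])) ∷ ((0 ∷ 4 ∷ 7 ∷ []) , 0 , (0 ∷ 1 ∷ 5 ∷ 8 ∷ [])) ∷ ((0 ∷ 1 ∷ 2 ∷ 7 ∷ []) , 3 , (1 ∷ 8 ∷ 0 ∷ 2 ∷ 3 ∷ 4 ∷ 5 ∷ [])) ∷ ((1 ∷ 3 ∷ 4 ∷ 7 ∷ []) , 3 , (0 ∷ 4 ∷ 2 ∷ 6 ∷ 7 ∷ 8 ∷ 5 ∷ [])) ∷ ((2 ∷ 4 ∷ 5 ∷ 6 ∷ []) , 3 , (3 ∷ 5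 ∷ 0 ∷ 6 ∷ 7 ∷ 2 ∷ 4 ∷ [])) ∷ ((0 ∷ 1 ∷ 4 ∷ 5 ∷ []) , 3 , (6 ∷ 2 ∷ 0 ∷ 1 ∷ 5 ∷ 8 ∷ 7 ∷ [])) ∷ ((0 ∷ 1 ∷ 4 ∷ 6 ∷ []) , 3 , (7 ∷ 2 ∷ 0 ∷ 1 ∷ 5 ∷ 8 ∷ 6 ∷ [])) ∷ ((0 ∷ 3 ∷ 5 ∷ 6 ∷ []) , 3 , (1 ∷ 4 ∷ 0 ∷ 6 ∷ 7 ∷ 8 ∷ 5 ∷ [])) ∷ ((2 ∷ 3 ∷ 5 ∷ 7 ∷ []) , 3 , (6 ∷ 8 ∷ 0 ∷ 3 ∷ 4 ∷ 2 ∷ 7 ∷ [])) ∷ ((2 ∷ 3 ∷ 6 ∷ 7 ∷ []) , 3 , (7 ∷ 8 ∷ 0 ∷ 3 ∷ 4 ∷ 2 ∷ 6 ∷ [])) ∷ [])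
        []) ∷ ((3 ∷ 4 ∷ 6 ∷ []) , node (1 ∷ 1 ∷ 1 ∷ 1 ∷ 1 ∷ 1 ∷ 1 ∷ 1 ∷ []) 4
        (((0 ∷ 1 ∷ 5 ∷ []) , 1 , (0 ∷ 1 ∷ 8 ∷ 7 ∷ 2 ∷ 6 ∷ [])) ∷ ((2 ∷ 3 ∷ 4 ∷ []) , 0 , (0 ∷ 3 ∷ 4 ∷ 5 ∷ [])) ∷ ((4 ∷ 6 ∷ 7 ∷ []) , 1 , (0 ∷ 5 ∷ 1 ∷ 6 ∷ 7 ∷ 8 ∷ [])) ∷ ((1 ∷ 2 ∷ 3 ∷ []) , 0 , (0 ∷ 2 ∷ 3 ∷ 4 ∷ [])) ∷ ((0 ∷ 5 ∷ 7 ∷ []) , 0 , (0 ∷ 1 ∷ 6 ∷ 8 ∷ [])) ∷ ((1 ∷ 5 ∷ 6 ∷ []) , 0 , (0 ∷ 2 ∷ 6 ∷ 7 ∷ [])) ∷ ((0 ∷ 4 ∷ 7 ∷ []) , 0 , (0 ∷ 1 ∷ 5 ∷ 8 ∷ [])) ∷ ((0 ∷ 1 ∷ 4 ∷ 6 ∷ []) , 3 , (1 ∷ 5 ∷ 0 ∷ 2 ∷ 7 ∷ 6 ∷ 8 ∷ [])) ∷ ((1 ∷ 4 ∷ 5 ∷ 7 ∷ []) , 3 , (0 ∷ 6 ∷ 2 ∷ 3 ∷ 4 ∷ 5 ∷ 8 ∷ [])) ∷ ((2 ∷ 3 ∷ 6 ∷ 7 ∷ []) , 3 , (7 ∷ 8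 ∷ 0 ∷ 3 ∷ 4 ∷ 2 ∷ 6 ∷ [])) ∷ ((0 ∷ 1 ∷ 2 ∷ 7 ∷ []) , 3 , (3 ∷ 2 ∷ 0 ∷ 1 ∷ 8 ∷ 5 ∷ 4 ∷ [])) ∷ ((0 ∷ 1 ∷ 3 ∷ 7 ∷ []) , 3 , (4 ∷ 2 ∷ 0 ∷ 1 ∷ 8 ∷ 5 ∷ 3 ∷ [])) ∷ ((0 ∷ 2 ∷ 3 ∷ 5 ∷ []) , 3 , (1 ∷ 6 ∷ 0 ∷ 3 ∷ 4 ∷ 5 ∷ 8 ∷ [])) ∷ ((2 ∷ 4 ∷ 5 ∷ 6 ∷ []) , 3 , (3 ∷ 5 ∷ 0 ∷ 6 ∷ 7 ∷ 2 ∷ 4 ∷ [])) ∷ ((3 ∷ 4 ∷ 5 ∷ 6 ∷ []) , 3 , (4 ∷ 5 ∷ 0 ∷ 6 ∷ 7 ∷ 2 ∷ 3 ∷ [])) ∷ [])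
        []) ∷ ((3 ∷ 5 ∷ 6 ∷ []) , node (1 ∷ 1 ∷ 1 ∷ 1 ∷ 1 ∷ 1 ∷ 1 ∷ 1 ∷ []) 4
        (((0 ∷ 1 ∷ 6 ∷ []) , 1 , (0 ∷ 1 ∷ 8 ∷ 6 ∷ 2 ∷ 7 ∷ [])) ∷ ((2 ∷ 3 ∷ 4 ∷ []) , 0 , (0 ∷ 3 ∷ 4 ∷ 5 ∷ [])) ∷ ((4 ∷ 5 ∷ 7 ∷ []) , 1 , (0 ∷ 5 ∷ 1 ∷ 7 ∷ 6 ∷ 8 ∷ [])) ∷ ((1 ∷ 2 ∷ 3 ∷ []) , 0 , (0 ∷ 2 ∷ 3 ∷ 4 ∷ [])) ∷ ((0 ∷ 6 ∷ 7 ∷ []) , 0 , (0 ∷ 1 ∷ 7 ∷ 8 ∷ [])) ∷ ((1 ∷ 5 ∷ 6 ∷ []) , 0 , (0 ∷ 2 ∷ 6 ∷ 7 ∷ [])) ∷ ((0 ∷ 4 ∷ 7 ∷ []) , 0 , (0 ∷ 1 ∷ 5 ∷ 8 ∷ [])) ∷ ((0 ∷ 1 ∷ 4 ∷ 5 ∷ []) , 3 , (1 ∷ 5 ∷ 0 ∷ 2 ∷ 6 ∷ 7 ∷ 8 ∷ [])) ∷ ((1 ∷ 4 ∷ 6 ∷ 7 ∷ []) , 3 , (0 ∷ 7 ∷ 2 ∷ 3 ∷ 4 ∷ 5 ∷ 8 ∷ [])) ∷ ((2 ∷ 3 ∷ 5 ∷ 7 ∷ []) , 3 , (6 ∷ 8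 ∷ 0 ∷ 3 ∷ 4 ∷ 2 ∷ 7 ∷ [])) ∷ ((0 ∷ 1 ∷ 2 ∷ 7 ∷ []) , 3 , (3 ∷ 2 ∷ 0 ∷ 1 ∷ 8 ∷ 5 ∷ 4 ∷ [])) ∷ ((0 ∷ 1 ∷ 3 ∷ 7 ∷ []) , 3 , (4 ∷ 2 ∷ 0 ∷ 1 ∷ 8 ∷ 5 ∷ 3 ∷ [])) ∷ ((0 ∷ 2 ∷ 3 ∷ 6 ∷ []) , 3 , (1 ∷ 7 ∷ 0 ∷ 3 ∷ 4 ∷ 5 ∷ 8 ∷ [])) ∷ ((2 ∷ 4 ∷ 5 ∷ 6 ∷ []) , 3 , (3 ∷ 5 ∷ 0 ∷ 6 ∷ 7 ∷ 2 ∷ 4 ∷ [])) ∷ ((3 ∷ 4 ∷ 5 ∷ 6 ∷ []) , 3 , (4 ∷ 5 ∷ 0 ∷ 6 ∷ 7 ∷ 2 ∷ 3 ∷ [])) ∷ [])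
        []) ∷ [])

  check-spindle : check (K₄ ∷ W₅ ∷ W₇ ∷ Γ₁ ∷ []) 7 15 spindle tree-spindle ≡ true
  check-spindle = refl

  -- Total 13 over bound 6 is 2 + c₉. The weight zero of vertex 7 matters again in `J-Θ`.
  tree-Θ : Tree
  tree-Θ =
    node (2 ∷ 1 ∷ 1 ∷ 1 ∷ 1 ∷ 1 ∷ 1 ∷ 0 ∷ 4 ∷ 1 ∷ []) 6
      (((0 ∷ 1 ∷ 8 ∷ []) , 1 , (0 ∷ 2 ∷ 10 ∷ 8 ∷ 9 ∷ 1 ∷ [])) ∷ ((2 ∷ 3 ∷ 8 ∷ []) , 0 , (0 ∷ 3 ∷ 4 ∷ 9 ∷ [])) ∷ ((4 ∷ 5 ∷ 8 ∷ []) , 0 , (0 ∷ 5 ∷ 6 ∷ 9 ∷ [])) ∷ ((0 ∷ 6 ∷ 8 ∷ []) , 0 , (0 ∷ 1 ∷ 7 ∷ 9 ∷ [])) ∷ ((1 ∷ 2 ∷ 9 ∷ []) , 0 , (0 ∷ 2 ∷ 3 ∷ 10 ∷ [])) ∷ ((3 ∷ 6 ∷ 8 ∷ []) , 1 , (0 ∷ 4 ∷ 5 ∷ 6 ∷ 7 ∷ 9 ∷ [])) ∷ ((0 ∷ 7 ∷ 8 ∷ []) , 0 , (0 ∷ 1 ∷ 8 ∷ 9 ∷ [])) ∷ ((2 ∷ 6 ∷ 8 ∷ []) , 3 , (1 ∷ 2 ∷ 10 ∷ 3 ∷ 7 ∷ 9 ∷ 0 ∷ [])) ∷ ((0 ∷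 3 ∷ 9 ∷ []) , 1 , (0 ∷ 1 ∷ 2 ∷ 3 ∷ 4 ∷ 10 ∷ [])) ∷ ((0 ∷ 2 ∷ 8 ∷ []) , 2 , (0 ∷ 1 ∷ 7 ∷ 6 ∷ 5 ∷ 4 ∷ 3 ∷ 9 ∷ [])) ∷ ((1 ∷ 4 ∷ 8 ∷ []) , 3 , (4 ∷ 3 ∷ 10 ∷ 2 ∷ 5 ∷ 9 ∷ 0 ∷ [])) ∷ ((1 ∷ 5 ∷ 9 ∷ []) , 3 , (1 ∷ 2 ∷ 10 ∷ 0 ∷ 7 ∷ 9 ∷ 6 ∷ [])) ∷ ((0 ∷ 3 ∷ 8 ∷ []) , 3 , (1 ∷ 0 ∷ 9 ∷ 4 ∷ 2 ∷ 10 ∷ 3 ∷ [])) ∷ ((0 ∷ 1 ∷ 2 ∷ 3 ∷ 4 ∷ 5 ∷ 6 ∷ []) , 2 , (1 ∷ 2 ∷ 3 ∷ 4 ∷ 5 ∷ 6 ∷ 7 ∷ 0 ∷ [])) ∷ ((0 ∷ 4 ∷ 8 ∷ []) , 1 , (0 ∷ 1 ∷ 7 ∷ 6 ∷ 5 ∷ 9 ∷ [])) ∷ ((0 ∷ 5 ∷ 9 ∷ []) , 2 , (0 ∷ 1 ∷ 2 ∷ 3 ∷ 4 ∷ 5 ∷ 6 ∷ 10 ∷ [])) ∷ [])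
      []

  check-Θ : check (K₄ ∷ W₅ ∷ W₇ ∷ spindle ∷ []) 6 13 Θ tree-Θ ≡ true
  check-Θ = refl

  -- The ratio 19/9 is below 15/7. Two members of I that miss heptagon positions two apart create
  -- this pattern.
  tree-Δ₂ : Tree
  tree-Δ₂ =
    node (1 ∷ 5 ∷ 1 ∷ 1 ∷ 1 ∷ 1 ∷ 1 ∷ 4 ∷ 4 ∷ []) 9
      (((1 ∷ 7 ∷ 8 ∷ []) , 4 , (2 ∷ 1 ∷ 7 ∷ 6 ∷ 5 ∷ 4 ∷ 3 ∷ 0 ∷ 8 ∷ 9 ∷ [])) ∷ ((0 ∷ 1 ∷ 7 ∷ []) , 3 , (1 ∷ 0 ∷ 2 ∷ 8 ∷ 7 ∷ 9 ∷ 6 ∷ [])) ∷ ((0 ∷ 1 ∷ 8 ∷ []) , 0 , (0 ∷ 1 ∷ 2 ∷ 9 ∷ [])) ∷ ((2 ∷ 3 ∷ 7 ∷ []) , 0 , (0 ∷ 3 ∷ 4 ∷ 8 ∷ [])) ∷ ((4 ∷ 5 ∷ 8 ∷ []) , 0 , (0 ∷ 5 ∷ 6 ∷ 9 ∷ [])) ∷ ((1 ∷ 2 ∷ 8 ∷ []) , 3 , (3 ∷ 0 ∷ 2 ∷ 9 ∷ 4 ∷ 8 ∷ 5 ∷ [])) ∷ ((1 ∷ 4 ∷ 7 ∷ []) , 1 , (0 ∷ 2 ∷ 3 ∷ 4 ∷ 5 ∷ 8 ∷ [])) ∷ ((0 ∷ 6 ∷ 7 ∷ []) , 1 , (0 ∷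 1 ∷ 9 ∷ 6 ∷ 8 ∷ 7 ∷ [])) ∷ ((1 ∷ 3 ∷ 8 ∷ []) , 2 , (0 ∷ 2 ∷ 1 ∷ 7 ∷ 6 ∷ 5 ∷ 4 ∷ 9 ∷ [])) ∷ ((1 ∷ 5 ∷ 7 ∷ []) , 3 , (2 ∷ 0 ∷ 8 ∷ 6 ∷ 1 ∷ 9 ∷ 7 ∷ [])) ∷ ((2 ∷ 6 ∷ 7 ∷ []) , 3 , (2 ∷ 1 ∷ 9 ∷ 7 ∷ 3 ∷ 8 ∷ 0 ∷ [])) ∷ ((3 ∷ 6 ∷ 7 ∷ []) , 1 , (0 ∷ 4 ∷ 5 ∷ 6 ∷ 7 ∷ 8 ∷ [])) ∷ ((0 ∷ 3 ∷ 8 ∷ []) , 3 , (2 ∷ 1 ∷ 9 ∷ 0 ∷ 3 ∷ 8 ∷ 4 ∷ [])) ∷ ((0 ∷ 4 ∷ 7 ∷ []) , 3 , (6 ∷ 5 ∷ 8 ∷ 0 ∷ 7 ∷ 9 ∷ 1 ∷ [])) ∷ ((1 ∷ 4 ∷ 8 ∷ []) , 3 , (2 ∷ 0 ∷ 9 ∷ 5 ∷ 3 ∷ 8 ∷ 4 ∷ [])) ∷ ((1 ∷ 5 ∷ 8 ∷ []) , 1 , (0 ∷ 2 ∷ 1 ∷ 7 ∷ 6 ∷ 9 ∷ [])) ∷ ((2 ∷ 5 ∷ 7 ∷ []) , 1 , (0 ∷ 3 ∷ 4 ∷ 5 ∷ 6 ∷ 8 ∷ [])) ∷ ((0 ∷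 1 ∷ 2 ∷ 3 ∷ 4 ∷ 5 ∷ 6 ∷ []) , 2 , (1 ∷ 2 ∷ 3 ∷ 4 ∷ 5 ∷ 6 ∷ 7 ∷ 0 ∷ [])) ∷ [])
      []

  check-Δ₂ : check (K₄ ∷ W₅ ∷ W₇ ∷ spindle ∷ Θ ∷ []) 7 15 Δ₂ tree-Δ₂ ≡ true
  check-Δ₂ = refl

  -- Unit weights have the weaker ratio 7/3 = 2 + c₃ but rely on `K₄`, `W₅` and `W₇` alone. They
  -- serve g ≤ 3 and, for every g, the step from four colours to three.
  tree-spindle′ : Tree
  tree-spindle′ =
    node (1 ∷ 1 ∷ 1 ∷ 1 ∷ 1 ∷ 1 ∷ 1 ∷ []) 3
      (((0 ∷ 1 ∷ 2 ∷ []) , 0 , (0 ∷ 1 ∷ 2 ∷ 3 ∷ [])) ∷ ((4 ∷ 5 ∷ 6 ∷ []) , 0 , (0 ∷ 5 ∷ 6 ∷ 7 ∷ [])) ∷ ((1 ∷ 2 ∷ 3 ∷ []) , 0 , (0 ∷ 2 ∷ 3 ∷ 4 ∷ [])) ∷ ((0 ∷ 4 ∷ 5 ∷ []) , 0 , (0 ∷ 1 ∷ 5 ∷ 6 ∷ [])) ∷ ((0 ∷ 1 ∷ 3 ∷ 4 ∷ 6 ∷ []) , 1 , (1 ∷ 2 ∷ 4 ∷ 7 ∷ 5 ∷ 0 ∷ [])) ∷ ((0 ∷ 1 ∷ 3 ∷ 5 ∷ 6 ∷ []) , 1 , (1 ∷ 2 ∷ 4 ∷ 7 ∷ 6 ∷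 0 ∷ [])) ∷ ((0 ∷ 2 ∷ 3 ∷ 4 ∷ 6 ∷ []) , 1 , (1 ∷ 3 ∷ 4 ∷ 7 ∷ 5 ∷ 0 ∷ [])) ∷ ((0 ∷ 2 ∷ 3 ∷ 5 ∷ 6 ∷ []) , 1 , (1 ∷ 3 ∷ 4 ∷ 7 ∷ 6 ∷ 0 ∷ [])) ∷ [])
      []

  check-spindle′ : check (K₄ ∷ W₅ ∷ W₇ ∷ []) 3 7 spindle tree-spindle′ ≡ true
  check-spindle′ = refl

-- Maximum independent sets meet all r-cliques.

module Cliques where
  open Sums
  open Graphs
  open import Defs using (sumFin)
  open import Data.Fin.Properties using (¬∀⟶∃¬)

  update : ∀ {r} {A : Set} → (Fin r → A) → Fin r → A → Fin r → A
  update T t u s with s ≟ᶠ t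
  ... | yes _ = u
  ... | no  _ = T s

  update-same : ∀ {r} {A : Set} (T : Fin r → A) t u → update T t u t ≡ u
  update-same T t u with t ≟ᶠ t
  ... | yes _ = refl
  ... | no ¬e = ⊥-elim (¬e refl)

  update-other : ∀ {r} {A : Set} (T : Fin r → A) t u s → ¬ s ≡ t → update T t u s ≡ T s
  update-other T t u s ne with s ≟ᶠ t
  ... | yes e = ⊥-elim (ne e)
  ... | no _  = refl

  module MaxIndepFacts {n : ℕ} (G : Gr n) where
    open Gr G
    open Structure G

    indep⊎edge : ∀ (Z : Sub) → Indep Z ⊎ ∃ λ u → ∃ λ v → Z u ≡ true × Z v ≡ true × adj u v ≡ true
    indep⊎edge Z with any? (λ u → any? λ v → (Z u ≟ᵇ true) ×-dec ((Z v ≟ᵇ true) ×-dec (adj u v ≟ᵇ true)))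
    ... | yes h = inj₂ h
    ... | no ¬h = inj₁ λ u v p q → ¬true⇒false λ e → ¬h (u , v , p , q , e)

    module _ {U : Sub} (M : MaxIndep U) where
      open MaxIndep M renaming (set to I)

      maximal : ∀ u → U u ≡ true → (∀ j → I j ≡ true → adj j u ≡ false) → I u ≡ true
      maximal u p h with I u in eq
      ... | true  = refl
      ... | false = ⊥-elim (<⇒≱ bigger (max I⁺ I⁺⊑U I⁺-indep))
        where
        I⁺ : Sub
        I⁺ v = I v ∨ ⌊ v ≟ᶠ u ⌋
        I⁺⇒ : ∀ v → I⁺ v ≡ true → I v ≡ true ⊎ v ≡ u
        I⁺⇒ v e with I v | v ≟ᶠ u
        ... | true  | _      = inj₁ refl
        ... | false | yes e′ = inj₂ e′
        I⁺⊑U : I⁺ ⊑ U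
        I⁺⊑U v e with I⁺⇒ v e
        ... | inj₁ i    = ⊑U v i
        ... | inj₂ refl = p
        I⁺-indep : Indep I⁺
        I⁺-indep x y e f with I⁺⇒ x e | I⁺⇒ y f
        ... | inj₁ i | inj₁ j = indep x y i j
        ... | inj₁ i | inj₂ refl = h x i
        ... | inj₂ refl | inj₁ j = adj-sym″ (h y j)
        ... | inj₂ refl | inj₂ refl = adj-irr u
        bigger : # I < # I⁺
        bigger = begin-strict
          # I ≡⟨ sym (+-identityʳ _) ⟩
          # I + 0 <⟨ +-monoʳ-< (# I) (s≤s z≤n) ⟩
          # I + 1 ≡⟨ cong (# I +_) (sym only) ⟩
          # I + sumFin (λ v → 𝟙 (not (I v) ∧ ⌊ v ≟ᶠ u ⌋)) ≡⟨ sym (∑-+ (λ v → 𝟙 (I v)) (λ v → 𝟙 (not (I v) ∧ ⌊ v ≟ᶠ u ⌋))) ⟩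
          sumFin (λ v → 𝟙 (I v) + 𝟙 (not (I v) ∧ ⌊ v ≟ᶠ u ⌋)) ≡⟨ ∑-cong (λ v → go (I v) ⌊ v ≟ᶠ u ⌋) ⟩
          # I⁺ ∎
          where
          open ≤-Reasoning
          go : ∀ a b → 𝟙 a + 𝟙 (not a ∧ b) ≡ 𝟙 (a ∨ b)
          go true  b = refl
          go false b = refl
          only : sumFin (λ v → 𝟙 (not (I v) ∧ ⌊ v ≟ᶠ u ⌋)) ≡ 1
          only = trans (∑-single u _ off) on
            where
            off : ∀ j → ¬ j ≡ u → 𝟙 (not (I j) ∧ ⌊ j ≟ᶠ u ⌋) ≡ 0
            off j ne with I j | j ≟ᶠ u
            ... | _     | yes e = ⊥-elim (ne e)
            ... | true  | no _  = refl
            ... | false | no _  = refl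
            on : 𝟙 (not (I u) ∧ ⌊ u ≟ᶠ u ⌋) ≡ 1
            on rewrite eq with u ≟ᶠ u
            ... | yes _ = refl
            ... | no ¬e = ⊥-elim (¬e refl)

      neighbour : ∀ u → U u ≡ true → I u ≡ false → ∃ λ j → I j ≡ true × adj j u ≡ true
      neighbour u p e with any? (λ j → (I j ≟ᵇ true) ×-dec (adj j u ≟ᵇ true))
      ... | yes h = h
      ... | no ¬h = absurd (maximal u p λ j q → ¬true⇒false λ a → ¬h (j , q , a)) e

      I⊑Miss : ∀ i → I i ≡ true → I ⊑ Miss U i
      I⊑Miss i p v q = ∧-intro (⊑U v q) (cong not (indep i v p q))

      module _ {m : ℕ} (bd : Bounded U m) where
        #I≤m : # I ≤ m
        #I≤m with # I in eq
        ... | zero  = z≤n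
        ... | suc _ with #-∃ I (subst (1 ≤_) (sym eq) (s≤s z≤n))
        ...   | i , p = subst (_≤ m) eq (≤-trans (#-mono (I⊑Miss i p)) (bd i (⊑U i p)))

        #-outside : ∀ i → I i ≡ true → # (Miss U i ∖ I) + # I ≤ m
        #-outside i p = ≤-trans (≤-reflexive (sym (∑-+ (λ v → 𝟙 ((Miss U i ∖ I) v)) (λ v → 𝟙 (I v)))))
          (≤-trans (∑-mono λ v → go (Miss U i v) (I v) (I⊑Miss i p v)) (bd i (⊑U i p)))
          where
          go : ∀ a b → (b ≡ true → a ≡ true) → 𝟙 (a ∧ not b) + 𝟙 b ≤ 𝟙 a
          go true  true  _ = ≤-refl
          go true  false _ = ≤-refl
          go false true  h with h refl
          ... | ()
          go false false _ = z≤n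

        Common : Fin n → Fin n → Sub
        Common i j v = U v ∧ (adj i v ∧ adj j v)

        -- A vertex that is no common neighbour is missed by i or by j, and the members of I are
        -- missed by both, which accounts for the extra `# I`.
        common-large : ∀ i j → I i ≡ true → I j ≡ true → # U + # I ≤ # (Common i j) + (m + m)
        common-large i j p q = begin
          # U + # I ≡⟨ sym (∑-+ (λ v → 𝟙 (U v)) (λ v → 𝟙 (I v))) ⟩
          sumFin (λ v → 𝟙 (U v) + 𝟙 (I v)) ≤⟨ ∑-mono (λ v → go (U v) (I v) (adj i v) (adj j v) (⊑U v) (indep i v p) (indep j v q)) ⟩
          sumFin (λ v → 𝟙 (Common i j v) + (𝟙 (Miss U i v) + 𝟙 (Miss U j v))) ≡⟨ ∑-+ (λ v → 𝟙 (Common i j v)) _ ⟩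
          # (Common i j) + sumFin (λ v → 𝟙 (Miss U i v) + 𝟙 (Miss U j v)) ≡⟨ cong (# (Common i j) +_) (∑-+ (λ v → 𝟙 (Miss U i v)) _) ⟩
          # (Common i j) + (# (Miss U i) + # (Miss U j)) ≤⟨ +-monoʳ-≤ (# (Common i j)) (+-mono-≤ (bd i (⊑U i p)) (bd j (⊑U j q))) ⟩
          # (Common i j) + (m + m) ∎
          where
          open ≤-Reasoning
          go : ∀ u x a b → (x ≡ true → u ≡ true) → (x ≡ true → a ≡ false) → (x ≡ true → b ≡ false) →
            𝟙 u + 𝟙 x ≤ 𝟙 (u ∧ (a ∧ b)) + (𝟙 (u ∧ not a) + 𝟙 (u ∧ not b))
          go u true a b h₁ h₂ h₃ rewrite h₁ refl | h₂ refl | h₃ refl = ≤-refl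
          go false false _ _ _ _ _ = z≤n
          go true false true  true  _ _ _ = ≤-refl
          go true false true  false _ _ _ = ≤-refl
          go true false false b     _ _ _ = s≤s z≤n

      -- Every r-clique of U meets I as soon as no member of I misses exactly one vertex of a clique avoiding I.
      module CliqueMeets (k : ℕ) {m : ℕ} (bd : Bounded U m) (gap : (2 + k) * m < # U)
        (free : ∀ (T : Fin (3 + k) → Fin n) → (∀ t → U (T t) ≡ true) → (∀ s t → ¬ s ≡ t → adj (T s) (T t) ≡ true) →
                ∀ v → U v ≡ true → ¬ (∀ t → adj (T t) v ≡ true))
        (one : ∀ (T : Fin (3 + k) → Fin n) → (∀ t → U (T t) ≡ true) → (∀ s t → ¬ s ≡ t → adj (T s) (T t) ≡ true) →
               (∀ t → I (T t) ≡ false) → ∀ i t₀ → I i ≡ true → (∀ t → ¬ t ≡ t₀ → adj (T t) i ≡ true) → ⊥)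
        where

        r : ℕ
        r = 3 + k

        misses : (Fin r → Fin n) → Fin n → Fin r → Bool
        misses T v t = not (adj (T t) v)

        -- By `free` such a vertex misses T t as well. These are the vertices that miss only the
        -- t-th clique vertex, hence the possible replacements for it.
        Only : (Fin r → Fin n) → Fin r → Sub
        Only T t v = U v ∧ ⌊ all? (λ s → ¬? (s ≟ᶠ t) →-dec (adj (T s) v ≟ᵇ true)) ⌋

        Only⇒ : ∀ T t v → Only T t v ≡ true → U v ≡ true × (∀ s → ¬ s ≡ t → adj (T s) v ≡ true)
        Only⇒ T t v e with U v | all? (λ s → ¬? (s ≟ᶠ t) →-dec (adj (T s) v ≟ᵇ true))
        ... | true | yes h = refl , h

        ⇒Only : ∀ T t v → U v ≡ true → (∀ s → ¬ s ≡ t → adj (T s) v ≡ true) → Only T t v ≡ true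
        ⇒Only T t v p h with U v | all? (λ s → ¬? (s ≟ᶠ t) →-dec (adj (T s) v ≟ᵇ true))
        ⇒Only T t v refl h | true | yes _ = refl
        ⇒Only T t v refl h | true | no ¬h = ⊥-elim (¬h h)

        module _ (T : Fin r → Fin n) (T∈U : ∀ t → U (T t) ≡ true)
                 (clique : ∀ s t → ¬ s ≡ t → adj (T s) (T t) ≡ true) where
          swap-clique : ∀ t u → (∀ s → ¬ s ≡ t → adj (T s) u ≡ true) →
            ∀ x y → ¬ x ≡ y → adj (update T t u x) (update T t u y) ≡ true
          swap-clique t u h x y ne with x ≟ᶠ t | y ≟ᶠ t
          ... | yes refl | yes refl = ⊥-elim (ne refl)
          ... | yes refl | no ny = adj-sym′ (h y ny)
          ... | no nx | yes refl = h x nx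
          ... | no nx | no ny = clique x y ne

          swap-∈ : ∀ t u → U u ≡ true → ∀ x → U (update T t u x) ≡ true
          swap-∈ t u p x with x ≟ᶠ t
          ... | yes _ = p
          ... | no _  = T∈U x

          -- Two adjacent replacements and the other r - 1 clique vertices would form a clique of
          -- size r + 1.
          Only-indep : ∀ t → Indep (Only T t)
          Only-indep t u v e f = ¬true⇒false λ a →
            let (pu , hu) = Only⇒ T t u e ; (pv , hv) = Only⇒ T t v f in
            free (update T t u) (swap-∈ t u pu) (swap-clique t u hu) v pv (all-adj hv a)
            where
            all-adj : (∀ s → ¬ s ≡ t → adj (T s) v ≡ true) → adj u v ≡ true → ∀ s → adj (update T t u s) v ≡ true
            all-adj hv a s with s ≟ᶠ t
            ... | yes _ = a
            ... | no ns = hv s ns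

          Only≤ : ∀ t → # (Only T t) ≤ # I
          Only≤ t = max (Only T t) (λ v e → proj₁ (Only⇒ T t v e)) (Only-indep t)

        -- With r = 3 + k: 2N ≤ rm + (m - ι) + (r - 2)ι ≤ (2r - 2)m because ι ≤ m, against N > (r -
        -- 1)m. The subtracted copies of ι are added back on the left.
        contradiction-count : ∀ N ι x s → 2 * N ≤ r * m + (x + s) → x + ι ≤ m → s + (ι + ι) ≤ r * ι → ι ≤ m →
          (2 + k) * m < N → ⊥
        contradiction-count N ι x s h hx hs hι g = <-irrefl refl (begin-strict
          2 * N + (ι + (ι + ι)) ≤⟨ +-monoˡ-≤ (ι + (ι + ι)) h ⟩
          r * m + (x + s) + (ι + (ι + ι)) ≡⟨ l₁ (r * m) x s ι ⟩
          r * m + ((x + ι) + (s + (ι + ι))) ≤⟨ +-monoʳ-≤ (r * m) (+-mono-≤ hx hs) ⟩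
          r * m + (m + r * ι) ≡⟨ l₂ k m ι ⟩
          (4 + k) * m + k * ι + (ι + (ι + ι)) ≤⟨ +-monoˡ-≤ (ι + (ι + ι)) (+-monoʳ-≤ ((4 + k) * m) (*-monoʳ-≤ k hι)) ⟩
          (4 + k) * m + k * m + (ι + (ι + ι)) ≡⟨ cong (_+ (ι + (ι + ι))) (l₃ k m) ⟩
          2 * ((2 + k) * m) + (ι + (ι + ι)) <⟨ +-monoˡ-< (ι + (ι + ι)) (*-monoʳ-< 2 g) ⟩
          2 * N + (ι + (ι + ι)) ∎)
          where
          open ≤-Reasoning
          l₁ : ∀ a x s ι → a + (x + s) + (ι + (ι + ι)) ≡ a + ((x + ι) + (s + (ι + ι)))
          l₁ = solve-∀
          l₂ : ∀ k m ι → (3 + k) * m + (m + (3 + k) * ι) ≡ (4 + k) * m + k * ι + (ι + (ι + ι))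
          l₂ = solve-∀
          l₃ : ∀ k m → (4 + k) * m + k * m ≡ 2 * ((2 + k) * m)
          l₃ = solve-∀

        module _ (T : Fin r → Fin n) (T∈U : ∀ t → U (T t) ≡ true)
                 (clique : ∀ s t → ¬ s ≡ t → adj (T s) (T t) ≡ true) (T∉I : ∀ t → I (T t) ≡ false)
                 (i : Fin n) (i∈I : I i ≡ true) (t₁ t₂ : Fin r) (t₁≢t₂ : ¬ t₁ ≡ t₂)
                 (far₁ : ∀ u → Only T t₁ u ≡ true → adj i u ≡ false)
                 (far₂ : ∀ u → Only T t₂ u ≡ true → adj i u ≡ false) where

          X : Sub
          X = Miss U i ∖ I

          Y : Fin r → Sub
          Y t v = not ⌊ t ≟ᶠ t₁ ⌋ ∧ (not ⌊ t ≟ᶠ t₂ ⌋ ∧ Only T t v)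

          Y-bound : sumFin (λ t → # (Y t)) + (# I + # I) ≤ r * # I
          Y-bound = ∑-vanish₂ (λ t → # (Y t)) (# I) t₁ t₂ t₁≢t₂ (off t₁ (inj₁ refl)) (off t₂ (inj₂ refl)) pointwise
            where
            off : ∀ t → t ≡ t₁ ⊎ t ≡ t₂ → # (Y t) ≡ 0
            off t h with t ≟ᶠ t₁ | t ≟ᶠ t₂
            ... | yes _ | _     = ∑-zero n
            ... | no _  | yes _ = ∑-zero n
            off t (inj₁ e) | no ne | no _ = ⊥-elim (ne e)
            off t (inj₂ e) | no _ | no ne = ⊥-elim (ne e)
            pointwise : ∀ t → # (Y t) ≤ # I
            pointwise t = ≤-trans (#-mono {p = Y t} {Only T t} λ v e → proj₂ (∧-true {not ⌊ t ≟ᶠ t₂ ⌋} (proj₂ (∧-true {not ⌊ t ≟ᶠ t₁ ⌋} e)))) (Only≤ T T∈U clique t)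

          -- A vertex missing a single T t is outside I by `one`. If t is t₁ or t₂ it also misses i
          -- and is counted again by X, otherwise by `Y t`.
          two-missed : ∀ v → U v ≡ true → 2 ≤ sumFin (λ t → 𝟙 (misses T v t)) + (𝟙 (X v) + sumFin (λ t → 𝟙 (Y t v)))
          two-missed v p with any? (λ t → adj (T t) v ≟ᵇ false)
          ... | no ¬a = ⊥-elim (free T T∈U clique v p λ t → yes-adj t)
            where
            yes-adj : ∀ t → adj (T t) v ≡ true
            yes-adj t with adj (T t) v in e
            ... | true  = refl
            ... | false = ⊥-elim (¬a (t , e))
          ... | yes (t , e) with all? (λ s → ¬? (s ≟ᶠ t) →-dec (adj (T s) v ≟ᵇ true))
          ...   | no ¬h with ¬∀⟶∃¬ r _ (λ s → ¬? (s ≟ᶠ t) →-dec (adj (T s) v ≟ᵇ true)) ¬h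
          ...     | s , ¬s = ≤-trans two (m≤m+n _ _)
            where
            s≢t : ¬ s ≡ t
            s≢t eq = ¬s λ ne → ⊥-elim (ne eq)
            es : adj (T s) v ≡ false
            es = ¬true⇒false λ a → ¬s λ _ → a
            two : 2 ≤ sumFin (λ t → 𝟙 (misses T v t))
            two = two≤ (λ t → 𝟙 (misses T v t)) s t s≢t (≤-reflexive (cong (λ b → 𝟙 (not b)) (sym es)))
              (≤-reflexive (cong (λ b → 𝟙 (not b)) (sym e)))
          two-missed v p | yes (t , e) | yes h = +-mono-≤ one-miss rest
            where
            one-miss : 1 ≤ sumFin (λ t → 𝟙 (misses T v t))
            one-miss = ≤-trans (≤-reflexive (cong (λ b → 𝟙 (not b)) (sym e))) (∑-term (λ t → 𝟙 (misses T v t)) t)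
            v∈Only : Only T t v ≡ true
            v∈Only = ⇒Only T t v p h
            v∉I : I v ≡ false
            v∉I = ¬true⇒false λ q → one T T∈U clique T∉I v t q h
            inX : adj i v ≡ false → 1 ≤ 𝟙 (X v) + sumFin (λ t → 𝟙 (Y t v))
            inX a rewrite p | a | v∉I = s≤s z≤n
            rest : 1 ≤ 𝟙 (X v) + sumFin (λ t → 𝟙 (Y t v))
            rest with t ≟ᶠ t₁ | t ≟ᶠ t₂
            ... | yes refl | _ = inX (far₁ v v∈Only)
            ... | no _ | yes refl = inX (far₂ v v∈Only)
            ... | no n₁ | no n₂ = ≤-trans (≤-trans (≤-reflexive (sym y≡1)) (∑-term (λ t → 𝟙 (Y t v)) t)) (m≤n+m _ (𝟙 (X v)))
              where
              y≡1 : 𝟙 (Y t v) ≡ 1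
              y≡1 with t ≟ᶠ t₁ | t ≟ᶠ t₂
              ... | yes e | _ = ⊥-elim (n₁ e)
              ... | no _ | yes e = ⊥-elim (n₂ e)
              ... | no _ | no _ = cong 𝟙 v∈Only

          impossible : ⊥
          impossible = contradiction-count (# U) (# I) (# X) (sumFin (λ t → # (Y t))) sum-bound
            (#-outside bd i i∈I) Y-bound (#I≤m bd) gap
            where
            open ≤-Reasoning
            sum-bound : 2 * # U ≤ r * m + (# X + sumFin (λ t → # (Y t)))
            sum-bound = begin
              2 * # U ≡⟨ sym (∑-*ˡ 2 (λ v → 𝟙 (U v))) ⟩
              sumFin (λ v → 2 * 𝟙 (U v)) ≤⟨ ∑-mono pw ⟩
              sumFin (λ v → sumFin (λ t → 𝟙 (Miss U (T t) v)) + (𝟙 (X v) + sumFin (λ t → 𝟙 (Y t v))))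
                ≡⟨ ∑-+ (λ v → sumFin (λ t → 𝟙 (Miss U (T t) v))) _ ⟩
              sumFin (λ v → sumFin (λ t → 𝟙 (Miss U (T t) v))) + sumFin (λ v → 𝟙 (X v) + sumFin (λ t → 𝟙 (Y t v)))
                ≡⟨ cong₂ _+_ (∑-swap (λ v t → 𝟙 (Miss U (T t) v))) (∑-+ (λ v → 𝟙 (X v)) _) ⟩
              sumFin (λ t → # (Miss U (T t))) + (# X + sumFin (λ v → sumFin (λ t → 𝟙 (Y t v))))
                ≡⟨ cong (λ a → sumFin (λ t → # (Miss U (T t))) + (# X + a)) (∑-swap (λ v t → 𝟙 (Y t v))) ⟩
              sumFin (λ t → # (Miss U (T t))) + (# X + sumFin (λ t → # (Y t)))
                ≤⟨ +-monoˡ-≤ (# X + sumFin (λ t → # (Y t))) (∑-mono λ t → bd (T t) (T∈U t)) ⟩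
              sumFin {r} (λ _ → m) + (# X + sumFin (λ t → # (Y t)))
                ≡⟨ cong (_+ (# X + sumFin (λ t → # (Y t)))) (∑-const r m) ⟩
              r * m + (# X + sumFin (λ t → # (Y t))) ∎
              where
              pw : ∀ v → 2 * 𝟙 (U v) ≤ sumFin (λ t → 𝟙 (Miss U (T t) v)) + (𝟙 (X v) + sumFin (λ t → 𝟙 (Y t v)))
              pw v with true? (U v)
              ... | inj₂ e = ≤-trans (≤-reflexive (cong (λ b → 2 * 𝟙 b) e)) z≤n
              ... | inj₁ e = ≤-trans (≤-reflexive (cong (λ b → 2 * 𝟙 b) e))
                      (≤-trans (two-missed v e) (≤-reflexive (cong (_+ (𝟙 (X v) + sumFin (λ t → 𝟙 (Y t v))))
                        (∑-cong λ t → cong (λ b → 𝟙 (b ∧ not (adj (T t) v))) (sym e)))))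

        private
          Clique : (Fin r → Fin n) → Set
          Clique T = (∀ t → U (T t) ≡ true) × (∀ s t → ¬ s ≡ t → adj (T s) (T t) ≡ true)

        swap-∉I : ∀ (T : Fin r → Fin n) → (∀ t → I (T t) ≡ false) → ∀ i → I i ≡ true → ∀ t u → adj i u ≡ true → ∀ s → I (update T t u s) ≡ false
        swap-∉I T T∉I i i∈I t u a s with s ≟ᶠ t
        ... | yes _ = ¬true⇒false λ q → absurd a (indep i u i∈I q)
        ... | no _  = T∉I s

        swap-fewer : ∀ (T : Fin r → Fin n) i (t : Fin r) u → adj (T t) i ≡ false → adj i u ≡ true → # (misses (update T t u) i) < # (misses T i)
        swap-fewer T i t u e a = ≤-trans (≤-reflexive (+-comm 1 (# (misses (update T t u) i)))) (≤-trans (+-monoʳ-≤ (# (misses (update T t u) i)) (≤-reflexive (sym (∑-spike t))))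
          (≤-trans (≤-reflexive (sym (∑-+ (λ s → 𝟙 (misses (update T t u) i s)) (λ s → 𝟙 ⌊ s ≟ᶠ t ⌋)))) (∑-mono pw)))
          where
          pw : ∀ s → 𝟙 (misses (update T t u) i s) + 𝟙 ⌊ s ≟ᶠ t ⌋ ≤ 𝟙 (misses T i s)
          pw s with s ≟ᶠ t
          ... | yes refl rewrite e | adj-sym′ a = ≤-refl
          ... | no _ = ≤-reflexive (+-identityʳ _)

        -- The number of clique vertices missed by i decreases: a u in `Only T t` adjacent to i
        -- replaces a missed T t, and the clique still avoids I because u has the neighbour i in I.
        -- With one missed vertex left, `one` applies; if two missed positions admit no exchange,
        -- `impossible` does.
        search : ∀ fuel T → Clique T → (∀ t → I (T t) ≡ false) → ∀ i → I i ≡ true → # (misses T i) < fuel → ⊥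
        search (suc fuel) T (T∈U , clique) T∉I i i∈I (s≤s l) with any? (λ t → adj (T t) i ≟ᵇ false)
        ... | no ¬a = free T T∈U clique i (⊑U i i∈I) λ t → yes-adj t
          where
          yes-adj : ∀ t → adj (T t) i ≡ true
          yes-adj t with adj (T t) i in e
          ... | true  = refl
          ... | false = ⊥-elim (¬a (t , e))
        ... | yes (t₁ , e₁) with any? (λ t → ¬? (t ≟ᶠ t₁) ×-dec (adj (T t) i ≟ᵇ false))
        ...   | no ¬a = one T T∈U clique T∉I i t₁ i∈I λ t ne → other t ne
          where
          other : ∀ t → ¬ t ≡ t₁ → adj (T t) i ≡ true
          other t ne with adj (T t) i in e
          ... | true  = refl
          ... | false = ⊥-elim (¬a (t , ne , e))
        ...   | yes (t₂ , ne , e₂)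
                with any? (λ u → (Only T t₁ u ≟ᵇ true) ×-dec (adj i u ≟ᵇ true))
                   | any? (λ u → (Only T t₂ u ≟ᵇ true) ×-dec (adj i u ≟ᵇ true))
        ...     | yes (u , o , a) | _ = search fuel (update T t₁ u)
                    (swap-∈ T T∈U clique t₁ u (proj₁ (Only⇒ T t₁ u o)) , swap-clique T T∈U clique t₁ u (proj₂ (Only⇒ T t₁ u o)))
                    (swap-∉I T T∉I i i∈I t₁ u a) i i∈I (≤-trans (swap-fewer T i t₁ u e₁ a) l)
        ...     | no _ | yes (u , o , a) = search fuel (update T t₂ u)
                    (swap-∈ T T∈U clique t₂ u (proj₁ (Only⇒ T t₂ u o)) , swap-clique T T∈U clique t₂ u (proj₂ (Only⇒ T t₂ u o)))
                    (swap-∉I T T∉I i i∈I t₂ u a) i i∈I (≤-trans (swap-fewer T i t₂ u e₂ a) l)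
        ...     | no ¬₁ | no ¬₂ = impossible T T∈U clique T∉I i i∈I t₁ t₂ (λ e → ne (sym e))
                    (λ u o → ¬true⇒false λ a → ¬₁ (u , o , a)) (λ u o → ¬true⇒false λ a → ¬₂ (u , o , a))

        meets : ∀ T → (∀ t → U (T t) ≡ true) → (∀ s t → ¬ s ≡ t → adj (T s) (T t) ≡ true) → ¬ (∀ t → I (T t) ≡ false)
        meets T T∈U clique T∉I with neighbour (T zero) (T∈U zero) (T∉I zero)
        ... | i , i∈I , _ = search (suc (# (misses T i))) T (T∈U , clique) T∉I i i∈I ≤-refl

-- Shortest odd closed walks.

module Cycles where
  open Sums
  open Graphs
  open Certificates
  open import Defs using (sumFin)
  open import Data.Bool using (_xor_)
  open import Data.Nat.Induction using (<-rec)

  pick₁ : ∀ {k} (f : Fin k → Bool) → 1 ≤ # f → ∃ λ a → f a ≡ true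
  pick₁ = #-∃

  pick₂ : ∀ {k} (f : Fin k → Bool) → 2 ≤ # f → ∃ λ a → ∃ λ b → toℕ a < toℕ b × f a ≡ true × f b ≡ true
  pick₂ {suc k} f l with f zero in e
  ... | true  with pick₁ (f ∘ suc) (≤-pred l)
  ...   | b , q = zero , suc b , s≤s z≤n , e , q
  pick₂ {suc k} f l | false with pick₂ (f ∘ suc) l
  ...   | a , b , lt , p , q = suc a , suc b , s≤s lt , p , q

  pick₃ : ∀ {k} (f : Fin k → Bool) → 3 ≤ # f →
    ∃ λ a → ∃ λ b → ∃ λ c → toℕ a < toℕ b × toℕ b < toℕ c × f a ≡ true × f b ≡ true × f c ≡ true
  pick₃ {suc k} f l with f zero in e
  ... | true  with pick₂ (f ∘ suc) (≤-pred l)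
  ...   | b , c , lt , p , q = zero , suc b , suc c , s≤s z≤n , s≤s lt , e , p , q
  pick₃ {suc k} f l | false with pick₃ (f ∘ suc) l
  ...   | a , b , c , l₁ , l₂ , p , q , r = suc a , suc b , suc c , s≤s l₁ , s≤s l₂ , p , q , r

  odd-2+ : ∀ d → odd (2 + d) ≡ odd d
  odd-2+ d with odd d
  ... | true  = refl
  ... | false = refl

  -- Of three arcs of an odd closed walk, one is odd and short enough to close up to a shorter odd closed walk.
  short-arc : ∀ k x y z → odd k ≡ true → 5 ≤ k → 1 ≤ x → 1 ≤ y → 1 ≤ z → x + (y + z) ≡ k →
    (odd x ≡ true × 2 + x < k) ⊎ ((odd y ≡ true × 2 + y < k) ⊎ (odd z ≡ true × 2 + z < k))
  short-arc k x y z ok k≥5 x≥1 y≥1 z≥1 eq with true? (odd x) | true? (odd y) | true? (odd z)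
  ... | inj₁ ox | _ | _ with 2 + x <? k
  ...   | yes l = inj₁ (ox , l)
  ...   | no ¬l = inj₂ (inj₁ (subst (λ t → odd t ≡ true) (sym y≡1) refl , subst (λ t → 2 + t < k) (sym y≡1) (≤-trans (s≤s (s≤s (s≤s (s≤s z≤n)))) k≥5)))
    where
    y≡1 : y ≡ 1
    y≡1 = ≤-antisym (≤-pred (≤-trans (≤-reflexive (+-comm 1 y)) (≤-trans (+-monoʳ-≤ y z≥1)
            (+-cancelˡ-≤ x (y + z) 2 (≤-trans (≤-reflexive eq) (≤-trans (≮⇒≥ ¬l) (≤-reflexive (+-comm 2 x)))))))) y≥1
  short-arc k x y z ok k≥5 x≥1 y≥1 z≥1 eq | inj₂ _ | inj₁ oy | _ with 2 + y <? k
  ...   | yes l = inj₂ (inj₁ (oy , l))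
  ...   | no ¬l = inj₁ (subst (λ t → odd t ≡ true) (sym x≡1) refl , subst (λ t → 2 + t < k) (sym x≡1) (≤-trans (s≤s (s≤s (s≤s (s≤s z≤n)))) k≥5))
    where
    perm : ∀ x y z → y + (x + z) ≡ x + (y + z)
    perm = solve-∀
    x≡1 : x ≡ 1
    x≡1 = ≤-antisym (≤-pred (≤-trans (≤-reflexive (+-comm 1 x)) (≤-trans (+-monoʳ-≤ x z≥1)
            (+-cancelˡ-≤ y (x + z) 2 (≤-trans (≤-reflexive (trans (perm x y z) eq)) (≤-trans (≮⇒≥ ¬l) (≤-reflexive (+-comm 2 y)))))))) x≥1
  short-arc k x y z ok k≥5 x≥1 y≥1 z≥1 eq | inj₂ _ | inj₂ _ | inj₁ oz with 2 + z <? k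
  ...   | yes l = inj₂ (inj₂ (oz , l))
  ...   | no ¬l = inj₁ (subst (λ t → odd t ≡ true) (sym x≡1) refl , subst (λ t → 2 + t < k) (sym x≡1) (≤-trans (s≤s (s≤s (s≤s (s≤s z≤n)))) k≥5))
    where
    perm : ∀ x y z → z + (x + y) ≡ x + (y + z)
    perm = solve-∀
    x≡1 : x ≡ 1
    x≡1 = ≤-antisym (≤-pred (≤-trans (≤-reflexive (+-comm 1 x)) (≤-trans (+-monoʳ-≤ x y≥1)
            (+-cancelˡ-≤ z (x + y) 2 (≤-trans (≤-reflexive (trans (perm x y z) eq)) (≤-trans (≮⇒≥ ¬l) (≤-reflexive (+-comm 2 z)))))))) x≥1
  short-arc k x y z ok k≥5 x≥1 y≥1 z≥1 eq | inj₂ ex | inj₂ ey | inj₂ ez = absurd ok even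
    where
    even : odd k ≡ false
    even rewrite sym eq | odd-+ x (y + z) | odd-+ y z | ex | ey | ez = refl

  module ClosedWalks {n : ℕ} (G : Gr n) where
    open Gr G
    open Structure G
    open Embeddings G using (no-gap)

    -- A closed walk of length k, unrolled periodically.
    record Cyc (P : Sub) (k : ℕ) : Set where
      field
        pos  : ℕ → Fin n
        on   : ∀ i → P (pos i) ≡ true
        next : ∀ i → adj (pos i) (pos (suc i)) ≡ true
        per  : ∀ i → pos (k + i) ≡ pos i

    module _ {P : Sub} where
      unroll : ∀ {v k} → Walk P v v (suc k) → Cyc P (suc k)
      unroll {v} {k} (step {v = v′} pv e W₀) = record
        { pos = run W ; on = run-on W ; next = run-next W ; per = λ i → trans (run-end W i) (sym (run-restart i)) }
        where
        W : Walk P v v (suc k)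
        W = step pv e W₀
        run : ∀ {x l} → Walk P x v l → ℕ → Fin n
        run {x} _            zero    = x
        -- The end of the walk is v again, so position i + 1 from there is position i of the tail
        -- `W₀`.
        run     (stop _)     (suc i) = run W₀ i
        run     (step _ _ w) (suc i) = run w i
        run-on : ∀ {x l} (w : Walk P x v l) i → P (run w i) ≡ true
        run-on w            zero    = start∈ w
        run-on (stop _)     (suc i) = run-on W₀ i
        run-on (step _ _ w) (suc i) = run-on w i
        run-next : ∀ {x l} (w : Walk P x v l) i → adj (run w i) (run w (suc i)) ≡ true
        run-next (stop _)     zero    = e
        run-next (step _ a w) zero    = a
        run-next (stop _)     (suc i) = run-next W₀ i
        run-next (step _ _ w) (suc i) = run-next w i
        run-end : ∀ {x l} (w : Walk P x v l) i → run w (l + i) ≡ run {v} (stop pv) i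
        run-end (stop _)     zero    = refl
        run-end (stop _)     (suc i) = refl
        run-end (step _ _ w) i       = run-end w i
        run-restart : ∀ i → run W i ≡ run {v} (stop pv) i
        run-restart zero    = refl
        run-restart (suc i) = refl

      module _ {k : ℕ} (C : Cyc P k) where
        open Cyc C

        rotate : ℕ → Cyc P k
        rotate a = record { pos = λ i → pos (i + a) ; on = λ i → on (i + a) ; next = λ i → next (i + a)
                          ; per = λ i → trans (cong pos (+-assoc k i a)) (per (i + a)) }

        arc : ∀ a d → Walk P (pos a) (pos (d + a)) d
        arc a zero    = stop (on a)
        arc a (suc d) = step (on a) (next a) (subst (λ t → Walk P (pos (suc a)) (pos t) d) (+-suc d a) (arc (suc a) d))

        chord : ∀ {v} a d → P v ≡ true → adj v (pos a) ≡ true → adj v (pos (d + a)) ≡ true → Walk P v v (2 + d)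
        chord a d p e f = step p e (snoc (arc a d) (adj-sym′ f) p)

      -- Three positions adjacent to v cut the closed walk into three arcs, and by `short-arc` one
      -- of them closes through v to a shorter odd closed walk. The third arc wraps around, hence
      -- `per`.
      few-neighbours : ∀ {k} (C : Cyc P k) → odd k ≡ true → 5 ≤ k →
        (∀ v d → d < k → odd d ≡ true → ¬ Walk P v v d) → ∀ v → P v ≡ true →
        # {k} (λ p → adj (Cyc.pos C (toℕ p)) v) ≤ 2
      few-neighbours {k} C ok k≥5 free v p with # {k} (λ p → adj (Cyc.pos C (toℕ p)) v) ≤? 2
      ... | yes l = l
      ... | no ¬l with pick₃ (λ p → adj (Cyc.pos C (toℕ p)) v) (≰⇒> ¬l)
      ...   | a , b , c , a<b , b<c , ea , eb , ec = ⊥-elim (go (short-arc k x y z ok k≥5 x≥1 y≥1 z≥1 total))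
        where
        open Cyc C
        A = toℕ a ; B = toℕ b ; D = toℕ c
        x = B ∸ A ; y = D ∸ B ; z = (k ∸ D) + A
        x+A : x + A ≡ B
        x+A = m∸n+n≡m (<⇒≤ a<b)
        y+B : y + B ≡ D
        y+B = m∸n+n≡m (<⇒≤ b<c)
        kD : (k ∸ D) + D ≡ k
        kD = m∸n+n≡m (<⇒≤ (toℕ<n c))
        x≥1 = m<n⇒0<n∸m a<b
        y≥1 = m<n⇒0<n∸m b<c
        z≥1 : 1 ≤ z
        z≥1 = ≤-trans (m<n⇒0<n∸m (toℕ<n c)) (m≤m+n _ A)
        total : x + (y + z) ≡ k
        total = trans (l x y (k ∸ D) A) (trans (cong (λ t → (k ∸ D) + (y + t)) x+A) (trans (cong ((k ∸ D) +_) y+B) kD))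
          where
          l : ∀ x y w a → x + (y + (w + a)) ≡ w + (y + (x + a))
          l = solve-∀
        z+D : z + D ≡ k + A
        z+D = trans (l (k ∸ D) A D) (cong (_+ A) kD)
          where
          l : ∀ w a d → w + a + d ≡ w + d + a
          l = solve-∀
        go : (odd x ≡ true × 2 + x < k) ⊎ ((odd y ≡ true × 2 + y < k) ⊎ (odd z ≡ true × 2 + z < k)) → ⊥
        go (inj₁ (o , l)) = free v (2 + x) l (trans (odd-2+ x) o)
          (chord C A x p (adj-sym′ ea) (subst (λ t → adj v (pos t) ≡ true) (sym x+A) (adj-sym′ eb)))
        go (inj₂ (inj₁ (o , l))) = free v (2 + y) l (trans (odd-2+ y) o)
          (chord C B y p (adj-sym′ eb) (subst (λ t → adj v (pos t) ≡ true) (sym y+B) (adj-sym′ ec)))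
        go (inj₂ (inj₂ (o , l))) = free v (2 + z) l (trans (odd-2+ z) o)
          (chord C D z p (adj-sym′ ec) (subst (λ t → adj v t ≡ true) (sym (trans (cong pos z+D) (per A))) (adj-sym′ ea)))

    #-not : ∀ {k} (f : Fin k → Bool) → k ≡ # f + sumFin (λ p → 1 * 𝟙 (not (f p)))
    #-not f = trans (sym (#-complement f)) (cong (# f +_) (∑-cong {f = λ p → 𝟙 (not (f p))} λ p → sym (+-identityʳ _)))

    bip⇒oddClosedFree : ∀ P → Bip P → OddClosedFree P
    bip⇒oddClosedFree P (c , proper) v k ok W = b≢not (c v) (trans (colour-parity W) (cong (_xor c v) ok))
      where
      colour-parity : ∀ {x y l} → Walk P x y l → c y ≡ odd l xor c x
      colour-parity (stop _) = refl
      colour-parity (step {u} {v′} {l} {j} p e w) with colour-parity w | proper _ _ p (start∈ w) e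
      ... | q | ne = trans q (go (odd j) (c u) (c v′) ne)
        where
        go : ∀ o a b → ¬ a ≡ b → o xor b ≡ not o xor a
        go o true  true  ne = ⊥-elim (ne refl)
        go o false false ne = ⊥-elim (ne refl)
        go true  true  false _ = refl
        go false true  false _ = refl
        go true  false true  _ = refl
        go false false true  _ = refl
      b≢not : ∀ b → ¬ b ≡ not b
      b≢not true  ()
      b≢not false ()

    -- Every vertex misses at least k - 2 positions of a shortest odd closed walk of length k, so (k
    -- - 2)|P| ≤ km. The hypothesis on ℓ says k/(k - 2) ≤ 1 + p/q at k = ℓ + 2, hence also beyond.
    bip-from-short : ∀ {P m} (p q ℓ : ℕ) → Bounded P m → (q + p) * m < q * # P → 2 * (q + p) ≤ (2 + ℓ) * p →
      odd ℓ ≡ true → 3 ≤ ℓ → (∀ v k → odd k ≡ true → k ≤ ℓ → ¬ Walk P v v k) → Bip P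
    bip-from-short {P} {m} p q ℓ bd gap long oℓ ℓ≥3 short =
      oddClosedFree⇒bip P λ v k ok → <-rec (λ k → ∀ v → odd k ≡ true → ¬ Walk P v v k) main k v ok
      where
      main : ∀ k → (∀ {j} → j < k → ∀ v → odd j ≡ true → ¬ Walk P v v j) → ∀ v → odd k ≡ true → ¬ Walk P v v k
      main k rec v ok W with k ≤? ℓ
      ... | yes l = short v k ok l W
      ... | no ¬l with k ≟ suc ℓ
      ...   | yes refl = absurd ok (cong not oℓ)
      ...   | no ne = go k ok (≤∧≢⇒< (≰⇒> ¬l) (λ e → ne (sym e))) rec W
        where
        go : ∀ k → odd k ≡ true → 2 + ℓ ≤ k → (∀ {j} → j < k → ∀ v → odd j ≡ true → ¬ Walk P v v j) → Walk P v v k → ⊥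
        -- From here on k is the length minus two, which is the number of positions surely missed.
        go (suc (suc k)) ok (s≤s (s≤s l)) rec W = no-gap k (2 + k) q (q + p) (# P) m count gap ratio (≤-trans (s≤s z≤n) (≤-trans ℓ≥3 l))
          where
          C = unroll W
          open Cyc C
          count : k * # P ≤ (2 + k) * m
          count = ≤-trans (weigh {2 + k} P (λ _ → false) (λ p → pos (toℕ p)) (λ _ → 1) k 0 (λ p → bd _ (on (toℕ p))) pointwise)
            (≤-reflexive (trans (+-identityʳ _) (cong (_* m) (trans (∑-const (2 + k) 1) (*-identityʳ (2 + k))))))
            where
            pointwise : ∀ v → P v ≡ true → k ≤ sumFin {2 + k} (λ p → 1 * 𝟙 (not (adj (pos (toℕ p)) v))) + 0 * 𝟙 false
            pointwise v pv = ≤-trans (+-cancelˡ-≤ 2 k _ (≤-trans (≤-reflexive (#-not (λ p → adj (pos (toℕ p)) v)))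
              (+-monoˡ-≤ _ (few-neighbours C ok (s≤s (s≤s (≤-trans ℓ≥3 l))) (λ v d lt od → rec lt v od) v pv)))) (m≤m+n _ _)
          ratio : (2 + k) * q ≤ k * (q + p)
          ratio = +-cancelʳ-≤ (2 * (q + p)) _ _ (≤-trans (+-monoʳ-≤ ((2 + k) * q) (≤-trans long (*-monoˡ-≤ p (s≤s (s≤s l)))))
            (≤-reflexive (eq k q p)))
            where
            eq : ∀ k q p → (2 + k) * q + (2 + k) * p ≡ k * (q + p) + 2 * (q + p)
            eq = solve-∀

-- Three colours: locally bipartite graphs without spindle and `T₀`.

module ThreeColours where
  open Sums
  open Graphs
  open Certificates
  open Cliques
  open Cycles
  open Trees
  open import Defs using (sumFin)
  open import Data.Nat.Induction using (<-rec)
  open import Data.Fin.Properties using (toℕ-fromℕ<)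

  module LocallyBipartite {n : ℕ} (G : Gr n) where
    open Gr G
    open Structure G
    open Embeddings G
    open ClosedWalks G

    module _ {U : Sub} (loc : ∀ a → U a ≡ true → Bip (Nb U a)) where
      noOdd : ∀ a → U a ≡ true → OddClosedFree (Nb U a)
      noOdd a p = bip⇒oddClosedFree (Nb U a) (loc a p)

      avoidK₄ : Avoids U K₄
      avoidK₄ φ E with Emb.edges E
      ... | e10 ∷ e20 ∷ e21 ∷ e30 ∷ e31 ∷ e32 ∷ [] =
        noOdd (φ 3) (i 3 (s≤s (s≤s (s≤s (s≤s z≤n))))) (φ 0) 3 refl
          (step p0 e10′ (step p1 e21′ (step p2 e20 (stop p0))))
        where
        i = Emb.inside E
        e10′ = adj-sym′ e10
        e21′ = adj-sym′ e21
        p0 = ∧-intro (i 0 (s≤s z≤n)) e30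
        p1 = ∧-intro (i 1 (s≤s (s≤s z≤n))) e31
        p2 = ∧-intro (i 2 (s≤s (s≤s (s≤s z≤n)))) e32

      avoidW₅ : Avoids U W₅
      avoidW₅ φ E with Emb.edges E
      ... | a ∷ b ∷ c ∷ d ∷ e ∷ h0 ∷ h1 ∷ h2 ∷ h3 ∷ h4 ∷ [] =
        noOdd (φ 5) (i 5 (<ᵇ-true refl)) (φ 0) 5 refl
          (step p0 a (step p1 b (step p2 c (step p3 d (step p4 e (stop p0))))))
        where
        i = Emb.inside E
        p0 = ∧-intro (i 0 (<ᵇ-true refl)) h0
        p1 = ∧-intro (i 1 (<ᵇ-true refl)) h1
        p2 = ∧-intro (i 2 (<ᵇ-true refl)) h2
        p3 = ∧-intro (i 3 (<ᵇ-true refl)) h3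
        p4 = ∧-intro (i 4 (<ᵇ-true refl)) h4

      avoidW₇ : Avoids U W₇
      avoidW₇ φ E with Emb.edges E
      ... | a ∷ b ∷ c ∷ d ∷ e ∷ f ∷ g ∷ h0 ∷ h1 ∷ h2 ∷ h3 ∷ h4 ∷ h5 ∷ h6 ∷ [] =
        noOdd (φ 7) (i 7 (<ᵇ-true refl)) (φ 0) 7 refl
          (step p0 a (step p1 b (step p2 c (step p3 d (step p4 e (step p5 f (step p6 g (stop p0))))))))
        where
        i = Emb.inside E
        p0 = ∧-intro (i 0 (<ᵇ-true refl)) h0
        p1 = ∧-intro (i 1 (<ᵇ-true refl)) h1
        p2 = ∧-intro (i 2 (<ᵇ-true refl)) h2
        p3 = ∧-intro (i 3 (<ᵇ-true refl)) h3
        p4 = ∧-intro (i 4 (<ᵇ-true refl)) h4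
        p5 = ∧-intro (i 5 (<ᵇ-true refl)) h5
        p6 = ∧-intro (i 6 (<ᵇ-true refl)) h6

      not-all : ∀ {k P} (C : Cyc P k) → P ⊑ U → odd k ≡ true → ∀ u → U u ≡ true →
        ¬ (∀ (p : Fin k) → adj (Cyc.pos C (toℕ p)) u ≡ true)
      not-all {k} {P} C sub ok u pu h = noOdd u pu (pos 0) k ok
        (subst (λ t → Walk (Nb U u) (pos 0) t k) (per 0) (arcIn 0 k λ i l → inN i l))
        where
        open Cyc C
        arcIn : ∀ {Q : Sub} a d → (∀ i → i ≤ d → Q (pos (i + a)) ≡ true) → Walk Q (pos a) (pos (d + a)) d
        arcIn a zero    q = stop (q 0 z≤n)
        arcIn {Q} a (suc d) q = step (q 0 z≤n) (next a) (subst (λ t → Walk Q (pos (suc a)) (pos t) d) (+-suc d a)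
          (arcIn (suc a) d λ i l → subst (λ t → Q (pos t) ≡ true) (sym (+-suc i a)) (q (suc i) (s≤s l))))
        near : ∀ i → i < k → adj u (pos i) ≡ true
        near i l = adj-sym′ (subst (λ t → adj (pos t) u ≡ true) (toℕ-fromℕ< l) (h (fromℕ< l)))
        inN : ∀ i → i ≤ k → Nb U u (pos (i + 0)) ≡ true
        inN i l with i <? k
        ... | yes lt = ∧-intro (sub _ (on (i + 0))) (subst (λ t → adj u (pos t) ≡ true) (sym (+-identityʳ i)) (near i lt))
        ... | no ¬lt with ≤-antisym l (≮⇒≥ ¬lt)
        ...   | refl = ∧-intro (sub _ (on (k + 0))) (subst (λ t → adj u t ≡ true) (sym (per 0)) (near 0 (pos-k k ok)))
          where
          pos-k : ∀ k → odd k ≡ true → 0 < k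
          pos-k (suc k) _ = s≤s z≤n

  module Level3 {n : ℕ} (G : Gr n) where
    open Gr G
    open Structure G
    open Embeddings G
    open ClosedWalks G
    open MaxIndepFacts G
    open LocallyBipartite G

    module _ {U : Sub} {m : ℕ} (bd : Bounded U m) (gap : 15 * m < 7 * # U)
             (loc : ∀ a → U a ≡ true → Bip (Nb U a)) (avS : Avoids U spindle) (avΘ : Avoids U Θ) where

      M : MaxIndep U
      M = maxIndep U
      open MaxIndep M renaming (set to I)

      small : # I ≤ m
      small = #I≤m M bd

      two-m<N : 2 * m < # U
      two-m<N = ≰⇒> λ l → <⇒≱ gap (≤-trans (*-monoʳ-≤ 7 l) (≤-trans (≤-reflexive (sym (*-assoc 7 2 m))) (*-monoˡ-≤ m (≤ᵇ-true {14} {15} refl))))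

      -- The common neighbourhood has at least N + |I| - 2m > |I| vertices, so it is too large to be
      -- independent.
      dense : ∀ i j → I i ≡ true → I j ≡ true → ∃ λ p → ∃ λ q →
        (U p ≡ true × adj i p ≡ true × adj j p ≡ true) × (U q ≡ true × adj i q ≡ true × adj j q ≡ true) × adj p q ≡ true
      dense i j pi pj with indep⊎edge (Common M bd i j)
      ... | inj₁ ind = ⊥-elim (<⇒≱ two-m<N (+-cancelʳ-≤ (# I) _ _ (≤-trans (common-large M bd i j pi pj)
              (≤-trans (+-monoˡ-≤ (m + m) (max (Common M bd i j) (λ v e → proj₁ (∧-true e)) ind))
                (≤-reflexive (trans (+-comm (# I) (m + m)) (cong (_+ # I) (cong (m +_) (sym (+-identityʳ m))))))))))
      ... | inj₂ (p , q , ep , eq , a) =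
        p , q , (proj₁ (∧-true ep) , ∧-true (proj₂ (∧-true {U p} ep))) , (proj₁ (∧-true eq) , ∧-true (proj₂ (∧-true {U q} eq))) , a

      -- Suppose u had a neighbour j in I. By `dense`, i and j are joined to a common edge xy, and
      -- the rhombi i,x,y,j and i,p,q,u with the edge ju form a Moser spindle. So u has no neighbour
      -- in I and belongs to I by maximality.
      closed : ∀ i u p q → I i ≡ true → U u ≡ true → U p ≡ true → U q ≡ true → adj p q ≡ true →
        adj i p ≡ true → adj i q ≡ true → adj u p ≡ true → adj u q ≡ true → I u ≡ true
      closed i u p q pi pu pp pq a ip iq up uq = maximal M u pu λ j pj → ¬true⇒false λ ju → bad j pj ju
        where
        bad : ∀ j → I j ≡ true → adj j u ≡ true → ⊥
        bad j pj ju with dense i j pi pj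
        ... | x , y , (ux , ix , jx) , (uy , iy , jy) , xy = avS φ record { inside = ins ; edges =
                ix ∷ iy ∷ xy ∷ adj-sym′ jx ∷ adj-sym′ jy ∷ ip ∷ iq ∷ a ∷ adj-sym′ up ∷ adj-sym′ uq ∷ ju ∷ [] }
          where
          φ : ℕ → Fin n
          φ 0 = i
          φ 1 = x
          φ 2 = y
          φ 3 = j
          φ 4 = p
          φ 5 = q
          φ _ = u
          ins : ∀ t → t < 7 → U (φ t) ≡ true
          ins 0 _ = ⊑U i pi
          ins 1 _ = ux
          ins 2 _ = uy
          ins 3 _ = ⊑U j pj
          ins 4 _ = pp
          ins 5 _ = pq
          ins (suc (suc (suc (suc (suc (suc t)))))) _ = pu

      no-K₄ : ∀ (T : Fin 3 → Fin n) → (∀ t → U (T t) ≡ true) → (∀ s t → ¬ s ≡ t → adj (T s) (T t) ≡ true) →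
        ∀ v → U v ≡ true → ¬ (∀ t → adj (T t) v ≡ true)
      no-K₄ T T∈U cl v pv h = avoidK₄ loc (λ { 0 → T zero ; 1 → T (suc zero) ; 2 → T (suc (suc zero)) ; _ → v })
          record { inside = λ { 0 _ → T∈U zero ; 1 _ → T∈U (suc zero) ; 2 _ → T∈U (suc (suc zero)) ; (suc (suc (suc t))) _ → pv }
                 ; edges = cl _ _ (λ ()) ∷ cl _ _ (λ ()) ∷ cl _ _ (λ ()) ∷ adj-sym′ (h _) ∷ adj-sym′ (h _) ∷ adj-sym′ (h _) ∷ [] }

      -- If i is adjacent to two vertices of a triangle, `closed` puts the third into I.
      not-one-missed : ∀ (T : Fin 3 → Fin n) → (∀ t → U (T t) ≡ true) → (∀ s t → ¬ s ≡ t → adj (T s) (T t) ≡ true) →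
        (∀ t → I (T t) ≡ false) → ∀ i t₀ → I i ≡ true → (∀ t → ¬ t ≡ t₀ → adj (T t) i ≡ true) → ⊥
      not-one-missed T T∈U cl T∉I i zero pi h = absurd (closed i _ (T (suc zero)) (T (suc (suc zero))) pi (T∈U zero) (T∈U _) (T∈U _)
                (cl _ _ λ ()) (adj-sym′ (h _ λ ())) (adj-sym′ (h _ λ ())) (cl _ _ λ ()) (cl _ _ λ ())) (T∉I zero)
      not-one-missed T T∈U cl T∉I i (suc zero) pi h = absurd (closed i _ (T zero) (T (suc (suc zero))) pi (T∈U (suc zero)) (T∈U _) (T∈U _)
                (cl _ _ λ ()) (adj-sym′ (h _ λ ())) (adj-sym′ (h _ λ ())) (cl _ _ λ ()) (cl _ _ λ ())) (T∉I (suc zero))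
      not-one-missed T T∈U cl T∉I i (suc (suc zero)) pi h = absurd (closed i _ (T zero) (T (suc zero)) pi (T∈U (suc (suc zero))) (T∈U _) (T∈U _)
                (cl _ _ λ ()) (adj-sym′ (h _ λ ())) (adj-sym′ (h _ λ ())) (cl _ _ λ ()) (cl _ _ λ ())) (T∉I (suc (suc zero)))

      open CliqueMeets M 0 bd two-m<N no-K₄ not-one-missed using (meets)

      J : Sub
      J = U ∖ I

      J⊑U : J ⊑ U
      J⊑U v e = proj₁ (∧-true e)

      J∉I : ∀ v → J v ≡ true → I v ≡ false
      J∉I v e = not-true (proj₂ (∧-true {U v} e))

      inJ : ∀ v → U v ≡ true → I v ≡ false → J v ≡ true
      inJ v p e = ∧-intro p (cong not e)

      no-triangle : ∀ v → ¬ Walk J v v 3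
      no-triangle v (step {v = a} p e (step {v = b} q f (step r g (stop _)))) =
        meets T (λ { zero → J⊑U _ p ; (suc zero) → J⊑U _ q ; (suc (suc zero)) → J⊑U _ r })
          (λ { zero zero ne → ⊥-elim (ne refl) ; zero (suc zero) _ → e ; zero (suc (suc zero)) _ → adj-sym′ g
             ; (suc zero) zero _ → adj-sym′ e ; (suc zero) (suc zero) ne → ⊥-elim (ne refl) ; (suc zero) (suc (suc zero)) _ → f
             ; (suc (suc zero)) zero _ → g ; (suc (suc zero)) (suc zero) _ → adj-sym′ f ; (suc (suc zero)) (suc (suc zero)) ne → ⊥-elim (ne refl) })
          (λ { zero → J∉I _ p ; (suc zero) → J∉I _ q ; (suc (suc zero)) → J∉I _ r })
        where
        T : Fin 3 → Fin n
        T zero = v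
        T (suc zero) = a
        T (suc (suc zero)) = b

      Shorter : ℕ → Set
      Shorter k = ∀ {j} → j < k → ∀ v → odd j ≡ true → ¬ Walk J v v j

      split-U : ∀ v → U v ≡ true → J v ≡ true ⊎ I v ≡ true
      split-U v p with true? (I v)
      ... | inj₁ i = inj₂ i
      ... | inj₂ e = inj₁ (inJ v p e)

      missing : ∀ {k} (C : Cyc J k) → Fin n → ℕ
      missing {k} C v = sumFin {k} (λ p → 1 * 𝟙 (not (adj (Cyc.pos C (toℕ p)) v)))

      few-J : ∀ {k} (C : Cyc J (2 + k)) → odd (2 + k) ≡ true → 3 ≤ k → Shorter (2 + k) → ∀ v → J v ≡ true → k ≤ missing C v
      few-J {k} C ok k≥3 rec v p = +-cancelˡ-≤ 2 k _ (≤-trans (≤-reflexive (#-not (λ q → adj (Cyc.pos C (toℕ q)) v)))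
        (+-monoˡ-≤ _ (few-neighbours C ok (s≤s (s≤s k≥3)) (λ v d lt od → rec lt v od) v p)))

      missing-one : ∀ {k} (C : Cyc J k) → odd k ≡ true → ∀ v → U v ≡ true → ∃ λ p → adj (Cyc.pos C (toℕ p)) v ≡ false
      missing-one C ok v p with any? (λ q → adj (Cyc.pos C (toℕ q)) v ≟ᵇ false)
      ... | yes h = h
      ... | no ¬h = ⊥-elim (not-all loc C J⊑U ok v p λ q → go q)
        where
        go : ∀ q → adj (Cyc.pos C (toℕ q)) v ≡ true
        go q with adj (Cyc.pos C (toℕ q)) v in e
        ... | true  = refl
        ... | false = ⊥-elim (¬h (q , e))

      missed≥1 : ∀ {k} (C : Cyc J k) v p → adj (Cyc.pos C (toℕ p)) v ≡ false → 1 ≤ missing C v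
      missed≥1 {k} C v p e = ≤-trans (≤-reflexive (cong (λ b → 1 * 𝟙 (not b)) (sym e)))
        (∑-term {k} (λ p → 1 * 𝟙 (not (adj (Cyc.pos C (toℕ p)) v))) p)

      -- Members of I may miss fewer positions than B; each is credited with e, which costs e·|I| ≤
      -- e·m in all.
      count : ∀ {k} (C : Cyc J k) B e → (∀ v → U v ≡ true → B ≤ missing C v + e * 𝟙 (I v)) → B * # U ≤ (k + e) * m
      count {k} C B e h = ≤-trans (weigh {k} U I (λ p → Cyc.pos C (toℕ p)) (λ _ → 1) B e
          (λ p → bd _ (J⊑U _ (Cyc.on C (toℕ p)))) h)
        (≤-trans (+-mono-≤ (≤-reflexive (cong (_* m) (trans (∑-const k 1) (*-identityʳ k)))) (*-monoʳ-≤ e small))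
          (≤-reflexive (sym (*-distribʳ-+ m k e))))

      -- Vertices of J miss 7 + j positions, members of I at least one, hence the credit 6 + j. The
      -- ratio (15 + 2j)/(7 + j) is at most 15/7, with equality at length 9. For lengths 5 and 7
      -- this count would be too weak.
      no-long : ∀ j → odd (9 + j) ≡ true → Shorter (9 + j) → ∀ v → ¬ Walk J v v (9 + j)
      no-long j ok rec v W = no-gap (7 + j) (9 + j + (6 + j)) 7 15 (# U) m (count C (7 + j) (6 + j) pointwise) gap
          (≤-trans (≤-reflexive (l₁ j)) (≤-trans (m≤m+n _ j) (≤-reflexive (l₂ j)))) (s≤s z≤n)
        where
        C = unroll W
        l₁ : ∀ j → (9 + j + (6 + j)) * 7 ≡ 105 + 14 * j
        l₁ = solve-∀
        l₂ : ∀ j → 105 + 14 * j + j ≡ (7 + j) * 15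
        l₂ = solve-∀
        pointwise : ∀ v → U v ≡ true → 7 + j ≤ missing C v + (6 + j) * 𝟙 (I v)
        pointwise v p with split-U v p
        ... | inj₁ q = ≤-trans (few-J C ok (s≤s (s≤s (s≤s z≤n))) rec v q) (m≤m+n _ _)
        ... | inj₂ q with missing-one C ok v p
        ...   | x , e = +-mono-≤ (missed≥1 C v x e) (≤-reflexive (sym (trans (cong (λ b → (6 + j) * 𝟙 b) q) (*-identityʳ (6 + j)))))

      two-or-all-but-one : ∀ {k} (C : Cyc J k) → odd k ≡ true → ∀ v → U v ≡ true →
        2 ≤ missing C v ⊎ ∃ λ p → (adj (Cyc.pos C (toℕ p)) v ≡ false) × (∀ q → ¬ q ≡ p → adj (Cyc.pos C (toℕ q)) v ≡ true)
      two-or-all-but-one {k} C ok v pv with missing-one C ok v pv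
      ... | p , e with any? (λ q → ¬? (q ≟ᶠ p) ×-dec (adj (Cyc.pos C (toℕ q)) v ≟ᵇ false))
      ...   | yes (q , ne , e′) = inj₁ (two≤ {k} (λ p → 1 * 𝟙 (not (adj (Cyc.pos C (toℕ p)) v))) q p ne
                (≤-reflexive (cong (λ b → 1 * 𝟙 (not b)) (sym e′))) (≤-reflexive (cong (λ b → 1 * 𝟙 (not b)) (sym e))))
      ...   | no ¬h = inj₂ (p , e , go)
        where
        go : ∀ q → ¬ q ≡ p → adj (Cyc.pos C (toℕ q)) v ≡ true
        go q ne with adj (Cyc.pos C (toℕ q)) v in e′
        ... | true  = refl
        ... | false = ⊥-elim (¬h (q , ne , e′))

      -- Everything except position p, read from p onwards around the closed walk.
      around : ∀ {k} (C : Cyc J k) (p : Fin k) v → (∀ q → ¬ q ≡ p → adj (Cyc.pos C (toℕ q)) v ≡ true) →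
        ∀ j → 1 ≤ j → j < k → adj v (Cyc.pos C (j + toℕ p)) ≡ true
      around {k} C p v h j j≥1 j<k with j + toℕ p <? k
      ... | yes l = adj-sym′ (subst (λ t → adj (pos t) v ≡ true) (toℕ-fromℕ< l) (h (fromℕ< l)
              λ e → <-irrefl (sym (trans (sym (toℕ-fromℕ< l)) (cong toℕ e))) (+-monoˡ-≤ (toℕ p) j≥1)))
        where open Cyc C
      ... | no ¬l = adj-sym′ (subst (λ t → adj t v ≡ true) (trans (cong pos (toℕ-fromℕ< x<k)) (trans (sym (per x)) (cong pos k+x)))
              (h (fromℕ< x<k) λ e → <-irrefl (trans (sym (toℕ-fromℕ< x<k)) (cong toℕ e)) x<p))
        where
        open Cyc C
        x = j + toℕ p ∸ k
        k+x : k + x ≡ j + toℕ p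
        k+x = m+[n∸m]≡n (≮⇒≥ ¬l)
        x<p : x < toℕ p
        x<p = +-cancelˡ-< k x (toℕ p) (≤-trans (s≤s (≤-reflexive k+x)) (+-monoˡ-≤ (toℕ p) j<k))
        x<k : x < k
        x<k = <-trans x<p (toℕ<n p)

      -- If every member of I misses two positions, then 3N ≤ 6m. Otherwise some i in I is adjacent
      -- to all positions but c 0; then every vertex misses two of c 0, c 1, c 4, i, and 2N ≤ 4m.
      no-pentagon : Shorter 5 → ∀ v → ¬ Walk J v v 5
      no-pentagon rec v W = by-search (any? λ i → (I i ≟ᵇ true) ×-dec any? λ p → all? λ q → ¬? (q ≟ᶠ p) →-dec (adj (pos (toℕ q)) i ≟ᵇ true))
        where
        C = unroll W
        open Cyc C
        by-search : Dec (∃ λ i → I i ≡ true × ∃ λ p → ∀ q → ¬ q ≡ p → adj (pos (toℕ q)) i ≡ true) → ⊥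
        by-search (no ¬h) = no-gap 3 6 7 15 (# U) m (count C 3 1 pointwise) gap (≤ᵇ-true refl) (s≤s z≤n)
          where
          pointwise : ∀ v → U v ≡ true → 3 ≤ missing C v + 1 * 𝟙 (I v)
          pointwise v p with split-U v p
          ... | inj₁ q = ≤-trans (few-J C refl ≤-refl rec v q) (m≤m+n _ _)
          ... | inj₂ q with two-or-all-but-one C refl v p
          ...   | inj₁ l = +-mono-≤ l (≤-reflexive (cong (λ b → 1 * 𝟙 b) (sym q)))
          ...   | inj₂ (x , _ , h) = ⊥-elim (¬h (v , q , x , h))
        by-search (yes (i , pi , p , h)) = no-gap 2 4 7 15 (# U) m
            (≤-trans (weigh {4} U (λ _ → false) φ (λ _ → 1) 2 0 (λ q → bd (φ q) (φ∈U q)) pointwise) (≤-reflexive (+-identityʳ _)))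
            gap (≤ᵇ-true refl) (s≤s z≤n)
          where
          c : ℕ → Fin n
          c j = pos (j + toℕ p)
          c-J : ∀ j → J (c j) ≡ true
          c-J j = on (j + toℕ p)
          c-U : ∀ j → U (c j) ≡ true
          c-U j = J⊑U _ (c-J j)
          i~ : ∀ j → 1 ≤ j → j < 5 → adj i (c j) ≡ true
          i~ = around C p i h
          i1 = i~ 1 (s≤s z≤n) (<ᵇ-true refl)
          i2 = i~ 2 (s≤s z≤n) (<ᵇ-true refl)
          i3 = i~ 3 (s≤s z≤n) (<ᵇ-true refl)
          i4 = i~ 4 (s≤s z≤n) (<ᵇ-true refl)
          e01 = next (toℕ p)
          e12 = next (1 + toℕ p)
          e23 = next (2 + toℕ p)
          e34 = next (3 + toℕ p)
          e40 : adj (c 4) (c 0) ≡ true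
          e40 = subst (λ t → adj (c 4) t ≡ true) (per (toℕ p)) (next (4 + toℕ p))
          φ : Fin 4 → Fin n
          φ zero = c 0
          φ (suc zero) = c 1
          φ (suc (suc zero)) = c 4
          φ (suc (suc (suc zero))) = i
          φ∈U : ∀ q → U (φ q) ≡ true
          φ∈U zero = c-U 0
          φ∈U (suc zero) = c-U 1
          φ∈U (suc (suc zero)) = c-U 4
          φ∈U (suc (suc (suc zero))) = ⊑U i pi
          -- Adjacency to three of the four is impossible. With c 0, i and one of c 1, c 4, the
          -- vertex c 0 would lie in I; with c 1, c 4, i there is a pentagon v, c 1, ..., c 4 in the
          -- neighbourhood of i; with c 0, c 1, c 4 there is a spindle whose apex is c 1.
          module _ (v : Fin n) (pv : U v ≡ true) where
            x01i : adj (c 0) v ≡ true → adj (c 1) v ≡ true → adj i v ≡ true → ⊥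
            x01i a b d = absurd (closed i (c 0) v (c 1) pi (c-U 0) pv (c-U 1) (adj-sym′ b) d i1 a e01) (J∉I _ (c-J 0))
            x04i : adj (c 0) v ≡ true → adj (c 4) v ≡ true → adj i v ≡ true → ⊥
            x04i a b d = absurd (closed i (c 0) v (c 4) pi (c-U 0) pv (c-U 4) (adj-sym′ b) d i4 a (adj-sym′ e40)) (J∉I _ (c-J 0))
            x14i : adj (c 1) v ≡ true → adj (c 4) v ≡ true → adj i v ≡ true → ⊥
            x14i a b d = noOdd loc i (⊑U i pi) v 5 refl
              (step qv (adj-sym′ a) (step (q 1 i1) e12 (step (q 2 i2) e23 (step (q 3 i3) e34 (step (q 4 i4) b (stop qv))))))
              where
              qv = ∧-intro pv d
              q : ∀ j → adj i (c j) ≡ true → Nb U i (c j) ≡ true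
              q j e = ∧-intro (c-U j) e
            x014 : adj (c 0) v ≡ true → adj (c 1) v ≡ true → adj (c 4) v ≡ true → ⊥
            x014 a b d = avS ψ record { inside = ins ; edges =
                b ∷ adj-sym′ e01 ∷ adj-sym′ a ∷ adj-sym′ d ∷ adj-sym′ e40 ∷ adj-sym′ i1 ∷ e12 ∷ i2 ∷ i3 ∷ e23 ∷ adj-sym′ e34 ∷ [] }
              where
              ψ : ℕ → Fin n
              ψ 0 = c 1
              ψ 1 = v
              ψ 2 = c 0
              ψ 3 = c 4
              ψ 4 = i
              ψ 5 = c 2
              ψ _ = c 3
              ins : ∀ t → t < 7 → U (ψ t) ≡ true
              ins 0 _ = c-U 1
              ins 1 _ = pv
              ins 2 _ = c-U 0
              ins 3 _ = c-U 4
              ins 4 _ = ⊑U i pi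
              ins 5 _ = c-U 2
              ins (suc (suc (suc (suc (suc (suc t)))))) _ = c-U 3
          pointwise : ∀ v → U v ≡ true → 2 ≤ sumFin {4} (λ q → 1 * 𝟙 (not (adj (φ q) v))) + 0 * 𝟙 false
          pointwise v pv with adj (c 0) v | adj (c 1) v | adj (c 4) v | adj i v | x01i v pv | x04i v pv | x14i v pv | x014 v pv
          ... | true  | true  | _     | true  | x | _ | _ | _ = ⊥-elim (x refl refl refl)
          ... | true  | _     | true  | true  | _ | x | _ | _ = ⊥-elim (x refl refl refl)
          ... | _     | true  | true  | true  | _ | _ | x | _ = ⊥-elim (x refl refl refl)
          ... | true  | true  | true  | _     | _ | _ | _ | x = ⊥-elim (x refl refl refl)
          ... | false | false | _     | _     | _ | _ | _ | _ = s≤s (s≤s z≤n)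
          ... | false | true  | false | _     | _ | _ | _ | _ = s≤s (s≤s z≤n)
          ... | false | true  | true  | false | _ | _ | _ | _ = s≤s (s≤s z≤n)
          ... | true  | false | false | _     | _ | _ | _ | _ = s≤s (s≤s z≤n)
          ... | true  | false | true  | false | _ | _ | _ | _ = s≤s (s≤s z≤n)
          ... | true  | true  | false | false | _ | _ | _ | _ = s≤s (s≤s z≤n)

      -- Mis C p: some member of I is adjacent to every position of C but (possibly) the p-th.
      Mis : Cyc J 7 → ℕ → Set
      Mis C p = ∃ λ i → I i ≡ true × (∀ (j : Fin 6) → adj i (Cyc.pos C (suc (toℕ j) + p)) ≡ true)

      mis? : ∀ C p → Dec (Mis C p)
      mis? C p = any? λ i → (I i ≟ᵇ true) ×-dec all? λ j → adj i (Cyc.pos C (suc (toℕ j) + p)) ≟ᵇ true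

      mis-per : ∀ C p → Mis C p → Mis C (7 + p)
      mis-per C p (i , pi , h) = i , pi , λ j → subst (λ t → adj i t ≡ true)
        (trans (sym (per (suc (toℕ j) + p))) (cong pos (l (suc (toℕ j)) p))) (h j)
        where
        open Cyc C
        l : ∀ a p → 7 + (a + p) ≡ a + (7 + p)
        l = solve-∀

      mis-unrotate : ∀ C a p → Mis (rotate C a) p → Mis C (p + a)
      mis-unrotate C a p (i , pi , h) = i , pi , λ j → subst (λ t → adj i (Cyc.pos C t) ≡ true) (+-assoc (suc (toℕ j)) p a) (h j)

      mis-unper : ∀ C p → Mis C (7 + p) → Mis C p
      mis-unper C p (i , pi , h) = i , pi , λ j → subst (λ t → adj i t ≡ true)
        (trans (cong (Cyc.pos C) (l (suc (toℕ j)) p)) (Cyc.per C (suc (toℕ j) + p))) (h j)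
        where
        l : ∀ a p → a + (7 + p) ≡ 7 + (a + p)
        l = solve-∀

      avΔ : Avoids U Δ₂
      avΔ = refute bd {forb = K₄ ∷ W₅ ∷ W₇ ∷ spindle ∷ Θ ∷ []} (avoidK₄ loc ∷ avoidW₅ loc ∷ avoidW₇ loc ∷ avS ∷ avΘ ∷ [])
        {num = 7} {den = 15} gap {Q = Δ₂} tree-Δ₂ check-Δ₂

      -- The heptagon and the two members of I carry a copy of `Δ₂`.
      no-two-apart : ∀ C p → Mis C p → Mis C (2 + p) → ⊥
      no-two-apart C p (i , pi , h) (j , pj , g) = avΔ φ record { inside = ins ; edges =
          next p ∷ next (1 + p) ∷ next (2 + p) ∷ next (3 + p) ∷ next (4 + p) ∷ next (5 + p) ∷
          subst (λ t → adj (pos (6 + p)) t ≡ true) (per p) (next (6 + p)) ∷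
          h zero ∷ h (suc zero) ∷ h (suc (suc zero)) ∷ h (suc (suc (suc zero))) ∷ h (suc (suc (suc (suc zero)))) ∷ h (suc (suc (suc (suc (suc zero))))) ∷
          subst (λ t → adj j t ≡ true) (per p) (g (suc (suc (suc (suc zero))))) ∷
          subst (λ t → adj j t ≡ true) (per (1 + p)) (g (suc (suc (suc (suc (suc zero)))))) ∷
          g zero ∷ g (suc zero) ∷ g (suc (suc zero)) ∷ g (suc (suc (suc zero))) ∷ [] }
        where
        open Cyc C
        φ : ℕ → Fin n
        φ 7 = i
        φ 8 = j
        φ t = pos (t + p)
        ins : ∀ t → t < 9 → U (φ t) ≡ true
        ins 0 _ = J⊑U _ (on p)
        ins 1 _ = J⊑U _ (on (1 + p))
        ins 2 _ = J⊑U _ (on (2 + p))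
        ins 3 _ = J⊑U _ (on (3 + p))
        ins 4 _ = J⊑U _ (on (4 + p))
        ins 5 _ = J⊑U _ (on (5 + p))
        ins 6 _ = J⊑U _ (on (6 + p))
        ins 7 _ = ⊑U i pi
        ins 8 _ = ⊑U j pj
        ins (suc (suc (suc (suc (suc (suc (suc (suc (suc t))))))))) l = ⊥-elim (<⇒≱ l (m≤m+n 9 t))

      -- Only positions 0, 1 and 4 may be the single position missed by a member of I; these have
      -- weight 2 in `ws`.
      Light : Cyc J 7 → Set
      Light C = ¬ Mis C 2 × ¬ Mis C 3 × ¬ Mis C 5 × ¬ Mis C 6

      -- By `no-two-apart`, the positions p with `Mis C p` include no two at distance two modulo 7.
      -- Up to rotation such a set lies in {0, 1, 4}; the cases ask whether a member p has p + 1 or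
      -- p - 1 beside it.
      light-rotation : ∀ C → ∃ λ a → Light (rotate C a)
      light-rotation C with any? {7} (λ p → mis? C (toℕ p))
      ... | no ¬h = 0 , none 2 refl , none 3 refl , none 5 refl , none 6 refl
        where
        none : ∀ q (l : (q <ᵇ 7) ≡ true) → ¬ Mis (rotate C 0) q
        none q l mq = ¬h (fromℕ< (<ᵇ-true l) , subst (Mis C) (sym (trans (toℕ-fromℕ< (<ᵇ-true l)) (sym (+-identityʳ q)))) (mis-unrotate C 0 q mq))
      ... | yes (p , mp) with mis? C (1 + toℕ p) | mis? C (6 + toℕ p)
      ...   | yes m₁ | _ = toℕ p , no2 , no3 , no5 , no6
        where
        P = toℕ p
        no2 : ¬ Mis (rotate C P) 2
        no2 x = no-two-apart C P mp (mis-unrotate C P 2 x)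
        no3 : ¬ Mis (rotate C P) 3
        no3 x = no-two-apart C (1 + P) m₁ (mis-unrotate C P 3 x)
        no5 : ¬ Mis (rotate C P) 5
        no5 x = no-two-apart C (5 + P) (mis-unrotate C P 5 x) (mis-per C P mp)
        no6 : ¬ Mis (rotate C P) 6
        no6 x = no-two-apart C (6 + P) (mis-unrotate C P 6 x) (mis-per C (1 + P) m₁)
      ...   | no ¬m₁ | yes m₆ = 6 + P , no2 , no3 , no5 , no6
        where
        P = toℕ p
        no2 : ¬ Mis (rotate C (6 + P)) 2
        no2 x = ¬m₁ (mis-unper C (1 + P) (mis-unrotate C (6 + P) 2 x))
        no3 : ¬ Mis (rotate C (6 + P)) 3
        no3 x = no-two-apart C P mp (mis-unper C (2 + P) (mis-unrotate C (6 + P) 3 x))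
        no5 : ¬ Mis (rotate C (6 + P)) 5
        no5 x = no-two-apart C (4 + P) (mis-unper C (4 + P) (mis-unrotate C (6 + P) 5 x)) m₆
        no6 : ¬ Mis (rotate C (6 + P)) 6
        no6 x = no-two-apart C (5 + P) (mis-unper C (5 + P) (mis-unrotate C (6 + P) 6 x)) (mis-per C P mp)
      ...   | no ¬m₁ | no ¬m₆ = 3 + P , no2 , no3 , no5 , no6
        where
        P = toℕ p
        no2 : ¬ Mis (rotate C (3 + P)) 2
        no2 x = no-two-apart C (5 + P) (mis-unrotate C (3 + P) 2 x) (mis-per C P mp)
        no3 : ¬ Mis (rotate C (3 + P)) 3
        no3 x = ¬m₆ (mis-unrotate C (3 + P) 3 x)
        no5 : ¬ Mis (rotate C (3 + P)) 5
        no5 x = ¬m₁ (mis-unper C (1 + P) (mis-unrotate C (3 + P) 5 x))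
        no6 : ¬ Mis (rotate C (3 + P)) 6
        no6 x = no-two-apart C P mp (mis-unper C (2 + P) (mis-unrotate C (3 + P) 6 x))

      ws : List ℕ
      ws = 2 ∷ 2 ∷ 1 ∷ 1 ∷ 2 ∷ 1 ∷ 1 ∷ []

      -- Pairs of positions at odd distance 1 or 3: a common neighbour in J would give a shorter odd closed walk.
      oddPairs : List (List ℕ)
      oddPairs = (0 ∷ 1 ∷ []) ∷ (1 ∷ 2 ∷ []) ∷ (2 ∷ 3 ∷ []) ∷ (3 ∷ 4 ∷ []) ∷ (4 ∷ 5 ∷ []) ∷ (5 ∷ 6 ∷ []) ∷ (6 ∷ 0 ∷ []) ∷
                 (0 ∷ 3 ∷ []) ∷ (1 ∷ 4 ∷ []) ∷ (2 ∷ 5 ∷ []) ∷ (3 ∷ 6 ∷ []) ∷ (4 ∷ 0 ∷ []) ∷ (5 ∷ 1 ∷ []) ∷ (6 ∷ 2 ∷ []) ∷ []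

      -- A vertex of J has at most two neighbours among the positions, and two of them are at
      -- distance two. The heavy positions 0, 1, 4 are pairwise at distance 1 or 3, so it sees
      -- weight at most 3 of the total 10. A member of I misses weight at least 2 and is credited
      -- with 5. This gives 7N ≤ 10m + 5m, exactly the threshold.
      no-light-heptagon : ∀ C → Light C → Shorter 7 → ⊥
      no-light-heptagon C light rec = <⇒≱ gap (≤-trans total (≤-trans (+-monoʳ-≤ (10 * m) (*-monoʳ-≤ 5 small)) (≤-reflexive (sym (*-distribʳ-+ m 10 5)))))
        where
        open Cyc C
        E : Emb J (7 , []) pos
        E = record { inside = λ i _ → on i ; edges = [] }
        oddPair : ∀ v → J v ≡ true → ∀ x d → odd d ≡ true → 2 + d < 7 → adj (pos x) v ≡ true → adj (pos (d + x)) v ≡ true → ⊥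
        oddPair v p x d o l e f = rec l v (trans (odd-2+ d) o) (chord C x d p (adj-sym′ e) (adj-sym′ f))
        J-bound : ∀ v → J v ≡ true → 7 ≤ sumFin {7} (λ q → at ws (toℕ q) * 𝟙 (not (adj (pos (toℕ q)) v)))
        J-bound = covered {J} {[]} [] ws 7 [] oddPairs E refl refl λ v p →
          ne v p 0 1 refl (<ᵇ-true refl) refl ∷ ne v p 1 1 refl (<ᵇ-true refl) refl ∷ ne v p 2 1 refl (<ᵇ-true refl) refl ∷
          ne v p 3 1 refl (<ᵇ-true refl) refl ∷ ne v p 4 1 refl (<ᵇ-true refl) refl ∷ ne v p 5 1 refl (<ᵇ-true refl) refl ∷
          ne v p 6 1 refl (<ᵇ-true refl) (per 0) ∷
          ne v p 0 3 refl (<ᵇ-true refl) refl ∷ ne v p 1 3 refl (<ᵇ-true refl) refl ∷ ne v p 2 3 refl (<ᵇ-true refl) refl ∷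
          ne v p 3 3 refl (<ᵇ-true refl) refl ∷ ne v p 4 3 refl (<ᵇ-true refl) (per 0) ∷ ne v p 5 3 refl (<ᵇ-true refl) (per 1) ∷
          ne v p 6 3 refl (<ᵇ-true refl) (per 2) ∷ []
          where
          ne : ∀ v → J v ≡ true → ∀ x d → odd d ≡ true → 2 + d < 7 → ∀ {y} → pos (d + x) ≡ pos y →
            ¬ All (λ q → adj (pos q) v ≡ true) (x ∷ y ∷ [])
          ne v p x d o l eq (e ∷ f ∷ []) = oddPair v p x d o l e (subst (λ t → adj t v ≡ true) (sym eq) f)
        weight : Fin 7 → ℕ
        weight q = at ws (toℕ q)
        weight≥1 : ∀ q → 1 ≤ weight q
        weight≥1 q = ≤ᵇ-true (go q)
          where
          go : ∀ q → (1 ≤ᵇ weight q) ≡ true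
          go zero = refl
          go (suc zero) = refl
          go (suc (suc zero)) = refl
          go (suc (suc (suc zero))) = refl
          go (suc (suc (suc (suc zero)))) = refl
          go (suc (suc (suc (suc (suc zero))))) = refl
          go (suc (suc (suc (suc (suc (suc zero)))))) = refl
        term≥1 : ∀ v q → adj (pos (toℕ q)) v ≡ false → weight q ≤ weight q * 𝟙 (not (adj (pos (toℕ q)) v))
        term≥1 v q e = ≤-reflexive (sym (trans (cong (λ b → weight q * 𝟙 (not b)) e) (*-identityʳ _)))
        I-bound : ∀ v → I v ≡ true → 2 ≤ sumFin {7} (λ q → weight q * 𝟙 (not (adj (pos (toℕ q)) v)))
        I-bound v pv with missing-one C refl v (⊑U v pv)
        ... | p , e with any? (λ q → ¬? (q ≟ᶠ p) ×-dec (adj (pos (toℕ q)) v ≟ᵇ false))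
        ...   | yes (q , ne , e′) = two≤ (λ q → weight q * 𝟙 (not (adj (pos (toℕ q)) v))) q p ne
                  (≤-trans (weight≥1 q) (term≥1 v q e′)) (≤-trans (weight≥1 p) (term≥1 v p e))
        ...   | no ¬h = ≤-trans (heavy p mis) (≤-trans (term≥1 v p e) (∑-term (λ q → weight q * 𝟙 (not (adj (pos (toℕ q)) v))) p))
          where
          rest : ∀ q → ¬ q ≡ p → adj (pos (toℕ q)) v ≡ true
          rest q ne with adj (pos (toℕ q)) v in e′
          ... | true  = refl
          ... | false = ⊥-elim (¬h (q , ne , e′))
          mis : Mis C (toℕ p)
          mis = v , pv , λ j → around C p v rest (suc (toℕ j)) (s≤s z≤n) (s≤s (toℕ<n j))
          heavy : ∀ q → Mis C (toℕ q) → 2 ≤ weight q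
          heavy zero _ = ≤-refl
          heavy (suc zero) _ = ≤-refl
          heavy (suc (suc zero)) x = ⊥-elim (proj₁ light x)
          heavy (suc (suc (suc zero))) x = ⊥-elim (proj₁ (proj₂ light) x)
          heavy (suc (suc (suc (suc zero)))) _ = ≤-refl
          heavy (suc (suc (suc (suc (suc zero))))) x = ⊥-elim (proj₁ (proj₂ (proj₂ light)) x)
          heavy (suc (suc (suc (suc (suc (suc zero)))))) x = ⊥-elim (proj₂ (proj₂ (proj₂ light)) x)
        total : 7 * # U ≤ 10 * m + 5 * # I
        total = weigh {7} U I (λ q → pos (toℕ q)) weight 7 5 (λ q → bd _ (J⊑U _ (on (toℕ q)))) pointwise
          where
          pointwise : ∀ v → U v ≡ true → 7 ≤ sumFin {7} (λ q → weight q * 𝟙 (not (adj (pos (toℕ q)) v))) + 5 * 𝟙 (I v)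
          pointwise v p with split-U v p
          ... | inj₁ q = ≤-trans (J-bound v q) (m≤m+n _ _)
          ... | inj₂ q = +-mono-≤ (I-bound v q) (≤-reflexive (cong (λ b → 5 * 𝟙 b) (sym q)))

      no-heptagon : Shorter 7 → ∀ v → ¬ Walk J v v 7
      no-heptagon rec v W = no-light-heptagon (rotate (unroll W) (proj₁ (light-rotation (unroll W)))) (proj₂ (light-rotation (unroll W))) rec

      J-oddClosedFree : OddClosedFree J
      J-oddClosedFree v k ok = <-rec (λ k → ∀ v → odd k ≡ true → ¬ Walk J v v k) main k v ok
        where
        main : ∀ k → Shorter k → ∀ v → odd k ≡ true → ¬ Walk J v v k
        main 1 rec v _ (step p e (stop _)) = absurd e (adj-irr v)
        main 3 rec v _ = no-triangle v
        main 5 rec v _ = no-pentagon rec v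
        main 7 rec v _ = no-heptagon rec v
        main (suc (suc (suc (suc (suc (suc (suc (suc (suc j))))))))) rec v o = no-long j o rec v

      three-colourable : Col 3 U
      three-colourable with oddClosedFree⇒bip J J-oddClosedFree
      ... | c , proper = colour , proper′
        where
        colour : Fin n → Fin 3
        colour v = if I v then zero else (if c v then suc zero else suc (suc zero))
        proper′ : ∀ u v → U u ≡ true → U v ≡ true → adj u v ≡ true → ¬ colour u ≡ colour v
        proper′ u v pu pv e eq with I u in iu | I v in iv
        ... | true  | true  = absurd e (indep u v iu iv)
        ... | false | false with c u in cu | c v in cv | proper u v (inJ u pu iu) (inJ v pv iv) e
        ...   | true  | true  | ne = ne refl
        ...   | false | false | ne = ne refl
        proper′ u v pu pv e () | false | false | true | false | ne
        proper′ u v pu pv e () | false | false | false | true | ne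
        proper′ u v pu pv e eq | true | false with c v
        proper′ u v pu pv e () | true | false | true
        proper′ u v pu pv e () | true | false | false
        proper′ u v pu pv e eq | false | true with c u
        proper′ u v pu pv e () | false | true | true
        proper′ u v pu pv e () | false | true | false

-- More colours: peeling off a maximum independent set.

module ManyColours where
  open Sums
  open Graphs
  open Certificates
  open Cliques
  open Cycles
  open Trees
  open ThreeColours
  open import Defs using (sumFin)
  open import Data.Fin using (punchOut)
  open import Data.Fin.Properties using (pigeonhole; punchOut-injective) renaming (suc-injective to sucᶠ-injective)

  -- `Θ` with vertex 7 made isolated, which keeps the numbering. It still has no proper 3-colouring.
  Θ⁻ : Pattern
  Θ⁻ = 10 , (0 , 1) ∷ (1 , 2) ∷ (2 , 3) ∷ (3 , 4) ∷ (4 , 5) ∷ (5 , 6) ∷ (6 , 0) ∷ (8 , 0) ∷ (8 , 2) ∷ (8 , 3) ∷ (8 , 4) ∷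
    (8 , 5) ∷ (8 , 6) ∷ (9 , 0) ∷ (9 , 1) ∷ (9 , 2) ∷ (9 , 3) ∷ (9 , 4) ∷ (9 , 5) ∷ []

  wellFormed : Pattern → Bool
  wellFormed (k , es) = all (λ e → (proj₁ e <ᵇ k) ∧ (proj₂ e <ᵇ k)) es
    where open import Data.Bool.ListAction using (all)

  wellFormed⇒ : ∀ Q → wellFormed Q ≡ true → All (λ e → proj₁ e < proj₁ Q × proj₂ e < proj₁ Q) (proj₂ Q)
  wellFormed⇒ (k , es) e = All-map (λ {x} h → <ᵇ-true (proj₁ (∧-true {proj₁ x <ᵇ k} h)) , <ᵇ-true (proj₂ (∧-true {proj₁ x <ᵇ k} h)))
    (all⇒All (λ e → (proj₁ e <ᵇ k) ∧ (proj₂ e <ᵇ k)) es e)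

  module LevelR {n : ℕ} (G : Gr n) where
    open Gr G
    open Structure G
    open Embeddings G
    open MaxIndepFacts G

    Bounded-⊑ : ∀ {U P m} → P ⊑ U → Bounded U m → Bounded P m
    Bounded-⊑ {U} {P} sub bd v p = ≤-trans (#-mono {p = Miss P v} {Miss U v} λ u e → ∧-intro (sub u (proj₁ (∧-true e))) (proj₂ (∧-true {P u} e))) (bd v (sub v p))

    module Peel (k : ℕ) {U : Sub} {m : ℕ} (bd : Bounded U m) (gap : (3 + k) * m < # U)
                (loc : ∀ a → U a ≡ true → Col (3 + k) (Nb U a)) where
      M : MaxIndep U
      M = maxIndep U
      open MaxIndep M renaming (set to I)

      small : # I ≤ m
      small = #I≤m M bd

      -- If i and j had different colours, the vertices of N(a) outside I with one of these colours
      -- would be missed by i or by j, at most m - |I| for each; the other k + 1 classes have at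
      -- most |I| vertices each. Together with I and the m vertices missed by a this gives N ≤ 3m +
      -- k|I| ≤ (3 + k)m.
      same-class : ∀ a (pa : U a ≡ true) i j → I i ≡ true → I j ≡ true → adj a i ≡ true → adj a j ≡ true →
        proj₁ (loc a pa) i ≡ proj₁ (loc a pa) j
      same-class a pa i j pi pj ai aj with proj₁ (loc a pa) i ≟ᶠ proj₁ (loc a pa) j
      ... | yes e = e
      ... | no ne = ⊥-elim (<⇒≱ gap bounded)
        where
        c = proj₁ (loc a pa)
        proper = proj₂ (loc a pa)
        X : Fin (3 + k) → Sub
        X l v = not ⌊ l ≟ᶠ c i ⌋ ∧ (not ⌊ l ≟ᶠ c j ⌋ ∧ (Nb U a v ∧ ⌊ c v ≟ᶠ l ⌋))
        Out : Fin n → Sub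
        Out x = Miss U x ∖ I
        class-indep : ∀ l → Indep (λ v → Nb U a v ∧ ⌊ c v ≟ᶠ l ⌋)
        class-indep l u v e f with c u ≟ᶠ l | c v ≟ᶠ l | ∧-true {Nb U a u} e | ∧-true {Nb U a v} f
        ... | yes x | yes y | eu , _ | ev , _ = ¬true⇒false λ d → proper u v eu ev d (trans x (sym y))
        X≤ : ∀ l → # (X l) ≤ # I
        X≤ l = ≤-trans (#-mono {p = X l} {λ v → Nb U a v ∧ ⌊ c v ≟ᶠ l ⌋} λ v e → proj₂ (∧-true {not ⌊ l ≟ᶠ c j ⌋} (proj₂ (∧-true {not ⌊ l ≟ᶠ c i ⌋} e))))
          (max (λ v → Nb U a v ∧ ⌊ c v ≟ᶠ l ⌋) (λ v e → proj₁ (∧-true (proj₁ (∧-true {Nb U a v} e)))) (class-indep l))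
        X-off : ∀ l → l ≡ c i ⊎ l ≡ c j → # (X l) ≡ 0
        X-off l h with l ≟ᶠ c i | l ≟ᶠ c j
        ... | yes _ | _     = ∑-zero n
        ... | no _  | yes _ = ∑-zero n
        X-off l (inj₁ e) | no x | no _ = ⊥-elim (x e)
        X-off l (inj₂ e) | no _ | no x = ⊥-elim (x e)
        s = sumFin (λ l → # (X l))
        pointwise : ∀ v → 𝟙 (U v) ≤ 𝟙 (Miss U a v) + ((𝟙 (Out i v) + 𝟙 (Out j v)) + (𝟙 (I v) + sumFin (λ l → 𝟙 (X l v))))
        pointwise v with U v in pu | adj a v in av | I v in iv
        ... | false | _     | _     = z≤n
        ... | true  | false | _     = s≤s z≤n
        ... | true  | true  | true  = ≤-trans (s≤s z≤n) (m≤n+m _ (𝟙 (not (adj i v) ∧ false) + 𝟙 (not (adj j v) ∧ false)))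
        ... | true  | true  | false with c v ≟ᶠ c i | c v ≟ᶠ c j
        ...   | yes e | _ = ≤-trans (≤-trans (≤-reflexive (cong (λ b → 𝟙 (not b ∧ true)) (sym far))) (m≤m+n _ (𝟙 (not (adj j v) ∧ true)))) (m≤m+n _ _)
          where
          far : adj i v ≡ false
          far = ¬true⇒false λ d → proper i v (∧-intro (⊑U i pi) ai) (∧-intro pu av) d (sym e)
        ...   | no _ | yes e = ≤-trans (≤-trans (≤-reflexive (cong (λ b → 𝟙 (not b ∧ true)) (sym far))) (m≤n+m _ (𝟙 (not (adj i v) ∧ true)))) (m≤m+n _ _)
          where
          far : adj j v ≡ false
          far = ¬true⇒false λ d → proper j v (∧-intro (⊑U j pj) aj) (∧-intro pu av) d (sym e)
        ...   | no ni | no nj = ≤-trans (≤-trans (≤-reflexive (sym here)) (∑-term (λ l → 𝟙 (not ⌊ l ≟ᶠ c i ⌋ ∧ (not ⌊ l ≟ᶠ c j ⌋ ∧ ⌊ c v ≟ᶠ l ⌋))) (c v)))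
                  (m≤n+m _ (𝟙 (not (adj i v) ∧ true) + 𝟙 (not (adj j v) ∧ true)))
          where
          here : 𝟙 (not ⌊ c v ≟ᶠ c i ⌋ ∧ (not ⌊ c v ≟ᶠ c j ⌋ ∧ ⌊ c v ≟ᶠ c v ⌋)) ≡ 1
          here with c v ≟ᶠ c i | c v ≟ᶠ c j | c v ≟ᶠ c v
          ... | yes e | _ | _ = ⊥-elim (ni e)
          ... | no _ | yes e | _ = ⊥-elim (nj e)
          ... | no _ | no _ | no x = ⊥-elim (x refl)
          ... | no _ | no _ | yes _ = refl
        summed : # U ≤ m + ((# (Out i) + # (Out j)) + (# I + s))
        summed = begin
          # U ≤⟨ ∑-mono pointwise ⟩
          sumFin (λ v → 𝟙 (Miss U a v) + ((𝟙 (Out i v) + 𝟙 (Out j v)) + (𝟙 (I v) + sumFin (λ l → 𝟙 (X l v)))))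
            ≡⟨ ∑-+ (λ v → 𝟙 (Miss U a v)) (λ v → (𝟙 (Out i v) + 𝟙 (Out j v)) + (𝟙 (I v) + sumFin (λ l → 𝟙 (X l v)))) ⟩
          # (Miss U a) + sumFin (λ v → (𝟙 (Out i v) + 𝟙 (Out j v)) + (𝟙 (I v) + sumFin (λ l → 𝟙 (X l v))))
            ≡⟨ cong (# (Miss U a) +_) (∑-+ (λ v → 𝟙 (Out i v) + 𝟙 (Out j v)) (λ v → 𝟙 (I v) + sumFin (λ l → 𝟙 (X l v)))) ⟩
          # (Miss U a) + (sumFin (λ v → 𝟙 (Out i v) + 𝟙 (Out j v)) + sumFin (λ v → 𝟙 (I v) + sumFin (λ l → 𝟙 (X l v))))
            ≡⟨ cong₂ (λ x y → # (Miss U a) + (x + y)) (∑-+ (λ v → 𝟙 (Out i v)) (λ v → 𝟙 (Out j v)))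
                  (trans (∑-+ (λ v → 𝟙 (I v)) (λ v → sumFin (λ l → 𝟙 (X l v)))) (cong (# I +_) (∑-swap (λ v l → 𝟙 (X l v))))) ⟩
          # (Miss U a) + ((# (Out i) + # (Out j)) + (# I + s)) ≤⟨ +-monoˡ-≤ _ (bd a pa) ⟩
          m + ((# (Out i) + # (Out j)) + (# I + s)) ∎
          where open ≤-Reasoning
        bounded : # U ≤ (3 + k) * m
        bounded = finish (# U) (# I) (# (Out i)) (# (Out j)) s summed (#-outside M bd i pi) (#-outside M bd j pj)
            (∑-vanish₂ (λ l → # (X l)) (# I) (c i) (c j) ne (X-off (c i) (inj₁ refl)) (X-off (c j) (inj₂ refl)) X≤) small
          where
          finish : ∀ N ι x y s → N ≤ m + ((x + y) + (ι + s)) → x + ι ≤ m → y + ι ≤ m → s + (ι + ι) ≤ (3 + k) * ι → ι ≤ m → N ≤ (3 + k) * m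
          finish N ι x y s h hx hy hs hι = +-cancelʳ-≤ (4 * ι) N _ (begin
            N + 4 * ι ≤⟨ +-monoˡ-≤ (4 * ι) h ⟩
            m + ((x + y) + (ι + s)) + 4 * ι ≡⟨ l₁ m x y ι s ⟩
            m + ((x + ι) + ((y + ι) + (ι + (s + (ι + ι))))) ≤⟨ +-monoʳ-≤ m (+-mono-≤ hx (+-mono-≤ hy (+-monoʳ-≤ ι hs))) ⟩
            m + (m + (m + (ι + (3 + k) * ι))) ≡⟨ l₂ k m ι ⟩
            3 * m + k * ι + 4 * ι ≤⟨ +-monoˡ-≤ (4 * ι) (+-monoʳ-≤ (3 * m) (*-monoʳ-≤ k hι)) ⟩
            3 * m + k * m + 4 * ι ≡⟨ cong (_+ 4 * ι) (sym (*-distribʳ-+ m 3 k)) ⟩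
            (3 + k) * m + 4 * ι ∎)
            where
            open ≤-Reasoning
            l₁ : ∀ m x y ι s → m + ((x + y) + (ι + s)) + 4 * ι ≡ m + ((x + ι) + ((y + ι) + (ι + (s + (ι + ι)))))
            l₁ = solve-∀
            l₂ : ∀ k m ι → m + (m + (m + (ι + (3 + k) * ι))) ≡ 3 * m + k * ι + 4 * ι
            l₂ = solve-∀

      r : ℕ
      r = 4 + k

      free : ∀ (T : Fin r → Fin n) → (∀ t → U (T t) ≡ true) → (∀ s t → ¬ s ≡ t → adj (T s) (T t) ≡ true) →
        ∀ v → U v ≡ true → ¬ (∀ t → adj (T t) v ≡ true)
      free T T∈U clique v pv h with pigeonhole ≤-refl (λ t → proj₁ (loc v pv) (T t))
      ... | s , t , lt , e = proj₂ (loc v pv) (T s) (T t) (∧-intro (T∈U s) (adj-sym′ (h s))) (∧-intro (T∈U t) (adj-sym′ (h t)))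
              (clique s t λ { refl → <-irrefl refl lt }) e

      -- Let a = T t. The other r - 1 clique vertices exhaust the r - 1 colours on N(a), so i,
      -- adjacent to all of them except T t₀, has the colour of T t₀. If j were adjacent to a, then
      -- by `same-class` it would share this colour, although it is adjacent to T t₀.
      opposite : ∀ (T : Fin r → Fin n) → (∀ t → U (T t) ≡ true) → (∀ s t → ¬ s ≡ t → adj (T s) (T t) ≡ true) →
        ∀ i t₀ → I i ≡ true → (∀ t → ¬ t ≡ t₀ → adj (T t) i ≡ true) →
        ∀ j → I j ≡ true → adj j (T t₀) ≡ true → ∀ t → ¬ t ≡ t₀ → adj (T t) j ≡ false
      opposite T T∈U clique i t₀ pi h j pj jt₀ t ne = ¬true⇒false λ tj → go tj
        where
        a = T t
        pa = T∈U t
        c = proj₁ (loc a pa)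
        proper = proj₂ (loc a pa)
        inN : ∀ s → ¬ s ≡ t → Nb U a (T s) ≡ true
        inN s d = ∧-intro (T∈U s) (clique t s λ e → d (sym e))
        iN : Nb U a i ≡ true
        iN = ∧-intro (⊑U i pi) (h t ne)
        T′ : Fin r → Fin n
        T′ = update T t i
        ci≡ : c i ≡ c (T t₀)
        ci≡ with c i ≟ᶠ c (T t₀)
        ... | yes e = e
        ... | no ¬e with pigeonhole ≤-refl (λ s → c (T′ s))
        ...   | x , y , lt , e = ⊥-elim (clash′ x y (λ { refl → <-irrefl refl lt }) e)
          where
          vs : ∀ y → ¬ y ≡ t → ¬ c i ≡ c (T y)
          vs y d e with y ≟ᶠ t₀
          ... | yes refl = ¬e e
          ... | no y≢ = proper i (T y) iN (inN y d) (adj-sym′ (h y y≢)) e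
          clash′ : ∀ x y → ¬ x ≡ y → ¬ c (T′ x) ≡ c (T′ y)
          clash′ x y d e with x ≟ᶠ t | y ≟ᶠ t
          ... | yes refl | yes refl = d refl
          ... | yes refl | no yn = vs y yn e
          ... | no xn | yes refl = vs x xn (sym e)
          ... | no xn | no yn = proper (T x) (T y) (inN x xn) (inN y yn) (clique x y d) e
        go : adj (T t) j ≡ true → ⊥
        go tj = proper j (T t₀) (∧-intro (⊑U j pj) tj) (inN t₀ λ e → ne (sym e)) jt₀
          (trans (sym (same-class a pa i j pi pj (h t ne) tj)) ci≡)

      -- Let j in I be adjacent to T t₀. A common neighbour of i and j misses two clique vertices:
      -- if it missed only one, exchanging it for that one would contradict `free` or `opposite`. So
      -- N + |Co| ≤ rm, while |Co| ≥ N + |I| - 2m, and 2N ≤ (6 + k)m ≤ 2(3 + k)m.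
      one : ∀ (T : Fin r → Fin n) → (∀ t → U (T t) ≡ true) → (∀ s t → ¬ s ≡ t → adj (T s) (T t) ≡ true) →
        (∀ t → I (T t) ≡ false) → ∀ i t₀ → I i ≡ true → (∀ t → ¬ t ≡ t₀ → adj (T t) i ≡ true) → ⊥
      one T T∈U clique T∉I i t₀ pi h with neighbour M (T t₀) (T∈U t₀) (T∉I t₀)
      ... | j , pj , jt₀ = <⇒≱ gap (*-cancelˡ-≤ 2 (finish (# U) (# I) (# Co) counted (common-large M bd i j pi pj)))
        where
        Co : Sub
        Co = Common M bd i j
        misses : Fin n → Fin r → ℕ
        misses v t = 1 * 𝟙 (not (adj (T t) v))
        missed₁ : ∀ v t → adj (T t) v ≡ false → 1 ≤ misses v t
        missed₁ v t e = ≤-reflexive (cong (λ b → 1 * 𝟙 (not b)) (sym e))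
        Co-only : ∀ v → Co v ≡ true → ∀ t → ¬ (∀ s → ¬ s ≡ t → adj (T s) v ≡ true)
        Co-only v e t g with ∧-true {U v} e
        ... | pv , e′ with ∧-true {adj i v} e′
        ...   | iv , jv with t ≟ᶠ t₀
        ...     | yes refl = free T″ ∈U cl i (⊑U i pi) λ s → all-i s
          where
          T″ : Fin r → Fin n
          T″ = update T t v
          ∈U : ∀ s → U (T″ s) ≡ true
          ∈U s with s ≟ᶠ t
          ... | yes _ = pv
          ... | no _ = T∈U s
          cl : ∀ x y → ¬ x ≡ y → adj (T″ x) (T″ y) ≡ true
          cl x y d with x ≟ᶠ t | y ≟ᶠ t
          ... | yes refl | yes refl = ⊥-elim (d refl)
          ... | yes refl | no yn = adj-sym′ (g y yn)
          ... | no xn | yes refl = g x xn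
          ... | no _ | no _ = clique x y d
          all-i : ∀ s → adj (T″ s) i ≡ true
          all-i s with s ≟ᶠ t
          ... | yes _ = adj-sym′ iv
          ... | no sn = h s sn
        ...     | no t≢ = absurd (adj-sym′ jv) (subst (λ x → adj x j ≡ false) (update-same T t v)
                    (opposite (update T t v) ∈U cl i t₀ pi adj-i j pj (subst (λ x → adj j x ≡ true) (sym (update-other T t v t₀ λ e → t≢ (sym e))) jt₀) t t≢))
          where
          ∈U : ∀ s → U (update T t v s) ≡ true
          ∈U s with s ≟ᶠ t
          ... | yes _ = pv
          ... | no _ = T∈U s
          cl : ∀ x y → ¬ x ≡ y → adj (update T t v x) (update T t v y) ≡ true
          cl x y d with x ≟ᶠ t | y ≟ᶠ t
          ... | yes refl | yes refl = ⊥-elim (d refl)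
          ... | yes refl | no yn = adj-sym′ (g y yn)
          ... | no xn | yes refl = g x xn
          ... | no _ | no _ = clique x y d
          adj-i : ∀ s → ¬ s ≡ t₀ → adj (update T t v s) i ≡ true
          adj-i s d with s ≟ᶠ t
          ... | yes _ = adj-sym′ iv
          ... | no _ = h s d
        enough : ∀ v → U v ≡ true → 1 + 𝟙 (Co v) ≤ sumFin (misses v)
        enough v pv with any? (λ t → adj (T t) v ≟ᵇ false)
        ... | no ¬a = ⊥-elim (free T T∈U clique v pv λ t → yes-adj t)
          where
          yes-adj : ∀ t → adj (T t) v ≡ true
          yes-adj t with adj (T t) v in e
          ... | true  = refl
          ... | false = ⊥-elim (¬a (t , e))
        ... | yes (t , e) with any? (λ s → ¬? (s ≟ᶠ t) ×-dec (adj (T s) v ≟ᵇ false))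
        ...   | yes (s , d , e′) = ≤-trans (s≤s (𝟙≤1 (Co v))) (two≤ (misses v) s t d (missed₁ v s e′) (missed₁ v t e))
          where
          𝟙≤1 : ∀ b → 𝟙 b ≤ 1
          𝟙≤1 true  = ≤-refl
          𝟙≤1 false = z≤n
        ...   | no ¬s = ≤-trans (≤-reflexive (cong (λ b → 1 + 𝟙 b) (¬true⇒false λ co → Co-only v co t others)))
                  (≤-trans (missed₁ v t e) (∑-term (misses v) t))
          where
          others : ∀ s → ¬ s ≡ t → adj (T s) v ≡ true
          others s d with adj (T s) v in e′
          ... | true  = refl
          ... | false = ⊥-elim (¬s (s , d , e′))
        counted : # U + # Co ≤ r * m
        counted = begin
          # U + # Co ≡⟨ sym (∑-+ (λ v → 𝟙 (U v)) (λ v → 𝟙 (Co v))) ⟩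
          sumFin (λ v → 𝟙 (U v) + 𝟙 (Co v)) ≤⟨ ∑-mono pw ⟩
          sumFin (λ v → sumFin (λ t → 𝟙 (Miss U (T t) v))) ≡⟨ ∑-swap (λ v t → 𝟙 (Miss U (T t) v)) ⟩
          sumFin (λ t → # (Miss U (T t))) ≤⟨ ∑-mono (λ t → bd (T t) (T∈U t)) ⟩
          sumFin {r} (λ _ → m) ≡⟨ ∑-const r m ⟩
          r * m ∎
          where
          open ≤-Reasoning
          pw : ∀ v → 𝟙 (U v) + 𝟙 (Co v) ≤ sumFin (λ t → 𝟙 (Miss U (T t) v))
          pw v with true? (U v)
          ... | inj₂ e = ≤-trans (≤-reflexive (cong (λ b → 𝟙 b + 𝟙 (b ∧ (adj i v ∧ adj j v))) e)) z≤n
          ... | inj₁ e = ≤-trans (≤-reflexive (cong (λ b → 𝟙 b + 𝟙 (Co v)) e)) (≤-trans (enough v e)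
                  (≤-reflexive (∑-cong {f = misses v} λ t → trans (+-identityʳ _) (cong (λ b → 𝟙 (b ∧ not (adj (T t) v))) (sym e)))))
        finish : ∀ N ι x → N + x ≤ r * m → N + ι ≤ x + (m + m) → 2 * N ≤ 2 * ((3 + k) * m)
        finish N ι x p q = +-cancelʳ-≤ x _ _ (begin
          2 * N + x ≡⟨ l₁ N x ⟩
          N + x + N ≤⟨ +-mono-≤ p (≤-trans (m≤m+n N ι) q) ⟩
          r * m + (x + (m + m)) ≡⟨ l₂ k m x ⟩
          (6 + k) * m + x ≤⟨ +-monoˡ-≤ x (*-monoˡ-≤ m (+-monoʳ-≤ 6 (m≤m+n k (k + 0)))) ⟩
          (6 + 2 * k) * m + x ≡⟨ cong (_+ x) (l₃ k m) ⟩
          2 * ((3 + k) * m) + x ∎)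
          where
          open ≤-Reasoning
          l₁ : ∀ N x → 2 * N + x ≡ N + x + N
          l₁ = solve-∀
          l₂ : ∀ k m x → (4 + k) * m + (x + (m + m)) ≡ (6 + k) * m + x
          l₂ = solve-∀
          l₃ : ∀ k m → (6 + 2 * k) * m ≡ 2 * ((3 + k) * m)
          l₃ = solve-∀

      open CliqueMeets M (1 + k) bd gap free one using (meets)

      common-neighbour : ∀ {j} (T : Fin j → Fin n) → j ≤ 3 + k → (∀ t → U (T t) ≡ true) →
        ∃ λ v → U v ≡ true × (∀ t → adj (T t) v ≡ true)
      common-neighbour {j} T l T∈U with any? (λ v → (U v ≟ᵇ true) ×-dec all? (λ t → adj (T t) v ≟ᵇ true))
      ... | yes h = h
      ... | no ¬h = ⊥-elim (<⇒≱ gap (≤-trans bounded (*-monoˡ-≤ m l)))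
        where
        pointwise : ∀ v → U v ≡ true → 1 ≤ sumFin (λ t → 1 * 𝟙 (not (adj (T t) v))) + 0 * 𝟙 false
        pointwise v p with any? (λ t → adj (T t) v ≟ᵇ false)
        ... | yes (t , e) = ≤-trans (≤-trans (≤-reflexive (cong (λ b → 1 * 𝟙 (not b)) (sym e))) (∑-term (λ t → 1 * 𝟙 (not (adj (T t) v))) t)) (m≤m+n _ _)
        ... | no ¬a = ⊥-elim (¬h (v , p , λ t → yes-adj t))
          where
          yes-adj : ∀ t → adj (T t) v ≡ true
          yes-adj t with adj (T t) v in e
          ... | true  = refl
          ... | false = ⊥-elim (¬a (t , e))
        bounded : # U ≤ j * m
        bounded = ≤-trans (≤-reflexive (sym (*-identityˡ (# U)))) (≤-trans (weigh {j} U (λ _ → false) T (λ _ → 1) 1 0 (λ t → bd (T t) (T∈U t)) pointwise)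
          (≤-reflexive (trans (+-identityʳ _) (cong (_* m) (trans (∑-const j 1) (*-identityʳ j))))))

      -- The hypothesis on common neighbours passes to larger cliques, so Q persists while d
      -- vertices are added; `common-neighbour` supplies them as long as there are fewer than r.
      grow : ∀ (Q : Fin n → Set) → (∀ d {j} (T : Fin j → Fin n) → d + j ≡ r → (∀ t → U (T t) ≡ true) →
        (∀ s t → ¬ s ≡ t → adj (T s) (T t) ≡ true) → (∀ t → Q (T t)) →
        (∀ v → U v ≡ true → (∀ t → adj (T t) v ≡ true) → Q v) →
        ∃ λ (T : Fin r → Fin n) → (∀ t → U (T t) ≡ true) × (∀ s t → ¬ s ≡ t → adj (T s) (T t) ≡ true) × (∀ t → Q (T t)))
      grow Q zero T refl T∈U cl q h = T , T∈U , cl , q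
      grow Q (suc d) {j} T eq T∈U cl q h with common-neighbour T (≤-pred (≤-trans (s≤s (m≤n+m j d)) (≤-reflexive eq))) T∈U
      ... | v , pv , a = grow Q d T′ (trans (+-suc d j) eq) ∈U cl′ q′ λ w pw g → h w pw λ t → g (suc t)
        where
        T′ : Fin (suc j) → Fin n
        T′ zero    = v
        T′ (suc t) = T t
        ∈U : ∀ t → U (T′ t) ≡ true
        ∈U zero    = pv
        ∈U (suc t) = T∈U t
        cl′ : ∀ s t → ¬ s ≡ t → adj (T′ s) (T′ t) ≡ true
        cl′ zero zero d = ⊥-elim (d refl)
        cl′ zero (suc t) _ = adj-sym′ (a t)
        cl′ (suc s) zero _ = a s
        cl′ (suc s) (suc t) d = cl s t λ e → d (cong suc e)
        q′ : ∀ t → Q (T′ t)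
        q′ zero    = h v pv a
        q′ (suc t) = q t

      J : Sub
      J = U ∖ I

      J⊑U : J ⊑ U
      J⊑U v e = proj₁ (∧-true e)

      J∉I : ∀ v → J v ≡ true → I v ≡ false
      J∉I v e = not-true (proj₂ (∧-true {U v} e))

      -- Let x be outside I. A common neighbour of a and x in I would have the colour of i by
      -- `same-class`, hence that of x, to which it is adjacent. So the edge ax grows to an r-clique
      -- avoiding I, against `meets`.
      class⊑I : ∀ a (pa : J a ≡ true) i → I i ≡ true → adj a i ≡ true →
        ∀ x → Nb U a x ≡ true → proj₁ (loc a (J⊑U a pa)) x ≡ proj₁ (loc a (J⊑U a pa)) i → I x ≡ true
      class⊑I a pa i pi ai x xN e with I x in ix
      ... | true  = refl
      ... | false = ⊥-elim (contradict (grow (λ v → I v ≡ false) (2 + k) T₂ (+-comm (2 + k) 2) ∈U cl q h))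
        where
        pU = J⊑U a pa
        ax = proj₂ (∧-true {U x} xN)
        T₂ : Fin 2 → Fin n
        T₂ zero       = a
        T₂ (suc zero) = x
        ∈U : ∀ t → U (T₂ t) ≡ true
        ∈U zero       = pU
        ∈U (suc zero) = proj₁ (∧-true xN)
        cl : ∀ s t → ¬ s ≡ t → adj (T₂ s) (T₂ t) ≡ true
        cl zero zero d = ⊥-elim (d refl)
        cl zero (suc zero) _ = ax
        cl (suc zero) zero _ = adj-sym′ ax
        cl (suc zero) (suc zero) d = ⊥-elim (d refl)
        q : ∀ t → I (T₂ t) ≡ false
        q zero       = J∉I a pa
        q (suc zero) = ix
        h : ∀ v → U v ≡ true → (∀ t → adj (T₂ t) v ≡ true) → I v ≡ false
        h v pv g = ¬true⇒false λ iv → proj₂ (loc a pU) x v xN (∧-intro pv (g zero)) (g (suc zero))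
          (trans e (same-class a pU i v pi iv ai (g zero)))
        contradict : (∃ λ (T : Fin r → Fin n) → (∀ t → U (T t) ≡ true) × (∀ s t → ¬ s ≡ t → adj (T s) (T t) ≡ true) × (∀ t → I (T t) ≡ false)) → ⊥
        contradict (T , T∈U , clique , T∉I) = meets T T∈U clique T∉I

      -- By maximality a has a neighbour i in I. The whole class of i in N(a) disappears with I, so
      -- its colour becomes free.
      local-J : ∀ a → J a ≡ true → Col (2 + k) (Nb J a)
      local-J a pa with neighbour M a (J⊑U a pa) (J∉I a pa)
      ... | i , pi , ia = c′ , proper′
        where
        pU = J⊑U a pa
        c = proj₁ (loc a pU)
        avoid : ∀ v → Nb J a v ≡ true → ¬ c i ≡ c v
        avoid v e eq = absurd (class⊑I a pa i pi (adj-sym′ ia) v (∧-intro (J⊑U v (proj₁ (∧-true e))) (proj₂ (∧-true {J v} e))) (sym eq))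
          (J∉I v (proj₁ (∧-true e)))
        c′ : Fin n → Fin (2 + k)
        c′ v with c i ≟ᶠ c v
        -- An arbitrary value: by `avoid` this case does not arise on `Nb J a`.
        ... | yes _ = zero
        ... | no ne = punchOut ne
        proper′ : ∀ u v → Nb J a u ≡ true → Nb J a v ≡ true → adj u v ≡ true → ¬ c′ u ≡ c′ v
        proper′ u v pu pv e eq with c i ≟ᶠ c u | c i ≟ᶠ c v
        ... | yes x | _ = avoid u pu x
        ... | no _ | yes y = avoid v pv y
        ... | no x | no y = proj₂ (loc a pU) u v (up u pu) (up v pv) e (punchOut-injective x y eq)
          where
          up : ∀ v → Nb J a v ≡ true → Nb U a v ≡ true
          up v e = ∧-intro (J⊑U v (proj₁ (∧-true e))) (proj₂ (∧-true {J v} e))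

      #J : # U ≤ # J + m
      #J = ≤-trans (≤-trans (∑-mono λ v → go (U v) (I v)) (≤-reflexive (∑-+ (λ v → 𝟙 (J v)) (λ v → 𝟙 (I v))))) (+-monoʳ-≤ (# J) small)
        where
        go : ∀ a b → 𝟙 a ≤ 𝟙 (a ∧ not b) + 𝟙 b
        go true  true  = ≤-refl
        go true  false = ≤-refl
        go false b     = z≤n

      add-class : Col (3 + k) J → Col (4 + k) U
      add-class (c , proper) = c′ , proper′
        where
        c′ : Fin n → Fin (4 + k)
        c′ v = if I v then zero else suc (c v)
        proper′ : ∀ u v → U u ≡ true → U v ≡ true → adj u v ≡ true → ¬ c′ u ≡ c′ v
        proper′ u v pu pv e eq with I u in iu | I v in iv
        ... | true  | true  = absurd e (indep u v iu iv)
        ... | false | false = proper u v (∧-intro pu (cong not iu)) (∧-intro pv (cong not iv)) e (sucᶠ-injective eq)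

    col₂⇒bip : ∀ {P} → Col 2 P → Bip P
    col₂⇒bip (c , proper) = (λ v → ⌊ c v ≟ᶠ zero ⌋) , λ u v pu pv e eq → go (c u) (c v) (proper u v pu pv e) eq
      where
      go : ∀ (x y : Fin 2) → ¬ x ≡ y → ¬ ⌊ x ≟ᶠ zero ⌋ ≡ ⌊ y ≟ᶠ zero ⌋
      go zero zero ne _ = ne refl
      go zero (suc zero) ne ()
      go (suc zero) zero ne ()
      go (suc zero) (suc zero) ne _ = ne refl

    module Four {U : Sub} {m : ℕ} (bd : Bounded U m) (gap : 22 * m < 7 * # U)
                (loc : ∀ a → U a ≡ true → Col 3 (Nb U a)) where
      gap₃ : 3 * m < # U
      gap₃ = ≰⇒> λ l → <⇒≱ gap (≤-trans (*-monoʳ-≤ 7 l) (≤-trans (≤-reflexive (sym (*-assoc 7 3 m))) (*-monoˡ-≤ m (≤ᵇ-true {21} {22} refl))))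
      open Peel 0 bd gap₃ loc public
      open MaxIndep M renaming (set to I)
      open LocallyBipartite G
      open ThreeColours.Level3 G using (three-colourable)

      J-loc : ∀ a → J a ≡ true → Bip (Nb J a)
      J-loc a p = col₂⇒bip (local-J a p)

      split-U : ∀ v → U v ≡ true → J v ≡ true ⊎ I v ≡ true
      split-U v p with true? (I v)
      ... | inj₁ i = inj₂ i
      ... | inj₂ e = inj₁ (∧-intro p (cong not e))

      -- Vertices of J miss three vertices of the spindle by `tree-spindle′`. A member of I misses
      -- at least one, since its neighbourhood is 3-colourable and the spindle is not. With credit 2
      -- this gives 3N ≤ 9m.
      J-spindle : Avoids J spindle
      J-spindle φ E = no-gap 3 9 7 22 (# U) m
          (≤-trans (weigh {7} U I (λ q → φ (toℕ q)) (λ _ → 1) 3 2 (λ q → bd _ (J⊑U _ (Emb.inside E (toℕ q) (toℕ<n q)))) pointwise)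
            (≤-trans (+-monoʳ-≤ (7 * m) (*-monoʳ-≤ 2 small)) (≤-reflexive (sym (*-distribʳ-+ m 7 2)))))
          gap (≤ᵇ-true refl) (s≤s z≤n)
        where
        skips : Fin n → Fin 7 → ℕ
        skips v q = 1 * 𝟙 (not (adj (φ (toℕ q)) v))
        pointwise : ∀ v → U v ≡ true → 3 ≤ sumFin (skips v) + 2 * 𝟙 (I v)
        pointwise v p with split-U v p
        ... | inj₁ q = ≤-trans (≤-trans (leaf-bound {J} {K₄ ∷ W₅ ∷ W₇ ∷ []} (avoidK₄ J-loc ∷ avoidW₅ J-loc ∷ avoidW₇ J-loc ∷ []) {3} {7} {spindle} {φ} tree-spindle′ refl check-spindle′ E v q)
                (∑-mono {7} (uniform v))) (m≤m+n _ _)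
          where
          uniform : ∀ v (q : Fin 7) → at (1 ∷ 1 ∷ 1 ∷ 1 ∷ 1 ∷ 1 ∷ 1 ∷ []) (toℕ q) * 𝟙 (not (adj (φ (toℕ q)) v)) ≤ skips v q
          uniform v q = *-monoˡ-≤ (𝟙 (not (adj (φ (toℕ q)) v))) (go q)
            where
            go : ∀ (q : Fin 7) → at (1 ∷ 1 ∷ 1 ∷ 1 ∷ 1 ∷ 1 ∷ 1 ∷ []) (toℕ q) ≤ 1
            go zero = ≤-refl
            go (suc zero) = ≤-refl
            go (suc (suc zero)) = ≤-refl
            go (suc (suc (suc zero))) = ≤-refl
            go (suc (suc (suc (suc zero)))) = ≤-refl
            go (suc (suc (suc (suc (suc zero))))) = ≤-refl
            go (suc (suc (suc (suc (suc (suc zero)))))) = ≤-refl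
        ... | inj₂ q with any? (λ t → adj (φ (toℕ t)) v ≟ᵇ false)
        ...   | yes (t , e) = +-mono-≤ (≤-trans (≤-reflexive (cong (λ b → 1 * 𝟙 (not b)) (sym e))) (∑-term (skips v) t)) (≤-reflexive (cong (λ b → 2 * 𝟙 b) (sym q)))
        ...   | no ¬a = ⊥-elim (not3⇒ {Nb U v} {spindle} {φ} refl record { inside = ins ; edges = Emb.edges E } (wellFormed⇒ spindle refl) (loc v p))
          where
          open import Data.Fin using (fromℕ<)
          open import Data.Fin.Properties using (toℕ-fromℕ<)
          ins : ∀ t → t < 7 → Nb U v (φ t) ≡ true
          ins t l with adj v (φ t) in e
          ... | true  = ∧-intro (J⊑U _ (Emb.inside E t l)) refl
          ... | false = ⊥-elim (¬a (fromℕ< l , trans (cong (λ t → adj (φ t) v) (toℕ-fromℕ< l)) (adj-sym″ e)))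

      -- As for the spindle, with the weights of `tree-Θ` and credit 5: 6N ≤ 18m. A member of I that
      -- misses no weight need only be adjacent to the vertices of positive weight, so `Θ⁻` has to
      -- be the pattern in its neighbourhood.
      J-Θ : Avoids J Θ
      J-Θ φ E = no-gap 6 18 7 22 (# U) m
          (≤-trans (weigh {10} U I (λ q → φ (toℕ q)) weight 6 5 (λ q → bd _ (J⊑U _ (Emb.inside E (toℕ q) (toℕ<n q)))) pointwise)
            (≤-trans (+-monoʳ-≤ (13 * m) (*-monoʳ-≤ 5 small)) (≤-reflexive (sym (*-distribʳ-+ m 13 5)))))
          gap (≤ᵇ-true refl) (s≤s z≤n)
        where
        ws : List ℕ
        ws = 2 ∷ 1 ∷ 1 ∷ 1 ∷ 1 ∷ 1 ∷ 1 ∷ 0 ∷ 4 ∷ 1 ∷ []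
        weight : Fin 10 → ℕ
        weight q = at ws (toℕ q)
        pointwise : ∀ v → U v ≡ true → 6 ≤ sumFin (λ q → weight q * 𝟙 (not (adj (φ (toℕ q)) v))) + 5 * 𝟙 (I v)
        pointwise v p with split-U v p
        ... | inj₁ q = ≤-trans (leaf-bound {J} {K₄ ∷ W₅ ∷ W₇ ∷ spindle ∷ []} (avoidK₄ J-loc ∷ avoidW₅ J-loc ∷ avoidW₇ J-loc ∷ J-spindle ∷ []) {6} {13} {Θ} {φ} tree-Θ refl check-Θ E v q) (m≤m+n _ _)
        ... | inj₂ q with any? (λ t → (1 ≤? weight t) ×-dec (adj (φ (toℕ t)) v ≟ᵇ false))
        ...   | yes (t , l , e) = +-mono-≤ (≤-trans (≤-trans l (≤-reflexive (sym (trans (cong (λ b → weight t * 𝟙 (not b)) e) (*-identityʳ _)))))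
                  (∑-term (λ q → weight q * 𝟙 (not (adj (φ (toℕ q)) v))) t)) (≤-reflexive (cong (λ b → 5 * 𝟙 b) (sym q)))
        ...   | no ¬a = ⊥-elim (not3⇒ {Nb U v} {Θ⁻} {ψ} refl record { inside = ins ; edges = edges } (wellFormed⇒ Θ⁻ refl) (loc v p))
          where
          open import Data.Fin using (fromℕ<)
          open import Data.Fin.Properties using (toℕ-fromℕ<)
          ψ : ℕ → Fin n
          -- The isolated vertex of `Θ⁻` may be placed anywhere in the neighbourhood.
          ψ 7 = φ 0
          ψ t = φ t
          near : ∀ t → (t <ᵇ 10) ≡ true → (1 ≤ᵇ at ws t) ≡ true → Nb U v (φ t) ≡ true
          near t l w with adj v (φ t) in e
          ... | true  = ∧-intro (J⊑U _ (Emb.inside E t t<10)) refl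
            where
            t<10 : t < 10
            t<10 = <ᵇ-true l
          ... | false = ⊥-elim (¬a (x , subst (λ y → 1 ≤ at ws y) (sym q≡t) (≤ᵇ-true {1} {at ws t} w) , trans (cong (λ t → adj (φ t) v) q≡t) (adj-sym″ e)))
            where
            x : Fin 10
            x = fromℕ< {t} {10} (<ᵇ-true {t} {10} l)
            q≡t : toℕ x ≡ t
            q≡t = toℕ-fromℕ< (<ᵇ-true {t} {10} l)
          ins : ∀ t → t < 10 → Nb U v (ψ t) ≡ true
          ins 0 _ = near 0 refl refl
          ins 1 _ = near 1 refl refl
          ins 2 _ = near 2 refl refl
          ins 3 _ = near 3 refl refl
          ins 4 _ = near 4 refl refl
          ins 5 _ = near 5 refl refl
          ins 6 _ = near 6 refl refl
          ins 7 _ = near 0 refl refl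
          ins 8 _ = near 8 refl refl
          ins 9 _ = near 9 refl refl
          ins (suc (suc (suc (suc (suc (suc (suc (suc (suc (suc t)))))))))) l = ⊥-elim (<⇒≱ l (m≤m+n 10 t))
          edges : All (λ e → adj (ψ (proj₁ e)) (ψ (proj₂ e)) ≡ true) (proj₂ Θ⁻)
          edges with Emb.edges E
          ... | a ∷ b ∷ c ∷ d ∷ e ∷ f ∷ g ∷ h₀ ∷ h₂ ∷ h₃ ∷ h₄ ∷ h₅ ∷ h₆ ∷ k₀ ∷ k₁ ∷ k₂ ∷ k₃ ∷ k₄ ∷ k₅ ∷ _ =
                a ∷ b ∷ c ∷ d ∷ e ∷ f ∷ g ∷ h₀ ∷ h₂ ∷ h₃ ∷ h₄ ∷ h₅ ∷ h₆ ∷ k₀ ∷ k₁ ∷ k₂ ∷ k₃ ∷ k₄ ∷ k₅ ∷ []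

      gap-J : 15 * m < 7 * # J
      gap-J = +-cancelʳ-< (7 * m) _ _ (begin-strict
        15 * m + 7 * m ≡⟨ sym (*-distribʳ-+ m 15 7) ⟩
        22 * m <⟨ gap ⟩
        7 * # U ≤⟨ *-monoʳ-≤ 7 #J ⟩
        7 * (# J + m) ≡⟨ *-distribˡ-+ 7 (# J) m ⟩
        7 * # J + 7 * m ∎)
        where open ≤-Reasoning

      four-colourable : Col 4 U
      four-colourable = add-class (three-colourable (Bounded-⊑ J⊑U bd) gap-J J-loc J-spindle J-Θ)

    -- Removing I costs one colour and at most m vertices, so N > (r - 1 + 1/7)m passes on with r
    -- lowered by one; `local-J` carries over the local hypothesis.
    level : ∀ k {U m} → Bounded U m → (7 * (3 + k) + 1) * m < 7 * # U → (∀ a → U a ≡ true → Col (3 + k) (Nb U a)) → Col (4 + k) U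
    level zero    bd gap loc = Four.four-colourable bd gap loc
    level (suc k) {U} {m} bd gap loc = add-class (level k (Bounded-⊑ J⊑U bd) gap-J local-J)
      where
      gap′ : (4 + k) * m < # U
      gap′ = ≰⇒> λ l → <⇒≱ gap (≤-trans (*-monoʳ-≤ 7 l) (≤-trans (≤-reflexive (sym (*-assoc 7 (4 + k) m))) (*-monoˡ-≤ m (m≤m+n (7 * (4 + k)) 1))))
      open Peel (suc k) bd gap′ loc
      gap-J : (7 * (3 + k) + 1) * m < 7 * # J
      gap-J = +-cancelʳ-< (7 * m) _ _ (begin-strict
        (7 * (3 + k) + 1) * m + 7 * m ≡⟨ l k m ⟩
        (7 * (4 + k) + 1) * m <⟨ gap ⟩
        7 * # U ≤⟨ *-monoʳ-≤ 7 #J ⟩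
        7 * (# J + m) ≡⟨ *-distribˡ-+ 7 (# J) m ⟩
        7 * # J + 7 * m ∎)
        where
        open ≤-Reasoning
        l : ∀ k m → (7 * (3 + k) + 1) * m + 7 * m ≡ (7 * (4 + k) + 1) * m
        l = solve-∀

-- The structural theorem for all g and r.

module Structural where
  open import Defs hiding (_//_)
  open Sums
  open Graphs
  open Certificates
  open Cycles
  open Trees
  open ThreeColours
  open ManyColours

  ≡ᵇ-refl : ∀ a → (a ≡ᵇ a) ≡ true
  ≡ᵇ-refl zero    = refl
  ≡ᵇ-refl (suc a) = ≡ᵇ-refl a

  -- c′ ≤ c weakens the hypothesis N > (l + c) m.
  weaken-gap : ∀ p q p′ q′ l {m N} → p′ * suc q ≤ p * q′ → 1 ≤ q′ → (suc q * l + p) * m < suc q * N → (q′ * l + p′) * m < q′ * N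
  weaken-gap p q p′ q′@(suc _) l {m} {N} h _ g = *-cancelˡ-< (suc q) _ _ (begin-strict
    suc q * ((q′ * l + p′) * m) ≡⟨ l₁ (suc q) q′ l p′ m ⟩
    (suc q * q′ * l + p′ * suc q) * m ≤⟨ *-monoˡ-≤ m (+-monoʳ-≤ (suc q * q′ * l) h) ⟩
    (suc q * q′ * l + p * q′) * m ≡⟨ l₂ (suc q) q′ l p m ⟩
    q′ * ((suc q * l + p) * m) <⟨ *-monoʳ-< q′ g ⟩
    q′ * (suc q * N) ≡⟨ l₃ q′ (suc q) N ⟩
    suc q * (q′ * N) ∎)
    where
    open ≤-Reasoning
    l₁ : ∀ a b l p m → a * ((b * l + p) * m) ≡ (a * b * l + p * a) * m
    l₁ = solve-∀
    l₂ : ∀ a b l p m → (a * b * l + p * b) * m ≡ b * ((a * l + p) * m)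
    l₂ = solve-∀
    l₃ : ∀ a b N → a * (b * N) ≡ b * (a * N)
    l₃ = solve-∀

  module Homs {n : ℕ} (G : Gr n) where
    open Gr G
    open Structure G
    open Embeddings G
    open ClosedWalks G
    open LocallyBipartite G

    record HomTo (H : Graph) (U : Sub) : Set where
      constructor hom
      field
        map    : Fin (size H) → Fin n
        inside : ∀ i → U (map i) ≡ true
        edges  : ∀ i j → Edge H i j → adj (map i) (map j) ≡ true

    pattern⇒hom : ∀ {U k es φ} → Emb U (k , es) φ → HomTo (fromEdges k es) U
    pattern⇒hom {U} {k} {es} {φ} E = hom (φ ∘ toℕ) (λ i → Emb.inside E (toℕ i) (toℕ<n i)) λ i j e → go i j (proj₂ (∧-true {not (toℕ i ≡ᵇ toℕ j)} e))
      where
      search : ∀ es → All (λ e → adj (φ (proj₁ e)) (φ (proj₂ e)) ≡ true) es → ∀ a b → rel (fromEdges k es) a b ≡ true → adj (φ a) (φ b) ≡ true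
      search ((x , y) ∷ es) (h ∷ hs) a b e with ∨-true {(x ≡ᵇ a) ∧ (y ≡ᵇ b)} e
      ... | inj₂ e′ = search es hs a b e′
      ... | inj₁ e′ with ∧-true {x ≡ᵇ a} e′
      ...   | p , q with ≡ᵇ-true {x} p | ≡ᵇ-true {y} q
      ...     | refl | refl = h
      go : ∀ i j → (rel (fromEdges k es) (toℕ i) (toℕ j) ∨ rel (fromEdges k es) (toℕ j) (toℕ i)) ≡ true → adj (φ (toℕ i)) (φ (toℕ j)) ≡ true
      go i j e with ∨-true {rel (fromEdges k es) (toℕ i) (toℕ j)} e
      ... | inj₁ e′ = search es (Emb.edges E) _ _ e′
      ... | inj₂ e′ = adj-sym′ (search es (Emb.edges E) _ _ e′)

    adjℕ-sym : ∀ H a b → adjℕ H a b ≡ adjℕ H b a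
    adjℕ-sym H a b = cong₂ _∧_ (cong not (≡ᵇ-sym a b)) (∨-comm (rel H a b) (rel H b a))
      where
      open import Data.Bool.Properties using (∨-comm)
      ≡ᵇ-sym : ∀ a b → (a ≡ᵇ b) ≡ (b ≡ᵇ a)
      ≡ᵇ-sym zero    zero    = refl
      ≡ᵇ-sym zero    (suc b) = refl
      ≡ᵇ-sym (suc a) zero    = refl
      ≡ᵇ-sym (suc a) (suc b) = ≡ᵇ-sym a b

    join₀ : ∀ {H U} → HomTo H U → HomTo (K 0 ⊕ H) U
    join₀ {H} (hom f ins ed) = hom f ins λ i j e → ed i j (go i j e)
      where
      go : ∀ i j → Edge (K 0 ⊕ H) i j → Edge H i j
      go i j e with ∨-true {adjℕ H (toℕ i) (toℕ j)} (proj₂ (∧-true {not (toℕ i ≡ᵇ toℕ j)} e))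
      ... | inj₁ e′ = e′
      ... | inj₂ e′ = trans (adjℕ-sym H (toℕ i) (toℕ j)) e′

    -- The vertex a becomes vertex 0 of the larger clique. Shifting indices by one turns edges of
    -- the larger join into edges of the smaller one by computation.
    join₊ : ∀ {s H U a} → U a ≡ true → HomTo (K s ⊕ H) (Nb U a) → HomTo (K (suc s) ⊕ H) U
    join₊ {s} {H} {U} {a} pa (hom f ins ed) = hom f′ ins′ ed′
      where
      f′ : Fin (suc (s + size H)) → Fin n
      f′ zero    = a
      f′ (suc i) = f i
      ins′ : ∀ i → U (f′ i) ≡ true
      ins′ zero    = pa
      ins′ (suc i) = proj₁ (∧-true (ins i))
      ed′ : ∀ i j → Edge (K (suc s) ⊕ H) i j → adj (f′ i) (f′ j) ≡ true
      ed′ zero    (suc j) e = proj₂ (∧-true {U (f j)} (ins j))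
      ed′ (suc i) zero    e = adj-sym′ (proj₂ (∧-true {U (f i)} (ins i)))
      ed′ (suc i) (suc j) e = ed i j e

    K₄-hom : ∀ {U a v} → U a ≡ true → Walk (Nb U a) v v 3 → HomTo (K 4) U
    K₄-hom {U} {a} {v} pa (step {v = b} p e (step {v = c} q f (step r g (stop _)))) = hom φ ins ed
      where
      φ : Fin 4 → Fin n
      φ zero = a
      φ (suc zero) = v
      φ (suc (suc zero)) = b
      φ (suc (suc (suc zero))) = c
      ins : ∀ i → U (φ i) ≡ true
      ins zero = pa
      ins (suc zero) = proj₁ (∧-true p)
      ins (suc (suc zero)) = proj₁ (∧-true q)
      ins (suc (suc (suc zero))) = proj₁ (∧-true r)
      hub : ∀ {x} → Nb U a x ≡ true → adj a x ≡ true
      hub {x} p = proj₂ (∧-true {U x} p)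
      ed : ∀ i j → Edge (K 4) i j → adj (φ i) (φ j) ≡ true
      ed zero zero ()
      ed zero (suc zero) _ = hub p
      ed zero (suc (suc zero)) _ = hub q
      ed zero (suc (suc (suc zero))) _ = hub r
      ed (suc zero) zero _ = adj-sym′ (hub p)
      ed (suc zero) (suc zero) ()
      ed (suc zero) (suc (suc zero)) _ = e
      ed (suc zero) (suc (suc (suc zero))) _ = adj-sym′ g
      ed (suc (suc zero)) zero _ = adj-sym′ (hub q)
      ed (suc (suc zero)) (suc zero) _ = adj-sym′ e
      ed (suc (suc zero)) (suc (suc zero)) ()
      ed (suc (suc zero)) (suc (suc (suc zero))) _ = f
      ed (suc (suc (suc zero))) zero _ = adj-sym′ (hub r)
      ed (suc (suc (suc zero))) (suc zero) _ = g
      ed (suc (suc (suc zero))) (suc (suc zero)) _ = adj-sym′ f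
      ed (suc (suc (suc zero))) (suc (suc (suc zero))) ()

    wheel-hom : ∀ {U a v k} → U a ≡ true → Walk (Nb U a) v v (suc k) → HomTo (W (suc k)) U
    wheel-hom {U} {a} {v} {k} pa walk = hom φ ins ed
      where
      open Cyc (unroll walk)
      φ : Fin (1 + suc k) → Fin n
      φ zero    = a
      φ (suc i) = pos (toℕ i)
      ins : ∀ i → U (φ i) ≡ true
      ins zero    = pa
      ins (suc i) = proj₁ (∧-true (on (toℕ i)))
      hub : ∀ i → adj a (pos i) ≡ true
      hub i = proj₂ (∧-true {U (pos i)} (on i))
      rim : ∀ x y → rel (C (suc k)) x y ≡ true → adj (pos x) (pos y) ≡ true
      rim x y e with ∨-true {y ≡ᵇ suc x} e
      ... | inj₁ e′ with ≡ᵇ-true {y} e′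
      ...   | refl = next x
      rim x y e | inj₂ e′ with ∧-true {x ≡ᵇ 0} e′
      ... | p , q with ≡ᵇ-true {x} p | ≡ᵇ-true {y} q
      ...   | refl | refl = adj-sym′ (subst (λ t → adj (pos k) t ≡ true) (trans (cong pos (cong suc (sym (+-identityʳ k)))) (per 0)) (next k))
      rim′ : ∀ x y → adjℕ (C (suc k)) x y ≡ true → adj (pos x) (pos y) ≡ true
      rim′ x y e with ∨-true {rel (C (suc k)) x y} (proj₂ (∧-true {not (x ≡ᵇ y)} e))
      ... | inj₁ e′ = rim x y e′
      ... | inj₂ e′ = adj-sym′ (rim y x e′)
      ed : ∀ i j → Edge (W (suc k)) i j → adj (φ i) (φ j) ≡ true
      ed zero zero ()
      ed zero (suc j) _ = hub (toℕ j)
      ed (suc i) zero _ = adj-sym′ (hub (toℕ i))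
      ed (suc i) (suc j) e with ∨-true {adjℕ (C (suc k)) (toℕ i) (toℕ j)} (proj₂ (∧-true {not (toℕ i ≡ᵇ toℕ j)} e))
      ... | inj₁ e′ = rim′ (toℕ i) (toℕ j) e′
      ... | inj₂ e′ = adj-sym′ (rim′ (toℕ j) (toℕ i) e′)

    #-Nb : ∀ {U m} → Bounded U m → ∀ a → U a ≡ true → # U ≤ # (Nb U a) + m
    #-Nb {U} bd a pa = ≤-trans (≤-reflexive (#-split U a)) (+-monoʳ-≤ (# (Nb U a)) (bd a pa))

    -- A neighbourhood loses at most m vertices, which lowers the integer part l by one and keeps
    -- the excess p/q.
    Nb-gap : ∀ p q l {U m} → Bounded U m → ∀ a → U a ≡ true → (q * suc l + p) * m < q * # U → (q * l + p) * m < q * # (Nb U a)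
    Nb-gap p q l {U} {m} bd a pa g = +-cancelʳ-< (q * m) _ _ (begin-strict
      (q * l + p) * m + q * m ≡⟨ eq q l p m ⟩
      (q * suc l + p) * m <⟨ g ⟩
      q * # U ≤⟨ *-monoʳ-≤ q (#-Nb bd a pa) ⟩
      q * (# (Nb U a) + m) ≡⟨ *-distribˡ-+ q (# (Nb U a)) m ⟩
      q * # (Nb U a) + q * m ∎)
      where
      open ≤-Reasoning
      eq : ∀ q l p m → (q * l + p) * m + q * m ≡ (q * (1 + l) + p) * m
      eq = solve-∀

    open ManyColours.LevelR G using (Bounded-⊑; level)

    Nb⊑ : ∀ U a → Nb U a ⊑ U
    Nb⊑ U a v e = proj₁ (∧-true e)

    module Three {U : Sub} {m : ℕ} (bd : Bounded U m) (g : ℕ)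
                 (noF : ∀ j → 1 ≤ j → j ≤ g → ¬ HomTo (F j) U) where

      no3 : 1 ≤ g → ∀ a → U a ≡ true → ∀ v → ¬ Walk (Nb U a) v v 3
      no3 l a pa v w = noF 1 ≤-refl l (K₄-hom pa w)

      noW : ∀ j k → 1 ≤ j → F j ≡ W (suc k) → j ≤ g → ∀ a → U a ≡ true → ∀ v → ¬ Walk (Nb U a) v v (suc k)
      noW j k l e le a pa v w = noF j l le (subst (λ H → HomTo H U) (sym e) (wheel-hom pa w))

      avoids : ∀ j {k es} → F j ≡ fromEdges k es → 1 ≤ j → j ≤ g → Avoids U (k , es)
      avoids j {k} {es} e l le φ E = noF j l le (subst (λ H → HomTo H U) (sym e) (pattern⇒hom E))

      Short : ℕ → Set
      Short ℓ = ∀ a → U a ≡ true → ∀ v k → odd k ≡ true → k ≤ ℓ → ¬ Walk (Nb U a) v v k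

      short₁ : Short 1
      short₁ a pa v 1 _ _ (step _ e (stop _)) = absurd e (adj-irr v)
      short₁ a pa v (suc (suc k)) o (s≤s ()) w

      longer : ∀ ℓ → odd ℓ ≡ true → Short ℓ → (∀ a → U a ≡ true → ∀ v → ¬ Walk (Nb U a) v v (2 + ℓ)) → Short (2 + ℓ)
      longer ℓ oℓ sh none a pa v k ok l w with m≤n⇒m<n∨m≡n l
      ... | inj₂ refl = none a pa v w
      ... | inj₁ (s≤s l′) with m≤n⇒m<n∨m≡n l′
      ...   | inj₂ refl = absurd ok (cong not oℓ)
      ...   | inj₁ (s≤s l″) = sh a pa v k ok l″ w

      short₃ : 1 ≤ g → Short 3
      short₃ l = longer 1 refl short₁ (no3 l)

      short₅ : 2 ≤ g → Short 5
      short₅ l = longer 3 refl (short₃ (≤-trans (s≤s z≤n) l)) (noW 2 4 (s≤s z≤n) refl l)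

      short₇ : 3 ≤ g → Short 7
      short₇ l = longer 5 refl (short₅ (≤-trans (s≤s (s≤s z≤n)) l)) (noW 3 6 (s≤s z≤n) refl l)

      short₉ : 5 ≤ g → Short 9
      short₉ l = longer 7 refl (short₇ (≤-trans (≤ᵇ-true {3} {5} refl) l)) (noW 5 8 (s≤s z≤n) refl l)

      short₁₁ : 7 ≤ g → Short 11
      short₁₁ l = longer 9 refl (short₉ (≤-trans (≤ᵇ-true {5} {7} refl) l)) (noW 7 10 (s≤s z≤n) refl l)

      short₁₃ : 9 ≤ g → Short 13
      short₁₃ l = longer 11 refl (short₁₁ (≤-trans (≤ᵇ-true {7} {9} refl) l)) (noW 9 12 (s≤s z≤n) refl l)

      short₁₅ : 11 ≤ g → Short 15
      short₁₅ l = longer 13 refl (short₁₃ (≤-trans (≤ᵇ-true {9} {11} refl) l)) (noW 11 14 (s≤s z≤n) refl l)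

      module _ (p q : ℕ) (gap : (suc q * 2 + p) * m < suc q * # U) where
        -- Neighbourhoods have more than (1 + c)m vertices. Wheels exclude odd walks up to length ℓ,
        -- and counting excludes longer ones as soon as ℓ ≥ 2/c.
        locally : ∀ ℓ → Short ℓ → odd ℓ ≡ true → 3 ≤ ℓ → (2 * (suc q + p) ≤ᵇ (2 + ℓ) * p) ≡ true → ∀ a → U a ≡ true → Bip (Nb U a)
        locally ℓ sh oℓ l h a pa = bip-from-short p (suc q) ℓ (Bounded-⊑ (Nb⊑ U a) bd)
          (subst (λ t → (t + p) * m < suc q * # (Nb U a)) (*-identityʳ (suc q)) (Nb-gap p (suc q) 1 bd a pa gap)) (≤ᵇ-true h) oℓ l (sh a pa)

        gapTo : ∀ p′ q′ → (p′ * suc q ≤ᵇ p * q′) ≡ true → (1 ≤ᵇ q′) ≡ true → (q′ * 2 + p′) * m < q′ * # U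
        gapTo p′ q′ h h′ = weaken-gap p q p′ q′ 2 (≤ᵇ-true h) (≤ᵇ-true h′) gap

        module Refutations (loc : ∀ a → U a ≡ true → Bip (Nb U a)) where
          base : All (Avoids U) (K₄ ∷ W₅ ∷ W₇ ∷ [])
          base = avoidK₄ loc ∷ avoidW₅ loc ∷ avoidW₇ loc ∷ []

          base+ : ∀ {Fs} → All (Avoids U) Fs → All (Avoids U) (K₄ ∷ W₅ ∷ W₇ ∷ Fs)
          base+ as = avoidK₄ loc ∷ avoidW₅ loc ∷ avoidW₇ loc ∷ as

          spindle-high : 7 * m < 3 * # U → Avoids U spindle
          spindle-high gp = refute bd {forb = K₄ ∷ W₅ ∷ W₇ ∷ []} base {num = 3} {den = 7} gp {Q = spindle} tree-spindle′ check-spindle′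

          Γ₂⁺-out : 9 * m < 4 * # U → Avoids U C̄ → Avoids U Γ₂⁺
          Γ₂⁺-out gp a = refute bd {forb = K₄ ∷ W₅ ∷ W₇ ∷ C̄ ∷ []} (base+ (a ∷ [])) {num = 4} {den = 9} gp {Q = Γ₂⁺} tree-Γ₂⁺ check-Γ₂⁺

          Γ₂-out : 11 * m < 5 * # U → Avoids U C̄ → Avoids U Γ₂⁺ → Avoids U Γ₂
          Γ₂-out gp a b = refute bd {forb = K₄ ∷ W₅ ∷ W₇ ∷ C̄ ∷ Γ₂⁺ ∷ []} (base+ (a ∷ b ∷ [])) {num = 5} {den = 11} gp {Q = Γ₂} tree-Γ₂ check-Γ₂

          Θ-out : 13 * m < 6 * # U → Avoids U spindle → Avoids U Θ
          Θ-out gp a = refute bd {forb = K₄ ∷ W₅ ∷ W₇ ∷ spindle ∷ []} (base+ (a ∷ [])) {num = 6} {den = 13} gp {Q = Θ} tree-Θ check-Θ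

          spindle-low : 15 * m < 7 * # U → Avoids U Γ₂ → Avoids U spindle
          spindle-low gp a = refute bd {forb = K₄ ∷ W₅ ∷ W₇ ∷ Γ₁ ∷ []} (base+ (Γ₁-out ∷ [])) {num = 7} {den = 15} gp {Q = spindle} tree-spindle check-spindle
            where
            Γ₁-out : Avoids U Γ₁
            Γ₁-out = refute bd {forb = K₄ ∷ W₅ ∷ W₇ ∷ Γ₂ ∷ []} (base+ (a ∷ [])) {num = 7} {den = 15} gp {Q = Γ₁} tree-Γ₁ check-Γ₁

          finish : 15 * m < 7 * # U → Avoids U spindle → Avoids U Θ → Col 3 U
          finish gp a b = ThreeColours.Level3.three-colourable G bd gp loc a b

    -- For g ≤ 3 the ratio 7/3 excludes the spindle. From g = 4 on it falls at the end of the chain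
    -- `C̄₇`, `H₂⁺`, `H₂`, `Γ₁`, spindle, which is entered later as g grows: the certificates of
    -- `H₂⁺`, `H₂`, `T₀` fail from g = 6, 8, 10 on, and from there these graphs are themselves
    -- forbidden.
    three : ∀ g → 1 ≤ g → g ≤ 11 → ∀ {U m} → Bounded U m → (cDen g * 2 + cNum g) * m < cDen g * # U →
      (∀ j → 1 ≤ j → j ≤ g → ¬ HomTo (F j) U) → Col 3 U
    three 0 () _ bd gap noF
    three 1 _ _ {U} {m} bd gap noF = finish (gapTo′ 1 7 refl refl) s (Θ-out (gapTo′ 1 6 refl refl) s)
      where
      open Three bd 1 noF
      loc = locally 2 2 gap 3 (short₃ (≤ᵇ-true refl)) refl (≤ᵇ-true {3} {3} refl) refl
      gapTo′ = gapTo 2 2 gap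
      open Refutations 2 2 gap loc
      s = spindle-high (gapTo′ 1 3 refl refl)
    three 2 _ _ {U} {m} bd gap noF = finish (gapTo′ 1 7 refl refl) s (Θ-out (gapTo′ 1 6 refl refl) s)
      where
      open Three bd 2 noF
      loc = locally 2 4 gap 5 (short₅ (≤ᵇ-true refl)) refl (≤ᵇ-true {3} {5} refl) refl
      gapTo′ = gapTo 2 4 gap
      open Refutations 2 4 gap loc
      s = spindle-high (gapTo′ 1 3 refl refl)
    three 3 _ _ {U} {m} bd gap noF = finish (gapTo′ 1 7 refl refl) s (Θ-out (gapTo′ 1 6 refl refl) s)
      where
      open Three bd 3 noF
      loc = locally 1 2 gap 7 (short₇ (≤ᵇ-true refl)) refl (≤ᵇ-true {3} {7} refl) refl
      gapTo′ = gapTo 1 2 gap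
      open Refutations 1 2 gap loc
      s = spindle-high (gapTo′ 1 3 refl refl)
    three 4 _ _ {U} {m} bd gap noF = finish (gapTo′ 1 7 refl refl) s (Θ-out (gapTo′ 1 6 refl refl) s)
      where
      open Three bd 4 noF
      loc = locally 2 6 gap 7 (short₇ (≤ᵇ-true refl)) refl (≤ᵇ-true {3} {7} refl) refl
      gapTo′ = gapTo 2 6 gap
      open Refutations 2 6 gap loc
      a = avoids 4 refl (≤ᵇ-true refl) (≤ᵇ-true refl)
      s = spindle-low (gapTo′ 1 7 refl refl) (Γ₂-out (gapTo′ 1 5 refl refl) a (Γ₂⁺-out (gapTo′ 1 4 refl refl) a))
    three 5 _ _ {U} {m} bd gap noF = finish (gapTo′ 1 7 refl refl) s (Θ-out (gapTo′ 1 6 refl refl) s)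
      where
      open Three bd 5 noF
      loc = locally 1 3 gap 9 (short₉ (≤ᵇ-true refl)) refl (≤ᵇ-true {3} {9} refl) refl
      gapTo′ = gapTo 1 3 gap
      open Refutations 1 3 gap loc
      a = avoids 4 refl (≤ᵇ-true refl) (≤ᵇ-true refl)
      s = spindle-low (gapTo′ 1 7 refl refl) (Γ₂-out (gapTo′ 1 5 refl refl) a (Γ₂⁺-out (gapTo′ 1 4 refl refl) a))
    three 6 _ _ {U} {m} bd gap noF = finish (gapTo′ 1 7 refl refl) s (Θ-out (gapTo′ 1 6 refl refl) s)
      where
      open Three bd 6 noF
      loc = locally 2 8 gap 9 (short₉ (≤ᵇ-true refl)) refl (≤ᵇ-true {3} {9} refl) refl
      gapTo′ = gapTo 2 8 gap
      open Refutations 2 8 gap loc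
      s = spindle-low (gapTo′ 1 7 refl refl) (Γ₂-out (gapTo′ 1 5 refl refl) (avoids 4 refl (≤ᵇ-true refl) (≤ᵇ-true refl)) (avoids 6 refl (≤ᵇ-true refl) (≤ᵇ-true refl)))
    three 7 _ _ {U} {m} bd gap noF = finish (gapTo′ 1 7 refl refl) s (Θ-out (gapTo′ 1 6 refl refl) s)
      where
      open Three bd 7 noF
      loc = locally 1 4 gap 11 (short₁₁ (≤ᵇ-true refl)) refl (≤ᵇ-true {3} {11} refl) refl
      gapTo′ = gapTo 1 4 gap
      open Refutations 1 4 gap loc
      s = spindle-low (gapTo′ 1 7 refl refl) (Γ₂-out (gapTo′ 1 5 refl refl) (avoids 4 refl (≤ᵇ-true refl) (≤ᵇ-true refl)) (avoids 6 refl (≤ᵇ-true refl) (≤ᵇ-true refl)))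
    three 8 _ _ {U} {m} bd gap noF = finish (gapTo′ 1 7 refl refl) s (Θ-out (gapTo′ 1 6 refl refl) s)
      where
      open Three bd 8 noF
      loc = locally 2 10 gap 11 (short₁₁ (≤ᵇ-true refl)) refl (≤ᵇ-true {3} {11} refl) refl
      gapTo′ = gapTo 2 10 gap
      open Refutations 2 10 gap loc
      s = spindle-low (gapTo′ 1 7 refl refl) (avoids 8 refl (≤ᵇ-true refl) (≤ᵇ-true refl))
    three 9 _ _ {U} {m} bd gap noF = finish (gapTo′ 1 7 refl refl) s (Θ-out (gapTo′ 1 6 refl refl) s)
      where
      open Three bd 9 noF
      loc = locally 1 5 gap 13 (short₁₃ (≤ᵇ-true refl)) refl (≤ᵇ-true {3} {13} refl) refl
      gapTo′ = gapTo 1 5 gap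
      open Refutations 1 5 gap loc
      s = spindle-low (gapTo′ 1 7 refl refl) (avoids 8 refl (≤ᵇ-true refl) (≤ᵇ-true refl))
    three 10 _ _ {U} {m} bd gap noF = finish (gapTo′ 1 7 refl refl) s (avoids 10 refl (≤ᵇ-true refl) (≤ᵇ-true refl))
      where
      open Three bd 10 noF
      loc = locally 2 12 gap 13 (short₁₃ (≤ᵇ-true refl)) refl (≤ᵇ-true {3} {13} refl) refl
      gapTo′ = gapTo 2 12 gap
      open Refutations 2 12 gap loc
      s = spindle-low (gapTo′ 1 7 refl refl) (avoids 8 refl (≤ᵇ-true refl) (≤ᵇ-true refl))
    three 11 _ _ {U} {m} bd gap noF = finish gap s (avoids 10 refl (≤ᵇ-true refl) (≤ᵇ-true refl))
      where
      open Three bd 11 noF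
      loc = locally 1 6 gap 15 (short₁₅ (≤ᵇ-true refl)) refl (≤ᵇ-true {3} {15} refl) refl
      open Refutations 1 6 gap loc
      s = spindle-low gap (avoids 8 refl (≤ᵇ-true refl) (≤ᵇ-true refl))
    three (suc (suc (suc (suc (suc (suc (suc (suc (suc (suc (suc (suc g)))))))))))) _ l bd gap noF = ⊥-elim (<⇒≱ (s≤s l) (m≤m+n 12 g))

    seventh : ∀ g → 1 ≤ g → g ≤ 11 → 1 * cDen g ≤ cNum g * 7 × 1 ≤ cDen g
    seventh 1 _ _ = ≤ᵇ-true refl , ≤ᵇ-true refl
    seventh 2 _ _ = ≤ᵇ-true refl , ≤ᵇ-true refl
    seventh 3 _ _ = ≤ᵇ-true refl , ≤ᵇ-true refl
    seventh 4 _ _ = ≤ᵇ-true refl , ≤ᵇ-true refl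
    seventh 5 _ _ = ≤ᵇ-true refl , ≤ᵇ-true refl
    seventh 6 _ _ = ≤ᵇ-true refl , ≤ᵇ-true refl
    seventh 7 _ _ = ≤ᵇ-true refl , ≤ᵇ-true refl
    seventh 8 _ _ = ≤ᵇ-true refl , ≤ᵇ-true refl
    seventh 9 _ _ = ≤ᵇ-true refl , ≤ᵇ-true refl
    seventh 10 _ _ = ≤ᵇ-true refl , ≤ᵇ-true refl
    seventh 11 _ _ = ≤ᵇ-true refl , ≤ᵇ-true refl
    seventh (suc (suc (suc (suc (suc (suc (suc (suc (suc (suc (suc (suc g)))))))))))) _ l = ⊥-elim (<⇒≱ (s≤s l) (m≤m+n 12 g))

    -- Induction on s: neighbourhoods satisfy the hypotheses for s - 1, since a homomorphism into
    -- N(a) extends by a. Their colourings are the local hypothesis of `level`.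
    structure : ∀ s g → 1 ≤ g → g ≤ 11 → ∀ {U m} → Bounded U m → (cDen g * (2 + s) + cNum g) * m < cDen g * # U →
      (∀ j → 1 ≤ j → j ≤ g → ¬ HomTo (K s ⊕ F j) U) → Col (3 + s) U
    structure zero    g l l′ bd gap noF = three g l l′ bd gap λ j a b h → noF j a b (join₀ h)
    structure (suc s) g l l′ {U} {m} bd gap noF = level s bd (go (cDen g) (seventh g l l′) gap) λ a pa →
        structure s g l l′ (Bounded-⊑ (Nb⊑ U a) bd) (Nb-gap (cNum g) (cDen g) (2 + s) bd a pa gap) λ j x y h → noF j x y (join₊ {s} {F j} pa h)
      where
      go : ∀ d → 1 * d ≤ cNum g * 7 × 1 ≤ d → (d * (3 + s) + cNum g) * m < d * # U → (7 * (3 + s) + 1) * m < 7 * # U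
      go (suc d) (h , _) gp = weaken-gap (cNum g) d 1 7 (3 + s) {m} {# U} h (s≤s z≤n) gp

-- Tree-shaped tuples and the box theorem.

module Shapes where
  open Sums
  open import Defs using (sumFin)
  open import Data.Unit using (⊤)
  open Graphs using (∧-true; absurd)

  -- Samples branch over colours, so tuples are indexed by binary trees; sums, averages and the box
  -- theorem then go by recursion on the tree.
  data Shape : Set where
    one pt : Shape
    _⊗_    : Shape → Shape → Shape

  leaves : Shape → ℕ
  leaves one     = 0
  leaves pt      = 1
  leaves (a ⊗ b) = leaves a + leaves b

  pow : Shape → ℕ → Shape
  pow s zero    = one
  pow s (suc k) = s ⊗ pow s k

  module _ (n : ℕ) where
    ⟦_⟧ : Shape → Set
    ⟦ one ⟧   = ⊤
    ⟦ pt ⟧    = Fin n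
    ⟦ a ⊗ b ⟧ = ⟦ a ⟧ × ⟦ b ⟧

    vol : Shape → ℕ
    vol one     = 1
    vol pt      = n
    vol (a ⊗ b) = vol a * vol b

  module _ {n : ℕ} where
    get : ∀ s → ⟦_⟧ n s → Fin (leaves s) → Fin n
    get pt      x       _ = x
    get (a ⊗ b) (x , y) i = [ get a x , get b y ]′ (splitAt (leaves a) i)

    fromFun : ∀ s → (Fin (leaves s) → Fin n) → ⟦_⟧ n s
    fromFun one     f = tt
    fromFun pt      f = f zero
    fromFun (a ⊗ b) f = fromFun a (λ i → f (i ↑ˡ leaves b)) , fromFun b (λ i → f (leaves a ↑ʳ i))

    get-fromFun : ∀ s f i → get s (fromFun s f) i ≡ f i
    get-fromFun pt      f zero = refl
    get-fromFun (a ⊗ b) f i with splitAt (leaves a) i in eq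
    ... | inj₁ j = trans (get-fromFun a _ j) (cong f (Data.Fin.Properties.splitAt⁻¹-↑ˡ eq))
      where import Data.Fin.Properties
    ... | inj₂ j = trans (get-fromFun b _ j) (cong f (Data.Fin.Properties.splitAt⁻¹-↑ʳ eq))
      where import Data.Fin.Properties

    get-↑ˡ : ∀ a b x y i → get (a ⊗ b) (x , y) (i ↑ˡ leaves b) ≡ get a x i
    get-↑ˡ a b x y i rewrite splitAt-↑ˡ (leaves a) i (leaves b) = refl

    get-↑ʳ : ∀ a b x y i → get (a ⊗ b) (x , y) (leaves a ↑ʳ i) ≡ get b y i
    get-↑ʳ a b x y i rewrite splitAt-↑ʳ (leaves a) (leaves b) i = refl

    ∑ˢ : ∀ s → (⟦_⟧ n s → ℕ) → ℕ
    ∑ˢ one     f = f tt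
    ∑ˢ pt      f = sumFin f
    ∑ˢ (a ⊗ b) f = ∑ˢ a (λ x → ∑ˢ b (λ y → f (x , y)))

    #ˢ : ∀ s → (⟦_⟧ n s → Bool) → ℕ
    #ˢ s p = ∑ˢ s (λ x → 𝟙 (p x))

    ∑ˢ-mono : ∀ s {f g : ⟦_⟧ n s → ℕ} → (∀ x → f x ≤ g x) → ∑ˢ s f ≤ ∑ˢ s g
    ∑ˢ-mono one     h = h tt
    ∑ˢ-mono pt      h = ∑-mono h
    ∑ˢ-mono (a ⊗ b) h = ∑ˢ-mono a λ x → ∑ˢ-mono b λ y → h (x , y)

    ∑ˢ-cong : ∀ s {f g : ⟦_⟧ n s → ℕ} → (∀ x → f x ≡ g x) → ∑ˢ s f ≡ ∑ˢ s g
    ∑ˢ-cong s h = ≤-antisym (∑ˢ-mono s λ x → ≤-reflexive (h x)) (∑ˢ-mono s λ x → ≤-reflexive (sym (h x)))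

    ∑ˢ-+ : ∀ s (f g : ⟦_⟧ n s → ℕ) → ∑ˢ s (λ x → f x + g x) ≡ ∑ˢ s f + ∑ˢ s g
    ∑ˢ-+ one     f g = refl
    ∑ˢ-+ pt      f g = ∑-+ f g
    ∑ˢ-+ (a ⊗ b) f g = trans (∑ˢ-cong a λ x → ∑ˢ-+ b (λ y → f (x , y)) (λ y → g (x , y))) (∑ˢ-+ a _ _)

    ∑ˢ-*ˡ : ∀ s k (f : ⟦_⟧ n s → ℕ) → ∑ˢ s (λ x → k * f x) ≡ k * ∑ˢ s f
    ∑ˢ-*ˡ one     k f = refl
    ∑ˢ-*ˡ pt      k f = ∑-*ˡ k f
    ∑ˢ-*ˡ (a ⊗ b) k f = trans (∑ˢ-cong a λ x → ∑ˢ-*ˡ b k (λ y → f (x , y))) (∑ˢ-*ˡ a k _)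

    ∑ˢ-*ʳ : ∀ s (f : ⟦_⟧ n s → ℕ) k → ∑ˢ s (λ x → f x * k) ≡ ∑ˢ s f * k
    ∑ˢ-*ʳ s f k = trans (∑ˢ-cong s λ x → *-comm (f x) k) (trans (∑ˢ-*ˡ s k f) (*-comm k _))

    ∑ˢ-const : ∀ s k → ∑ˢ s (λ _ → k) ≡ vol n s * k
    ∑ˢ-const one     k = sym (+-identityʳ k)
    ∑ˢ-const pt      k = ∑-const n k
    ∑ˢ-const (a ⊗ b) k = trans (∑ˢ-cong a λ x → ∑ˢ-const b k) (trans (∑ˢ-const a _) (sym (*-assoc (vol n a) (vol n b) k)))

    ∑ˢ-swapᶠ : ∀ s {k} (f : ⟦_⟧ n s → Fin k → ℕ) → ∑ˢ s (λ x → sumFin (f x)) ≡ sumFin (λ i → ∑ˢ s (λ x → f x i))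
    ∑ˢ-swapᶠ one     f = refl
    ∑ˢ-swapᶠ pt      f = ∑-swap f
    ∑ˢ-swapᶠ (a ⊗ b) f = trans (∑ˢ-cong a λ x → ∑ˢ-swapᶠ b (λ y → f (x , y))) (∑ˢ-swapᶠ a (λ x i → ∑ˢ b (λ y → f (x , y) i)))


  module _ {n : ℕ} where
    ∑ˢ-swap : ∀ {k} s t (f : ⟦_⟧ n s → ⟦_⟧ k t → ℕ) →
      ∑ˢ s (λ x → ∑ˢ t (f x)) ≡ ∑ˢ t (λ y → ∑ˢ s (λ x → f x y))
    ∑ˢ-swap s one     f = refl
    ∑ˢ-swap s pt      f = ∑ˢ-swapᶠ s f
    ∑ˢ-swap s (a ⊗ b) f = trans (∑ˢ-swap s a (λ x u → ∑ˢ b (λ v → f x (u , v)))) (∑ˢ-cong a λ u → ∑ˢ-swap s b (λ x v → f x (u , v)))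

    avg : ∀ c (h : Fin n → ℕ) → 1 ≤ n → n * c ≤ sumFin h → ∃ λ x → c ≤ h x
    avg zero    h l _ = first-el l , z≤n
      where
      first-el : 1 ≤ n → Fin n
      first-el (s≤s _) = zero
    avg (suc c) h l b = ∑-<⇒∃ {f = λ _ → c} {h} (≤-trans (s≤s (≤-reflexive (∑-const n c))) (≤-trans lt b))
      where
      lt : suc (n * c) ≤ n * suc c
      lt = ≤-trans (+-monoˡ-≤ (n * c) l) (≤-reflexive (sym (*-suc n c)))

    vol-pos : 1 ≤ n → ∀ s → 1 ≤ vol n s
    vol-pos l one     = ≤-refl
    vol-pos l pt      = l
    vol-pos l (a ⊗ b) = *-mono-≤ (vol-pos l a) (vol-pos l b)

    avgˢ : ∀ s c (h : ⟦_⟧ n s → ℕ) → 1 ≤ n → vol n s * c ≤ ∑ˢ s h → ∃ λ x → c ≤ h x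
    avgˢ one     c h l b = tt , ≤-trans (≤-reflexive (sym (+-identityʳ c))) b
    avgˢ pt      c h l b = avg c h l b
    avgˢ (a ⊗ b) c h l le with avgˢ a (vol n b * c) (λ x → ∑ˢ b λ y → h (x , y)) l (≤-trans (≤-reflexive (sym (*-assoc (vol n a) (vol n b) c))) le)
    ... | x , le′ with avgˢ b c (λ y → h (x , y)) l le′
    ...   | y , le″ = (x , y) , le″

  -- The Erdős box theorem.

  -- Loss of density: a factor 2k for restricting to rich tuples and 4k for each vertex chosen.
  boxBase : ℕ → ℕ → ℕ
  boxBase k zero    = 2 * k
  boxBase k (suc b) = 4 * k * boxBase k b

  module Base {n : ℕ} (k : ℕ) (b : ℕ) (large : 4 * k * b ≤ n) (n≥1 : 1 ≤ n) (k≥1 : 1 ≤ k)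
              (y : Shape) (E : Fin n → ⟦_⟧ n y → Bool)
              (dense : n * vol n y ≤ k * sumFin (λ x → #ˢ y (E x))) where
    N : ℕ
    N = vol n y

    deg : ⟦_⟧ n y → ℕ
    deg z = # (λ x → E x z)

    rich : ⟦_⟧ n y → Bool
    rich z = n ≤ᵇ 2 * k * deg z

    -- Tuples that are not rich account for at most half of the pairs guaranteed by `dense`.
    rich-many : N ≤ 2 * k * #ˢ y rich
    rich-many = *-cancelˡ-≤ n ⦃ >-nonZero n≥1 ⦄ (+-cancelʳ-≤ (n * N) _ _ (begin
      n * N + n * N ≤⟨ +-mono-≤ dense dense ⟩
      k * S + k * S ≡⟨ l₁ k S ⟩
      2 * k * S ≡⟨ cong (2 * k *_) (sym (∑ˢ-swapᶠ y (λ z x → 𝟙 (E x z)))) ⟩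
      2 * k * ∑ˢ y deg ≡⟨ sym (∑ˢ-*ˡ y (2 * k) deg) ⟩
      ∑ˢ y (λ z → 2 * k * deg z) ≤⟨ ∑ˢ-mono y pw ⟩
      ∑ˢ y (λ z → 2 * k * n * 𝟙 (rich z) + n) ≡⟨ ∑ˢ-+ y (λ z → 2 * k * n * 𝟙 (rich z)) (λ _ → n) ⟩
      ∑ˢ y (λ z → 2 * k * n * 𝟙 (rich z)) + ∑ˢ y (λ _ → n) ≡⟨ cong₂ _+_ (∑ˢ-*ˡ y (2 * k * n) (λ z → 𝟙 (rich z))) (∑ˢ-const y n) ⟩
      2 * k * n * #ˢ y rich + N * n ≡⟨ l₂ k n (#ˢ y rich) N ⟩
      n * (2 * k * #ˢ y rich) + n * N ∎))
      where
      open ≤-Reasoning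
      S = sumFin (λ x → #ˢ y (E x))
      l₁ : ∀ k S → k * S + k * S ≡ 2 * k * S
      l₁ = solve-∀
      l₂ : ∀ k n R N → 2 * k * n * R + N * n ≡ n * (2 * k * R) + n * N
      l₂ = solve-∀
      pw : ∀ z → 2 * k * deg z ≤ 2 * k * n * 𝟙 (rich z) + n
      pw z with n ≤ᵇ 2 * k * deg z in e
      ... | true  = ≤-trans (*-monoʳ-≤ (2 * k) (#-≤n (λ x → E x z))) (≤-trans (≤-reflexive (sym (*-identityʳ _))) (m≤m+n _ n))
      ... | false = ≤-trans (<⇒≤ (≰⇒> λ l → absurd (≤⇒≤ᵇ-true l) e)) (m≤n+m n _)
        where
        ≤⇒≤ᵇ-true : ∀ {a b} → a ≤ b → (a ≤ᵇ b) ≡ true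
        ≤⇒≤ᵇ-true {a} {b} l with a ≤ᵇ b | ≤⇒≤ᵇ l
        ... | true | _ = refl

    Common : ∀ {i} → (Fin i → Fin n) → ⟦_⟧ n y → Bool
    Common {zero}  a z = rich z
    Common {suc i} a z = E (a zero) z ∧ Common (a ∘ suc) z

    Common-rich : ∀ {i} (a : Fin i → Fin n) z → Common a z ≡ true → rich z ≡ true
    Common-rich {zero}  a z e = e
    Common-rich {suc i} a z e = Common-rich (a ∘ suc) z (proj₂ (∧-true {E (a zero) z} e))

    Common-E : ∀ {i} (a : Fin i → Fin n) z → Common a z ≡ true → ∀ j → E (a j) z ≡ true
    Common-E {suc i} a z e zero    = proj₁ (∧-true e)
    Common-E {suc i} a z e (suc j) = Common-E (a ∘ suc) z (proj₂ (∧-true {E (a zero) z} e)) j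

    used : ∀ {i} → (Fin i → Fin n) → Fin n → Bool
    used a x = ⌊ any? (λ j → a j ≟ᶠ x) ⌋

    #-used : ∀ {i} (a : Fin i → Fin n) → # (used a) ≤ i
    #-used {i} a = begin
      # (used a) ≤⟨ ∑-mono pw ⟩
      sumFin (λ x → sumFin (λ j → 𝟙 ⌊ x ≟ᶠ a j ⌋)) ≡⟨ ∑-swap (λ x j → 𝟙 ⌊ x ≟ᶠ a j ⌋) ⟩
      sumFin (λ j → sumFin (λ x → 𝟙 ⌊ x ≟ᶠ a j ⌋)) ≡⟨ ∑-cong (λ j → ∑-spike (a j)) ⟩
      sumFin {i} (λ _ → 1) ≡⟨ trans (∑-const i 1) (*-identityʳ i) ⟩
      i ∎
      where
      open ≤-Reasoning
      pw : ∀ x → 𝟙 (used a x) ≤ sumFin (λ j → 𝟙 ⌊ x ≟ᶠ a j ⌋)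
      pw x with any? (λ j → a j ≟ᶠ x)
      ... | no _ = z≤n
      ... | yes (j , e) = ≤-trans (≤-reflexive (sym here)) (∑-term (λ j → 𝟙 ⌊ x ≟ᶠ a j ⌋) j)
        where
        here : 𝟙 ⌊ x ≟ᶠ a j ⌋ ≡ 1
        here with x ≟ᶠ a j
        ... | yes _ = refl
        ... | no ne = ⊥-elim (ne (sym e))

    Good : ∀ i → Set
    Good i = Σ (Fin i → Fin n) λ a → (∀ s t → a s ≡ a t → s ≡ t) × N ≤ boxBase k i * #ˢ y (Common a)

    choose : ∀ i → i ≤ b → Good i
    choose zero    _ = (λ ()) , (λ ()) , rich-many
    choose (suc i) l with choose i (<⇒≤ l)
    ... | a , inj , big with avg (#ˢ y (Common a)) h n≥1 total
      where
      h : Fin n → ℕ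
      h x = 4 * k * (𝟙 (not (used a x)) * #ˢ y (λ z → E x z ∧ Common a z))
      open ≤-Reasoning
      pw : ∀ z → n * 𝟙 (Common a z) ≤ 4 * k * sumFin (λ x → 𝟙 (not (used a x)) * 𝟙 (E x z ∧ Common a z))
      pw z with Common a z in e
      ... | false = ≤-trans (≤-reflexive (*-zeroʳ n)) z≤n
      ... | true  = ≤-trans (≤-reflexive (*-identityʳ n)) (+-cancelʳ-≤ n _ _ (begin
        n + n ≤⟨ +-mono-≤ rz rz ⟩
        2 * k * deg z + 2 * k * deg z ≡⟨ l₁ k (deg z) ⟩
        4 * k * deg z ≤⟨ *-monoʳ-≤ (4 * k) split ⟩
        4 * k * (Y + # (used a)) ≤⟨ *-monoʳ-≤ (4 * k) (+-monoʳ-≤ Y (≤-trans (#-used a) (<⇒≤ l))) ⟩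
        4 * k * (Y + b) ≡⟨ *-distribˡ-+ (4 * k) Y b ⟩
        4 * k * Y + 4 * k * b ≤⟨ +-monoʳ-≤ (4 * k * Y) large ⟩
        4 * k * Y + n ∎))
        where
        Y = sumFin (λ x → 𝟙 (not (used a x)) * 𝟙 (E x z ∧ true))
        l₁ : ∀ k d → 2 * k * d + 2 * k * d ≡ 4 * k * d
        l₁ = solve-∀
        rz : n ≤ 2 * k * deg z
        rz = ≤ᵇ⇒≤ n _ (subst Data.Bool.T (sym (Common-rich a z e)) tt)
          where import Data.Bool
        split : deg z ≤ Y + # (used a)
        split = ≤-trans (∑-mono λ x → go (E x z) (used a x)) (≤-reflexive (∑-+ (λ x → 𝟙 (not (used a x)) * 𝟙 (E x z ∧ true)) (λ x → 𝟙 (used a x))))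
          where
          go : ∀ e u → 𝟙 e ≤ 𝟙 (not u) * 𝟙 (e ∧ true) + 𝟙 u
          go true  true  = ≤-refl
          go true  false = ≤-refl
          go false _     = z≤n
      total : n * #ˢ y (Common a) ≤ sumFin h
      total = begin
        n * #ˢ y (Common a) ≡⟨ sym (∑ˢ-*ˡ y n (λ z → 𝟙 (Common a z))) ⟩
        ∑ˢ y (λ z → n * 𝟙 (Common a z)) ≤⟨ ∑ˢ-mono y pw ⟩
        ∑ˢ y (λ z → 4 * k * sumFin (λ x → 𝟙 (not (used a x)) * 𝟙 (E x z ∧ Common a z))) ≡⟨ ∑ˢ-*ˡ y (4 * k) (λ z → sumFin (λ x → 𝟙 (not (used a x)) * 𝟙 (E x z ∧ Common a z))) ⟩
        4 * k * ∑ˢ y (λ z → sumFin (λ x → 𝟙 (not (used a x)) * 𝟙 (E x z ∧ Common a z))) ≡⟨ cong (4 * k *_) (∑ˢ-swapᶠ y (λ z x → 𝟙 (not (used a x)) * 𝟙 (E x z ∧ Common a z))) ⟩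
        4 * k * sumFin (λ x → ∑ˢ y (λ z → 𝟙 (not (used a x)) * 𝟙 (E x z ∧ Common a z))) ≡⟨ cong (4 * k *_) (∑-cong λ x → ∑ˢ-*ˡ y (𝟙 (not (used a x))) (λ z → 𝟙 (E x z ∧ Common a z))) ⟩
        4 * k * sumFin (λ x → 𝟙 (not (used a x)) * #ˢ y (λ z → E x z ∧ Common a z)) ≡⟨ sym (∑-*ˡ (4 * k) (λ x → 𝟙 (not (used a x)) * #ˢ y (λ z → E x z ∧ Common a z))) ⟩
        sumFin h ∎
    ... | x , le = a′ , inj′ , big′
      where
      Z = #ˢ y (λ z → E x z ∧ Common a z)
      -- A used x has h x = 0, whereas there are survivors.
      new : used a x ≡ false
      new with used a x
      ... | false = refl
      ... | true  = ⊥-elim (<⇒≱ (≤-trans (vol-pos n≥1 y) (≤-trans big (≤-trans (*-monoʳ-≤ (boxBase k i) (≤-trans le (≤-reflexive (*-zeroʳ (4 * k))))) (≤-reflexive (*-zeroʳ (boxBase k i)))))) z≤n)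
      fresh : ∀ j → ¬ a j ≡ x
      fresh j e with any? (λ j → a j ≟ᶠ x) | new
      ... | no ¬h | _ = ¬h (j , e)
      a′ : Fin (suc i) → Fin n
      a′ zero    = x
      a′ (suc j) = a j
      inj′ : ∀ s t → a′ s ≡ a′ t → s ≡ t
      inj′ zero    zero    e = refl
      inj′ zero    (suc t) e = ⊥-elim (fresh t (sym e))
      inj′ (suc s) zero    e = ⊥-elim (fresh s e)
      inj′ (suc s) (suc t) e = cong suc (inj s t e)
      big′ : N ≤ 4 * k * boxBase k i * Z
      big′ = ≤-trans big (≤-trans (*-monoʳ-≤ (boxBase k i) (≤-trans le (*-monoʳ-≤ (4 * k) (drop (used a x))))) (≤-reflexive (reorder (boxBase k i) k Z)))
        where
        drop : ∀ u → 𝟙 (not u) * Z ≤ Z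
        drop true  = z≤n
        drop false = ≤-reflexive (+-identityʳ Z)
        reorder : ∀ B k Z → B * (4 * k * Z) ≡ 4 * k * B * Z
        reorder = solve-∀

  boxK : Shape → ℕ → ℕ → ℕ
  boxK one     b k = k
  boxK pt      b k = boxBase k b
  boxK (s ⊗ t) b k = boxK t b (boxK s b k)

  boxN : Shape → ℕ → ℕ → ℕ
  boxN one     b k = 1
  boxN pt      b k = 1 + 4 * k * b
  boxN (s ⊗ t) b k = boxN s b k + boxN t b (boxK s b k)

  boxBase-pos : ∀ k b → 1 ≤ k → 1 ≤ boxBase k b
  boxBase-pos k zero    l = ≤-trans l (m≤m+n k _)
  boxBase-pos k (suc b) l = *-mono-≤ (≤-trans l (m≤m+n k _)) (boxBase-pos k b l)

  boxK-pos : ∀ s b k → 1 ≤ k → 1 ≤ boxK s b k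
  boxK-pos one     b k l = l
  boxK-pos pt      b k l = boxBase-pos k b l
  boxK-pos (s ⊗ t) b k l = boxK-pos t b _ (boxK-pos s b k l)

  -- P is a dense set of parameters z for which the whole box lies in E. The parameter shape y
  -- allows a product to be treated factor by factor: the second factor waits inside y while the
  -- first is handled. Rows need not be disjoint from each other.
  record Box {n : ℕ} (s : Shape) (b k : ℕ) (y : Shape) (E : ⟦_⟧ n s → ⟦_⟧ n y → Bool) : Set where
    field
      β     : Fin (leaves s) → Fin b → Fin n
      inj   : ∀ i u v → β i u ≡ β i v → u ≡ v
      P     : ⟦_⟧ n y → Bool
      dense : vol n y ≤ k * #ˢ y P
      sound : ∀ z → P z ≡ true → ∀ x → (∀ i → ∃ λ u → get s x i ≡ β i u) → E x z ≡ true

  box : ∀ {n} s b k → 1 ≤ k → boxN s b k ≤ n → 1 ≤ n → ∀ y (E : ⟦_⟧ n s → ⟦_⟧ n y → Bool) →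
    vol n s * vol n y ≤ k * ∑ˢ s (λ x → #ˢ y (E x)) → Box s b (boxK s b k) y E
  box one b k _ _ _ y E d = record
    { β = λ () ; inj = λ () ; P = E tt ; dense = ≤-trans (≤-reflexive (sym (+-identityʳ _))) d ; sound = λ z p x _ → p }
  box {n} pt b k k≥1 l n≥1 y E d = record
    { β = λ _ → proj₁ g ; inj = λ _ u v e → proj₁ (proj₂ g) u v e ; P = Common (proj₁ g) ; dense = proj₂ (proj₂ g)
    ; sound = λ z p x h → subst (λ t → E t z ≡ true) (sym (proj₂ (h zero))) (Common-E (proj₁ g) z p (proj₁ (h zero))) }
    where
    open Base k b (≤-trans (n≤1+n _) l) n≥1 k≥1 y E d
    g = choose b ≤-refl
  box {n} (s ⊗ t) b k k≥1 l n≥1 y E d = record { β = β′ ; inj = inj′ ; P = Box.P B₂ ; dense = Box.dense B₂ ; sound = sound′ }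
    where
    B₁ : Box s b (boxK s b k) (t ⊗ y) (λ x z → E (x , proj₁ z) (proj₂ z))
    B₁ = box s b k k≥1 (≤-trans (m≤m+n _ _) l) n≥1 (t ⊗ y) _ (≤-trans (≤-reflexive (sym (*-assoc (vol n s) (vol n t) (vol n y)))) d)
    B₂ : Box t b (boxK t b (boxK s b k)) y (λ x z → Box.P B₁ (x , z))
    B₂ = box t b (boxK s b k) (boxK-pos s b k k≥1) (≤-trans (m≤n+m _ (boxN s b k)) l) n≥1 y _ (Box.dense B₁)
    β′ : Fin (leaves s + leaves t) → Fin b → Fin n
    β′ i = [ Box.β B₁ , Box.β B₂ ]′ (splitAt (leaves s) i)
    inj′ : ∀ i u v → β′ i u ≡ β′ i v → u ≡ v
    inj′ i u v e with splitAt (leaves s) i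
    ... | inj₁ j = Box.inj B₁ j u v e
    ... | inj₂ j = Box.inj B₂ j u v e
    sound′ : ∀ z → Box.P B₂ z ≡ true → ∀ x → (∀ i → ∃ λ u → get (s ⊗ t) x i ≡ β′ i u) → E x z ≡ true
    sound′ z p (x₁ , x₂) h = Box.sound B₁ (x₂ , z) (Box.sound B₂ z p x₂ right) x₁ left
      where
      left : ∀ i → ∃ λ u → get s x₁ i ≡ Box.β B₁ i u
      left i with h (i ↑ˡ leaves t)
      ... | u , e rewrite splitAt-↑ˡ (leaves s) i (leaves t) = u , e
      right : ∀ i → ∃ λ u → get t x₂ i ≡ Box.β B₂ i u
      right i with h (leaves s ↑ʳ i)
      ... | u , e rewrite splitAt-↑ʳ (leaves s) (leaves t) i = u , e

-- Non-colourability is visible in bounded samples.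

module Testing where
  open Sums
  open Graphs
  open Shapes
  open import Defs using (sumFin)
  open import Data.Fin.Properties using (¬∀⟶∃¬)

  module Powers {n : ℕ} (s : Shape) where
    component : ∀ {r} → ⟦_⟧ n (pow s r) → Fin r → ⟦_⟧ n s
    component (x , xs) zero    = x
    component (x , xs) (suc c) = component xs c

    place : ∀ {r} → Fin r → Fin (leaves s) → Fin (leaves (pow s r))
    place {suc r} zero    i = i ↑ˡ leaves (pow s r)
    place {suc r} (suc c) i = leaves s ↑ʳ place c i

    get-place : ∀ {r} (xs : ⟦_⟧ n (pow s r)) c i → get (pow s r) xs (place c i) ≡ get s (component xs c) i
    get-place {suc r} (x , xs) zero    i = get-↑ˡ s (pow s r) x xs i
    get-place {suc r} (x , xs) (suc c) i = trans (get-↑ʳ s (pow s r) x xs (place c i)) (get-place xs c i)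

    allP : ∀ {r} → (Fin r → ⟦_⟧ n s → Bool) → ⟦_⟧ n (pow s r) → Bool
    allP {zero}  Q _        = true
    allP {suc r} Q (x , xs) = Q zero x ∧ allP (Q ∘ suc) xs

    allP⇒ : ∀ {r} (Q : Fin r → ⟦_⟧ n s → Bool) xs → allP Q xs ≡ true → ∀ c → Q c (component xs c) ≡ true
    allP⇒ {suc r} Q (x , xs) e zero    = proj₁ (∧-true e)
    allP⇒ {suc r} Q (x , xs) e (suc c) = allP⇒ (Q ∘ suc) xs (proj₂ (∧-true {Q zero x} e)) c

    allP-dense : ∀ {r} k (Q : Fin r → ⟦_⟧ n s → Bool) → (∀ c → vol n s ≤ k * #ˢ s (Q c)) →
      vol n (pow s r) ≤ k ^ r * #ˢ (pow s r) (allP Q)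
    allP-dense {zero}  k Q h = ≤-refl
    allP-dense {suc r} k Q h = begin
      vol n s * vol n (pow s r) ≤⟨ *-mono-≤ (h zero) (allP-dense k (Q ∘ suc) (h ∘ suc)) ⟩
      k * A * (k ^ r * B) ≡⟨ l k A (k ^ r) B ⟩
      k * k ^ r * (A * B) ≡⟨ cong (k * k ^ r *_) (sym product) ⟩
      k * k ^ r * #ˢ (pow s (suc r)) (allP Q) ∎
      where
      open ≤-Reasoning
      A = #ˢ s (Q zero)
      B = #ˢ (pow s r) (allP (Q ∘ suc))
      l : ∀ k A K B → k * A * (K * B) ≡ k * K * (A * B)
      l = solve-∀
      and : ∀ a b → 𝟙 (a ∧ b) ≡ 𝟙 a * 𝟙 b
      and true  b = sym (+-identityʳ _)
      and false b = refl
      product : #ˢ (pow s (suc r)) (allP Q) ≡ A * B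
      product = trans (∑ˢ-cong s λ x → trans (∑ˢ-cong (pow s r) λ xs → and (Q zero x) _) (∑ˢ-*ˡ (pow s r) (𝟙 (Q zero x)) (λ xs → 𝟙 (allP (Q ∘ suc) xs))))
        (∑ˢ-*ʳ s (λ x → 𝟙 (Q zero x)) B)

  -- A vertex, followed by one subtree for each of the r colours it might receive.
  tup : ℕ → ℕ → Shape
  tup r zero    = pt
  tup r (suc d) = pt ⊗ pow (tup r d) r

  tupK : ℕ → ℕ → ℕ → ℕ
  tupK E r zero    = 1
  tupK E r (suc d) = E * tupK E r d ^ r

  module Tester {n : ℕ} (G : Gr n) (r′ e : ℕ) where
    open Gr G
    r = suc r′

    monoPairs : (Fin n → Fin r) → ℕ
    monoPairs f = sumFin λ u → # λ v → adj u v ∧ ⌊ f u ≟ᶠ f v ⌋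

    E : ℕ
    E = 3 * e

    Lists : Set
    Lists = Fin n → Fin r → Bool

    full : Lists
    full _ _ = true

    cand : Lists → Fin n → Fin r → Fin n → Bool
    cand L v c u = adj v u ∧ L u c

    -- Whichever colour of its list v receives, at least n/E vertices lose a colour.
    Heavy : Lists → Fin n → Set
    Heavy L v = ∀ c → L v c ≡ true → n ≤ E * # (cand L v c)

    heavy? : ∀ L v → Dec (Heavy L v)
    heavy? L v = all? λ c → (L v c ≟ᵇ true) →-dec (n ≤? E * # (cand L v c))

    heavy : Lists → Fin n → Bool
    heavy L v = ⌊ heavy? L v ⌋

    remove : Lists → Fin n → Fin r → Lists
    remove L v c u d = L u d ∧ not (adj v u ∧ ⌊ d ≟ᶠ c ⌋)

    Φ : Lists → ℕ
    Φ L = sumFin λ u → # (L u)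

    -- The sampled tree refutes proper colourings from the lists L: at depth zero its vertex has an
    -- empty list; above, the subtree of each listed colour refutes the lists left after using that
    -- colour.
    Ref : ∀ d → Lists → ⟦_⟧ n (tup r d) → Bool
    Ref zero    L v        = ⌊ all? (λ c → L v c ≟ᵇ false) ⌋
    Ref (suc d) L (v , xs) = Powers.allP (tup r d) (λ c x → not (L v c) ∨ Ref d (remove L v c) x) xs

    kk : ℕ → ℕ
    kk = tupK E r

    -- Descend into the subtree of the colour that v actually has; properness keeps the colours
    -- within the reduced lists.
    Ref-sound : ∀ d L x → Ref d L x ≡ true → (c : Fin (leaves (tup r d)) → Fin r) →
      (∀ i → L (get (tup r d) x i) (c i) ≡ true) →
      ¬ (∀ i j → adj (get (tup r d) x i) (get (tup r d) x j) ≡ true → ¬ c i ≡ c j)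
    Ref-sound zero L v ref c inL proper with all? (λ c → L v c ≟ᵇ false)
    ... | yes h = absurd (inL zero) (h (c zero))
    Ref-sound (suc d) L (v , xs) ref c inL proper =
      Ref-sound d (remove L v c₀) (component xs c₀) ref′ (λ i → c (idx i)) inL′ proper′
      where
      open Powers {n} (tup r d)
      c₀ = c zero
      idx : Fin (leaves (tup r d)) → Fin (leaves (tup r (suc d)))
      idx i = suc (place c₀ i)
      at-idx : ∀ i → get (tup r (suc d)) (v , xs) (idx i) ≡ get (tup r d) (component xs c₀) i
      at-idx i = trans (get-↑ʳ pt (pow (tup r d) r) v xs (place c₀ i)) (get-place xs c₀ i)
      at-0 : get (tup r (suc d)) (v , xs) zero ≡ v
      at-0 = get-↑ˡ pt (pow (tup r d) r) v xs zero
      ref′ : Ref d (remove L v c₀) (component xs c₀) ≡ true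
      ref′ with allP⇒ (λ c x → not (L v c) ∨ Ref d (remove L v c) x) xs ref c₀
      ... | h rewrite subst (λ t → L t c₀ ≡ true) at-0 (inL zero) = h
      inL′ : ∀ i → remove L v c₀ (get (tup r d) (component xs c₀) i) (c (idx i)) ≡ true
      inL′ i = ∧-intro (subst (λ t → L t (c (idx i)) ≡ true) (at-idx i) (inL (idx i))) (cong not (¬true⇒false clash))
        where
        clash : ¬ (adj v (get (tup r d) (component xs c₀) i) ∧ ⌊ c (idx i) ≟ᶠ c₀ ⌋) ≡ true
        clash h with ∧-true {adj v (get (tup r d) (component xs c₀) i)} h
        ... | a , q with c (idx i) ≟ᶠ c₀
        ...   | yes eq = proper zero (idx i) (trans (cong₂ adj at-0 (at-idx i)) a) (sym eq)
      proper′ : ∀ i j → adj (get (tup r d) (component xs c₀) i) (get (tup r d) (component xs c₀) j) ≡ true → ¬ c (idx i) ≡ c (idx j)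
      proper′ i j a = proper (idx i) (idx j) (trans (cong₂ adj (at-idx i) (at-idx j)) a)

    remove-drop : ∀ L v c → Φ (remove L v c) + # (cand L v c) ≤ Φ L
    remove-drop L v c = ≤-trans (≤-reflexive (sym (∑-+ (λ u → # (remove L v c u)) (λ u → 𝟙 (cand L v c u))))) (∑-mono pw)
      where
      open ≤-Reasoning
      pw : ∀ u → # (remove L v c u) + 𝟙 (cand L v c u) ≤ # (L u)
      pw u = begin
        # (remove L v c u) + 𝟙 (cand L v c u)
          ≡⟨ cong (# (remove L v c u) +_) (sym (trans (∑-*ʳ (λ d → 𝟙 ⌊ d ≟ᶠ c ⌋) (𝟙 (cand L v c u))) (trans (cong (_* 𝟙 (cand L v c u)) (∑-spike c)) (+-identityʳ _)))) ⟩
        # (remove L v c u) + sumFin (λ d → 𝟙 ⌊ d ≟ᶠ c ⌋ * 𝟙 (cand L v c u))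
          ≡⟨ sym (∑-+ (λ d → 𝟙 (remove L v c u d)) (λ d → 𝟙 ⌊ d ≟ᶠ c ⌋ * 𝟙 (cand L v c u))) ⟩
        sumFin (λ d → 𝟙 (remove L v c u d) + 𝟙 ⌊ d ≟ᶠ c ⌋ * 𝟙 (cand L v c u)) ≤⟨ ∑-mono each ⟩
        # (L u) ∎
        where
        each : ∀ d → 𝟙 (remove L v c u d) + 𝟙 ⌊ d ≟ᶠ c ⌋ * 𝟙 (cand L v c u) ≤ 𝟙 (L u d)
        each d with d ≟ᶠ c
        ... | no _ = ≤-trans (≤-reflexive (+-identityʳ _)) (go (L u d) (adj v u))
          where
          go : ∀ x a → 𝟙 (x ∧ not (a ∧ false)) ≤ 𝟙 x
          go true  true  = ≤-refl
          go true  false = ≤-refl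
          go false _     = z≤n
        ... | yes refl = go (L u c) (adj v u)
          where
          go : ∀ x a → 𝟙 (x ∧ not (a ∧ true)) + (𝟙 (a ∧ x) + 0) ≤ 𝟙 x
          go true  true  = ≤-refl
          go true  false = ≤-refl
          go false true  = z≤n
          go false false = z≤n

    module _ (far : ∀ f → n * n < e * monoPairs f) where

      -- Otherwise colour each light vertex so that at most n/E neighbours still list its colour. In
      -- a monochromatic pair the first vertex is heavy, or the second is, or the second is one of
      -- those neighbours. Each case has at most n²/E pairs, and E = 3e contradicts `far`.
      heavy-many : ∀ L → n ≤ E * # (heavy L)
      heavy-many L with n ≤? E * # (heavy L)
      ... | yes l = l
      ... | no ¬l = ⊥-elim (<⇒≱ (far f) (*-cancelˡ-≤ 3 bounded))
        where
        h<n : E * # (heavy L) ≤ n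
        h<n = <⇒≤ (≰⇒> ¬l)
        pick : ∀ v → heavy L v ≡ true ⊎ ∃ λ c → L v c ≡ true × E * # (cand L v c) ≤ n
        pick v with heavy? L v
        ... | yes _ = inj₁ refl
        ... | no ¬h with ¬∀⟶∃¬ r _ (λ c → (L v c ≟ᵇ true) →-dec (n ≤? E * # (cand L v c))) ¬h
        ...   | c , ¬c = inj₂ (c , in-list , <⇒≤ (≰⇒> λ l → ¬c λ _ → l))
          where
          in-list : L v c ≡ true
          in-list with L v c in eq
          ... | true  = refl
          ... | false = ⊥-elim (¬c λ ())
        f : Fin n → Fin r
        f v with pick v
        -- Heavy vertices are few, so their colour is arbitrary.
        ... | inj₁ _       = zero
        ... | inj₂ (c , _) = c
        f-list : ∀ v → heavy L v ≡ true ⊎ L v (f v) ≡ true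
        f-list v with pick v
        ... | inj₁ h           = inj₁ h
        ... | inj₂ (c , p , _) = inj₂ p
        light : Fin n → ℕ
        light u = 𝟙 (not (heavy L u)) * # (cand L u (f u))
        light-small : ∀ u → E * light u ≤ n
        light-small u with pick u
        ... | inj₁ h rewrite h = ≤-trans (≤-reflexive (*-zeroʳ E)) z≤n
        ... | inj₂ (c , _ , l) = ≤-trans (*-monoʳ-≤ E (drop (heavy L u))) l
          where
          drop : ∀ b → 𝟙 (not b) * # (cand L u c) ≤ # (cand L u c)
          drop true  = z≤n
          drop false = ≤-reflexive (+-identityʳ _)
        pw : ∀ u v → 𝟙 (adj u v ∧ ⌊ f u ≟ᶠ f v ⌋) ≤ 𝟙 (heavy L u) + (𝟙 (heavy L v) + 𝟙 (not (heavy L u)) * 𝟙 (cand L u (f u) v))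
        pw u v with adj u v | f u ≟ᶠ f v | true? (heavy L u) | true? (heavy L v)
        ... | false | _ | _ | _ = z≤n
        ... | true | no _ | _ | _ = z≤n
        ... | true | yes _ | inj₁ h | _ rewrite h = s≤s z≤n
        ... | true | yes _ | inj₂ h | inj₁ h′ rewrite h | h′ = s≤s z≤n
        ... | true | yes eq | inj₂ h | inj₂ h′ with f-list v
        ...   | inj₁ x = absurd x h′
        ...   | inj₂ x rewrite h | h′ | subst (λ c → L v c ≡ true) (sym eq) x = ≤-refl
        row : ∀ u → # (λ v → adj u v ∧ ⌊ f u ≟ᶠ f v ⌋) ≤ n * 𝟙 (heavy L u) + (# (heavy L) + light u)
        row u = ≤-trans (∑-mono (pw u)) (≤-reflexive (trans (∑-+ (λ v → 𝟙 (heavy L u)) (λ v → 𝟙 (heavy L v) + 𝟙 (not (heavy L u)) * 𝟙 (cand L u (f u) v)))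
          (cong₂ _+_ (∑-const n _) (trans (∑-+ (λ v → 𝟙 (heavy L v)) (λ v → 𝟙 (not (heavy L u)) * 𝟙 (cand L u (f u) v)))
            (cong (# (heavy L) +_) (∑-*ˡ (𝟙 (not (heavy L u))) (λ v → 𝟙 (cand L u (f u) v))))))))
        total : monoPairs f ≤ n * # (heavy L) + (n * # (heavy L) + sumFin light)
        total = ≤-trans (∑-mono row) (≤-reflexive (trans (∑-+ (λ u → n * 𝟙 (heavy L u)) (λ u → # (heavy L) + light u))
          (cong₂ _+_ (∑-*ˡ n (λ u → 𝟙 (heavy L u))) (trans (∑-+ (λ u → # (heavy L)) light) (cong (_+ sumFin light) (∑-const n (# (heavy L))))))))
        bounded : 3 * (e * monoPairs f) ≤ 3 * (n * n)
        bounded = begin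
          3 * (e * monoPairs f) ≡⟨ sym (*-assoc 3 e _) ⟩
          E * monoPairs f ≤⟨ *-monoʳ-≤ E total ⟩
          E * (n * H + (n * H + sumFin light)) ≡⟨ l₁ E n H (sumFin light) ⟩
          n * (E * H) + (n * (E * H) + E * sumFin light) ≤⟨ +-mono-≤ (*-monoʳ-≤ n h<n) (+-mono-≤ (*-monoʳ-≤ n h<n) third) ⟩
          n * n + (n * n + n * n) ≡⟨ l₂ (n * n) ⟩
          3 * (n * n) ∎
          where
          open ≤-Reasoning
          H = # (heavy L)
          l₁ : ∀ E n H s → E * (n * H + (n * H + s)) ≡ n * (E * H) + (n * (E * H) + E * s)
          l₁ = solve-∀
          l₂ : ∀ x → x + (x + x) ≡ 3 * x
          l₂ = solve-∀
          third : E * sumFin light ≤ n * n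
          third = ≤-trans (≤-reflexive (sym (∑-*ˡ E light))) (≤-trans (∑-mono light-small) (≤-reflexive (∑-const n n)))

      module _ (e≥1 : 1 ≤ e) (n≥1 : 1 ≤ n) where
        E≥1 : 1 ≤ E
        E≥1 = ≤-trans e≥1 (m≤m+n e _)

        kk≥1 : ∀ d → 1 ≤ kk d
        kk≥1 zero    = ≤-refl
        kk≥1 (suc d) = *-mono-≤ E≥1 (^-pos r)
          where
          ^-pos : ∀ j → 1 ≤ kk d ^ j
          ^-pos zero    = ≤-refl
          ^-pos (suc j) = *-mono-≤ (kk≥1 d) (^-pos j)

        -- Φ is a potential of at most d·n/E. A heavy vertex, hence at least one in E, lowers it by
        -- n/E whatever its colour, so induction applies to all r subtrees. At d = 0 all lists are
        -- empty.
        Ref-dense : ∀ d L → E * Φ L ≤ d * n → vol n (tup r d) ≤ kk d * #ˢ (tup r d) (Ref d L)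
        Ref-dense zero L h = ≤-reflexive (sym (trans (+-identityʳ _) (trans (∑-cong every) (trans (∑-const n 1) (*-identityʳ n)))))
          where
          empty : ∀ v c → L v c ≡ false
          empty v c with L v c in eq
          ... | false = refl
          ... | true  = ⊥-elim (<⇒≱ (*-mono-≤ E≥1 (≤-trans (≤-trans (≤-reflexive (cong 𝟙 (sym eq))) (∑-term (λ c → 𝟙 (L v c)) c)) (∑-term (λ u → # (L u)) v))) h)
          every : ∀ v → 𝟙 (Ref zero L v) ≡ 1
          every v with all? (λ c → L v c ≟ᵇ false)
          ... | yes _ = refl
          ... | no ¬h = ⊥-elim (¬h (empty v))
        Ref-dense (suc d) L h = begin
          n * VP ≤⟨ *-monoˡ-≤ VP (heavy-many L) ⟩
          E * # (heavy L) * VP ≡⟨ l₁ E (# (heavy L)) VP ⟩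
          E * (# (heavy L) * VP) ≡⟨ cong (E *_) (sym (∑-*ʳ (λ v → 𝟙 (heavy L v)) VP)) ⟩
          E * sumFin (λ v → 𝟙 (heavy L v) * VP) ≤⟨ *-monoʳ-≤ E (∑-mono row) ⟩
          E * sumFin (λ v → kk d ^ r * count v) ≡⟨ cong (E *_) (∑-*ˡ (kk d ^ r) count) ⟩
          E * (kk d ^ r * sumFin count) ≡⟨ sym (*-assoc E _ _) ⟩
          E * kk d ^ r * sumFin count ∎
          where
          open ≤-Reasoning
          open Powers {n} (tup r d)
          VP = vol n (pow (tup r d) r)
          l₁ : ∀ a b c → a * b * c ≡ a * (b * c)
          l₁ = solve-∀
          Q : Fin n → Fin r → ⟦_⟧ n (tup r d) → Bool
          Q v c x = not (L v c) ∨ Ref d (remove L v c) x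
          count : Fin n → ℕ
          count v = #ˢ (pow (tup r d) r) (allP (Q v))
          row : ∀ v → 𝟙 (heavy L v) * VP ≤ kk d ^ r * count v
          row v with heavy? L v
          ... | no _ = z≤n
          ... | yes hv = ≤-trans (≤-reflexive (+-identityʳ _)) (allP-dense (kk d) (Q v) each)
            where
            each : ∀ c → vol n (tup r d) ≤ kk d * #ˢ (tup r d) (Q v c)
            each c with L v c in eq
            ... | false = ≤-trans (≤-reflexive (sym (trans (∑ˢ-const (tup r d) 1) (*-identityʳ _)))) (≤-trans (≤-reflexive (sym (*-identityˡ _))) (*-monoˡ-≤ _ (kk≥1 d)))
            ... | true  = Ref-dense d (remove L v c) (+-cancelʳ-≤ n _ _ (begin
              E * Φ (remove L v c) + n ≤⟨ +-monoʳ-≤ (E * Φ (remove L v c)) (hv c eq) ⟩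
              E * Φ (remove L v c) + E * # (cand L v c) ≡⟨ sym (*-distribˡ-+ E (Φ (remove L v c)) _) ⟩
              E * (Φ (remove L v c) + # (cand L v c)) ≤⟨ *-monoʳ-≤ E (remove-drop L v c) ⟩
              E * Φ L ≤⟨ h ⟩
              suc d * n ≡⟨ +-comm n (d * n) ⟩
              d * n + n ∎))

        -- The full lists have Φ = r·n.
        depth : ℕ
        depth = E * r

        full-dense : vol n (tup r depth) ≤ kk depth * #ˢ (tup r depth) (Ref depth full)
        full-dense = Ref-dense depth full (≤-reflexive (trans (cong (E *_) (trans (∑-cong {f = λ (u : Fin n) → # (full u)} λ u → trans (∑-const r 1) (*-identityʳ r)) (trans (∑-const n r) (*-comm n r)))) (sym (*-assoc E r n))))

-- Second moments of random samples.

module Chebyshev where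
  open Sums
  open Graphs
  open Shapes
  open import Defs using (sumFin)

  ≤ᵇ-intro : ∀ {a b} → a ≤ b → (a ≤ᵇ b) ≡ true
  ≤ᵇ-intro {a} {b} l with a ≤ᵇ b | ≤⇒≤ᵇ l
  ... | true | _ = refl

  ≤ᵇ-elim : ∀ {a b} → (a ≤ᵇ b) ≡ true → a ≤ b
  ≤ᵇ-elim {a} {b} e = ≤ᵇ⇒≤ a b (subst Data.Bool.T (sym e) tt)
    where import Data.Bool

  module _ {n : ℕ} where
    hits : ∀ {M} → (Fin n → Bool) → ⟦_⟧ n (pow pt M) → ℕ
    hits {zero}  p _       = 0
    hits {suc M} p (u , τ) = 𝟙 (p u) + hits p τ

    hits-get : ∀ {M} (p : Fin n → Bool) (τ : ⟦_⟧ n (pow pt M)) → hits p τ ≡ # (λ i → p (get (pow pt M) τ i))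
    hits-get {zero}  p τ       = refl
    hits-get {suc M} p (u , τ) = cong (𝟙 (p u) +_) (hits-get p τ)

    leaves-pow : ∀ M → leaves (pow pt M) ≡ M
    leaves-pow zero    = refl
    leaves-pow (suc M) = cong suc (leaves-pow M)

    module _ (p : Fin n → Bool) where
      a : ℕ
      a = # p

      W : ℕ → ℕ
      W M = vol n (pow pt M)

      S₁ S₂ : ℕ → ℕ
      S₁ M = ∑ˢ (pow pt M) (hits p)
      S₂ M = ∑ˢ (pow pt M) (λ τ → hits p τ * hits p τ)

      S₁-step : ∀ M → S₁ (suc M) ≡ W M * a + n * S₁ M
      S₁-step M = trans (∑-cong {f = λ u → ∑ˢ (pow pt M) (λ τ → 𝟙 (p u) + hits p τ)} λ u →
          trans (∑ˢ-+ (pow pt M) (λ _ → 𝟙 (p u)) (hits p)) (cong (_+ S₁ M) (∑ˢ-const (pow pt M) (𝟙 (p u)))))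
        (trans (∑-+ (λ u → W M * 𝟙 (p u)) (λ _ → S₁ M)) (cong₂ _+_ (∑-*ˡ (W M) (λ u → 𝟙 (p u))) (∑-const n (S₁ M))))

      S₂-step : ∀ M → S₂ (suc M) ≡ W M * a + (a * (2 * S₁ M) + n * S₂ M)
      S₂-step M = trans (∑-cong {f = λ u → ∑ˢ (pow pt M) (λ τ → (𝟙 (p u) + hits p τ) * (𝟙 (p u) + hits p τ))} row)
        (trans (∑-+ (λ u → W M * 𝟙 (p u)) (λ u → 𝟙 (p u) * (2 * S₁ M) + S₂ M))
          (cong₂ _+_ (∑-*ˡ (W M) (λ u → 𝟙 (p u))) (trans (∑-+ (λ u → 𝟙 (p u) * (2 * S₁ M)) (λ _ → S₂ M))
            (cong₂ _+_ (∑-*ʳ (λ u → 𝟙 (p u)) (2 * S₁ M)) (∑-const n (S₂ M))))))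
        where
        expand : ∀ b x → (𝟙 b + x) * (𝟙 b + x) ≡ 𝟙 b + (𝟙 b * (2 * x) + x * x)
        expand true  x = l x
          where
          l : ∀ x → (1 + x) * (1 + x) ≡ 1 + (1 * (2 * x) + x * x)
          l = solve-∀
        expand false x = refl
        row : ∀ u → ∑ˢ (pow pt M) (λ τ → (𝟙 (p u) + hits p τ) * (𝟙 (p u) + hits p τ)) ≡ W M * 𝟙 (p u) + (𝟙 (p u) * (2 * S₁ M) + S₂ M)
        row u = trans (∑ˢ-cong (pow pt M) λ τ → expand (p u) (hits p τ))
          (trans (∑ˢ-+ (pow pt M) (λ _ → 𝟙 (p u)) (λ τ → 𝟙 (p u) * (2 * hits p τ) + hits p τ * hits p τ))
            (cong₂ _+_ (∑ˢ-const (pow pt M) (𝟙 (p u))) (trans (∑ˢ-+ (pow pt M) (λ τ → 𝟙 (p u) * (2 * hits p τ)) (λ τ → hits p τ * hits p τ))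
              (cong (_+ S₂ M) (trans (∑ˢ-*ˡ (pow pt M) (𝟙 (p u)) (λ τ → 2 * hits p τ)) (cong (𝟙 (p u) *_) (∑ˢ-*ˡ (pow pt M) 2 (hits p))))))))

      mean : ∀ M → n * S₁ M ≡ M * a * W M
      mean zero    = *-zeroʳ n
      mean (suc M) = trans (cong (n *_) (S₁-step M)) (trans (l₁ n (W M) a (S₁ M)) (trans (cong (λ t → n * (W M * a) + n * t) (mean M)) (l₂ n (W M) a M)))
        where
        l₁ : ∀ n W a S → n * (W * a + n * S) ≡ n * (W * a) + n * (n * S)
        l₁ = solve-∀
        l₂ : ∀ n W a M → n * (W * a) + n * (M * a * W) ≡ (1 + M) * a * (n * W)
        l₂ = solve-∀

      -- The term a·a·n·W added in the estimate is the negative part of the variance, given away to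
      -- stay within ℕ.
      second-moment : ∀ M → n * n * S₂ M ≤ (M * M * (a * a) + M * a * n) * W M
      second-moment zero    = ≤-reflexive (*-zeroʳ (n * n))
      second-moment (suc M) = begin
        n * n * S₂ (suc M) ≡⟨ cong (n * n *_) (S₂-step M) ⟩
        n * n * (W M * a + (a * (2 * S₁ M) + n * S₂ M)) ≡⟨ l₁ n (W M) a (S₁ M) (S₂ M) ⟩
        n * n * (W M * a) + (2 * a * n * (n * S₁ M) + n * (n * n * S₂ M))
          ≤⟨ +-monoʳ-≤ (n * n * (W M * a)) (+-mono-≤ (≤-reflexive (cong (2 * a * n *_) (mean M))) (*-monoʳ-≤ n (second-moment M))) ⟩
        n * n * (W M * a) + (2 * a * n * (M * a * W M) + n * ((M * M * (a * a) + M * a * n) * W M))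
          ≤⟨ m≤m+n _ (a * a * (n * W M)) ⟩
        n * n * (W M * a) + (2 * a * n * (M * a * W M) + n * ((M * M * (a * a) + M * a * n) * W M)) + a * a * (n * W M)
          ≡⟨ l₂ n (W M) a M ⟩
        ((1 + M) * (1 + M) * (a * a) + (1 + M) * a * n) * (n * W M) ∎
        where
        open ≤-Reasoning
        l₁ : ∀ n W a S T → n * n * (W * a + (a * (2 * S) + n * T)) ≡ n * n * (W * a) + (2 * a * n * (n * S) + n * (n * n * T))
        l₁ = solve-∀
        l₂ : ∀ n W a M → n * n * (W * a) + (2 * a * n * (M * a * W) + n * ((M * M * (a * a) + M * a * n) * W)) + a * a * (n * W) ≡
          ((1 + M) * (1 + M) * (a * a) + (1 + M) * a * n) * (n * W)
        l₂ = solve-∀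

      -- Sums (y - b)² ≥ D² over the bad tuples, for y = n·hits and b = M·a, in the form D² + 2by ≤
      -- y² + b².
      chebyshev : ∀ M D → D * D * #ˢ (pow pt M) (λ τ → M * a + D ≤ᵇ n * hits p τ) ≤ M * a * n * W M
      chebyshev M D = +-cancelʳ-≤ (2 * (b * b) * W M) _ _ (begin
        D * D * B + 2 * (b * b) * W M ≡⟨ cong (D * D * B +_) (trans (l₀ b (W M)) (trans (cong (2 * b *_) (sym (mean M))) (l₁ b n (S₁ M)))) ⟩
        D * D * B + 2 * b * n * S₁ M ≡⟨ cong₂ _+_ (sym (∑ˢ-*ˡ (pow pt M) (D * D) (λ τ → 𝟙 (bad τ)))) (sym (∑ˢ-*ˡ (pow pt M) (2 * b * n) (hits p))) ⟩
        ∑ˢ (pow pt M) (λ τ → D * D * 𝟙 (bad τ)) + ∑ˢ (pow pt M) (λ τ → 2 * b * n * hits p τ) ≡⟨ sym (∑ˢ-+ (pow pt M) (λ τ → D * D * 𝟙 (bad τ)) (λ τ → 2 * b * n * hits p τ)) ⟩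
        ∑ˢ (pow pt M) (λ τ → D * D * 𝟙 (bad τ) + 2 * b * n * hits p τ) ≤⟨ ∑ˢ-mono (pow pt M) pw ⟩
        ∑ˢ (pow pt M) (λ τ → n * n * (hits p τ * hits p τ) + b * b) ≡⟨ ∑ˢ-+ (pow pt M) (λ τ → n * n * (hits p τ * hits p τ)) (λ _ → b * b) ⟩
        ∑ˢ (pow pt M) (λ τ → n * n * (hits p τ * hits p τ)) + ∑ˢ (pow pt M) (λ _ → b * b) ≡⟨ cong₂ _+_ (∑ˢ-*ˡ (pow pt M) (n * n) (λ τ → hits p τ * hits p τ)) (∑ˢ-const (pow pt M) (b * b)) ⟩
        n * n * S₂ M + W M * (b * b) ≤⟨ +-monoˡ-≤ (W M * (b * b)) (second-moment M) ⟩
        (M * M * (a * a) + M * a * n) * W M + W M * (b * b) ≡⟨ l₂ M a n (W M) ⟩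
        M * a * n * W M + 2 * (b * b) * W M ∎)
        where
        open ≤-Reasoning
        b = M * a
        bad : ⟦_⟧ n (pow pt M) → Bool
        bad τ = M * a + D ≤ᵇ n * hits p τ
        B = #ˢ (pow pt M) bad
        l₀ : ∀ b W → 2 * (b * b) * W ≡ 2 * b * (b * W)
        l₀ = solve-∀
        l₁ : ∀ b n S → 2 * b * (n * S) ≡ 2 * b * n * S
        l₁ = solve-∀
        l₂ : ∀ M a n W → (M * M * (a * a) + M * a * n) * W + W * (M * a * (M * a)) ≡ M * a * n * W + 2 * (M * a * (M * a)) * W
        l₂ = solve-∀
        square : ∀ b y → 2 * b * y ≤ y * y + b * b
        square b y with ≤-total b y
        ... | inj₁ le with m≤n⇒∃[o]m+o≡n le
        ...   | z , refl = ≤-trans (m≤m+n _ (z * z)) (≤-reflexive (l b z))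
          where
          l : ∀ b z → 2 * b * (b + z) + z * z ≡ (b + z) * (b + z) + b * b
          l = solve-∀
        square b y | inj₂ le with m≤n⇒∃[o]m+o≡n le
        ...   | z , refl = ≤-trans (m≤m+n _ (z * z)) (≤-reflexive (l y z))
          where
          l : ∀ y z → 2 * (y + z) * y + z * z ≡ y * y + (y + z) * (y + z)
          l = solve-∀
        far-square : ∀ b D y → b + D ≤ y → D * D + 2 * b * y ≤ y * y + b * b
        far-square b D y le with m≤n⇒∃[o]m+o≡n le
        ... | z , refl = ≤-trans (m≤m+n _ (2 * D * z + z * z)) (≤-reflexive (l b D z))
          where
          l : ∀ b D z → D * D + 2 * b * (b + D + z) + (2 * D * z + z * z) ≡ (b + D + z) * (b + D + z) + b * b
          l = solve-∀
        sq : ∀ n x → n * x * (n * x) ≡ n * n * (x * x)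
        sq = solve-∀
        as : ∀ b n x → 2 * b * (n * x) ≡ 2 * b * n * x
        as = solve-∀
        pw : ∀ τ → D * D * 𝟙 (bad τ) + 2 * b * n * hits p τ ≤ n * n * (hits p τ * hits p τ) + b * b
        pw τ with M * a + D ≤ᵇ n * hits p τ in e
        ... | true  = ≤-trans (≤-reflexive (cong₂ _+_ (*-identityʳ (D * D)) (sym (as b n (hits p τ)))))
              (≤-trans (far-square b D (n * hits p τ) (≤ᵇ-elim e)) (≤-reflexive (cong (_+ b * b) (sq n (hits p τ)))))
        ... | false = ≤-trans (≤-reflexive (trans (cong (_+ 2 * b * n * hits p τ) (*-zeroʳ (D * D))) (sym (as b n (hits p τ)))))
              (≤-trans (square b (n * hits p τ)) (≤-reflexive (cong (_+ b * b) (sq n (hits p τ)))))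

    -- Separates the i-th coordinate u from the rest of the tuple, which no longer depends on u, so
    -- that tail bounds for a fixed vertex apply.
    coordinate : ∀ (p : Fin n → Fin n → Bool) M (i : Fin (leaves (pow pt (suc M)))) (T : Fin n → ℕ → ℕ) →
      ∑ˢ (pow pt (suc M)) (λ τ → T (get (pow pt (suc M)) τ i) (hits (p (get (pow pt (suc M)) τ i)) τ)) ≡
      sumFin (λ u → ∑ˢ (pow pt M) (λ τ → T u (𝟙 (p u u) + hits (p u) τ)))
    coordinate p M       zero    T = refl
    coordinate p (suc M) (suc j) T =
      trans (∑-cong {f = λ w → ∑ˢ (pow pt (suc M)) (λ τ → T (get (pow pt (suc M)) τ j) (𝟙 (p (get (pow pt (suc M)) τ j) w) + hits (p (get (pow pt (suc M)) τ j)) τ))}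
               λ w → coordinate p M j (λ u x → T u (𝟙 (p u w) + x)))
      (trans (∑-swap (λ w u → ∑ˢ (pow pt M) (λ τ → T u (𝟙 (p u w) + (𝟙 (p u u) + hits (p u) τ)))))
        (∑-cong λ u → ∑-cong λ w → ∑ˢ-cong (pow pt M) λ τ → cong (T u) (l (𝟙 (p u w)) (𝟙 (p u u)) (hits (p u) τ))))
      where
      l : ∀ x y z → x + (y + z) ≡ y + (x + z)
      l = solve-∀

  module Concentration {n : ℕ} (G : Gr n) (n≥1 : 1 ≤ n) (k₁ M′ : ℕ) (M′≥1 : 1 ≤ M′) (k₁≥1 : 1 ≤ k₁) where
    open Gr G

    M : ℕ
    M = k₁ * M′

    S : Shape
    S = pow pt M

    Vol : ℕ
    Vol = vol n S

    mis : Fin n → Fin n → Bool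
    mis v u = not (adj v u)

    -- The deviation is twice the one in `tail`. The second half pays in `bad-at` for the coordinate
    -- that holds the vertex itself.
    bad : Fin n → ⟦_⟧ n S → Bool
    bad v τ = M * # (mis v) + 2 * M′ * n ≤ᵇ n * hits {M = M} (mis v) τ

    tail : ∀ L v → M′ * M′ * #ˢ (pow pt L) (λ τ → L * # (mis v) + M′ * n ≤ᵇ n * hits (mis v) τ) ≤ L * vol n (pow pt L)
    tail L v = *-cancelˡ-≤ (n * n) ⦃ >-nonZero (*-mono-≤ n≥1 n≥1) ⦄ (begin
      n * n * (M′ * M′ * B) ≡⟨ l₁ n M′ B ⟩
      M′ * n * (M′ * n) * B ≤⟨ chebyshev (mis v) L (M′ * n) ⟩
      L * # (mis v) * n * V ≤⟨ *-monoˡ-≤ V (*-monoˡ-≤ n (*-monoʳ-≤ L (#-≤n (mis v)))) ⟩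
      L * n * n * V ≡⟨ l₂ L n V ⟩
      n * n * (L * V) ∎)
      where
      open ≤-Reasoning
      V = vol n (pow pt L)
      B = #ˢ (pow pt L) (λ τ → L * # (mis v) + M′ * n ≤ᵇ n * hits (mis v) τ)
      l₁ : ∀ n m B → n * n * (m * m * B) ≡ m * n * (m * n) * B
      l₁ = solve-∀
      l₂ : ∀ L n V → L * n * n * V ≡ n * n * (L * V)
      l₂ = solve-∀

    cancel-M′ : ∀ x V → M′ * M′ * x ≤ M * V → M′ * x ≤ k₁ * V
    cancel-M′ x V h = *-cancelˡ-≤ M′ ⦃ >-nonZero M′≥1 ⦄ (≤-trans (≤-reflexive (sym (*-assoc M′ M′ x))) (≤-trans h (≤-reflexive (l k₁ M′ V))))
      where
      l : ∀ k m V → k * m * V ≡ m * (k * V)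
      l = solve-∀

    #-bad : ∀ v → M′ * #ˢ S (bad v) ≤ k₁ * Vol
    #-bad v = cancel-M′ (#ˢ S (bad v)) Vol (≤-trans (*-monoʳ-≤ (M′ * M′) (∑ˢ-mono S weaker)) (tail M v))
      where
      weaker : ∀ (τ : ⟦_⟧ n S) → 𝟙 (bad v τ) ≤ 𝟙 (M * # (mis v) + M′ * n ≤ᵇ n * hits {M = M} (mis v) τ)
      weaker τ with bad v τ in e
      ... | false = z≤n
      ... | true rewrite ≤ᵇ-intro {M * # (mis v) + M′ * n} {n * hits {M = M} (mis v) τ}
                   (≤-trans (+-monoʳ-≤ (M * # (mis v)) (*-monoˡ-≤ n (m≤m+n M′ (M′ + 0)))) (≤ᵇ-elim e)) = ≤-refl

    bad-at : ∀ (i : Fin (leaves S)) → M′ * #ˢ S (λ τ → bad (get S τ i) τ) ≤ k₁ * Vol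
    bad-at i = cancel-M′ _ Vol (go M refl i)
      where
      go : ∀ L → L ≡ M → (i : Fin (leaves (pow pt L))) →
        M′ * M′ * #ˢ (pow pt L) (λ τ → M * # (mis (get (pow pt L) τ i)) + 2 * M′ * n ≤ᵇ n * hits (mis (get (pow pt L) τ i)) τ) ≤ M * vol n (pow pt L)
      go (suc L) eq i = begin
        M′ * M′ * #ˢ (pow pt (suc L)) (λ τ → M * # (mis (get (pow pt (suc L)) τ i)) + 2 * M′ * n ≤ᵇ n * hits (mis (get (pow pt (suc L)) τ i)) τ)
          ≡⟨ cong (M′ * M′ *_) (coordinate mis L i (λ u x → 𝟙 (M * # (mis u) + 2 * M′ * n ≤ᵇ n * x))) ⟩
        M′ * M′ * sumFin (λ u → ∑ˢ (pow pt L) (λ τ → 𝟙 (M * # (mis u) + 2 * M′ * n ≤ᵇ n * (𝟙 (mis u u) + hits (mis u) τ))))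
          ≤⟨ *-monoʳ-≤ (M′ * M′) (∑-mono λ u → ∑ˢ-mono (pow pt L) (weaker u)) ⟩
        M′ * M′ * sumFin (λ u → B u) ≡⟨ sym (∑-*ˡ (M′ * M′) B) ⟩
        sumFin (λ u → M′ * M′ * B u) ≤⟨ ∑-mono (λ u → tail L u) ⟩
        sumFin {n} (λ _ → L * vol n (pow pt L)) ≡⟨ ∑-const n _ ⟩
        n * (L * vol n (pow pt L)) ≤⟨ *-monoʳ-≤ n (*-monoˡ-≤ (vol n (pow pt L)) (≤-trans (n≤1+n L) (≤-reflexive eq))) ⟩
        n * (M * vol n (pow pt L)) ≡⟨ l n M (vol n (pow pt L)) ⟩
        M * (n * vol n (pow pt L)) ∎
        where
        open ≤-Reasoning
        B : Fin n → ℕ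
        B u = #ˢ (pow pt L) (λ τ → L * # (mis u) + M′ * n ≤ᵇ n * hits (mis u) τ)
        l : ∀ n M V → n * (M * V) ≡ M * (n * V)
        l = solve-∀
        n≤M′n : n ≤ M′ * n
        n≤M′n = ≤-trans (≤-reflexive (sym (*-identityˡ n))) (*-monoˡ-≤ n M′≥1)
        l₁ : ∀ x m n → x + m * n + m * n ≡ x + 2 * m * n
        l₁ = solve-∀
        l₂ : ∀ n x → n * (1 + x) ≡ n * x + n
        l₂ = solve-∀
        shift : ∀ u (τ : ⟦_⟧ n (pow pt L)) → M * # (mis u) + 2 * M′ * n ≤ n * (𝟙 (mis u u) + hits {M = L} (mis u) τ) → L * # (mis u) + M′ * n ≤ n * hits {M = L} (mis u) τ
        shift u τ h = +-cancelʳ-≤ n _ _ (begin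
          L * # (mis u) + M′ * n + n ≤⟨ +-mono-≤ (+-monoˡ-≤ (M′ * n) (*-monoˡ-≤ (# (mis u)) (≤-trans (n≤1+n L) (≤-reflexive eq)))) n≤M′n ⟩
          M * # (mis u) + M′ * n + M′ * n ≡⟨ l₁ (M * # (mis u)) M′ n ⟩
          M * # (mis u) + 2 * M′ * n ≤⟨ h ⟩
          n * (𝟙 (mis u u) + hits {M = L} (mis u) τ) ≡⟨ cong (λ b → n * (𝟙 (not b) + hits {M = L} (mis u) τ)) (adj-irr u) ⟩
          n * (1 + hits {M = L} (mis u) τ) ≡⟨ l₂ n (hits {M = L} (mis u) τ) ⟩
          n * hits {M = L} (mis u) τ + n ∎)
        weaker : ∀ u (τ : ⟦_⟧ n (pow pt L)) → 𝟙 (M * # (mis u) + 2 * M′ * n ≤ᵇ n * (𝟙 (mis u u) + hits {M = L} (mis u) τ)) ≤ 𝟙 (L * # (mis u) + M′ * n ≤ᵇ n * hits {M = L} (mis u) τ)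
        weaker u τ with M * # (mis u) + 2 * M′ * n ≤ᵇ n * (𝟙 (mis u u) + hits {M = L} (mis u) τ) in e
        ... | false = z≤n
        ... | true rewrite ≤ᵇ-intro {L * # (mis u) + M′ * n} {n * hits {M = L} (mis u) τ} (shift u τ (≤ᵇ-elim e)) = ≤-refl

    badCount : ⟦_⟧ n S → ℕ
    badCount τ = # (λ i → bad (get S τ i) τ)

    badCount-sum : ∑ˢ S badCount ≤ k₁ * k₁ * Vol
    badCount-sum = *-cancelˡ-≤ M′ ⦃ >-nonZero M′≥1 ⦄ (begin
      M′ * ∑ˢ S badCount ≡⟨ cong (M′ *_) (∑ˢ-swapᶠ S (λ τ i → 𝟙 (bad (get S τ i) τ))) ⟩
      M′ * sumFin (λ i → #ˢ S (λ τ → bad (get S τ i) τ)) ≡⟨ sym (∑-*ˡ M′ (λ i → #ˢ S (λ τ → bad (get S τ i) τ))) ⟩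
      sumFin (λ i → M′ * #ˢ S (λ τ → bad (get S τ i) τ)) ≤⟨ ∑-mono bad-at ⟩
      sumFin {leaves S} (λ _ → k₁ * Vol) ≡⟨ trans (∑-const (leaves S) (k₁ * Vol)) (cong (_* (k₁ * Vol)) (leaves-pow {n} M)) ⟩
      k₁ * M′ * (k₁ * Vol) ≡⟨ l k₁ M′ Vol ⟩
      M′ * (k₁ * k₁ * Vol) ∎)
      where
      open ≤-Reasoning
      l : ∀ k m V → k * m * (k * V) ≡ m * (k * k * V)
      l = solve-∀

    -- Four times the mean bound `badCount-sum`, so that by Markov's inequality at most a quarter of
    -- the samples reach it.
    β : ℕ
    β = 4 * (k₁ * k₁)

    module _ {t : ℕ} (base : Fin t → Fin n) (t≥1 : 1 ≤ t) (M′-large : 4 * (t * k₁) ≤ M′) where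
      good : ⟦_⟧ n S → Bool
      good τ = ⌊ all? (λ j → bad (base j) τ ≟ᵇ false) ⌋ ∧ not (β ≤ᵇ badCount τ)

      -- Both failures have probability at most 1/4: some base vertex is bad, by the union bound and
      -- M′ ≥ 4·t·k₁, or `badCount` reaches β.
      good-many : Vol ≤ 2 * #ˢ S good
      good-many = *-cancelˡ-≤ 2 (+-cancelʳ-≤ (2 * Vol) _ _ (begin
        2 * Vol + 2 * Vol ≡⟨ l₁ Vol ⟩
        4 * Vol ≡⟨ cong (4 *_) (sym (trans (∑ˢ-const S 1) (*-identityʳ Vol))) ⟩
        4 * ∑ˢ S (λ _ → 1) ≤⟨ *-monoʳ-≤ 4 (∑ˢ-mono S pw) ⟩
        4 * ∑ˢ S (λ τ → 𝟙 (good τ) + (sumFin (λ j → 𝟙 (bad (base j) τ)) + 𝟙 (β ≤ᵇ badCount τ)))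
          ≡⟨ cong (4 *_) (trans (∑ˢ-+ S (λ τ → 𝟙 (good τ)) (λ τ → sumFin (λ j → 𝟙 (bad (base j) τ)) + 𝟙 (β ≤ᵇ badCount τ)))
               (cong (#ˢ S good +_) (∑ˢ-+ S (λ τ → sumFin (λ j → 𝟙 (bad (base j) τ))) (λ τ → 𝟙 (β ≤ᵇ badCount τ))))) ⟩
        4 * (#ˢ S good + (X + Y)) ≡⟨ l₂ (#ˢ S good) X Y ⟩
        4 * #ˢ S good + (4 * X + 4 * Y) ≤⟨ +-monoʳ-≤ (4 * #ˢ S good) (+-mono-≤ X-small Y-small) ⟩
        4 * #ˢ S good + (Vol + Vol) ≡⟨ l₃ (#ˢ S good) Vol ⟩
        2 * (2 * #ˢ S good) + 2 * Vol ∎))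
        where
        open ≤-Reasoning
        X = ∑ˢ S (λ τ → sumFin (λ j → 𝟙 (bad (base j) τ)))
        Y = #ˢ S (λ τ → β ≤ᵇ badCount τ)
        l₁ : ∀ V → 2 * V + 2 * V ≡ 4 * V
        l₁ = solve-∀
        l₂ : ∀ g x y → 4 * (g + (x + y)) ≡ 4 * g + (4 * x + 4 * y)
        l₂ = solve-∀
        l₃ : ∀ g v → 4 * g + (v + v) ≡ 2 * (2 * g) + 2 * v
        l₃ = solve-∀
        third : ∀ x y z → 1 ≤ z → 1 ≤ x + (y + z)
        third x y z l = ≤-trans l (≤-trans (m≤n+m z y) (m≤n+m (y + z) x))
        second : ∀ x y z → 1 ≤ y → 1 ≤ x + (y + z)
        second x y z l = ≤-trans l (≤-trans (m≤m+n y z) (m≤n+m (y + z) x))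
        pw : ∀ τ → 1 ≤ 𝟙 (good τ) + (sumFin (λ j → 𝟙 (bad (base j) τ)) + 𝟙 (β ≤ᵇ badCount τ))
        pw τ with any? (λ j → bad (base j) τ ≟ᵇ true) | all? (λ j → bad (base j) τ ≟ᵇ false) | β ≤ᵇ badCount τ
        ... | yes (j , e) | g | b = second (𝟙 (⌊ g ⌋ ∧ not b)) (sumFin (λ j → 𝟙 (bad (base j) τ))) (𝟙 b)
                (≤-trans (≤-reflexive (cong 𝟙 (sym e))) (∑-term (λ j → 𝟙 (bad (base j) τ)) j))
        ... | no _ | g | true = third (𝟙 (⌊ g ⌋ ∧ false)) (sumFin (λ j → 𝟙 (bad (base j) τ))) 1 ≤-refl
        ... | no _ | yes _ | false = s≤s z≤n
        ... | no ¬h | no ¬g | false = ⊥-elim (¬g λ j → ¬true⇒false λ e → ¬h (j , e))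
        X-small : 4 * X ≤ Vol
        X-small = *-cancelˡ-≤ (t * k₁) ⦃ >-nonZero (*-mono-≤ t≥1 k₁≥1) ⦄ (begin
          t * k₁ * (4 * X) ≡⟨ l (t * k₁) X ⟩
          4 * (t * k₁) * X ≤⟨ *-monoˡ-≤ X M′-large ⟩
          M′ * X ≡⟨ cong (M′ *_) (∑ˢ-swapᶠ S (λ τ j → 𝟙 (bad (base j) τ))) ⟩
          M′ * sumFin (λ j → #ˢ S (bad (base j))) ≡⟨ sym (∑-*ˡ M′ (λ j → #ˢ S (bad (base j)))) ⟩
          sumFin (λ j → M′ * #ˢ S (bad (base j))) ≤⟨ ∑-mono (λ j → #-bad (base j)) ⟩
          sumFin {t} (λ _ → k₁ * Vol) ≡⟨ ∑-const t _ ⟩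
          t * (k₁ * Vol) ≡⟨ sym (*-assoc t k₁ Vol) ⟩
          t * k₁ * Vol ∎)
          where
          l : ∀ a x → a * (4 * x) ≡ 4 * a * x
          l = solve-∀
        Y-small : 4 * Y ≤ Vol
        Y-small = *-cancelˡ-≤ (k₁ * k₁) ⦃ >-nonZero (*-mono-≤ k₁≥1 k₁≥1) ⦄ (begin
          k₁ * k₁ * (4 * Y) ≡⟨ l (k₁ * k₁) Y ⟩
          β * Y ≡⟨ sym (∑ˢ-*ˡ S β (λ τ → 𝟙 (β ≤ᵇ badCount τ))) ⟩
          ∑ˢ S (λ τ → β * 𝟙 (β ≤ᵇ badCount τ)) ≤⟨ ∑ˢ-mono S markov ⟩
          ∑ˢ S badCount ≤⟨ badCount-sum ⟩
          k₁ * k₁ * Vol ∎)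
          where
          l : ∀ a x → a * (4 * x) ≡ 4 * a * x
          l = solve-∀
          markov : ∀ τ → β * 𝟙 (β ≤ᵇ badCount τ) ≤ badCount τ
          markov τ with β ≤ᵇ badCount τ in e
          ... | true  = ≤-trans (≤-reflexive (*-identityʳ β)) (≤ᵇ-elim e)
          ... | false = ≤-trans (≤-reflexive (*-zeroʳ β)) z≤n

-- From dense samples to a copy of H.

module Sampling where
  open import Defs hiding (_//_)
  open Sums
  open Graphs
  open Shapes
  open Testing
  open Chebyshev using (≤ᵇ-intro; hits; hits-get; leaves-pow; module Concentration)
  open Structural
  open import Data.Fin using (cast)
  open import Data.Fin.Properties using (pigeonhole; cast-is-id; cast-trans)

  -- Greedy choice: a row is injective and longer than the number of earlier choices. Rows of a box
  -- may overlap, so distinctness has to be arranged here.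
  representatives : ∀ {n b} h → h ≤ b → (row : Fin h → Fin b → Fin n) → (∀ i u v → row i u ≡ row i v → u ≡ v) →
    ∃ λ (c : Fin h → Fin b) → ∀ i j → row i (c i) ≡ row j (c j) → i ≡ j
  representatives zero    _ row inj = (λ ()) , λ ()
  representatives {n} {b} (suc h) l row inj with representatives h (<⇒≤ l) (row ∘ suc) (inj ∘ suc)
  ... | c , distinct with any? (λ u → all? λ i → ¬? (row zero u ≟ᶠ row (suc i) (c i)))
  ...   | yes (u , fresh) = c′ , distinct′
    where
    c′ : Fin (suc h) → Fin b
    c′ zero    = u
    c′ (suc i) = c i
    distinct′ : ∀ i j → row i (c′ i) ≡ row j (c′ j) → i ≡ j
    distinct′ zero    zero    e = refl
    distinct′ zero    (suc j) e = ⊥-elim (fresh j e)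
    distinct′ (suc i) zero    e = ⊥-elim (fresh i (sym e))
    distinct′ (suc i) (suc j) e = cong suc (distinct i j e)
  ...   | no ¬fresh = ⊥-elim (repeat (pigeonhole l (λ u → proj₁ (hit u))))
    where
    hit : ∀ u → ∃ λ i → row zero u ≡ row (suc i) (c i)
    hit u with any? (λ i → row zero u ≟ᶠ row (suc i) (c i))
    ... | yes h = h
    ... | no ¬h = ⊥-elim (¬fresh (u , λ i e → ¬h (i , e)))
    repeat : (∃ λ u → ∃ λ v → toℕ u < toℕ v × proj₁ (hit u) ≡ proj₁ (hit v)) → ⊥
    repeat (u , v , lt , e) with inj zero u v (trans (proj₂ (hit u)) (trans (cong (λ i → row (suc i) (c i)) e) (sym (proj₂ (hit v)))))
    ... | refl = <-irrefl refl lt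

  module _ (X : Shape) {n : ℕ} (G : Gr n) (T : Graph) (h : ⟦_⟧ (leaves X) (pow pt (size T))) where
    open Gr G

    -- A map from the vertices of T to coordinates is coded as a tuple h, so that maps can be summed
    -- and averaged over.
    place : Fin (size T) → Fin (leaves X)
    place a = get (pow pt (size T)) h (cast (sym (leaves-pow {leaves X} (size T))) a)

    maps? : (x : ⟦_⟧ n X) → Dec (∀ a b → Edge T a b → adj (get X x (place a)) (get X x (place b)) ≡ true)
    maps? x = all? λ a → all? λ b → (Adj T a b ≟ᵇ true) →-dec (adj (get X x (place a)) (get X x (place b)) ≟ᵇ true)

    maps : ⟦_⟧ n X → Bool
    maps x = ⌊ maps? x ⌋

    maps-sound : ∀ x → maps x ≡ true → ∀ a b → Edge T a b → adj (get X x (place a)) (get X x (place b)) ≡ true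
    maps-sound x e with maps? x
    ... | yes hm = hm

    maps-complete : ∀ x → (∀ a b → Edge T a b → adj (get X x (place a)) (get X x (place b)) ≡ true) → maps x ≡ true
    maps-complete x hm with maps? x
    ... | yes _ = refl
    ... | no ¬h = ⊥-elim (¬h hm)

    -- The box theorem puts |H| + 1 vertices into each coordinate so that every transversal carries
    -- T. Vertices of H go to the coordinates given by ψ and receive distinct representatives.
    blow-up : ∀ H D → 1 ≤ D → boxN X (suc (size H)) D ≤ n → 1 ≤ n → vol n X ≤ D * #ˢ X maps → Hom H T →
      Σ (Fin (size H) → Fin n) λ φ → (∀ {x y} → φ x ≡ φ y → x ≡ y) × (∀ x y → Edge H x y → adj (φ x) (φ y) ≡ true)
    blow-up H D D≥1 large n≥1 dense (ψ , ψ-edges) = φ , (λ {x} {y} → proj₂ sdr x y) , edges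
      where
      b = suc (size H)
      box′ : Box X b (boxK X b D) one (λ x _ → maps x)
      box′ = box X b D D≥1 large n≥1 one (λ x _ → maps x) (≤-trans (≤-reflexive (*-identityʳ (vol n X))) dense)
      holds : Box.P box′ tt ≡ true
      holds with Box.P box′ tt | Box.dense box′
      ... | true  | _ = refl
      ... | false | d = ⊥-elim (<⇒≱ d (≤-reflexive (*-zeroʳ (boxK X b D))))
      row = Box.β box′
      π : Fin (size H) → Fin (leaves X)
      π x = place (ψ x)
      sdr = representatives (size H) (n≤1+n _) (λ x → row (π x)) (λ x → Box.inj box′ (π x))
      choice : Fin (size H) → Fin b
      choice = proj₁ sdr
      φ : Fin (size H) → Fin n
      φ x = row (π x) (choice x)
      all-hom : ∀ (f : Fin (leaves X) → Fin b) a a′ → Edge T a a′ → adj (row (place a) (f (place a))) (row (place a′) (f (place a′))) ≡ true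
      all-hom f a a′ ed = trans (sym (cong₂ adj (get-fromFun X (λ i → row i (f i)) (place a)) (get-fromFun X (λ i → row i (f i)) (place a′))))
        (maps-sound z (Box.sound box′ tt holds z (λ i → f i , get-fromFun X (λ i → row i (f i)) i)) a a′ ed)
        where
        z : ⟦_⟧ n X
        z = fromFun X (λ i → row i (f i))
      edges : ∀ x y → Edge H x y → adj (φ x) (φ y) ≡ true
      edges x y ed with π x ≟ᶠ π y
      -- Adjacent vertices of H never share a coordinate, since a transversal would then have a
      -- loop.
      ... | yes e = ⊥-elim (absurd (subst (λ i → adj (row (π x) zero) (row i zero) ≡ true) (sym e) (all-hom (λ _ → zero) (ψ x) (ψ y) (ψ-edges x y ed))) (adj-irr (row (π x) zero)))
      ... | no ne = subst₂ (λ u v → adj (row (π x) u) (row (π y) v) ≡ true) fx fy (all-hom f (ψ x) (ψ y) (ψ-edges x y ed))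
        where
        f : Fin (leaves X) → Fin b
        f i = if ⌊ i ≟ᶠ π x ⌋ then choice x else choice y
        fx : f (π x) ≡ choice x
        fx with π x ≟ᶠ π x
        ... | yes _ = refl
        ... | no ¬e = ⊥-elim (¬e refl)
        fy : f (π y) ≡ choice y
        fy with π y ≟ᶠ π x
        ... | yes e = ⊥-elim (ne (sym e))
        ... | no _ = refl

  leaves-tup : ∀ r d → 1 ≤ leaves (tup r d)
  leaves-tup r zero    = ≤-refl
  leaves-tup r (suc d) = s≤s z≤n

  module Parameters (s g e k : ℕ) (H : Graph) where
    r E : ℕ
    r = 3 + s
    E = 3 * e

    -- Sealed, lest conversion checking unfold the arithmetic.
    abstract
      q P k₁ depth : ℕ
      q = cDen g
      P = q * (2 + s) + cNum g
      k₁ = 4 * (P * k)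
      depth = E * r

      q-def : q ≡ cDen g
      q-def = refl

      P-def : P ≡ cDen g * (2 + s) + cNum g
      P-def = refl

      k₁-def : k₁ ≡ 4 * (P * k)
      k₁-def = refl

    B S X : Shape
    B = tup r depth

    t β M N b : ℕ
    t = leaves B
    β = 4 * (k₁ * k₁)

    abstract
      M′ : ℕ
      -- The first summand is for `good-many`. The second makes the β bad coordinates and the t base
      -- coordinates negligible in `gap`.
      M′ = 4 * (t * k₁) + (q * β + t)

      M′-large : 4 * (t * k₁) ≤ M′
      M′-large = m≤m+n (4 * (t * k₁)) (q * β + t)

      M′-large₂ : q * β + t ≤ M′
      M′-large₂ = m≤n+m (q * β + t) (4 * (t * k₁))

    M = k₁ * M′
    S = pow pt M
    X = B ⊗ S
    N = leaves X
    b = suc (size H)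

    target : Fin g → Graph
    target j = K s ⊕ F (suc (toℕ j))

    abstract
      dens : ℕ
      dens = 2 * tupK E r depth

      dens-def : dens ≡ 2 * tupK E r depth
      dens-def = refl

      densAt : Fin g → ℕ
      densAt j = vol N (pow pt (size (target j))) * (g * dens)

      densAt-def : ∀ j → densAt j ≡ vol N (pow pt (size (target j))) * (g * dens)
      densAt-def j = refl

      n₀ : ℕ
      n₀ = 1 + sumFin λ j → boxN X b (densAt j)

      n₀≥1 : 1 ≤ n₀
      n₀≥1 = s≤s z≤n

      n₀-large : ∀ j → boxN X b (densAt j) ≤ n₀
      n₀-large j = ≤-trans (∑-term (λ j → boxN X b (densAt j)) j) (n≤1+n (sumFin λ j → boxN X b (densAt j)))

    module Main (g≥1 : 1 ≤ g) (g≤11 : g ≤ 11) (e≥1 : 1 ≤ e) (k≥1 : 1 ≤ k) {n : ℕ} (n≥n₀ : n₀ ≤ n) (G : Gr n)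
      (degrees : ∀ v → (cDen g * (2 + s) + cNum g) * k * # (λ u → not (Gr.adj G v u)) + n ≤ k * cDen g * n)
      (far : ∀ f → n * n < e * Testing.Tester.monoPairs G (2 + s) e f) where
      open Gr G
      open Testing.Tester G (2 + s) e using (Ref; Ref-sound; full; full-dense; kk≥1)

      abstract
        n≥1 : 1 ≤ n
        n≥1 = ≤-trans n₀≥1 n≥n₀

        t≥1 : 1 ≤ t
        t≥1 = leaves-tup r depth

        q≥1 : 1 ≤ q
        q≥1 = proj₂ (Homs.seventh G g g≥1 g≤11)

        P≥1 : 1 ≤ P
        P≥1 = ≤-trans (*-mono-≤ q≥1 (s≤s z≤n)) (m≤m+n (q * (2 + s)) (cNum g))

        Pk≥1 : 1 ≤ P * k
        Pk≥1 = *-mono-≤ P≥1 k≥1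

        k₁≥1 : 1 ≤ k₁
        k₁≥1 = *-mono-≤ (s≤s {0} {3} z≤n) Pk≥1

        M′≥1 : 1 ≤ M′
        M′≥1 = ≤-trans t≥1 (≤-trans (m≤n+m t (q * β)) M′-large₂)

        degrees′ : ∀ v → P * k * # (λ u → not (adj v u)) + n ≤ k * q * n
        degrees′ = degrees

        base-dense : vol n B ≤ tupK E r depth * #ˢ B (Ref depth full)
        base-dense = full-dense far e≥1 n≥1

      open Concentration G n≥1 k₁ M′ M′≥1 k₁≥1 using (bad; badCount; mis; good; good-many)

      usable : ⟦_⟧ n X → Bool
      usable (σ , τ) = Ref depth full σ ∧ good (get B σ) t≥1 M′-large τ

      usable-dense : vol n X ≤ dens * #ˢ X usable
      usable-dense = begin
        vol n B * vol n S ≤⟨ *-monoˡ-≤ (vol n S) base-dense ⟩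
        κ * #ˢ B (Ref depth full) * vol n S ≡⟨ *-assoc κ _ _ ⟩
        κ * (#ˢ B (Ref depth full) * vol n S) ≡⟨ cong (κ *_) (sym (∑ˢ-*ʳ B (λ σ → 𝟙 (Ref depth full σ)) (vol n S))) ⟩
        κ * ∑ˢ B (λ σ → 𝟙 (Ref depth full σ) * vol n S) ≤⟨ *-monoʳ-≤ κ (∑ˢ-mono B row) ⟩
        κ * ∑ˢ B (λ σ → 2 * #ˢ S (λ τ → usable (σ , τ))) ≡⟨ cong (κ *_) (∑ˢ-*ˡ B 2 (λ σ → #ˢ S (λ τ → usable (σ , τ)))) ⟩
        κ * (2 * #ˢ X usable) ≡⟨ trans (l κ (#ˢ X usable)) (cong (_* #ˢ X usable) (sym dens-def)) ⟩
        dens * #ˢ X usable ∎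
        where
        open ≤-Reasoning
        κ = tupK E r depth
        l : ∀ a x → a * (2 * x) ≡ 2 * a * x
        l = solve-∀
        row : ∀ σ → 𝟙 (Ref depth full σ) * vol n S ≤ 2 * #ˢ S (λ τ → usable (σ , τ))
        row σ with Ref depth full σ
        ... | false = z≤n
        ... | true  = ≤-trans (≤-reflexive (+-identityʳ _)) (good-many (get B σ) t≥1 M′-large)

      -- A graph on coordinates: a vertex sampled repeatedly yields twins.
      pullback : ⟦_⟧ n X → Gr N
      pullback x = record { adj = λ i j → adj (get X x i) (get X x j)
                          ; adj-sym = λ i j → adj-sym (get X x i) (get X x j) ; adj-irr = λ i → adj-irr (get X x i) }

      isHom : ∀ j → ⟦_⟧ N (pow pt (size (target j))) → ⟦_⟧ n X → Bool
      isHom j = maps X G (target j)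

      module Good (σ : ⟦_⟧ n B) (τ : ⟦_⟧ n S) (use : usable (σ , τ) ≡ true) where
        x : ⟦_⟧ n X
        x = σ , τ

        ref : Ref depth full σ ≡ true
        ref = proj₁ (∧-true use)

        good′ : good (get B σ) t≥1 M′-large τ ≡ true
        good′ = proj₂ (∧-true {Ref depth full σ} use)

        base-fine : ∀ j → bad (get B σ j) τ ≡ false
        base-fine j with all? (λ j → bad (get B σ j) τ ≟ᵇ false) | good′
        ... | yes h | _ = h j

        few-bad : badCount τ < β
        few-bad = ≰⇒> λ l → absurd (≤ᵇ-intro l) (not-true (proj₂ (∧-true {⌊ all? (λ j → bad (get B σ j) τ ≟ᵇ false) ⌋} good′)))

        G′ : Gr N
        G′ = pullback x
        open Structure G′ using (Sub; Bounded; Miss; Col)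
        open Homs G′ using (HomTo; hom; structure)

        U : Sub
        U i = [ (λ _ → true) , (λ j → not (bad (get S τ j) τ)) ]′ (splitAt t i)

        fine : ∀ i → U i ≡ true → bad (get X x i) τ ≡ false
        fine i u with splitAt t i
        ... | inj₁ j = base-fine j
        ... | inj₂ j = not-true u

        Y : ℕ
        Y = 4 * M′ * (k * q)

        -- The t base coordinates are all counted as missed; the sampled ones obey `hits-bound`.
        m : ℕ
        m = t + (Y ∸ 2 * M′)

        -- With M = 4PkM′, the surplus n in `degrees′` becomes M·n = 4PkM′n. Half of it covers the
        -- deviation 2M′n allowed by `bad`; the other half remains as the margin 2M′.
        hits-bound : ∀ v → bad v τ ≡ false → hits {M = M} (mis v) τ + 2 * M′ < Y
        hits-bound v nb = *-cancelˡ-< (P * k) _ _ (+-cancelʳ-< (P * k * (2 * M′)) _ _ (*-cancelʳ-< n _ _ (begin-strict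
          (P * k * (h + 2 * M′) + P * k * (2 * M′)) * n ≡⟨ trans (l₁ (P * k) h M′ n) (cong (λ z → P * k * (n * h) + z * M′ * n) (sym k₁-def)) ⟩
          P * k * (n * h) + M * n <⟨ +-monoˡ-< (M * n) (*-monoʳ-< (P * k) ⦃ >-nonZero Pk≥1 ⦄ below) ⟩
          P * k * (M * a + 2 * M′ * n) + M * n ≡⟨ l₂ (P * k) M a M′ n ⟩
          M * (P * k * a + n) + P * k * (2 * M′) * n ≤⟨ +-monoˡ-≤ (P * k * (2 * M′) * n) (*-monoʳ-≤ M (degrees′ v)) ⟩
          M * (k * q * n) + P * k * (2 * M′) * n ≡⟨ trans (cong (λ z → z * M′ * (k * q * n) + P * k * (2 * M′) * n) k₁-def) (l₃ (P * k) M′ k q n) ⟩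
          (P * k * Y + P * k * (2 * M′)) * n ∎)))
          where
          open ≤-Reasoning
          h = hits {M = M} (mis v) τ
          a = # (mis v)
          below : n * h < M * a + 2 * M′ * n
          below = ≰⇒> λ l → absurd (≤ᵇ-intro l) nb
          l₁ : ∀ A h m n → (A * (h + 2 * m) + A * (2 * m)) * n ≡ A * (n * h) + 4 * A * m * n
          l₁ = solve-∀
          l₂ : ∀ A M a m n → A * (M * a + 2 * m * n) + M * n ≡ M * (A * a + n) + A * (2 * m) * n
          l₂ = solve-∀
          l₃ : ∀ A m k q n → 4 * A * m * (k * q * n) + A * (2 * m) * n ≡ (A * (4 * m * (k * q)) + A * (2 * m)) * n
          l₃ = solve-∀

        bounded : Bounded U m
        bounded i u = begin
          # (Miss U i) ≤⟨ #-mono {p = Miss U i} {λ j → mis v (get X x j)} (λ j e → proj₂ (∧-true {U j} e)) ⟩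
          # (λ j → mis v (get X x j)) ≡⟨ ∑-split t (leaves S) (λ j → 𝟙 (mis v (get X x j))) ⟩
          # (λ j → mis v (get X x (j ↑ˡ leaves S))) + # (λ j → mis v (get X x (t ↑ʳ j)))
            ≤⟨ +-mono-≤ (#-≤n _) (≤-reflexive (trans (∑-cong λ j → cong (λ w → 𝟙 (mis v w)) (get-↑ʳ B S σ τ j)) (sym (hits-get {M = M} (mis v) τ)))) ⟩
          t + hits {M = M} (mis v) τ ≤⟨ +-monoʳ-≤ t (m+n≤o⇒m≤o∸n _ (<⇒≤ (hits-bound v (fine i u)))) ⟩
          m ∎
          where
          open ≤-Reasoning
          v = get X x i

        #U : t + M ≤ # U + badCount τ
        #U = begin
          t + M ≡⟨ cong₂ _+_ (sym (trans (∑-const t 1) (*-identityʳ t))) (sym (leaves-pow {n} M)) ⟩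
          sumFin {t} (λ _ → 1) + leaves S
            ≡⟨ cong₂ _+_ (∑-cong {f = λ _ → 1} λ j → cong 𝟙 (sym (U-base j))) (sym (#-complement (λ j → bad (get S τ j) τ))) ⟩
          # (λ j → U (j ↑ˡ leaves S)) + (badCount τ + # (λ j → not (bad (get S τ j) τ)))
            ≡⟨ cong (λ z → # (λ j → U (j ↑ˡ leaves S)) + (badCount τ + z)) (∑-cong {f = λ j → 𝟙 (not (bad (get S τ j) τ))} λ j → cong 𝟙 (sym (U-rest j))) ⟩
          # (λ j → U (j ↑ˡ leaves S)) + (badCount τ + # (λ j → U (t ↑ʳ j))) ≡⟨ l (# (λ j → U (j ↑ˡ leaves S))) (badCount τ) (# (λ j → U (t ↑ʳ j))) ⟩
          # (λ j → U (j ↑ˡ leaves S)) + # (λ j → U (t ↑ʳ j)) + badCount τ ≡⟨ cong (_+ badCount τ) (sym (∑-split t (leaves S) (λ j → 𝟙 (U j)))) ⟩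
          # U + badCount τ ∎
          where
          open ≤-Reasoning
          l : ∀ a b c → a + (b + c) ≡ a + c + b
          l = solve-∀
          U-base : ∀ j → U (j ↑ˡ leaves S) ≡ true
          U-base j rewrite splitAt-↑ˡ t j (leaves S) = refl
          U-rest : ∀ j → U (t ↑ʳ j) ≡ not (bad (get S τ j) τ)
          U-rest j rewrite splitAt-↑ʳ t (leaves S) j = refl

        2M′≤Y : 2 * M′ ≤ Y
        2M′≤Y = ≤-trans (m≤n+m (2 * M′) (hits {M = M} (mis (get B σ (first-leaf t≥1))) τ)) (<⇒≤ (hits-bound (get B σ (first-leaf t≥1)) (base-fine (first-leaf t≥1))))
          where
          first-leaf : ∀ {t} → 1 ≤ t → Fin t
          first-leaf (s≤s _) = zero

        -- P·Y equals q·M exactly, so only Pt + qβ < 2PM′ remains, and M′ ≥ qβ + t.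
        gap : P * m < q * # U
        gap = +-cancelʳ-< (P * (2 * M′)) _ _ (+-cancelʳ-< (q * β) _ _ (begin-strict
          P * m + P * (2 * M′) + q * β ≡⟨ cong (_+ q * β) (trans (sym (*-distribˡ-+ P m (2 * M′))) (cong (P *_) (trans (+-assoc t _ _) (cong (t +_) (m∸n+n≡m 2M′≤Y))))) ⟩
          P * (t + Y) + q * β ≡⟨ trans (l₁ P t M′ k q (q * β)) (cong (λ z → q * (z * M′) + (P * t + q * β)) (sym k₁-def)) ⟩
          q * M + (P * t + q * β) <⟨ +-monoʳ-< (q * M) slack ⟩
          q * M + P * (2 * M′) ≤⟨ +-monoˡ-≤ (P * (2 * M′)) (*-monoʳ-≤ q (≤-trans (m≤n+m M t) (≤-trans #U (+-monoʳ-≤ (# U) (<⇒≤ few-bad))))) ⟩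
          q * (# U + β) + P * (2 * M′) ≡⟨ l₂ q (# U) β (P * (2 * M′)) ⟩
          q * # U + P * (2 * M′) + q * β ∎))
          where
          open ≤-Reasoning
          l₁ : ∀ P t m k q z → P * (t + 4 * m * (k * q)) + z ≡ q * (4 * (P * k) * m) + (P * t + z)
          l₁ = solve-∀
          l₂ : ∀ q u β z → q * (u + β) + z ≡ q * u + z + q * β
          l₂ = solve-∀
          slack : P * t + q * β < P * (2 * M′)
          slack = begin-strict
            P * t + q * β ≤⟨ +-monoʳ-≤ (P * t) (≤-trans (≤-reflexive (sym (*-identityˡ (q * β)))) (*-monoˡ-≤ (q * β) P≥1)) ⟩
            P * t + P * (q * β) ≡⟨ trans (sym (*-distribˡ-+ P t (q * β))) (cong (P *_) (+-comm t (q * β))) ⟩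
            P * (q * β + t) ≤⟨ *-monoʳ-≤ P M′-large₂ ⟩
            P * M′ <⟨ *-monoʳ-< P ⦃ >-nonZero P≥1 ⦄ (≤-trans (≤-reflexive (+-comm 1 M′)) (≤-trans (+-monoʳ-≤ M′ M′≥1) (≤-reflexive (cong (M′ +_) (sym (+-identityʳ M′)))))) ⟩
            P * (2 * M′) ∎

        not-colourable : ¬ Col r U
        not-colourable (c , proper) = Ref-sound depth full σ ref (λ i → c (i ↑ˡ leaves S)) (λ _ → refl) λ i j a →
          proper (i ↑ˡ leaves S) (j ↑ˡ leaves S) (U-base i) (U-base j) (trans (cong₂ adj (get-↑ˡ B S σ τ i) (get-↑ˡ B S σ τ j)) a)
          where
          U-base : ∀ j → U (j ↑ˡ leaves S) ≡ true
          U-base j rewrite splitAt-↑ˡ t j (leaves S) = refl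

        some-hom : ¬ (∀ (j : Fin g) → ¬ HomTo (target j) U)
        some-hom none = not-colourable (structure s g g≥1 g≤11 bounded (subst₂ (λ P q → P * m < q * # U) P-def q-def gap) λ { (suc j) _ l h → none (Data.Fin.fromℕ< l)
            (subst (λ z → HomTo (K s ⊕ F (suc z)) U) (sym (Data.Fin.Properties.toℕ-fromℕ< l)) h) })
          where
          import Data.Fin
          import Data.Fin.Properties

        -- `some-hom` yields existence only up to double negation; comparing the count with 1 is
        -- decidable.
        homs-sum : 1 ≤ sumFin (λ j → ∑ˢ (pow pt (size (target j))) (λ h → 𝟙 (isHom j h x)))
        homs-sum with 1 ≤? sumFin (λ j → ∑ˢ (pow pt (size (target j))) (λ h → 𝟙 (isHom j h x)))
        ... | yes l = l
        ... | no ¬l = ⊥-elim (some-hom λ j hm → ¬l (≤-trans (≤-trans (≤-reflexive (cong 𝟙 (sym (found j hm)))) (term (pow pt (size (target j))) (λ h → 𝟙 (isHom j h x)) (tuple j hm)))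
                  (∑-term (λ j → ∑ˢ (pow pt (size (target j))) (λ h → 𝟙 (isHom j h x))) j)))
          where
          term : ∀ {k} s (f : ⟦_⟧ k s → ℕ) y → f y ≤ ∑ˢ s f
          term one     f tt      = ≤-refl
          term pt      f y       = ∑-term f y
          term (a ⊗ b) f (y , z) = ≤-trans (term b (λ z → f (y , z)) z) (term a (λ y → ∑ˢ b (λ z → f (y , z))) y)
          tuple : ∀ j → HomTo (target j) U → ⟦_⟧ N (pow pt (size (target j)))
          tuple j hm = fromFun (pow pt (size (target j))) (λ i → HomTo.map hm (cast (leaves-pow {N} (size (target j))) i))
          found : ∀ j hm → isHom j (tuple j hm) x ≡ true
          found j hm = maps-complete X G (target j) (tuple j hm) x λ a b ed →
            trans (cong₂ (λ u v → adj (get X x u) (get X x v)) (eq a) (eq b)) (HomTo.edges hm a b ed)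
            where
            eq : ∀ a → get (pow pt (size (target j))) (tuple j hm) (cast (sym (leaves-pow {N} (size (target j)))) a) ≡ HomTo.map hm a
            eq a = trans (get-fromFun (pow pt (size (target j))) _ _) (cong (HomTo.map hm)
              (trans (cast-trans (sym (leaves-pow {N} (size (target j)))) (leaves-pow {N} (size (target j))) a) (cast-is-id refl a)))

      count : ∀ j → ⟦_⟧ N (pow pt (size (target j))) → ℕ
      count j h = #ˢ X (isHom j h)

      homs-dense : vol n X ≤ dens * sumFin (λ j → ∑ˢ (pow pt (size (target j))) (count j))
      homs-dense = ≤-trans usable-dense (*-monoʳ-≤ dens (≤-trans (∑ˢ-mono X pw) (≤-reflexive
        (trans (∑ˢ-swapᶠ X (λ x j → ∑ˢ (pow pt (size (target j))) (λ h → 𝟙 (isHom j h x))))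
          (∑-cong {f = λ j → ∑ˢ X (λ x → ∑ˢ (pow pt (size (target j))) (λ h → 𝟙 (isHom j h x)))} λ j → ∑ˢ-swap X (pow pt (size (target j))) (λ x h → 𝟙 (isHom j h x)))))))
        where
        pw : ∀ x → 𝟙 (usable x) ≤ sumFin (λ j → ∑ˢ (pow pt (size (target j))) (λ h → 𝟙 (isHom j h x)))
        pw (σ , τ) with true? (usable (σ , τ))
        ... | inj₁ u = ≤-trans (≤-reflexive (cong 𝟙 u)) (Good.homs-sum σ τ u)
        ... | inj₂ u = ≤-trans (≤-reflexive (cong 𝟙 u)) z≤n

      N≥1 : 1 ≤ N
      N≥1 = ≤-trans t≥1 (m≤m+n t (leaves S))

      -- Averaging over the index j of the target and then over the coded maps h; `densAt j`
      -- collects both losses.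
      popular : ∃ λ j → ∃ λ h → vol n X ≤ densAt j * count j h
      popular = j , h , ≤-trans le′ (≤-reflexive (cong (_* count j h) (sym (densAt-def j))))
        where
        V = vol n X
        homs : Fin g → ℕ
        homs j = ∑ˢ (pow pt (size (target j))) (count j)
        vols : Fin g → ℕ
        vols j = vol N (pow pt (size (target j)))
        step₁ : ∃ λ j → V ≤ g * dens * homs j
        step₁ = avg {g} V (λ j → g * dens * homs j) g≥1
          (≤-trans (*-monoʳ-≤ g homs-dense) (≤-reflexive (trans (sym (*-assoc g dens (sumFin homs))) (sym (∑-*ˡ (g * dens) homs)))))
        j = proj₁ step₁
        step₂ : ∃ λ h → V ≤ vols j * (g * dens) * count j h
        step₂ = avgˢ {N} (pow pt (size (target j))) V (λ h → vols j * (g * dens) * count j h) N≥1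
          (≤-trans (*-monoʳ-≤ (vols j) (proj₂ step₁)) (≤-reflexive (trans (sym (*-assoc (vols j) (g * dens) (homs j)))
            (sym (∑ˢ-*ˡ (pow pt (size (target j))) (vols j * (g * dens)) (count j))))))
        h = proj₁ step₂
        le′ = proj₂ step₂

      dens≥1 : ∀ j → 1 ≤ densAt j
      dens≥1 j = subst (1 ≤_) (sym (densAt-def j)) (*-mono-≤ {1} {vol N (pow pt (size (target j)))} {1} {g * dens} (vol-pos N≥1 (pow pt (size (target j))))
        (*-mono-≤ {1} {g} {1} {dens} g≥1 (subst (1 ≤_) (sym dens-def) (*-mono-≤ {1} {2} {1} {tupK E r depth} (s≤s {0} {1} z≤n) (kk≥1 far e≥1 n≥1 depth)))))

      contains : (∀ j → 1 ≤ j → j ≤ g → Hom H (K s ⊕ F j)) →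
        Σ (Fin (size H) → Fin n) λ φ → (∀ {x y} → φ x ≡ φ y → x ≡ y) × (∀ x y → Edge H x y → adj (φ x) (φ y) ≡ true)
      contains homs = blow-up X G (target j) (proj₁ (proj₂ popular)) H (densAt j) (dens≥1 j)
          (≤-trans (n₀-large j) n≥n₀) n≥1 (proj₂ (proj₂ popular)) (homs (suc (toℕ j)) (s≤s z≤n) (toℕ<n j))
        where j = proj₁ popular

-- The upper bound for the threshold.

module Upper where
  open import Defs hiding (_//_)
  open Sums
  open Graphs using (Gr; ∧-true)
  open Rationals
  open Structural using (module Homs)
  open Sampling using (module Parameters)
  open Testing using (module Tester)
  open import Data.Bool.Properties using (∨-comm)
  open import Data.Product using (map₂)

  ≡ᵇ-sym : ∀ a b → (a ≡ᵇ b) ≡ (b ≡ᵇ a)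
  ≡ᵇ-sym zero    zero    = refl
  ≡ᵇ-sym zero    (suc b) = refl
  ≡ᵇ-sym (suc a) zero    = refl
  ≡ᵇ-sym (suc a) (suc b) = ≡ᵇ-sym a b

  ≡ᵇ-refl : ∀ a → (a ≡ᵇ a) ≡ true
  ≡ᵇ-refl zero    = refl
  ≡ᵇ-refl (suc a) = ≡ᵇ-refl a

  adjℕ-sym : ∀ G a b → adjℕ G a b ≡ adjℕ G b a
  adjℕ-sym G a b = cong₂ _∧_ (cong not (≡ᵇ-sym a b)) (∨-comm (rel G a b) (rel G b a))

  adjℕ-irr : ∀ G a → adjℕ G a a ≡ false
  adjℕ-irr G a rewrite ≡ᵇ-refl a = refl

  graph : (G : Graph) → Gr (size G)
  graph G = record { adj = Adj G ; adj-sym = λ i j → adjℕ-sym G (toℕ i) (toℕ j) ; adj-irr = λ i → adjℕ-irr G (toℕ i) }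

  cons : ∀ {n} {A : Set} → A → (Fin n → A) → Fin (suc n) → A
  cons x f zero    = x
  cons x f (suc i) = f i

  -- Functions are searched value by value, so P has to respect pointwise equality in place of
  -- function extensionality.
  anyFun? : ∀ {n r} {P : (Fin n → Fin r) → Set} → (∀ {f f′} → (∀ i → f i ≡ f′ i) → P f → P f′) → (∀ f → Dec (P f)) → Dec (∃ P)
  anyFun? {zero} ext P? with P? (λ ())
  ... | yes p = yes (_ , p)
  ... | no ¬p = no λ { (f , p) → ¬p (ext (λ ()) p) }
  anyFun? {suc n} {r} {P} ext P? with any? (λ x → anyFun? {n} {r} {λ f → P (cons x f)} (λ e → ext λ { zero → refl ; (suc i) → e i }) (λ f → P? (cons x f)))
  ... | yes (x , f , p) = yes (cons x f , p)
  ... | no ¬p = no λ { (f , p) → ¬p (f zero , f ∘ suc , ext (λ { zero → refl ; (suc i) → refl }) p) }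

  monoEdges-cong : ∀ {r} G {f f′ : Fin (size G) → Fin r} → (∀ i → f i ≡ f′ i) → monoEdges G f ≡ monoEdges G f′
  monoEdges-cong {r} G {f} {f′} e = ∑-cong λ i → trans (countTrue≡# (mono f i)) (trans (∑-cong {f = λ j → 𝟙 (mono f i j)} λ j →
      cong 𝟙 (cong₂ (λ x y → (toℕ i <ᵇ toℕ j) ∧ Adj G i j ∧ ⌊ x ≟ᶠ y ⌋) (e i) (e j))) (sym (countTrue≡# (mono f′ i))))
    where
    mono : (Fin (size G) → Fin r) → Fin (size G) → Fin (size G) → Bool
    mono f i j = (toℕ i <ᵇ toℕ j) ∧ Adj G i j ∧ ⌊ f i ≟ᶠ f j ⌋

  few-or-many : ∀ r G e → (Σ (Fin (size G) → Fin r) λ f → e * monoEdges G f ≤ size G * size G) ⊎ (∀ f → size G * size G < e * monoEdges {r} G f)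
  few-or-many r G e with anyFun? {size G} {r} {λ f → e * monoEdges G f ≤ size G * size G}
        (λ {f} {f′} ex l → subst (λ z → e * z ≤ size G * size G) (monoEdges-cong G ex) l) (λ f → e * monoEdges G f ≤? size G * size G)
  ... | yes few = inj₁ few
  ... | no none = inj₂ λ f → ≰⇒> λ l → none (f , l)

  upper-ℕ : ∀ s g H k e → 1 ≤ g → g ≤ 11 → 1 ≤ k → 1 ≤ e → (∀ j → 1 ≤ j → j ≤ g → Hom H (K s ⊕ F j)) →
    ∃ λ n₀ → ∀ G → n₀ ≤ size G → Free H G →
      (∀ v → (cNum g + (2 + s) * cDen g) * k * # (λ u → not (Adj G v u)) + size G ≤ k * cDen g * size G) →
      Σ (Fin (size G) → Fin (3 + s)) λ f → e * monoEdges G f ≤ size G * size G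
  upper-ℕ s g H k e g≥1 g≤11 k≥1 e≥1 homs = n₀ , λ G large free degrees → [ (λ few → few) , (λ many →
      ⊥-elim (free (Main.contains g≥1 g≤11 e≥1 k≥1 large (graph G)
        (λ v → subst (λ z → z * k * # (λ u → not (Adj G v u)) + size G ≤ k * cDen g * size G) D≡ (degrees v))
        (λ f → ≤-trans (many f) (*-monoʳ-≤ e (mono≤ G f))) homs))) ]′ (few-or-many (3 + s) G e)
    where
    open Parameters s g e k H using (n₀; module Main)
    D≡ : cNum g + (2 + s) * cDen g ≡ cDen g * (2 + s) + cNum g
    D≡ = trans (+-comm (cNum g) ((2 + s) * cDen g)) (cong (_+ cNum g) (*-comm (2 + s) (cDen g)))
    mono≤ : ∀ G f → monoEdges G f ≤ Tester.monoPairs (graph G) (2 + s) e f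
    mono≤ G f = ∑-mono λ i → ≤-trans (≤-reflexive (countTrue≡# (λ j → (toℕ i <ᵇ toℕ j) ∧ Adj G i j ∧ ⌊ f i ≟ᶠ f j ⌋)))
        (#-mono {p = λ j → (toℕ i <ᵇ toℕ j) ∧ Adj G i j ∧ ⌊ f i ≟ᶠ f j ⌋} {q = λ j → Adj G i j ∧ ⌊ f i ≟ᶠ f j ⌋} λ j e → proj₂ (∧-true {toℕ i <ᵇ toℕ j} e))

  cDen-pos : ∀ g → 1 ≤ g → g ≤ 11 → 1 ≤ cDen g
  cDen-pos g g≥1 g≤11 = proj₂ (Homs.seventh (graph (K 0)) g g≥1 g≤11)

  upper : ∀ s g H → 1 ≤ g → g ≤ 11 → (∀ j → 1 ≤ j → j ≤ g → Hom H (K s ⊕ F j)) → DeltaLe H (3 + s) (bnd (3 + s) (cNum g) (cDen g))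
  upper s g H g≥1 g≤11 homs c x<c η η>0 = go (strict-slack {D} {q} {c} D≥1 x<c) (denominator-of η η>0)
    where
    q = cDen g
    D = cNum g + (2 + s) * q
    D≥1 : 1 ≤ D
    D≥1 = ≤-trans (cDen-pos g g≥1 g≤11) (≤-trans (m≤m+n q ((1 + s) * q)) (m≤n+m ((2 + s) * q) (cNum g)))
    Goal : Set
    Goal = ∃ λ n₀ → ∀ (G : Graph) → n₀ ≤ size G → Free H G → (∀ v → c ℚ.* ℕtoℚ (size G) ℚ.≤ ℕtoℚ (degree G v)) →
      Σ (Fin (size G) → Fin (3 + s)) λ f → ℕtoℚ (monoEdges G f) ℚ.≤ η ℚ.* ℕtoℚ (size G * size G)
    go : (∃ λ k → 1 ≤ k × (∀ n d m → d + m ≡ n → c ℚ.* ℕtoℚ n ℚ.≤ ℕtoℚ d → D * k * m + n ≤ k * q * n)) →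
         (∃ λ e → 1 ≤ e × (∀ M N → e * M ≤ N → ℕtoℚ M ℚ.≤ η ℚ.* ℕtoℚ N)) → Goal
    go (k , k≥1 , slack) (e , e≥1 , fine) = proj₁ bound , λ G large free degrees →
        map₂ (λ {f} → fine (monoEdges G f) (size G * size G))
          (proj₂ bound G large free λ v → slack (size G) (degree G v) (# (λ u → not (Adj G v u)))
            (trans (cong (_+ # (λ u → not (Adj G v u))) (countTrue≡# (Adj G v))) (#-complement (Adj G v))) (degrees v))
      where
      bound = upper-ℕ s g H k e g≥1 g≤11 k≥1 e≥1 homs

-- Blow-ups and the lower bound for the threshold.

module Lower where
  open import Defs
  open Sums
  open Graphs using (∧-intro; absurd)
  open Certificates using (≡ᵇ-true)
  open Shapes using (avg)
  open Rationals
  open Upper using (adjℕ-sym; adjℕ-irr)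
  open import Data.Bool.Properties using (∨-idem)
  open import Relation.Binary.Definitions using (tri<; tri≈; tri>)
  open import Data.Fin using (combine; quotient; punchOut)
  open import Data.Fin.Properties using (fromℕ<-toℕ; toℕ-↑ˡ; toℕ-↑ʳ; remQuot-combine; combine-monoˡ-<; join-splitAt; punchOut-injective)

  <ᵇ-intro : ∀ {a b} → a < b → (a <ᵇ b) ≡ true
  <ᵇ-intro {a} {b} l with a <ᵇ b | <⇒<ᵇ l
  ... | true | _ = refl

  adjℕ-proper : ∀ G → (∀ x y → rel G x y ≡ rel G y x) → (∀ x → rel G x x ≡ false) → ∀ x y → adjℕ G x y ≡ rel G x y
  adjℕ-proper G symm irr x y with x ≡ᵇ y in e
  ... | true  = sym (trans (cong (rel G x) (sym (≡ᵇ-true e))) (irr x))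
  ... | false = trans (cong (rel G x y ∨_) (symm y x)) (∨-idem (rel G x y))

  extend : ∀ {n} → (Fin n → Fin n → Bool) → ℕ → ℕ → Bool
  extend {n} adj x y with x <? n | y <? n
  ... | yes p | yes q = adj (fromℕ< p) (fromℕ< q)
  ... | yes p | no _  = false
  ... | no _  | _     = false

  extend-sym : ∀ {n} {adj : Fin n → Fin n → Bool} → (∀ i j → adj i j ≡ adj j i) → ∀ x y → extend adj x y ≡ extend adj y x
  extend-sym {n} s x y with x <? n | y <? n
  ... | yes p | yes q = s (fromℕ< p) (fromℕ< q)
  ... | yes p | no _  = refl
  ... | no _  | yes q = refl
  ... | no _  | no _  = refl

  extend-irr : ∀ {n} {adj : Fin n → Fin n → Bool} → (∀ i → adj i i ≡ false) → ∀ x → extend adj x x ≡ false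
  extend-irr {n} h x with x <? n
  ... | yes p = h (fromℕ< p)
  ... | no _  = refl

  extend-toℕ : ∀ {n} (adj : Fin n → Fin n → Bool) i j → extend adj (toℕ i) (toℕ j) ≡ adj i j
  extend-toℕ {n} adj i j with toℕ i <? n | toℕ j <? n
  ... | yes p | yes q = cong₂ adj (fromℕ<-toℕ i p) (fromℕ<-toℕ j q)
  ... | yes p | no ¬q = ⊥-elim (¬q (toℕ<n j))
  ... | no ¬p | _     = ⊥-elim (¬p (toℕ<n i))

  -- The blow-up of T in which vertex a is replaced by the fibre of ψ over a, an independent set.
  pull : ∀ {n} (T : Graph) → (Fin n → Fin (size T)) → Graph
  pull {n} T ψ = record { size = n ; rel = extend (λ i j → Adj T (ψ i) (ψ j)) }

  pull-adj : ∀ {n} T (ψ : Fin n → Fin (size T)) i j → Adj (pull T ψ) i j ≡ Adj T (ψ i) (ψ j)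
  pull-adj T ψ i j = trans (adjℕ-proper (pull T ψ) (extend-sym {adj = λ i j → Adj T (ψ i) (ψ j)} λ i j → adjℕ-sym T (toℕ (ψ i)) (toℕ (ψ j)))
    (extend-irr {adj = λ i j → Adj T (ψ i) (ψ j)} λ i → adjℕ-irr T (toℕ (ψ i))) (toℕ i) (toℕ j)) (extend-toℕ (λ i j → Adj T (ψ i) (ψ j)) i j)

  pull-hom : ∀ {n} T (ψ : Fin n → Fin (size T)) → Hom (pull T ψ) T
  pull-hom T ψ = ψ , λ i j e → trans (sym (pull-adj T ψ i j)) e

  Hom-trans : ∀ A {B C} → Hom A B → Hom B C → Hom A C
  Hom-trans A (φ , φ-edges) (ψ , ψ-edges) = ψ ∘ φ , λ i j e → ψ-edges (φ i) (φ j) (φ-edges i j e)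

  Hom-colour : ∀ {A B r} → Hom A B → Colourable B r → Colourable A r
  Hom-colour (φ , edges) (f , proper) = f ∘ φ , λ i j e → proper (φ i) (φ j) (edges i j e)

  ∑-combine : ∀ t L (f : Fin (t * L) → ℕ) → sumFin f ≡ sumFin {t} λ a → sumFin {L} λ i → f (combine a i)
  ∑-combine zero    L f = refl
  ∑-combine (suc t) L f = trans (∑-split L (t * L) f) (cong (sumFin (λ i → f (i ↑ˡ (t * L))) +_) (∑-combine t L (λ z → f (L ↑ʳ z))))

  -- The order of a and b is recorded because `monoEdges` counts a pair at its smaller index;
  -- `combine` respects the order of the parts.
  clash? : ∀ {r} T (c : Fin (size T) → Fin r) → ¬ Colourable T r → ∃ λ a → ∃ λ b → toℕ a < toℕ b × Edge T a b × c a ≡ c b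
  clash? T c uncol with any? (λ a → any? λ b → (toℕ a <? toℕ b) ×-dec (Adj T a b ≟ᵇ true) ×-dec (c a ≟ᶠ c b))
  ... | yes (a , b , h) = a , b , h
  ... | no none = ⊥-elim (uncol (c , proper))
    where
    proper : ∀ i j → Edge T i j → ¬ c i ≡ c j
    proper i j e eq with <-cmp (toℕ i) (toℕ j)
    ... | tri< l _ _ = none (i , j , l , e , eq)
    ... | tri≈ _ q _ = absurd e (trans (cong (adjℕ T (toℕ i)) (sym q)) (adjℕ-irr T (toℕ i)))
    ... | tri> _ _ l = none (j , i , l , trans (adjℕ-sym T (toℕ j) (toℕ i)) e , sym eq)

  ⌊⌋-true : ∀ {P : Set} (d : Dec P) → P → ⌊ d ⌋ ≡ true
  ⌊⌋-true (yes _) _ = refl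
  ⌊⌋-true (no ¬p) p = ⊥-elim (¬p p)

  module BlowUp (T : Graph) (L : ℕ) where
    t n : ℕ
    t = size T
    n = t * L

    cell : Fin n → Fin t
    cell = quotient {t} L

    G : Graph
    G = pull T cell

    cell-combine : ∀ a i → cell (combine a i) ≡ a
    cell-combine a i = cong proj₁ (remQuot-combine {t} {L} a i)

    misses : ∀ {m} → (∀ a → # (λ b → not (Adj T a b)) ≤ m) → ∀ v → # (λ u → not (Adj G v u)) ≤ L * m
    misses {m} light v = begin
      # (λ u → not (Adj G v u)) ≡⟨ ∑-combine t L (λ u → 𝟙 (not (Adj G v u))) ⟩
      sumFin {t} (λ b → sumFin {L} λ i → 𝟙 (not (Adj G v (combine b i)))) ≡⟨ ∑-cong {t} {λ b → sumFin {L} λ i → 𝟙 (not (Adj G v (combine b i)))} (λ b →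
        trans (∑-cong {f = λ i → 𝟙 (not (Adj G v (combine b i)))} λ i → cong (𝟙 ∘ not) (trans (pull-adj T cell v (combine b i)) (cong (Adj T (cell v)) (cell-combine b i))))
              (∑-const L (𝟙 (not (Adj T (cell v) b))))) ⟩
      sumFin (λ b → L * 𝟙 (not (Adj T (cell v) b))) ≡⟨ ∑-*ˡ L (λ b → 𝟙 (not (Adj T (cell v) b))) ⟩
      L * # (λ b → not (Adj T (cell v) b)) ≤⟨ *-monoʳ-≤ L (light (cell v)) ⟩
      L * m ∎
      where open ≤-Reasoning

    monochromatic : ∀ {r N} → 1 ≤ r → L ≡ r * N → ¬ Colourable T r → (f : Fin n → Fin r) → N * N ≤ monoEdges G f
    monochromatic {r} {N} r≥1 L≡ uncol f = conclude (clash? T (λ a → proj₁ (popular a)) uncol)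
      where
      share : Fin t → Fin r → ℕ
      share a x = sumFin {L} λ i → 𝟙 ⌊ x ≟ᶠ f (combine a i) ⌋
      popular : ∀ a → ∃ λ x → N ≤ share a x
      popular a = avg {r} N (share a) r≥1 (≤-reflexive (sym (trans (∑-swap (λ x i → 𝟙 ⌊ x ≟ᶠ f (combine a i) ⌋))
        (trans (∑-cong {f = λ i → sumFin {r} λ x → 𝟙 ⌊ x ≟ᶠ f (combine a i) ⌋} λ i → ∑-spike (f (combine a i))) (trans (∑-const L 1) (trans (*-identityʳ L) L≡))))))
      mono : Fin n → Fin n → Bool
      mono i j = (toℕ i <ᵇ toℕ j) ∧ Adj G i j ∧ ⌊ f i ≟ᶠ f j ⌋
      conclude : (∃ λ a → ∃ λ b → toℕ a < toℕ b × Edge T a b × proj₁ (popular a) ≡ proj₁ (popular b)) → N * N ≤ monoEdges G f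
      conclude (a , b , a<b , edge , same) = begin
        N * N ≤⟨ *-monoˡ-≤ N (proj₂ (popular a)) ⟩
        share a x * N ≡⟨ sym (∑-*ʳ (λ i → 𝟙 ⌊ x ≟ᶠ f (combine a i) ⌋) N) ⟩
        sumFin {L} (λ i → 𝟙 ⌊ x ≟ᶠ f (combine a i) ⌋ * N) ≤⟨ ∑-mono {f = λ i → 𝟙 ⌊ x ≟ᶠ f (combine a i) ⌋ * N} row ⟩
        sumFin {L} (λ i → # (mono (combine a i))) ≤⟨ ∑-term (λ a → sumFin {L} λ i → # (mono (combine a i))) a ⟩
        sumFin {t} (λ a → sumFin {L} λ i → # (mono (combine a i))) ≡⟨ sym (∑-combine t L (λ u → # (mono u))) ⟩
        sumFin (λ u → # (mono u)) ≡⟨ ∑-cong {f = λ u → # (mono u)} (λ u → sym (countTrue≡# (mono u))) ⟩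
        monoEdges G f ∎
        where
        open ≤-Reasoning
        x = proj₁ (popular a)
        mono-true : ∀ i j → x ≡ f (combine a i) → x ≡ f (combine b j) → mono (combine a i) (combine b j) ≡ true
        mono-true i j e e′ = ∧-intro (<ᵇ-intro (combine-monoˡ-< i j a<b)) (∧-intro
          (trans (pull-adj T cell (combine a i) (combine b j)) (trans (cong₂ (Adj T) (cell-combine a i) (cell-combine b j)) edge))
          (⌊⌋-true (f (combine a i) ≟ᶠ f (combine b j)) (trans (sym e) e′)))
        entry : ∀ i → x ≡ f (combine a i) → ∀ j → 𝟙 ⌊ x ≟ᶠ f (combine b j) ⌋ ≤ 𝟙 (mono (combine a i) (combine b j))
        entry i e j with x ≟ᶠ f (combine b j)
        ... | no _ = z≤n
        ... | yes e′ = ≤-reflexive (cong 𝟙 (sym (mono-true i j e e′)))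
        row : ∀ i → 𝟙 ⌊ x ≟ᶠ f (combine a i) ⌋ * N ≤ # (mono (combine a i))
        row i with x ≟ᶠ f (combine a i)
        ... | no _ = z≤n
        ... | yes e = begin
          N + 0 ≡⟨ +-identityʳ N ⟩
          N ≤⟨ proj₂ (popular b) ⟩
          share b (proj₁ (popular b)) ≡⟨ cong (share b) (sym same) ⟩
          share b x ≤⟨ ∑-mono (entry i e) ⟩
          sumFin {L} (λ j → 𝟙 (mono (combine a i) (combine b j))) ≤⟨ ∑-term (λ b → sumFin {L} λ j → 𝟙 (mono (combine a i) (combine b j))) b ⟩
          sumFin {t} (λ b → sumFin {L} λ j → 𝟙 (mono (combine a i) (combine b j))) ≡⟨ sym (∑-combine t L (λ u → 𝟙 (mono (combine a i) u))) ⟩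
          # (mono (combine a i)) ∎

  -- `ratio` bounds the missed share m/|T| by q/D + 1/(D·k), just what `tolerance` permits.
  record Obstruction (H : Graph) (r D q k : ℕ) : Set where
    field
      T      : Graph
      no-hom : ¬ Hom H T
      uncol  : ¬ Colourable T r
      m      : ℕ
      light  : ∀ a → # (λ b → not (Adj T a b)) ≤ m
      ratio  : D * k * m ≤ k * q * size T + size T

  uncol⇒size≥1 : ∀ {r} T → ¬ Colourable T r → 1 ≤ size T
  uncol⇒size≥1 T uncol = n≢0⇒n>0 λ e → uncol ((λ i → ⊥-elim (empty e i)) , λ i → ⊥-elim (empty e i))
    where
    empty : size T ≡ 0 → ¬ Fin (size T)
    empty e i = n≮0 (subst (toℕ i <_) e (toℕ<n i))

  obstruction⇒DeltaGe : ∀ H r D q → 1 ≤ r → 1 ≤ D → (∀ k → 1 ≤ k → Obstruction H r D q k) → DeltaGe H r (ℚ.1ℚ ℚ.- (q // D))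
  obstruction⇒DeltaGe H r D q r≥1 D≥1 obstruct c c<x works = go (tolerance {D} {q} {c} D≥1 c<x)
    where
    go : (∃ λ k → 1 ≤ k × (∀ n d m → d + m ≡ n → D * k * m ≤ k * q * n + n → c ℚ.* ℕtoℚ n ℚ.≤ ℕtoℚ d)) → ⊥
    go (k , k≥1 , tol) = finish (works (1 // E) (//-mono-< {0} {1} {1} {E} ≤-refl (s≤s z≤n) (s≤s z≤n)))
      where
      open Obstruction (obstruct k k≥1)
      t E : ℕ
      t = size T
      -- Chosen before n₀ is known: the blow-up has n = t·r·N vertices, so n²/E < N², fewer than the
      -- forced monochromatic edges.
      E = suc (r * r * (t * t))
      t≥1 : 1 ≤ t
      t≥1 = uncol⇒size≥1 T uncol
      finish : (∃ λ n₀ → ∀ (G : Graph) → n₀ ≤ size G → Free H G → (∀ v → c ℚ.* ℕtoℚ (size G) ℚ.≤ ℕtoℚ (degree G v)) →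
        Σ (Fin (size G) → Fin r) λ f → ℕtoℚ (monoEdges G f) ℚ.≤ (1 // E) ℚ.* ℕtoℚ (size G * size G)) → ⊥
      finish (n₀ , sparse) = contra (sparse G large free degrees)
        where
        N L : ℕ
        N = suc n₀
        L = r * N
        open BlowUp T L using (G; n; cell; misses; monochromatic)
        large : n₀ ≤ n
        large = ≤-trans (n≤1+n n₀) (≤-trans (≤-reflexive (sym (*-identityˡ N))) (≤-trans (*-monoˡ-≤ N r≥1)
          (≤-trans (≤-reflexive (sym (*-identityˡ L))) (*-monoˡ-≤ L t≥1))))
        free : Free H G
        free (φ , _ , edges) = no-hom (Hom-trans H {G} {T} (φ , edges) (pull-hom T cell))
        degrees : ∀ v → c ℚ.* ℕtoℚ n ℚ.≤ ℕtoℚ (degree G v)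
        degrees v = tol n (degree G v) miss (trans (cong (_+ miss) (countTrue≡# (Adj G v))) (#-complement (Adj G v))) (begin
          D * k * miss ≤⟨ *-monoʳ-≤ (D * k) (misses light v) ⟩
          D * k * (L * m) ≡⟨ l₁ D k L m ⟩
          L * (D * k * m) ≤⟨ *-monoʳ-≤ L ratio ⟩
          L * (k * q * t + t) ≡⟨ l₂ L k q t ⟩
          k * q * (t * L) + t * L ∎)
          where
          open ≤-Reasoning
          miss = # (λ u → not (Adj G v u))
          l₁ : ∀ D k L m → D * k * (L * m) ≡ L * (D * k * m)
          l₁ = solve-∀
          l₂ : ∀ L k q t → L * (k * q * t + t) ≡ k * q * (t * L) + t * L
          l₂ = solve-∀
        contra : (Σ (Fin n → Fin r) λ f → ℕtoℚ (monoEdges G f) ℚ.≤ (1 // E) ℚ.* ℕtoℚ (n * n)) → ⊥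
        contra (f , few) = <⇒≱ (m<n+m (r * r * (t * t) * (N * N)) (s≤s z≤n)) (begin
          E * (N * N) ≤⟨ *-monoʳ-≤ E (monochromatic r≥1 refl uncol f) ⟩
          E * monoEdges G f ≤⟨ //-bound E (monoEdges G f) (n * n) (s≤s z≤n) few ⟩
          t * (r * N) * (t * (r * N)) ≡⟨ l t r N ⟩
          r * r * (t * t) * (N * N) ∎)
          where
          open ≤-Reasoning
          l : ∀ t r N → t * (r * N) * (t * (r * N)) ≡ r * r * (t * t) * (N * N)
          l = solve-∀

  module _ (A B : Graph) where
    ⊕-adj : ∀ x y → adjℕ (A ⊕ B) x y ≡ rel (A ⊕ B) x y
    ⊕-adj = adjℕ-proper (A ⊕ B) symm irr
      where
      symm : ∀ x y → rel (A ⊕ B) x y ≡ rel (A ⊕ B) y x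
      symm x y with x <ᵇ size A | y <ᵇ size A
      ... | true  | true  = adjℕ-sym A x y
      ... | true  | false = refl
      ... | false | true  = refl
      ... | false | false = adjℕ-sym B (x ∸ size A) (y ∸ size A)
      irr : ∀ x → rel (A ⊕ B) x x ≡ false
      irr x with x <ᵇ size A
      ... | true  = adjℕ-irr A x
      ... | false = adjℕ-irr B (x ∸ size A)

    private
      low : ∀ (i : Fin (size A)) → (toℕ (i ↑ˡ size B) <ᵇ size A) ≡ true
      low i rewrite toℕ-↑ˡ i (size B) = <ᵇ-intro (toℕ<n i)
      high : ∀ (j : Fin (size B)) → (toℕ (size A ↑ʳ j) <ᵇ size A) ≡ false
      high j rewrite toℕ-↑ʳ (size A) j = go (size A)
        where
        go : ∀ a → (a + toℕ j <ᵇ a) ≡ false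
        go zero    = refl
        go (suc a) = go a

    ⊕-ll : ∀ i j → Adj (A ⊕ B) (i ↑ˡ size B) (j ↑ˡ size B) ≡ Adj A i j
    ⊕-ll i j rewrite ⊕-adj (toℕ (i ↑ˡ size B)) (toℕ (j ↑ˡ size B)) | low i | low j = cong₂ (adjℕ A) (toℕ-↑ˡ i (size B)) (toℕ-↑ˡ j (size B))

    ⊕-lr : ∀ i j → Adj (A ⊕ B) (i ↑ˡ size B) (size A ↑ʳ j) ≡ true
    ⊕-lr i j rewrite ⊕-adj (toℕ (i ↑ˡ size B)) (toℕ (size A ↑ʳ j)) | low i | high j = refl

    ⊕-rl : ∀ i j → Adj (A ⊕ B) (size A ↑ʳ i) (j ↑ˡ size B) ≡ true
    ⊕-rl i j = trans (adjℕ-sym (A ⊕ B) (toℕ (size A ↑ʳ i)) (toℕ (j ↑ˡ size B))) (⊕-lr j i)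

    ⊕-rr : ∀ i j → Adj (A ⊕ B) (size A ↑ʳ i) (size A ↑ʳ j) ≡ Adj B i j
    ⊕-rr i j rewrite ⊕-adj (toℕ (size A ↑ʳ i)) (toℕ (size A ↑ʳ j)) | high i | high j =
      cong₂ (adjℕ B) (drop i) (drop j)
      where
      drop : ∀ i → toℕ (size A ↑ʳ i) ∸ size A ≡ toℕ i
      drop i = trans (cong (_∸ size A) (toℕ-↑ʳ (size A) i)) (m+n∸m≡n (size A) (toℕ i))

    ⊕-uncolourable : ∀ {r} → 1 ≤ size A → ¬ Colourable B r → ¬ Colourable (A ⊕ B) (suc r)
    ⊕-uncolourable {r} A≥1 uncol (f , proper) = uncol (f′ , λ i j e eq →
        proper (size A ↑ʳ i) (size A ↑ʳ j) (trans (⊕-rr i j) e) (punchOut-injective (apart i) (apart j) eq))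
      where
      v : Fin (size A)
      v = fromℕ< A≥1
      apart : ∀ j → ¬ f (v ↑ˡ size B) ≡ f (size A ↑ʳ j)
      apart j = proper (v ↑ˡ size B) (size A ↑ʳ j) (⊕-lr v j)
      f′ : Fin (size B) → Fin r
      f′ j = punchOut (apart j)

  Indep : ℕ → Graph
  Indep m = record { size = m ; rel = λ _ _ → false }

  -- The clique of size s blown up with parts of size m, joined to G. A clique vertex misses exactly
  -- its own part.
  cones : ℕ → ℕ → Graph → Graph
  cones zero    m G = G
  cones (suc s) m G = Indep m ⊕ cones s m G

  cones-size : ∀ s m G → size (cones s m G) ≡ s * m + size G
  cones-size zero    m G = refl
  cones-size (suc s) m G = trans (cong (m +_) (cones-size s m G)) (sym (+-assoc m (s * m) (size G)))

  cones-uncolourable : ∀ s {m r} G → 1 ≤ m → ¬ Colourable G r → ¬ Colourable (cones s m G) (s + r)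
  cones-uncolourable zero    G m≥1 uncol = uncol
  cones-uncolourable (suc s) {m} G m≥1 uncol = ⊕-uncolourable (Indep m) (cones s m G) m≥1 (cones-uncolourable s G m≥1 uncol)

  split-elim : ∀ {m n} (P : Fin (m + n) → Set) → (∀ i → P (i ↑ˡ n)) → (∀ j → P (m ↑ʳ j)) → ∀ x → P x
  split-elim {m} {n} P l r x with splitAt m x | join-splitAt m n x
  ... | inj₁ i | e = subst P e (l i)
  ... | inj₂ j | e = subst P e (r j)

  cones-light : ∀ s {m} G → (∀ a → # (λ b → not (Adj G a b)) ≤ m) → ∀ a → # (λ b → not (Adj (cones s m G) a b)) ≤ m
  cones-light zero    G light = light
  cones-light (suc s) {m} G light = split-elim (λ a → # (λ b → not (Adj (Indep m ⊕ T) a b)) ≤ m)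
    (λ i → ≤-trans (≤-reflexive (∑-split m (size T) (λ b → 𝟙 (not (Adj (Indep m ⊕ T) (i ↑ˡ size T) b)))))
      (≤-trans (+-mono-≤ (#-≤n (λ b → not (Adj (Indep m ⊕ T) (i ↑ˡ size T) (b ↑ˡ size T))))
          (≤-reflexive (trans (∑-cong {f = λ b → 𝟙 (not (Adj (Indep m ⊕ T) (i ↑ˡ size T) (m ↑ʳ b)))} λ b → cong (𝟙 ∘ not) (⊕-lr (Indep m) T i b)) (∑-zero (size T)))))
        (≤-reflexive (+-identityʳ m))))
    (λ j → ≤-trans (≤-reflexive (∑-split m (size T) (λ b → 𝟙 (not (Adj (Indep m ⊕ T) (m ↑ʳ j) b)))))
      (≤-trans (≤-reflexive (cong₂ _+_
          (trans (∑-cong {f = λ b → 𝟙 (not (Adj (Indep m ⊕ T) (m ↑ʳ j) (b ↑ˡ size T)))} λ b → cong (𝟙 ∘ not) (⊕-rl (Indep m) T j b)) (∑-zero m))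
          (∑-cong {f = λ b → 𝟙 (not (Adj (Indep m ⊕ T) (m ↑ʳ j) (m ↑ʳ b)))} λ b → cong (𝟙 ∘ not) (⊕-rr (Indep m) T j b))))
        (cones-light s G light j)))
    where T = cones s m G

  cones-hom : ∀ s {m} G B → Hom G B → Hom (cones s m G) (K s ⊕ B)
  cones-hom zero    G B (φ , edges) = φ , λ i j e → trans (⊕-rr (K 0) B (φ i) (φ j)) (edges i j e)
  cones-hom (suc s) {m} G B h = ψ , split-elim (λ x → ∀ y → Edge (Indep m ⊕ T) x y → Edge (K (suc s) ⊕ B) (ψ x) (ψ y))
      (λ i → split-elim (λ y → Edge (Indep m ⊕ T) (i ↑ˡ size T) y → Edge (K (suc s) ⊕ B) (ψ (i ↑ˡ size T)) (ψ y))
        (λ j e → absurd (trans (sym (⊕-ll (Indep m) T i j)) e) (Indep-adj i j))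
        (λ j e → subst₂ (Edge (K (suc s) ⊕ B)) (sym (ψ-l i)) (sym (ψ-r j)) (apex (φ j))))
      (λ i → split-elim (λ y → Edge (Indep m ⊕ T) (m ↑ʳ i) y → Edge (K (suc s) ⊕ B) (ψ (m ↑ʳ i)) (ψ y))
        (λ j e → subst₂ (Edge (K (suc s) ⊕ B)) (sym (ψ-r i)) (sym (ψ-l j)) (trans (adjℕ-sym (K (suc s) ⊕ B) (suc (toℕ (φ i))) 0) (apex (φ i))))
        (λ j e → subst₂ (Edge (K (suc s) ⊕ B)) (sym (ψ-r i)) (sym (ψ-r j)) (proj₂ rest i j (trans (sym (⊕-rr (Indep m) T i j)) e))))
    where
    T = cones s m G
    rest = cones-hom s {m} G B h
    φ = proj₁ rest
    ψ : Fin (m + size T) → Fin (suc (s + size B))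
    ψ x = [ (λ _ → zero) , (λ j → suc (φ j)) ]′ (splitAt m x)
    ψ-l : ∀ i → ψ (i ↑ˡ size T) ≡ zero
    ψ-l i rewrite splitAt-↑ˡ m i (size T) = refl
    ψ-r : ∀ j → ψ (m ↑ʳ j) ≡ suc (φ j)
    ψ-r j rewrite splitAt-↑ʳ m (size T) j = refl
    Indep-adj : ∀ i j → Adj (Indep m) i j ≡ false
    Indep-adj i j = adjℕ-proper (Indep m) (λ _ _ → refl) (λ _ → refl) (toℕ i) (toℕ j)
    apex : ∀ y → Edge (K (suc s) ⊕ B) zero (suc y)
    apex y with toℕ y <ᵇ s
    ... | true  = refl
    ... | false = refl

-- Weightings of the graphs `F g`.

module Weights where
  open import Defs
  open Sums
  open Certificates using (at; Edges; uncolourable₃; uncolourable₃⇒)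
  open Upper using (≡ᵇ-refl; cDen-pos)
  open Lower
  open import Data.Bool.Properties using (∨-zeroʳ)
  open import Data.Nat.DivMod using (_mod_)
  open import Data.Fin using (combine; quotient)
  open import Data.Fin.Properties using (toℕ-injective; toℕ-fromℕ<; remQuot-combine)
  open import Data.List using (length; filter; cartesianProduct; upTo; map; replicate; _++_)
  open import Data.List.Relation.Unary.All as All using (All)
  open import Data.List.Relation.Unary.All.Properties using (all-filter)
  open import Relation.Nullary.Decidable using (True; toWitness)
  open import Function using (id)

  isEdge? : ∀ G (e : ℕ × ℕ) → Dec (proj₁ e < size G × proj₂ e < size G × adjℕ G (proj₁ e) (proj₂ e) ≡ true)
  isEdge? G (a , b) = (a <? size G) ×-dec (b <? size G) ×-dec (adjℕ G a b ≟ᵇ true)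

  edgesOf : Graph → Edges
  edgesOf G = filter (isEdge? G) (cartesianProduct (upTo (size G)) (upTo (size G)))

  uncolourable₃-sound : ∀ G → uncolourable₃ (size G) (edgesOf G) [] 0 ≡ true → ¬ Colourable G 3
  uncolourable₃-sound G e (c , proper) = uncolourable₃⇒ (size G) (edgesOf G) 0 f f<3
      (All.map (λ {e} h → f-proper (proj₁ e) (proj₂ e) (proj₁ h) (proj₁ (proj₂ h)) (proj₂ (proj₂ h))) (all-filter (isEdge? G) (cartesianProduct (upTo (size G)) (upTo (size G))))) e
    where
    f : ℕ → ℕ
    f i with i <? size G
    ... | yes l = toℕ (c (fromℕ< l))
    ... | no _  = 0
    f<3 : ∀ i → f i < 3
    f<3 i with i <? size G
    ... | yes l = toℕ<n (c (fromℕ< l))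
    ... | no _  = s≤s z≤n
    f-proper : ∀ a b → a < size G → b < size G → adjℕ G a b ≡ true → ¬ f a ≡ f b
    f-proper a b la lb ed eq with a <? size G | b <? size G
    ... | yes l | yes l′ = proper (fromℕ< l) (fromℕ< l′) (trans (cong₂ (adjℕ G) (toℕ-fromℕ< l) (toℕ-fromℕ< l′)) ed) (toℕ-injective eq)
    ... | yes _ | no ¬l  = ¬l lb
    ... | no ¬l | _      = ¬l la

  -- A multiset of vertices of B (vertex a with multiplicity its weight) of which every vertex misses at most μ; p/q is the excess over 2μ, in units of μ.
  record Weighting (B : Graph) (p q : ℕ) : Set where
    field
      len μ    : ℕ
      cell     : Fin len → Fin (size B)
      light    : ∀ a → # (λ y → not (Adj B a (cell y))) ≤ μ
      ratio    : (p + 2 * q) * μ ≡ q * len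
      nonempty : 1 ≤ len
      uncol    : ¬ Colourable B 3

  weighting : ∀ B .{{_ : NonZero (size B)}} p q (cells : List ℕ) μ →
    True (all? λ a → # (λ (y : Fin (length cells)) → not (Adj B a (at cells (toℕ y) mod size B))) ≤? μ) →
    (p + 2 * q) * μ ≡ q * length cells → 1 ≤ length cells → ¬ Colourable B 3 → Weighting B p q
  weighting B p q cells μ light ratio nonempty uncol = record
    { len = length cells ; μ = μ ; cell = λ y → at cells (toℕ y) mod size B ; light = toWitness light
    ; ratio = ratio ; nonempty = nonempty ; uncol = uncol }

  -- Every weight is multiplied by b and increased by one, so that vertices of weight zero are not lost.
  module Perturbed {B : Graph} {p q : ℕ} (w : Weighting B p q) (b : ℕ) where
    open Weighting w

    t M : ℕ
    t = size B
    M = t + b * μ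

    place : Fin (t + len * b) → Fin t
    place x = [ id , (λ y → cell (quotient {len} b y)) ]′ (splitAt t x)

    place-l : ∀ a → place (a ↑ˡ (len * b)) ≡ a
    place-l a rewrite splitAt-↑ˡ t a (len * b) = refl

    place-r : ∀ y i → place (t ↑ʳ combine y i) ≡ cell y
    place-r y i rewrite splitAt-↑ʳ t (len * b) (combine y i) = cong cell (cong proj₁ (remQuot-combine {len} {b} y i))

    T : Graph
    T = pull B place

    T-uncol : ¬ Colourable T 3
    T-uncol c = uncol (Hom-colour {B} {T} ((λ a → a ↑ˡ (len * b)) , λ i j e →
      trans (pull-adj B place (i ↑ˡ (len * b)) (j ↑ˡ (len * b))) (trans (cong₂ (Adj B) (place-l i) (place-l j)) e)) c)

    T-light : ∀ v → # (λ u → not (Adj T v u)) ≤ M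
    T-light v = begin
      # (λ u → not (Adj T v u)) ≡⟨ ∑-split t (len * b) (λ u → 𝟙 (not (Adj T v u))) ⟩
      # (λ a → not (Adj T v (a ↑ˡ (len * b)))) + sumFin {len * b} (λ z → 𝟙 (not (Adj T v (t ↑ʳ z))))
        ≤⟨ +-mono-≤ (#-≤n (λ a → not (Adj T v (a ↑ˡ (len * b))))) (≤-reflexive (∑-combine len b (λ z → 𝟙 (not (Adj T v (t ↑ʳ z)))))) ⟩
      t + sumFin {len} (λ y → sumFin {b} λ i → 𝟙 (not (Adj T v (t ↑ʳ combine y i))))
        ≡⟨ cong (t +_) (∑-cong {len} {λ y → sumFin {b} λ i → 𝟙 (not (Adj T v (t ↑ʳ combine y i)))} λ y →
             trans (∑-cong {b} {λ i → 𝟙 (not (Adj T v (t ↑ʳ combine y i)))} λ i → cong (𝟙 ∘ not)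
               (trans (pull-adj B place v (t ↑ʳ combine y i)) (cong (Adj B (place v)) (place-r y i)))) (∑-const b (𝟙 (not (Adj B (place v) (cell y)))))) ⟩
      t + sumFin {len} (λ y → b * 𝟙 (not (Adj B (place v) (cell y)))) ≡⟨ cong (t +_) (∑-*ˡ b (λ y → 𝟙 (not (Adj B (place v) (cell y))))) ⟩
      t + b * # (λ y → not (Adj B (place v) (cell y))) ≤⟨ +-monoʳ-≤ t (*-monoʳ-≤ b (light (place v))) ⟩
      M ∎
      where open ≤-Reasoning

  weighted-obstruction : ∀ {B p q} s H → Weighting B p q → ¬ Hom H (K s ⊕ B) → ∀ k → Obstruction H (3 + s) (p + (2 + s) * q) q k
  weighted-obstruction {B} {p} {q} s H w ¬hom k = record
    { T = cones s M T
    ; no-hom = λ h → ¬hom (Hom-trans H {cones s M T} {K s ⊕ B} h (cones-hom s {M} T B (pull-hom B place)))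
    ; uncol = subst (λ z → ¬ Colourable (cones s M T) z) (+-comm s 3) (cones-uncolourable s T (≤-trans (uncol⇒size≥1 B uncol) (m≤m+n t (b * μ))) T-uncol)
    ; m = M
    ; light = cones-light s T T-light
    ; ratio = subst (λ z → (p + (2 + s) * q) * k * M ≤ k * q * z + z) (sym (cones-size s M T)) enough }
    where
    open Weighting w
    b : ℕ
    -- Increasing each weight by one costs k·(p + 2q)·|B|, which is b itself and thus within the
    -- tolerance `len * b`.
    b = k * (p + 2 * q) * size B
    open Perturbed w b using (T; M; t; place; T-uncol; T-light)
    enough : (p + (2 + s) * q) * k * M ≤ k * q * (s * M + (t + len * b)) + (s * M + (t + len * b))
    enough = begin
      (p + (2 + s) * q) * k * M ≡⟨ l₁ p q s k t b μ M ⟩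
      k * q * s * M + (p + 2 * q) * k * M ≡⟨ cong (k * q * s * M +_) (l₂ (p + 2 * q) k t b μ) ⟩
      k * q * s * M + (k * b * ((p + 2 * q) * μ) + b) ≡⟨ cong (λ z → k * q * s * M + (k * b * z + b)) ratio ⟩
      k * q * s * M + (k * b * (q * len) + b) ≤⟨ +-monoʳ-≤ (k * q * s * M) (+-monoʳ-≤ (k * b * (q * len)) (≤-trans (≤-reflexive (sym (*-identityˡ b))) (*-monoˡ-≤ b nonempty))) ⟩
      k * q * s * M + (k * b * (q * len) + len * b) ≤⟨ m≤m+n _ (k * q * t + (s * M + t)) ⟩
      k * q * s * M + (k * b * (q * len) + len * b) + (k * q * t + (s * M + t)) ≡⟨ l₃ k q s M t len b ⟩
      k * q * (s * M + (t + len * b)) + (s * M + (t + len * b)) ∎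
      where
      open ≤-Reasoning
      l₁ : ∀ p q s k t b μ M → (p + (2 + s) * q) * k * M ≡ k * q * s * M + (p + 2 * q) * k * M
      l₁ = solve-∀
      l₂ : ∀ P k t b μ → P * k * (t + b * μ) ≡ k * b * (P * μ) + k * P * t
      l₂ = solve-∀
      l₃ : ∀ k q s M t l b → k * q * s * M + (k * b * (q * l) + l * b) + (k * q * t + (s * M + t)) ≡ k * q * (s * M + (t + l * b)) + (s * M + (t + l * b))
      l₃ = solve-∀

  n≢ᵇ1+n : ∀ n → (n ≡ᵇ suc n) ≡ false
  n≢ᵇ1+n zero    = refl
  n≢ᵇ1+n (suc n) = n≢ᵇ1+n n

  C-next : ∀ m a → adjℕ (C m) a (suc a) ≡ true
  C-next m a rewrite ≡ᵇ-refl a | n≢ᵇ1+n a = refl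

  C-close : ∀ m → adjℕ (C (2 + m)) 0 (suc m) ≡ true
  C-close m rewrite ≡ᵇ-refl m | ∨-zeroʳ (m ≡ᵇ 0) = refl

  two-colours : ∀ (x y z : Fin 2) → ¬ x ≡ y → ¬ y ≡ z → x ≡ z
  two-colours zero       zero       z          n _ = ⊥-elim (n refl)
  two-colours zero       (suc zero) zero       _ _ = refl
  two-colours zero       (suc zero) (suc zero) _ n = ⊥-elim (n refl)
  two-colours (suc zero) zero       zero       _ n = ⊥-elim (n refl)
  two-colours (suc zero) zero       (suc zero) _ _ = refl
  two-colours (suc zero) (suc zero) z          n _ = ⊥-elim (n refl)

  -- All even positions would share the colour of 0, and the last position is even.
  C-odd-uncolourable : ∀ g → ¬ Colourable (C (2 * suc g + 1)) 2
  C-odd-uncolourable g (c , proper) = proper (fromℕ< {0} 0<m) (fromℕ< last<m)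
      (trans (cong₂ (adjℕ (C m)) (toℕ-fromℕ< 0<m) (toℕ-fromℕ< last<m)) closing) (alternate (suc g) last<m)
    where
    m = 2 * suc g + 1
    0<m : 0 < m
    0<m = s≤s z≤n
    last<m : 2 * suc g < m
    last<m = ≤-reflexive (+-comm 1 (2 * suc g))
    closing : adjℕ (C m) 0 (2 * suc g) ≡ true
    closing = subst₂ (λ x y → adjℕ (C x) 0 y ≡ true) (l₁ g) (l₂ g) (C-close (1 + 2 * g))
      where
      l₁ : ∀ g → 2 + (1 + 2 * g) ≡ 2 * (1 + g) + 1
      l₁ = solve-∀
      l₂ : ∀ g → 1 + (1 + 2 * g) ≡ 2 * (1 + g)
      l₂ = solve-∀
    step : ∀ a (l : a < m) (l′ : suc a < m) → ¬ c (fromℕ< l) ≡ c (fromℕ< l′)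
    step a l l′ = proper (fromℕ< l) (fromℕ< l′) (trans (cong₂ (adjℕ (C m)) (toℕ-fromℕ< l) (toℕ-fromℕ< l′)) (C-next m a))
    alternate : ∀ j (l : 2 * j < m) → c (fromℕ< 0<m) ≡ c (fromℕ< l)
    alternate zero    l = cong c (toℕ-injective (trans (toℕ-fromℕ< 0<m) (sym (toℕ-fromℕ< l))))
    alternate (suc j) l = trans (alternate j l₀) (trans (two-colours _ _ _ (step (2 * j) l₀ l₁) (step (suc (2 * j)) l₁ l₂))
        (cong c (toℕ-injective (trans (toℕ-fromℕ< l₂) (trans (eq j) (sym (toℕ-fromℕ< l)))))))
      where
      eq : ∀ j → 2 + 2 * j ≡ 2 * (1 + j)
      eq = solve-∀
      l₂ : suc (suc (2 * j)) < m
      l₂ = subst (_< m) (sym (eq j)) l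
      l₁ : suc (2 * j) < m
      l₁ = <-trans (n<1+n _) l₂
      l₀ : 2 * j < m
      l₀ = <-trans (n<1+n _) l₁

  W-odd-uncolourable : ∀ g → ¬ Colourable (W (2 * suc g + 1)) 3
  W-odd-uncolourable g = ⊕-uncolourable (K 1) (C (2 * suc g + 1)) ≤-refl (C-odd-uncolourable g)

  -- For the wheel with 2g + 3 rim vertices: the hub has weight 2g + 1, which is also what a rim
  -- vertex misses, and the total 4g + 4 has ratio 2 + 2/(2g + 1).
  wheelCells : ℕ → List ℕ
  wheelCells g = replicate (2 * g + 1) 0 ++ map suc (upTo (2 * suc g + 1))

  -- For `C̄₇`, `H₂⁺`, `H₂`, `T₀`, `H₁⁺⁺` the totals 7, 9, 11, 13, 15 over 3, 4, 5, 6, 7 attain the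
  -- ratios of the certificates. Some vertices of `H₂⁺`, `T₀` and `H₁⁺⁺` have weight zero, whence
  -- `Perturbed`.
  weightings : ∀ g → 1 ≤ g → g ≤ 11 → Weighting (F (g + 1)) (cNum g) (cDen g)
  weightings 1  _ _ = weighting (W 5)  2 3  (wheelCells 1) 3 _ refl (s≤s z≤n) (W-odd-uncolourable 1)
  weightings 2  _ _ = weighting (W 7)  2 5  (wheelCells 2) 5 _ refl (s≤s z≤n) (W-odd-uncolourable 2)
  weightings 3  _ _ = weighting C̄₇     1 3  (0 ∷ 1 ∷ 2 ∷ 3 ∷ 4 ∷ 5 ∷ 6 ∷ []) 3 _ refl (s≤s z≤n) (uncolourable₃-sound C̄₇ refl)
  weightings 4  _ _ = weighting (W 9)  2 7  (wheelCells 3) 7 _ refl (s≤s z≤n) (W-odd-uncolourable 3)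
  weightings 5  _ _ = weighting H₂⁺    1 4  (0 ∷ 0 ∷ 2 ∷ 2 ∷ 3 ∷ 4 ∷ 5 ∷ 5 ∷ 7 ∷ []) 4 _ refl (s≤s z≤n) (uncolourable₃-sound H₂⁺ refl)
  weightings 6  _ _ = weighting (W 11) 2 9  (wheelCells 4) 9 _ refl (s≤s z≤n) (W-odd-uncolourable 4)
  weightings 7  _ _ = weighting H₂     1 5  (0 ∷ 0 ∷ 0 ∷ 1 ∷ 2 ∷ 2 ∷ 3 ∷ 4 ∷ 5 ∷ 5 ∷ 6 ∷ []) 5 _ refl (s≤s z≤n) (uncolourable₃-sound H₂ refl)
  weightings 8  _ _ = weighting (W 13) 2 11 (wheelCells 5) 11 _ refl (s≤s z≤n) (W-odd-uncolourable 5)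
  weightings 9  _ _ = weighting T₀     1 6  (0 ∷ 0 ∷ 0 ∷ 0 ∷ 3 ∷ 4 ∷ 7 ∷ 8 ∷ 8 ∷ 8 ∷ 9 ∷ 9 ∷ 9 ∷ []) 6 _ refl (s≤s z≤n) (uncolourable₃-sound T₀ refl)
  weightings 10 _ _ = weighting (W 15) 2 13 (wheelCells 6) 13 _ refl (s≤s z≤n) (W-odd-uncolourable 6)
  weightings 11 _ _ = weighting H₁⁺⁺   1 7  (0 ∷ 0 ∷ 0 ∷ 0 ∷ 0 ∷ 2 ∷ 2 ∷ 2 ∷ 3 ∷ 3 ∷ 5 ∷ 5 ∷ 5 ∷ 7 ∷ 8 ∷ []) 7 _ refl (s≤s z≤n) (uncolourable₃-sound H₁⁺⁺ refl)
  weightings (suc (suc (suc (suc (suc (suc (suc (suc (suc (suc (suc (suc g)))))))))))) _ (s≤s (s≤s (s≤s (s≤s (s≤s (s≤s (s≤s (s≤s (s≤s (s≤s (s≤s ())))))))))))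

  lower : ∀ s g H → 1 ≤ g → g ≤ 11 → ¬ Hom H (K s ⊕ F (g + 1)) → DeltaGe H (3 + s) (bnd (3 + s) (cNum g) (cDen g))
  lower s g H g≥1 g≤11 ¬hom = obstruction⇒DeltaGe H (3 + s) (cNum g + (2 + s) * cDen g) (cDen g) (s≤s z≤n) D≥1
    λ k _ → weighted-obstruction s H (weightings g g≥1 g≤11) ¬hom k
    where
    D≥1 : 1 ≤ cNum g + (2 + s) * cDen g
    D≥1 = ≤-trans (cDen-pos g g≥1 g≤11) (≤-trans (m≤m+n (cDen g) ((1 + s) * cDen g)) (m≤n+m ((2 + s) * cDen g) (cNum g)))

-- Odd cycles and the graphs below all thresholds.

module OddCycles where
  open import Defs
  open Sums
  open Graphs using (∧-true; absurd; odd)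
  open Certificates using (≡ᵇ-true; <ᵇ-true; ∨-true)
  open Rationals using (//-mono-<)
  open Upper using (adjℕ-sym; adjℕ-irr; anyFun?)
  open Lower
  open Weights
  open import Data.Bool using (_xor_)
  open import Data.Bool.Properties using (not-involutive)
  open import Data.Fin.Properties using (pigeonhole; toℕ-fromℕ<)
  import Data.Rational.Properties as ℚP

  two-neighbours : ∀ {j} (a : Fin (3 + j)) x y → x < 3 + j → y < 3 + j → ¬ x ≡ y →
    adjℕ (C (3 + j)) (toℕ a) x ≡ true → adjℕ (C (3 + j)) (toℕ a) y ≡ true → # (λ b → not (Adj (C (3 + j)) a b)) ≤ 1 + j
  two-neighbours {j} a x y lx ly x≢y ax ay = +-cancelˡ-≤ 2 _ _ (≤-trans
    (+-monoˡ-≤ _ (two≤ (λ b → 𝟙 (Adj (C (3 + j)) a b)) (fromℕ< lx) (fromℕ< ly)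
      (λ e → x≢y (trans (sym (toℕ-fromℕ< lx)) (trans (cong toℕ e) (toℕ-fromℕ< ly)))) (at x lx ax) (at y ly ay)))
    (≤-reflexive (#-complement (Adj (C (3 + j)) a))))
    where
    at : ∀ x (l : x < 3 + j) → adjℕ (C (3 + j)) (toℕ a) x ≡ true → 1 ≤ 𝟙 (Adj (C (3 + j)) a (fromℕ< l))
    at x l e = ≤-reflexive (cong 𝟙 (sym (trans (cong (adjℕ (C (3 + j)) (toℕ a)) (toℕ-fromℕ< l)) e)))

  C-light : ∀ j (a : Fin (3 + j)) → # (λ b → not (Adj (C (3 + j)) a b)) ≤ 1 + j
  C-light j a = go (toℕ a) refl
    where
    m = 3 + j
    nbr : ∀ {x} → toℕ a ≡ x → ∀ y → adjℕ (C m) x y ≡ true → adjℕ (C m) (toℕ a) y ≡ true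
    nbr e y h = trans (cong (λ z → adjℕ (C m) z y) e) h
    go : ∀ x → toℕ a ≡ x → # (λ b → not (Adj (C m) a b)) ≤ 1 + j
    go zero e = two-neighbours a 1 (2 + j) (s≤s (s≤s z≤n)) ≤-refl (λ ()) (nbr e 1 (C-next m 0)) (nbr e (2 + j) (C-close (1 + j)))
    go (suc x) e with suc (suc x) <? m
    ... | yes l = two-neighbours a x (2 + x) (<-trans (n<1+n x) (<-trans (n<1+n (suc x)) l)) l (λ ()) (nbr e x (trans (adjℕ-sym (C m) (suc x) x) (C-next m x))) (nbr e (2 + x) (C-next m (suc x)))
    ... | no ¬l = two-neighbours a x 0 (subst (x <_) refl (<-trans (n<1+n x) (subst (_< m) e (toℕ<n a)))) (s≤s z≤n) (x≢0 x last)
        (nbr e x (trans (adjℕ-sym (C m) (suc x) x) (C-next m x))) (nbr e 0 (trans (adjℕ-sym (C m) (suc x) 0) (subst (λ z → adjℕ (C m) 0 z ≡ true) (cong suc (sym last)) (C-close (1 + j)))))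
      where
      last : x ≡ 1 + j
      last = suc-injective (suc-injective (≤-antisym (subst (λ z → suc z ≤ m) e (toℕ<n a)) (≮⇒≥ ¬l)))
      x≢0 : ∀ x → x ≡ 1 + j → ¬ x ≡ 0
      x≢0 zero ()
      x≢0 (suc _) _ ()

  -- Unit weights on the cycle balance parts of size 1 + j, and N/m = s + 1 + 2/(1 + j) exactly.
  cycle-obstruction : ∀ s j H → ¬ Hom H (K s ⊕ C (3 + j)) → ¬ Colourable (C (3 + j)) 2 → ∀ k → Obstruction H (2 + s) (2 + (1 + s) * (1 + j)) (1 + j) k
  cycle-obstruction s j H ¬hom uncol k = record
    { T = cones s (1 + j) (C (3 + j))
    ; no-hom = λ h → ¬hom (Hom-trans H {cones s (1 + j) (C (3 + j))} {K s ⊕ C (3 + j)} h (cones-hom s {1 + j} (C (3 + j)) (C (3 + j)) ((λ i → i) , λ _ _ e → e)))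
    ; uncol = subst (λ z → ¬ Colourable (cones s (1 + j) (C (3 + j))) z) (+-comm s 2) (cones-uncolourable s (C (3 + j)) (s≤s z≤n) uncol)
    ; m = 1 + j
    ; light = cones-light s (C (3 + j)) (C-light j)
    ; ratio = subst (λ z → (2 + (1 + s) * (1 + j)) * k * (1 + j) ≤ k * (1 + j) * z + z) (sym (cones-size s (1 + j) (C (3 + j))))
        (≤-trans (≤-reflexive (l s j k)) (m≤m+n _ _)) }
    where
    l : ∀ s j k → (2 + (1 + s) * (1 + j)) * k * (1 + j) ≡ k * (1 + j) * (s * (1 + j) + (3 + j))
    l = solve-∀

  -- The path obtained from an odd cycle by deleting v is coloured by parity, switching after v.
  side : ℕ → ℕ → Bool
  side v x = odd x xor (v <ᵇ x)

  odd-double : ∀ g → odd (2 * g) ≡ false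
  odd-double zero    = refl
  odd-double (suc g) = trans (cong odd (+-suc (suc g) (g + 0))) (trans (not-involutive _) (odd-double g))

  <ᵇ-suc : ∀ v x → ¬ x ≡ v → (v <ᵇ suc x) ≡ (v <ᵇ x)
  <ᵇ-suc zero    zero    h = ⊥-elim (h refl)
  <ᵇ-suc zero    (suc x) h = refl
  <ᵇ-suc (suc v) zero    h = <ᵇ-zero v
    where
    <ᵇ-zero : ∀ v → (v <ᵇ 0) ≡ false
    <ᵇ-zero zero    = refl
    <ᵇ-zero (suc v) = refl
  <ᵇ-suc (suc v) (suc x) h = <ᵇ-suc v x (h ∘ cong suc)

  side-proper : ∀ g v x y → v < 2 * g + 1 → ¬ x ≡ v → ¬ y ≡ v → rel (C (2 * g + 1)) x y ≡ true → ¬ side v x ≡ side v y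
  side-proper g v x y v<m x≢v y≢v e eq with ∨-true {y ≡ᵇ suc x} e
  ... | inj₁ e′ rewrite ≡ᵇ-true {y} {suc x} e′ = flip (odd x) (v <ᵇ x) (trans eq (cong (not (odd x) xor_) (<ᵇ-suc v x x≢v)))
    where
    flip : ∀ a b → ¬ (a xor b) ≡ (not a xor b)
    flip true  true  ()
    flip true  false ()
    flip false true  ()
    flip false false ()
  ... | inj₂ e′ with ∧-true {x ≡ᵇ 0} e′
  ...   | x0 , ym rewrite ≡ᵇ-true {x} {0} x0 | trans (≡ᵇ-true {y} {2 * g + 1 ∸ 1} ym) (m+n∸n≡m (2 * g) 1) =
    absurd (trans eq (cong₂ _xor_ (odd-double g) (<ᵇ-intro (≤∧≢⇒< (≤-pred (subst (v <_) (+-comm (2 * g) 1) v<m)) (y≢v ∘ sym))))) (zero-side v)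
    where
    zero-side : ∀ v → side v 0 ≡ false
    zero-side zero    = refl
    zero-side (suc v) = refl

  module _ (s g v : ℕ) (v<m : v < 2 * g + 1) where
    m = 2 * g + 1

    shade : ℕ → ℕ
    shade x = if x <ᵇ s then x else s + 𝟙 (side v (x ∸ s))

    shade< : ∀ x → shade x < 2 + s
    shade< x with x <ᵇ s in e
    ... | true  = ≤-trans (<ᵇ-true e) (m≤n+m s 2)
    ... | false = ≤-trans (≤-reflexive (sym (+-suc s _))) (≤-trans (+-monoʳ-≤ s (𝟙<2 (side v (x ∸ s)))) (≤-reflexive (+-comm s 2)))
      where
      𝟙<2 : ∀ b → suc (𝟙 b) ≤ 2
      𝟙<2 true  = ≤-refl
      𝟙<2 false = s≤s z≤n

    shade-proper : ∀ x y → ¬ x ≡ s + v → ¬ y ≡ s + v → rel (K s ⊕ C m) x y ≡ true → ¬ shade x ≡ shade y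
    shade-proper x y x≢ y≢ e eq with x <ᵇ s in ex | y <ᵇ s in ey
    ... | true  | true  = absurd (subst (λ z → adjℕ (K s) x z ≡ true) (sym eq) e) (adjℕ-irr (K s) x)
    ... | true  | false = <⇒≱ (<ᵇ-true ex) (≤-trans (m≤m+n s _) (≤-reflexive (sym eq)))
    ... | false | true  = <⇒≱ (<ᵇ-true ey) (≤-trans (m≤m+n s _) (≤-reflexive eq))
    ... | false | false = [ (λ h → side-proper g v (x ∸ s) (y ∸ s) v<m (shift x ex x≢) (shift y ey y≢) h eq′)
                          , (λ h → side-proper g v (y ∸ s) (x ∸ s) v<m (shift y ey y≢) (shift x ex x≢) h (sym eq′)) ]′
                          (∨-true (proj₂ (∧-true {not ((x ∸ s) ≡ᵇ (y ∸ s))} e)))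
      where
      𝟙-injective : ∀ a b → 𝟙 a ≡ 𝟙 b → a ≡ b
      𝟙-injective true  true  _ = refl
      𝟙-injective false false _ = refl
      eq′ : side v (x ∸ s) ≡ side v (y ∸ s)
      eq′ = 𝟙-injective _ _ (+-cancelˡ-≡ s _ _ eq)
      ≥s : ∀ z → (z <ᵇ s) ≡ false → s ≤ z
      ≥s z h = ≮⇒≥ λ l → absurd (<ᵇ-intro l) h
      shift : ∀ z → (z <ᵇ s) ≡ false → ¬ z ≡ s + v → ¬ z ∸ s ≡ v
      shift z h z≢ e = z≢ (trans (sym (m+[n∸m]≡n (≥s z h))) (cong (s +_) e))

  -- The cycle has more vertices than H, so some v of it is not an image. Without v it is a path,
  -- which needs two colours beyond the s of the clique.
  long-cycle-colourable : ∀ H s g → size H < 2 * g + 1 → Hom H (K s ⊕ C (2 * g + 1)) → Colourable H (2 + s)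
  long-cycle-colourable H s g small (φ , edges) with any? (λ (v : Fin (2 * g + 1)) → all? λ x → ¬? (toℕ (φ x) ≟ s + toℕ v))
  ... | yes (v , free) = (λ x → fromℕ< (shade< s g (toℕ v) (toℕ<n v) (toℕ (φ x)))) , λ i j e eq →
      shade-proper s g (toℕ v) (toℕ<n v) (toℕ (φ i)) (toℕ (φ j)) (free i) (free j)
        (trans (sym (⊕-adj (K s) (C (2 * g + 1)) (toℕ (φ i)) (toℕ (φ j)))) (edges i j e))
        (trans (sym (toℕ-fromℕ< _)) (trans (cong toℕ eq) (toℕ-fromℕ< _)))
  ... | no ¬free = ⊥-elim (repeat (pigeonhole small (λ v → proj₁ (hit v))))
    where
    hit : ∀ v → ∃ λ x → toℕ (φ x) ≡ s + toℕ v
    hit v with any? (λ x → toℕ (φ x) ≟ s + toℕ v)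
    ... | yes h = h
    ... | no ¬h = ⊥-elim (¬free (v , λ x e → ¬h (x , e)))
    repeat : (∃ λ u → ∃ λ v → toℕ u < toℕ v × proj₁ (hit u) ≡ proj₁ (hit v)) → ⊥
    repeat (u , v , lt , e) = <-irrefl (+-cancelˡ-≡ s _ _ (trans (sym (proj₂ (hit u))) (trans (cong (toℕ ∘ φ) e) (proj₂ (hit v))))) lt

  Hom? : ∀ A B → Dec (Hom A B)
  Hom? A B = anyFun? (λ {f} {f′} ext h i j e → subst₂ (Edge B) (ext i) (ext j) (h i j e))
    (λ φ → all? λ i → all? λ j → (Adj A i j ≟ᵇ true) →-dec (Adj B (φ i) (φ j) ≟ᵇ true))

  least-failure : ∀ {P : ℕ → Set} → (∀ g → Dec (P g)) → ∀ n →
    (∀ g → 1 ≤ g → g ≤ n → P g) ⊎ (Σ ℕ λ g → 1 ≤ g × ¬ P g × (∀ g′ → 1 ≤ g′ → g′ < g → P g′))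
  least-failure P? zero    = inj₁ λ { zero () _ ; (suc _) _ () }
  least-failure {P} P? (suc n) with least-failure P? n | P? (suc n)
  ... | inj₂ found | _      = inj₂ found
  ... | inj₁ below | no ¬p  = inj₂ (suc n , s≤s z≤n , ¬p , λ g′ l lt → below g′ l (≤-pred lt))
  ... | inj₁ below | yes p  = inj₁ λ g l le → [ (λ lt → below g l (≤-pred lt)) , (λ e → subst P (sym e) p) ]′ (m≤n⇒m<n∨m≡n le)

  above-trivial : ∀ a q → 1 ≤ q → (ℚ.1ℚ ℚ.- (1 // (1 + a))) ℚ.< (ℚ.1ℚ ℚ.- (q // (2 + (1 + a) * q)))
  above-trivial a q q≥1 = ℚP.+-monoʳ-< ℚ.1ℚ (ℚP.neg-antimono-< (//-mono-< {q} {2 + (1 + a) * q} {1} {1 + a} (s≤s z≤n) (s≤s z≤n)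
    (≤-trans (s≤s (≤-trans (≤-reflexive (*-comm q (1 + a))) (n≤1+n _))) (≤-reflexive (sym (+-identityʳ _))))))

-- Assembly of the theorem.

open import Defs
open import Data.Rational using (1ℚ; _-_) renaming (_<_ to _<ℚ_)
open Upper using (upper)
open Lower using (obstruction⇒DeltaGe)
open Weights using (lower; C-odd-uncolourable)
open OddCycles

theorem1p4 : ∀ (r : ℕ) (H : Graph) → 3 ≤ r → HasChromaticNumber H (r + 1) →
    (∀ (g : ℕ) → 1 ≤ g → g ≤ 11 →
       (∀ (j : ℕ) → 1 ≤ j → j ≤ g → Hom H (K (r ∸ 3) ⊕ F j)) →
       ¬ Hom H (K (r ∸ 3) ⊕ F (g + 1)) →
       DeltaEq H r (bnd r (cNum g) (cDen g)))
    ×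
    ((∀ (g : ℕ) → 1 ≤ g → g ≤ 12 → Hom H (K (r ∸ 3) ⊕ F g)) →
       Σ ℕ λ g → 1 ≤ g × ¬ Hom H (K (r ∸ 2) ⊕ C (2 * g + 1))
         × (∀ (g′ : ℕ) → 1 ≤ g′ → g′ < g → Hom H (K (r ∸ 2) ⊕ C (2 * g′ + 1)))
         × (1ℚ - (1 // (r ∸ 1))) <ℚ bnd r 2 (2 * g ∸ 1)
         × DeltaGe H r (bnd r 2 (2 * g ∸ 1))
         × DeltaLe H r (bnd r 1 7))
theorem1p4 (suc (suc (suc s))) H _ (_ , least) =
    (λ g g≥1 g≤11 homs ¬hom → upper s g H g≥1 g≤11 homs , lower s g H g≥1 g≤11 ¬hom)
  , λ homs → tail homs ([ (λ all → ⊥-elim (¬all all)) , (λ found → found) ]′ (least-failure (λ g → Hom? H (K (1 + s) ⊕ C (2 * g + 1))) (suc (size H))))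
  where
  -- The cycle for g = |H| + 1 is longer than H, so a homomorphism would give a colouring with r
  -- colours. Hence a failing g exists and is found by bounded search.
  ¬all : ¬ (∀ g → 1 ≤ g → g ≤ suc (size H) → Hom H (K (1 + s) ⊕ C (2 * g + 1)))
  ¬all all = least (3 + s) (≤-reflexive (+-comm 1 (3 + s))) (long-cycle-colourable H (1 + s) (suc (size H))
    (≤-trans (m≤m+n (suc (size H)) _) (m≤m+n _ 1)) (all (suc (size H)) (s≤s z≤n) ≤-refl))
  tail : (∀ g → 1 ≤ g → g ≤ 12 → Hom H (K s ⊕ F g)) →
    (Σ ℕ λ g → 1 ≤ g × ¬ Hom H (K (1 + s) ⊕ C (2 * g + 1)) × (∀ g′ → 1 ≤ g′ → g′ < g → Hom H (K (1 + s) ⊕ C (2 * g′ + 1)))) → _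
  tail homs (suc g , g≥1 , ¬hom , minimal) = suc g , g≥1 , ¬hom , minimal
    , subst (λ q → (1ℚ - (1 // (2 + s))) <ℚ bnd (3 + s) 2 q) (sym (q≡ g)) (above-trivial (1 + s) (1 + 2 * g) (s≤s z≤n))
    , subst (λ q → DeltaGe H (3 + s) (bnd (3 + s) 2 q)) (sym (q≡ g))
        (obstruction⇒DeltaGe H (3 + s) (2 + (2 + s) * (1 + 2 * g)) (1 + 2 * g) (s≤s z≤n) (s≤s z≤n) λ k _ →
          cycle-obstruction (1 + s) (2 * g) H (subst (λ m → ¬ Hom H (K (1 + s) ⊕ C m)) (m≡ g) ¬hom)
            (subst (λ m → ¬ Colourable (C m) 2) (m≡ g) (C-odd-uncolourable g)) k)
    -- The bound with 1/7 is the case g = 11, as c₁₁ = 1/7.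
    , upper s 11 H (s≤s z≤n) ≤-refl (λ j j≥1 j≤11 → homs j j≥1 (≤-trans j≤11 (n≤1+n 11)))
    where
    m≡ : ∀ g → 2 * (1 + g) + 1 ≡ 3 + 2 * g
    m≡ = solve-∀
    q≡ : ∀ g → 2 * suc g ∸ 1 ≡ 1 + 2 * g
    q≡ g = +-suc g (g + 0)
theorem1p4 0 H ()
theorem1p4 1 H (s≤s ())
theorem1p4 2 H (s≤s (s≤s ()))
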